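{- Let $m,D\in\mathbb{Z}^+$, $D\neq1$ squarefree, $F=\mathbb{Q}(\sqrt D)$, and let $L$ be a classical totally positive definite quadratic $\mathcal{O}_F$-lattice which represents every element of $m\mathcal{O}_F^+$. Then there exist primes $p_1,p_2\le2m^2$, integers $C_1,C_2$ with $2\le C_i\le\gamma_{p_i}$, primes $q_1,q_2$ with $q_i\le2C_im^3$, and integers $D_1,D_2$ with $1\le D_i\le q_i\gamma_{q_i}$, such that: (1) if $\operatorname{rank}L\le3$, then $\Delta_D\le4C_1m^2(\omega_D-\lfloor\omega_D'\rfloor)$; (2) if $\operatorname{rank}L\le4$, then $\Delta_D\le4C_1m^2(2\omega_D-\lfloor2\omega_D'\rfloor)$; (3) if $\operatorname{rank}L\le5$, then $\Delta_D\le4C_1m^2(C_2\omega_D-\lfloor C_2\omega_D'\rfloor)$ or $\sqrt{\Delta_D}^3\le36C_2m^3\sqrt{\Delta_D}^2+18C_2m^3\sqrt{\Delta_D}+m^3$; (4) if $\operatorname{rank}L\le6$, then $\Delta_D\le4C_1m^2(C_2\omega_D-\lfloor C_2\omega_D'\rfloor)$ or $\sqrt{\Delta_D}^3\le36C_2m^3\sqrt{\Delta_D}^2+18C_2m^3\sqrt{\Delta_D}+m^3$ or $\Delta_D\le4D_1m^2\max\{C_1,\,C_2\omega_D-\lfloor C_2\omega_D'\rfloor\}$; (5) if $\operatorname{rank}L\le7$, then $\Delta_D\le4C_1D_1m^2$ or $\Delta_D\le4\max\{C_1,D_1\}m^2\max\{C_2\omega_D-\lfloor C_2\omega_D'\rfloor,\,D_2\omega_D-\lfloor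 D_2\omega_D'\rfloor\}$ or $\sqrt{\Delta_D}^3\le36C_2m^3\sqrt{\Delta_D}^2+18C_2m^3\sqrt{\Delta_D}+m^3$ or $\sqrt{\Delta_D}^4\le192C_2D_2m^4\sqrt{\Delta_D}^3+144C_2D_2m^4\sqrt{\Delta_D}^2+96\max\{C_2,D_2\}m^4\sqrt{\Delta_D}+m^4$.
   Context: For an odd prime $p$, $\gamma_p$ denotes the least positive quadratic non-residue modulo $p$; by convention $\gamma_2=7$. $\Delta_D=D$ and $\omega_D=\frac{1+\sqrt D}{2}$ if $D\equiv1\pmod4$; $\Delta_D=4D$ and $\omega_D=\sqrt D$ if $D\equiv2,3\pmod4$; so $\mathcal{O}_F=\mathbb{Z}[\omega_D]$. For $\alpha\in F$, $\alpha'$ denotes its Galois conjugate. $\mathcal{O}_F^+$ is the set of totally positive elements of $\mathcal{O}_F$. For a quadratic space $(V,Q)$ over $F$, $\mathcal{B}(v,w)=\frac12(Q(v+w)-Q(v)-Q(w))$. A quadratic $\mathcal{O}_F$-lattice is a finitely generated $\mathcal{O}_F$-submodule $L\subseteq V$ with $Q(L)\subseteq\mathcal{O}_F$; classical means $\mathcal{B}(L,L)\subseteq\mathcal{O}_F$; totally positive definite means $Q(v)$ totally positive for all nonzero $v\in L$; $\operatorname{rank}L=\dim_F FL$. -}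

module Defs where

open import Data.Bool using (Bool; true; false; _∧_; _∨_; not; if_then_else_; T)
open import Data.Nat as ℕ using (ℕ; zero; suc; _≡ᵇ_; _%_; _⊔_)
open import Data.Nat.Divisibility using () renaming (_∣_ to _∣ℕ_)
open import Data.Integer as ℤ using (ℤ; +_)
open import Data.Integer.Divisibility using () renaming (_∣_ to _∣ℤ_)
open import Data.Rational as ℚ using (ℚ; 0ℚ; 1ℚ; ½; _≤ᵇ_)
open import Data.Fin using (Fin; zero; suc)
open import Data.Product using (Σ; ∃; ∃-syntax; _×_; _,_)
open import Data.Sum using (_⊎_)
open import Relation.Binary.PropositionalEquality using (_≡_; _≢_)
open import Relation.Nullary using (¬_)

Squarefree : ℕ → Set
Squarefree n = ∀ k → (k ℕ.* k) ∣ℕ n → k ≡ 1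

IsQR : ℕ → ℕ → Set
IsQR p a = ∃[ x ] ((+ p) ∣ℤ (x ℤ.* x ℤ.- + a))

IsQNR : ℕ → ℕ → Set
IsQNR p a = ¬ (p ∣ℕ a) × ¬ IsQR p a

IsLeastQNR : ℕ → ℕ → Set
IsLeastQNR p g = 1 ℕ.≤ g × IsQNR p g × (∀ h → 1 ℕ.≤ h → h ℕ.< g → ¬ IsQNR p h)

IsGamma : ℕ → ℕ → Set
IsGamma p g = (p ≡ 2 × g ≡ 7) ⊎ (p ≢ 2 × IsLeastQNR p g)

-- The quadratic field F = ℚ(√D): an element a + b√D is the pair (a , b).
-- The real embedding is the one with √D > 0.

record F : Set where
  constructor _+√_
  field
    re : ℚ
    im : ℚ
open F public

ℕ→ℚ : ℕ → ℚ
ℕ→ℚ n = (+ n) ℚ./ 1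

ℤ→ℚ : ℤ → ℚ
ℤ→ℚ z = z ℚ./ 1

ℕ→F : ℕ → F
ℕ→F n = ℕ→ℚ n +√ 0ℚ

ℤ→F : ℤ → F
ℤ→F z = ℤ→ℚ z +√ 0ℚ

0F : F
0F = 0ℚ +√ 0ℚ

infixl 6 _+F_ _-F_
_+F_ : F → F → F
(a +√ b) +F (c +√ d) = (a ℚ.+ c) +√ (b ℚ.+ d)

-F_ : F → F
-F (a +√ b) = (ℚ.- a) +√ (ℚ.- b)

_-F_ : F → F → F
x -F y = x +F (-F y)

conj : F → F
conj (a +√ b) = a +√ (ℚ.- b)

module Field (D : ℕ) where

  infixl 7 _*F_
  _*F_ : F → F → F
  (a +√ b) *F (c +√ d) = (a ℚ.* c ℚ.+ ℕ→ℚ D ℚ.* b ℚ.* d) +√ (a ℚ.* d ℚ.+ b ℚ.* c)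

  infixr 8 _^F_
  _^F_ : F → ℕ → F
  x ^F zero = ℕ→F 1
  x ^F suc k = x *F (x ^F k)

  private
    _<ᵇ_ : ℚ → ℚ → Bool
    x <ᵇ y = not (y ≤ᵇ x)

  -- a + b√D > 0 (as a real number, √D > 0, D not a square)
  posᵇ : F → Bool
  posᵇ (a +√ b) =
       ((0ℚ <ᵇ a) ∧ (0ℚ ≤ᵇ b))
    ∨ ((0ℚ ≤ᵇ a) ∧ (0ℚ <ᵇ b))
    ∨ ((0ℚ <ᵇ a) ∧ (b <ᵇ 0ℚ) ∧ ((ℕ→ℚ D ℚ.* b ℚ.* b) <ᵇ (a ℚ.* a)))
    ∨ ((a <ᵇ 0ℚ) ∧ (0ℚ <ᵇ b) ∧ ((a ℚ.* a) <ᵇ (ℕ→ℚ D ℚ.* b ℚ.* b)))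

  nonnegᵇ : F → Bool
  nonnegᵇ x@(a +√ b) = posᵇ x ∨ ((a ≤ᵇ 0ℚ) ∧ (0ℚ ≤ᵇ a) ∧ (b ≤ᵇ 0ℚ) ∧ (0ℚ ≤ᵇ b))

  infix 4 _≤F_ _<F_
  _≤F_ : F → F → Set
  x ≤F y = T (nonnegᵇ (y -F x))

  _<F_ : F → F → Set
  x <F y = T (posᵇ (y -F x))

  maxF : F → F → F
  maxF x y = if nonnegᵇ (y -F x) then y else x

  TotPos : F → Set
  TotPos x = 0F <F x × 0F <F conj x

  is1mod4 : Bool
  is1mod4 = D % 4 ≡ᵇ 1

  Δ : ℕ
  Δ = if is1mod4 then D else 4 ℕ.* D

  ω : F
  ω = if is1mod4 then (½ +√ ½) else (0ℚ +√ 1ℚ)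

  √Δ : F
  √Δ = if is1mod4 then (0ℚ +√ 1ℚ) else (0ℚ +√ ((+ 2) ℚ./ 1))

  InO : F → Set
  InO x = ∃[ u ] ∃[ v ] (x ≡ ℤ→F u +F ℤ→F v *F ω)

  IsFloor : F → ℤ → Set
  IsFloor x n = (ℤ→F n ≤F x) × (x <F ℤ→F (n ℤ.+ + 1))

  IsCω : ℕ → F → Set
  IsCω c e = ∃[ n ] (IsFloor (conj (ℕ→F c *F ω)) n × e ≡ ℕ→F c *F ω -F ℤ→F n)

  -- Quadratic spaces and lattices over F.
  -- A (finite-dimensional) quadratic space over F is F^n with
  -- Q(v) = Σ_{i,j} G i j v_i v_j for a symmetric matrix G.

  Vec : ℕ → Set
  Vec n = Fin n → F

  ΣF : ∀ {n} → (Fin n → F) → F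
  ΣF {zero} f = 0F
  ΣF {suc n} f = f zero +F ΣF (λ i → f (suc i))

  record QuadSpace : Set where
    field
      dim : ℕ
      G   : Fin dim → Fin dim → F
      sym : ∀ i j → G i j ≡ G j i

    Q : Vec dim → F
    Q v = ΣF (λ i → ΣF (λ j → G i j *F v i *F v j))

    _+V_ : Vec dim → Vec dim → Vec dim
    (v +V w) i = v i +F w i

    B : Vec dim → Vec dim → F
    B v w = (½ +√ 0ℚ) *F (Q (v +V w) -F Q v -F Q w)

    IsZero : Vec dim → Set
    IsZero v = ∀ i → v i ≡ 0F

    -- A finitely generated O_F-submodule of V, given by generators
    -- g 0, …, g (k−1):  L = O_F g₀ + … + O_F g_{k−1}.
    record Lattice : Set where
      field
        k : ℕ
        gen : Fin k → Vec dim

      _∈L : Vec dim → Set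
      v ∈L = Σ (Fin k → F) λ c → ((∀ j → InO (c j)) × (∀ i → v i ≡ ΣF (λ j → c j *F gen j i)))

      -- rank L ≤ r :  dim_F (F L) ≤ r, i.e. F L is spanned by r vectors
      RankLe : ℕ → Set
      RankLe r = Σ (Fin r → Vec dim) λ w → ∀ (j : Fin k) → Σ (Fin r → F) λ d →
                   (∀ i → gen j i ≡ ΣF (λ t → d t *F w t i))

      Integral : Set
      Integral = ∀ v → v ∈L → InO (Q v)

      Classical : Set
      Classical = ∀ v w → v ∈L → w ∈L → InO (B v w)

      TotPosDef : Set
      TotPosDef = ∀ v → v ∈L → ¬ IsZero v → TotPos (Q v)

      RepresentsMult : ℕ → Set
      RepresentsMult m = ∀ a → InO a → TotPos a → ∃[ v ] (v ∈L × Q v ≡ ℕ→F m *F a)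

-- Let v_c and w_c be vectors of L with Q(v_c) = m c and Q(w_c) = m α_c, where α_c = c ω − ⌊c ω'⌋ has
-- conjugate in (0 , 1). An inner product β = B(v_c , ·) that is not a rational integer satisfies
-- Δ ≤ (β − β')², so by Cauchy–Schwarz under both embeddings all of them are rational integers once Δ
-- exceeds the stated bounds. Let G be the Gram matrix of v_1, v_2, v_C, v_D and let A be the matrix of
-- the w's with entries (β − β')/√Δ; both are integral with diagonal m, 2m, Cm, Dm. If G and A are
-- positive definite, then the v's and w's are independent: taking the conjugate of the norm of the
-- conjugate combination turns a relation Σ x v + Σ y w = 0 into A(y) ≤ 0, so y = 0 and then x = 0.
--
-- The leading binary minor 2m² − e² is not zero because √2 is irrational. The number C is a non-residue
-- at an odd prime dividing this minor d to an odd power, or 7 if d is a square or twice a square, so that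
-- C z² = x² + d y² is insoluble and the ternary minor is not zero. Similarly D is such that the ternary form does not represent D over ℚ. It comes
-- from a prime at which the quaternion algebra (−a , −b / ℚ) attached to the form is ramified; this prime
-- is found without reciprocity, by replacing b with (t² + a)/b, which stays positive, until some −a is
-- not a square modulo a prime factor of b or a = b = 1.
--
-- The minors of G are then positive as G is semidefinite. If a minor d of A were negative, the last
-- column u of the adjugate would satisfy A(u) = u_k d < 0, hence √Δ u_k |d| ≤ Q(Σ u_i w_i)', and Jacobi's
-- identity for the u_i² bounds √Δ.

module Submission where

open import Defs using (Squarefree; IsQR; IsQNR; IsLeastQNR; IsGamma)
open import Algebra.Bundles using (CommutativeRing)
import Algebra.Solver.Ring as Solver
import Algebra.Solver.Ring.AlmostCommutativeRing as ACR
open import Algebra.Structures using (IsCommutativeRing)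
open import Data.Bool using (Bool; true; false; T; _∧_; _∨_; not; if_then_else_)
open import Data.Bool.Properties using (T-∧; T-∨)
open import Data.Empty using (⊥; ⊥-elim)
open import Data.Fin as Fin using (Fin; zero; suc; toℕ; fromℕ<; splitAt; punchIn; punchOut; _↑ˡ_; _↑ʳ_)
import Data.Fin.Properties as Finₚ
open import Data.Integer as ℤ using (ℤ; 0ℤ; 1ℤ)
open import Data.Integer.DivMod using (_%ℕ_; _/ℕ_; a≡a%ℕn+[a/ℕn]*n; n%ℕd<d)
import Data.Integer.Divisibility.Signed as S
import Data.Integer.Properties as ℤₚ
open import Data.Integer.Tactic.RingSolver using (solve-∀)
open import Data.List using (List; []; _∷_)
open import Data.List.Relation.Unary.All as All using (All)
open import Data.Maybe using (Maybe; just; nothing)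
open import Data.Nat as ℕ using (ℕ; zero; suc; NonZero)
open import Data.Nat.Coprimality as Cop using (Coprime)
import Data.Nat.Divisibility as ℕ∣
import Data.Nat.DivMod as ℕ
import Data.Nat.GCD as GCD
open import Data.Nat.Induction using (<-wellFounded)
open import Data.Nat.ListAction using (product)
open import Data.Nat.Primality
open import Data.Nat.Primality.Factorisation using (factorise; PrimeFactorisation)
import Data.Nat.Properties as ℕₚ
open import Data.Nat.Tactic.RingSolver using () renaming (solve-∀ to solveℕ-∀)
open import Data.Product using (Σ; ∃; ∃₂; _×_; _,_; proj₁; proj₂)
open import Data.Rational as ℚ using (ℚ; mkℚ; 0ℚ; 1ℚ; ½; ↥_; ↧_)
import Data.Rational.Properties as ℚₚ
import Data.Rational.Unnormalised as ℚᵘ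
import Data.Rational.Unnormalised.Properties as ℚᵘₚ
open import Data.Sum using (_⊎_; inj₁; inj₂; [_,_]′)
open import Data.Unit using (⊤; tt)
open import Function using (_∘_; Equivalence)
open import Induction.WellFounded using (Acc; acc)
open import Relation.Binary.Definitions using (tri<; tri≈; tri>)
open import Relation.Binary.PropositionalEquality
open import Relation.Nullary using (¬_; Dec; yes; no; contradiction)
open import Relation.Nullary.Decidable using (map′; _×-dec_; ¬?; decidable-stable; from-yes; from-no; False; toWitnessFalse)

-- The convention `γ_2 = 7` is used twice. For the binary form, 7 is the least odd prime at which
-- both -1 and -2 are non-residues, so neither x² + y² nor x² + 2y² represents it. For the ternary
-- form, 7 is the largest of 1, 3, 5, 7, which represent the units of ℚ_2 modulo squares; the
-- classes of ℚ_2 are these and their doubles, so D ≤ 14 = 2·7. At an odd q the classes are 1, γ_q,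
-- q, qγ_q, and this is the bound qγ_q.
--
-- The class excluded by a ramified algebra is determined by the ternary determinant, so D must be
-- adapted to that determinant, whereas q depends on the algebra alone. The delicate point is that q
-- exists and is at most 2Cm³. A positive form means ramification at the real place, and reciprocity
-- would then give a finite ramified prime, but the descent on (a, b) finds one directly and also
-- controls its size.
--
-- All inner products are supplied for every index before C and D are chosen, since the choice of C
-- looks at the entry (1, 2) and the choice of D at the entries involving C.

module NumberTheory where

  open import Data.Integer using (+_; -[1+_]; _+_; _*_; _-_; -_) renaming (∣_∣ to abs)
  open S using (_∣_; divides)

  -- Quadratic residues

  ∣-resp : ∀ {d x y : ℤ} → x ≡ y → d ∣ x → d ∣ y
  ∣-resp refl d = d

  ∣-*ʳ : ∀ {d x} y → d ∣ x → d ∣ x * y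
  ∣-*ʳ {d} y (divides q refl) = divides (q * y) (lem q d y)
    where
    lem : ∀ q d y → q * d * y ≡ q * y * d
    lem = solve-∀

  ∣-*ˡ : ∀ {d x} y → d ∣ x → d ∣ y * x
  ∣-*ˡ {x = x} y d∣x = ∣-resp (ℤₚ.*-comm x y) (∣-*ʳ y d∣x)

  bezout : ∀ {m n} → Coprime m n → ∃₂ λ x y → x * + m + y * + n ≡ 1ℤ
  bezout {m} {n} cop with Cop.coprime-Bézout cop
  ... | GCD.Bézout.+- x y eq = + x , - (+ y) , trans (lem (+ x) (+ y) (+ m) (+ n)) (trans (cong (_- + y * + n) eq′) (lem′ (+ y * + n)))
    where
    eq′ : + x * + m ≡ 1ℤ + + y * + n
    eq′ = trans (sym (ℤₚ.pos-* x m)) (trans (cong +_ (sym eq)) (cong (λ t → 1ℤ + t) (ℤₚ.pos-* y n)))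
    lem : ∀ x y m n → x * m + - y * n ≡ x * m - y * n
    lem = solve-∀
    lem′ : ∀ z → 1ℤ + z - z ≡ 1ℤ
    lem′ = solve-∀
  ... | GCD.Bézout.-+ x y eq = - (+ x) , + y , trans (lem (+ x) (+ y) (+ m) (+ n)) (trans (cong (_- + x * + m) eq′) (lem′ (+ x * + m)))
    where
    eq′ : + y * + n ≡ 1ℤ + + x * + m
    eq′ = trans (sym (ℤₚ.pos-* y n)) (trans (cong +_ (sym eq)) (cong (λ t → 1ℤ + t) (ℤₚ.pos-* x m)))
    lem : ∀ x y m n → - x * m + y * n ≡ y * n - x * m
    lem = solve-∀
    lem′ : ∀ z → 1ℤ + z - z ≡ 1ℤ
    lem′ = solve-∀

  %ℕ-∣ : ∀ n .{{_ : NonZero n}} x → + n ∣ x - + (x %ℕ n)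
  %ℕ-∣ n x = divides (x /ℕ n) (trans (cong (_- + (x %ℕ n)) (a≡a%ℕn+[a/ℕn]*n x n)) (lem (+ (x %ℕ n)) (x /ℕ n * + n)))
    where
    lem : ∀ r q → r + q - r ≡ q
    lem = solve-∀

  ∣-small : ∀ {n a b} → a ℕ.< n → b ℕ.< n → + n ∣ + a - + b → a ≡ b
  ∣-small {n} {a} {b} a<n b<n d with ℕₚ.≤-total a b
  ... | inj₁ a≤b = ℕₚ.≤-antisym a≤b (ℕₚ.m∸n≡0⇒m≤n (go (b ℕ.∸ a) (ℕₚ.≤-<-trans (ℕₚ.m∸n≤m b a) b<n) e))
    where
    go : ∀ c → c ℕ.< n → n ℕ∣.∣ c → c ≡ 0
    go zero _ _ = refl
    go (suc c) c<n d = contradiction (ℕ∣.∣⇒≤ d) (ℕₚ.<⇒≱ c<n)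
    lem : ∀ x y → - (x - y) ≡ y - x
    lem = solve-∀
    e : n ℕ∣.∣ b ℕ.∸ a
    e = S.∣⇒∣ᵤ (∣-resp (trans (lem (+ a) (+ b)) (trans (ℤₚ.m-n≡m⊖n b a) (ℤₚ.⊖-≥ a≤b))) (S.∣m⇒∣-m d))
  ... | inj₂ b≤a = ℕₚ.≤-antisym (ℕₚ.m∸n≡0⇒m≤n (go (a ℕ.∸ b) (ℕₚ.≤-<-trans (ℕₚ.m∸n≤m a b) a<n) e)) b≤a
    where
    go : ∀ c → c ℕ.< n → n ℕ∣.∣ c → c ≡ 0
    go zero _ _ = refl
    go (suc c) c<n d = contradiction (ℕ∣.∣⇒≤ d) (ℕₚ.<⇒≱ c<n)
    e : n ℕ∣.∣ a ℕ.∸ b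
    e = S.∣⇒∣ᵤ (∣-resp (trans (ℤₚ.m-n≡m⊖n a b) (ℤₚ.⊖-≥ b≤a)) d)

  least : ∀ {P : ℕ → Set} → (∀ n → Dec (P n)) → ∀ {n} → P n → ∃ λ k → P k × (∀ h → h ℕ.< k → ¬ P h)
  least {P} P? {n} Pn = go n (<-wellFounded n) Pn
    where
    go : ∀ n → Acc ℕ._<_ n → P n → ∃ λ k → P k × (∀ h → h ℕ.< k → ¬ P h)
    go n (acc rec) Pn with ℕₚ.anyUpTo? P? n
    ... | yes (k , k<n , Pk) = go k (rec k<n) Pk
    ... | no ¬any = n , Pn , λ h h<n Ph → ¬any (h , h<n , Ph)

  module PrimeLemmas {p : ℕ} (pp : Prime p) where

    instance
      p≢0 : NonZero p
      p≢0 = prime⇒nonZero pp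

    1<p : 1 ℕ.< p
    1<p = ℕ.nonTrivial⇒n>1 p {{prime⇒nonTrivial pp}}

    euclid : ∀ x y → + p ∣ x * y → + p ∣ x ⊎ + p ∣ y
    euclid x y d with euclidsLemma (abs x) (abs y) pp (subst (p ℕ∣.∣_) (ℤₚ.abs-* x y) (S.∣⇒∣ᵤ d))
    ... | inj₁ e = inj₁ (S.∣ᵤ⇒∣ e)
    ... | inj₂ e = inj₂ (S.∣ᵤ⇒∣ e)

    euclid² : ∀ x → + p ∣ x * x → + p ∣ x
    euclid² x d = [ (λ e → e) , (λ e → e) ]′ (euclid x x d)

    p∣? : ∀ x → Dec (+ p ∣ x)
    p∣? x = + p S.∣? x

    coprime : ∀ {c} → ¬ p ℕ∣.∣ c → Coprime c p
    coprime p∤c {d} (d∣c , d∣p) with prime⇒irreducible pp d∣p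
    ... | inj₁ d≡1 = d≡1
    ... | inj₂ refl = contradiction d∣c p∤c

    inverse : ∀ y → ¬ + p ∣ y → ∃ λ z → + p ∣ y * z - 1ℤ
    inverse y p∤y = z , ∣-resp eq₃ (S.∣m∣n⇒∣m+n (∣-*ʳ z (%ℕ-∣ p y)) (divides (- w) refl))
      where
      r = y %ℕ p
      p∤r : ¬ p ℕ∣.∣ r
      p∤r e = p∤y (∣-resp (lem₁ y (+ r)) (S.∣m∣n⇒∣m+n (%ℕ-∣ p y) (S.∣ᵤ⇒∣ e)))
        where
        lem₁ : ∀ y r → y - r + r ≡ y
        lem₁ = solve-∀
      bz = bezout (coprime p∤r)
      z = proj₁ bz
      w = proj₁ (proj₂ bz)
      lem : ∀ y r z w p → (y - r) * z + - w * p ≡ y * z - (z * r + w * p)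
      lem = solve-∀
      eq₃ : (y - + r) * z + - w * + p ≡ y * z - 1ℤ
      eq₃ = trans (lem y (+ r) z w (+ p)) (cong (λ t → y * z - t) (proj₂ (proj₂ bz)))

    QR : ℤ → Set
    QR a = ∃ λ x → + p ∣ x * x - a

    QR? : ∀ a → Dec (QR a)
    QR? a = map′ (λ { (x , _ , d) → + x , d }) to (ℕₚ.anyUpTo? (λ x → p∣? (+ x * + x - a)) p)
      where
      to : QR a → ∃ λ x → x ℕ.< p × + p ∣ + x * + x - a
      to (x , d) = r , n%ℕd<d x p , ∣-resp (lem x (+ r) a) (S.∣m∣n⇒∣m-n d (∣-*ʳ (x + + r) (%ℕ-∣ p x)))
        where
        r = x %ℕ p
        lem : ∀ x r a → x * x - a - (x - r) * (x + r) ≡ r * r - a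
        lem = solve-∀

    residue-pigeonhole : ∀ {n} → p ℕ.< n → (x : Fin n → ℤ) → ∃₂ λ i j → i Fin.< j × + p ∣ x i - x j
    residue-pigeonhole p<n x = let (i , j , i<j , eq) = Finₚ.pigeonhole p<n (λ i → fromℕ< (rem i)) in i , j , i<j , congruent i j eq
      where
      rem : ∀ i → x i %ℕ p ℕ.< p
      rem i = n%ℕd<d (x i) p
      congruent : ∀ i j → fromℕ< (rem i) ≡ fromℕ< (rem j) → + p ∣ x i - x j
      congruent i j eq = ∣-resp (lem (x i) (x j) (+ (x i %ℕ p)))
        (S.∣m∣n⇒∣m-n (%ℕ-∣ p (x i)) (subst (λ t → + p ∣ x j - + t) (sym (Finₚ.fromℕ<-injective _ _ (rem i) (rem j) eq)) (%ℕ-∣ p (x j))))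
        where
        lem : ∀ x y r → x - r - (y - r) ≡ x - y
        lem = solve-∀

    IsQR⇒QR : ∀ {a} → IsQR p a → QR (+ a)
    IsQR⇒QR (x , d) = x , S.∣ᵤ⇒∣ d

    QR⇒IsQR : ∀ {a} → QR (+ a) → IsQR p a
    QR⇒IsQR (x , d) = x , S.∣⇒∣ᵤ d

    IsQNR? : ∀ a → Dec (IsQNR p a)
    IsQNR? a = ¬? (p ℕ∣.∣? a) ×-dec ¬? (map′ QR⇒IsQR IsQR⇒QR (QR? (+ a)))

    -- If every residue had a square root ρ a then ρ would be injective, and together with
    -- whichever of 1, −1 is not ρ 1 it would give p + 1 distinct residues.
    exists-QNR : p ≢ 2 → ∃ λ a → IsQNR p a
    exists-QNR p≢2 with ℕₚ.anyUpTo? IsQNR? p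
    ... | yes (a , _ , q) = a , q
    ... | no none = ⊥-elim (collide (residue-pigeonhole (ℕₚ.n<1+n p) val))
      where
      root : ∀ (a : Fin p) → ∃ λ x → + p ∣ x * x - + toℕ a
      root a with QR? (+ toℕ a) | p ℕ∣.∣? toℕ a
      ... | yes q | _ = q
      ... | no _ | yes d = 0ℤ , ∣-resp (sym (ℤₚ.+-identityˡ (- + toℕ a))) (S.∣m⇒∣-m (S.∣ᵤ⇒∣ d))
      ... | no nq | no nd = contradiction (toℕ a , Finₚ.toℕ<n a , nd , λ q → nq (IsQR⇒QR q)) none
      ρ : Fin p → ℤ
      ρ a = proj₁ (root a)
      one : Fin p
      one = fromℕ< 1<p
      extra′ : ∀ r → Dec (+ p ∣ 1ℤ - r) → ∃ λ e → + p ∣ e * e - 1ℤ × ¬ + p ∣ e - r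
      extra′ r (no nd) = 1ℤ , divides 0ℤ refl , nd
      extra′ r (yes d) = - 1ℤ , divides 0ℤ refl , λ d′ → p≢2 (ℕₚ.≤-antisym (ℕ∣.∣⇒≤ (S.∣⇒∣ᵤ (∣-resp (lem r) (S.∣m∣n⇒∣m-n d d′)))) 1<p)
        where
        lem : ∀ r → 1ℤ - r - (- 1ℤ - r) ≡ + 2
        lem = solve-∀
      extra : ∃ λ e → + p ∣ e * e - 1ℤ × ¬ + p ∣ e - ρ one
      extra = extra′ (ρ one) (p∣? (1ℤ - ρ one))
      val : Fin (suc p) → ℤ
      val Fin.zero = proj₁ extra
      val (Fin.suc a) = ρ a
      ρ-cong : ∀ x y c d → + p ∣ x * x - c → + p ∣ y * y - d → + p ∣ x - y → + p ∣ c - d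
      ρ-cong x y c d e₁ e₂ e₃ = ∣-resp (lem x y c d) (S.∣m∣n⇒∣m-n (S.∣m∣n⇒∣m+n (∣-*ʳ (x + y) e₃) e₂) e₁)
        where
        lem : ∀ x y c d → (x - y) * (x + y) + (y * y - d) - (x * x - c) ≡ c - d
        lem = solve-∀
      collide : ∃₂ (λ i j → i Fin.< j × + p ∣ val i - val j) → ⊥
      collide (Fin.zero , Fin.suc b , _ , eq) = proj₂ (proj₂ extra) (subst (λ t → + p ∣ proj₁ extra - ρ t) (sym same) eq)
        where
        same : one ≡ b
        same = Finₚ.toℕ-injective (trans (Finₚ.toℕ-fromℕ< 1<p) (∣-small 1<p (Finₚ.toℕ<n b)
          (ρ-cong (proj₁ extra) (ρ b) 1ℤ (+ toℕ b) (proj₁ (proj₂ extra)) (proj₂ (root b)) eq)))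
      collide (Fin.suc a , Fin.suc b , a<b , eq) = Finₚ.<⇒≢ (ℕ.s≤s⁻¹ a<b) (Finₚ.toℕ-injective
        (∣-small (Finₚ.toℕ<n a) (Finₚ.toℕ<n b) (ρ-cong (ρ a) (ρ b) (+ toℕ a) (+ toℕ b) (proj₂ (root a)) (proj₂ (root b)) eq)))

    IsQNR⇒1≤ : ∀ {a} → IsQNR p a → 1 ℕ.≤ a
    IsQNR⇒1≤ {zero} (nd , _) = contradiction (p ℕ∣.∣0) nd
    IsQNR⇒1≤ {suc a} _ = ℕ.s≤s ℕ.z≤n

    exists-gamma : p ≢ 2 → ∃ λ g → IsLeastQNR p g
    exists-gamma p≢2 with exists-QNR p≢2
    ... | a , q with least IsQNR? q
    ... | g , qg , min = g , IsQNR⇒1≤ qg , qg , λ h _ h<g → min h h<g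

    2≤QNR : ∀ {g} → IsQNR p g → 2 ℕ.≤ g
    2≤QNR {zero} (nd , _) = contradiction (p ℕ∣.∣0) nd
    2≤QNR {suc zero} (_ , nq) = contradiction (QR⇒IsQR (1ℤ , divides 0ℤ refl)) nq
    2≤QNR {suc (suc g)} _ = ℕ.s≤s (ℕ.s≤s ℕ.z≤n)

    half : p ≢ 2 → ∃ λ h → p ≡ suc (h ℕ.+ h)
    half p≢2 = go p refl
      where
      par : ∀ n → ∃ λ h → n ≡ h ℕ.+ h ⊎ n ≡ suc (h ℕ.+ h)
      par zero = 0 , inj₁ refl
      par (suc n) with par n
      ... | h , inj₁ refl = h , inj₂ refl
      ... | h , inj₂ refl = suc h , inj₁ (cong suc (sym (ℕₚ.+-suc h h)))
      go : ∀ n → p ≡ n → ∃ λ h → p ≡ suc (h ℕ.+ h)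
      go n refl with par n
      ... | h , inj₂ e = h , e
      ... | h , inj₁ e with prime⇒irreducible pp {2} (ℕ∣.divides h (trans e (trans (cong (h ℕ.+_) (sym (ℕₚ.+-identityʳ h))) (ℕₚ.*-comm 2 h))))
      ... | inj₂ e′ = contradiction (sym e′) p≢2

    -- The residues x² and u x² with 1 ≤ x ≤ (p−1)/2, together with 0 and c, are p + 1 many.
    QR-index-two : p ≢ 2 → ∀ {u} → IsQNR p u → ∀ c → ¬ + p ∣ c →
                   (∃ λ x → + p ∣ x * x - c) ⊎ (∃ λ x → + p ∣ + u * (x * x) - c)
    QR-index-two p≢2 {u} (p∤u , ¬QRu) c p∤c = collide (residue-pigeonhole p<n val)
      where
      h = proj₁ (half p≢2)
      p≡ : p ≡ suc (h ℕ.+ h)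
      p≡ = proj₂ (half p≢2)
      p<n : p ℕ.< 2 ℕ.+ (h ℕ.+ h)
      p<n = ℕₚ.≤-reflexive (cong suc p≡)
      root : Fin h → ℕ
      root i = suc (toℕ i)
      val′ : Fin h ⊎ Fin h → ℤ
      val′ (inj₁ i) = + root i * + root i
      val′ (inj₂ i) = + u * (+ root i * + root i)
      val : Fin (2 ℕ.+ (h ℕ.+ h)) → ℤ
      val Fin.zero = 0ℤ
      val (Fin.suc Fin.zero) = c
      val (Fin.suc (Fin.suc i)) = val′ (splitAt h i)
      root<p : ∀ i → root i ℕ.+ root i ℕ.< p
      root<p i = subst (root i ℕ.+ root i ℕ.<_) (sym p≡) (ℕ.s≤s (ℕₚ.+-mono-≤ (Finₚ.toℕ<n i) (Finₚ.toℕ<n i)))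
      p∤+ : ∀ {k} → suc k ℕ.< p → ¬ + p ∣ + suc k
      p∤+ k<p d = ℕₚ.<⇒≱ k<p (ℕ∣.∣⇒≤ (S.∣⇒∣ᵤ d))
      p∤root : ∀ i → ¬ + p ∣ + root i
      p∤root i = p∤+ (ℕₚ.≤-<-trans (ℕₚ.m≤m+n (root i) (root i)) (root<p i))
      p∤u′ : ¬ + p ∣ + u
      p∤u′ d = p∤u (S.∣⇒∣ᵤ d)
      neg : ∀ x → - (0ℤ - x) ≡ x
      neg = solve-∀
      p∤val′ : ∀ s → ¬ + p ∣ val′ s
      p∤val′ (inj₁ i) d = p∤root i (euclid² _ d)
      p∤val′ (inj₂ i) d with euclid (+ u) _ d
      ... | inj₁ d′ = p∤u′ d′
      ... | inj₂ d′ = p∤root i (euclid² _ d′)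
      -- The roots run over 1, ..., (p-1)/2, so the sum of two of them lies strictly between 0 and
      -- p.
      squares-inj : ∀ i j → + p ∣ + root i * + root i - + root j * + root j → i ≡ j
      squares-inj i j d = [ (λ d′ → Finₚ.toℕ-injective (ℕₚ.suc-injective (∣-small (lt i) (lt j) d′)))
                          , (λ d′ → contradiction d′ (p∤+ (subst (λ t → root i ℕ.+ root j ℕ.< t) (sym p≡) (ℕ.s≤s (ℕₚ.+-mono-≤ (Finₚ.toℕ<n i)
                              (Finₚ.toℕ<n j))))))
                          ]′ (factor (+ root i) (+ root j) d)
        where
        lem : ∀ x y → x * x - y * y ≡ (x - y) * (x + y)
        lem = solve-∀
        factor : ∀ x y → + p ∣ x * x - y * y → (+ p ∣ x - y) ⊎ (+ p ∣ x + y)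
        factor x y d = euclid (x - y) (x + y) (∣-resp (lem x y) d)
        lt : ∀ i → root i ℕ.< p
        lt i = ℕₚ.≤-<-trans (ℕₚ.m≤m+n (root i) (root i)) (root<p i)
      -- A coincidence x² ≡ u y² would make u the square of x / y.
      mixed : ∀ i j → ¬ + p ∣ + root i * + root i - + u * (+ root j * + root j)
      mixed i j d = ¬QRu (QR⇒IsQR (x * z , ∣-resp (lem x y z (+ u)) (S.∣m∣n⇒∣m+n (∣-*ʳ (z * z) d) (∣-*ˡ (+ u * (y * z + 1ℤ)) dz))))
        where
        x = + root i
        y = + root j
        z = proj₁ (inverse y (p∤root j))
        dz = proj₂ (inverse y (p∤root j))
        lem : ∀ x y z u → (x * x - u * (y * y)) * (z * z) + u * (y * z + 1ℤ) * (y * z - 1ℤ) ≡ x * z * (x * z) - u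
        lem = solve-∀
      flip : ∀ x y → + p ∣ x - y → + p ∣ y - x
      flip x y d = ∣-resp (lem x y) (S.∣m⇒∣-m d)
        where
        lem : ∀ x y → - (x - y) ≡ y - x
        lem = solve-∀
      val′-inj : ∀ s t → + p ∣ val′ s - val′ t → s ≡ t
      val′-inj (inj₁ i) (inj₁ j) d = cong inj₁ (squares-inj i j d)
      val′-inj (inj₁ i) (inj₂ j) d = contradiction d (mixed i j)
      val′-inj (inj₂ i) (inj₁ j) d = contradiction (flip (val′ (inj₂ i)) (val′ (inj₁ j)) d) (mixed j i)
      val′-inj (inj₂ i) (inj₂ j) d = cong inj₂ (squares-inj i j (cancel (+ root i * + root i) (+ root j * + root j) d))
        where
        lem : ∀ u x y → u * x - u * y ≡ u * (x - y)
        lem = solve-∀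
        cancel : ∀ x y → + p ∣ + u * x - + u * y → + p ∣ x - y
        cancel x y d = [ (λ d′ → contradiction d′ p∤u′) , (λ d′ → d′) ]′ (euclid (+ u) (x - y) (∣-resp (lem (+ u) x y) d))
      hit : ∀ s → + p ∣ val′ s - c → (∃ λ x → + p ∣ x * x - c) ⊎ (∃ λ x → + p ∣ + u * (x * x) - c)
      hit (inj₁ i) d = inj₁ (+ root i , d)
      hit (inj₂ i) d = inj₂ (+ root i , d)
      collide : ∃₂ (λ i j → i Fin.< j × + p ∣ val i - val j) → _
      collide (Fin.zero , Fin.suc Fin.zero , _ , eq) = contradiction (∣-resp (neg c) (S.∣m⇒∣-m eq)) p∤c
      collide (Fin.zero , Fin.suc (Fin.suc j) , _ , eq) =
        contradiction (∣-resp (neg _) (S.∣m⇒∣-m eq)) (p∤val′ (splitAt h j))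
      collide (Fin.suc Fin.zero , Fin.suc (Fin.suc j) , _ , eq) = hit (splitAt h j) (flip c _ eq)
      collide (Fin.suc (Fin.suc i) , Fin.suc (Fin.suc j) , i<j , eq) = contradiction
        (trans (sym (Finₚ.join-splitAt h h i)) (trans (cong (Fin.join h h) (val′-inj (splitAt h i) (splitAt h j) eq)) (Finₚ.join-splitAt h h j)))
        (Finₚ.<⇒≢ (ℕ.s≤s⁻¹ (ℕ.s≤s⁻¹ i<j)))
      collide (Fin.suc Fin.zero , Fin.suc Fin.zero , ℕ.s≤s () , _)
      collide (Fin.suc (Fin.suc _) , Fin.suc Fin.zero , ℕ.s≤s () , _)

  -- Infinite descent: division by p strictly lowers the absolute value of a nonzero w. `P w` will
  -- say that w is the last coordinate of some solution of a homogeneous equation.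
  descent : ∀ {p} → 1 ℕ.< p → (P : ℤ → Set) → (∀ w → P w → ∃ λ w′ → w ≡ w′ * + p × P w′) → ∀ w → P w → w ≡ 0ℤ
  descent {p} 1<p P step w Pw = go w Pw (<-wellFounded (abs w))
    where
    go : ∀ w → P w → Acc ℕ._<_ (abs w) → w ≡ 0ℤ
    go w Pw (acc rec) with w ℤ.≟ 0ℤ
    ... | yes w≡0 = w≡0
    ... | no w≢0 = next (step w Pw)
      where
      next : (∃ λ w′ → w ≡ w′ * + p × P w′) → w ≡ 0ℤ
      next (w′ , eq , Pw′) = trans eq (cong (_* + p) (go w′ Pw′ (rec lt)))
        where
        e : abs w ≡ abs w′ ℕ.* p
        e = trans (cong abs eq) (ℤₚ.abs-* w′ (+ p))
        w′≢0 : NonZero (abs w′)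
        w′≢0 = ℕ.≢-nonZero λ z → w≢0 (ℤₚ.∣i∣≡0⇒i≡0 (trans e (cong (ℕ._* p) z)))
        lt : abs w′ ℕ.< abs w
        lt = subst (abs w′ ℕ.<_) (sym e) (ℕₚ.m<m*n (abs w′) p {{w′≢0}} 1<p)

  square-divisor? : ∀ n → 1 ℕ.≤ n → (∃₂ λ k e → n ≡ e ℕ.* (k ℕ.* k) × 1 ℕ.≤ e × e ℕ.< n) ⊎ (∀ k → 2 ℕ.≤ k → ¬ (k ℕ.* k) ℕ∣.∣ n)
  square-divisor? n 1≤n with ℕₚ.anyUpTo? (λ k → (2 ℕ.≤? k) ×-dec ((k ℕ.* k) ℕ∣.∣? n)) (suc n)
  ... | no none = inj₂ λ k 2≤k d → none (k , ℕ.s≤s (ℕₚ.≤-trans (ℕₚ.m≤m*n k k {{ℕ.>-nonZero (ℕₚ.<⇒≤ 2≤k)}}) (ℕ∣.∣⇒≤ {{ℕ.>-nonZero 1≤n}} d)) , 2≤k , d)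
  ... | yes (k , _ , 2≤k , ℕ∣.divides e refl) = inj₁ (k , e , refl , 1≤e ,
      ℕₚ.m<m*n e (k ℕ.* k) {{ℕ.>-nonZero 1≤e}} (ℕₚ.<-≤-trans 2≤k (ℕₚ.m≤m*n k k {{ℕ.>-nonZero (ℕₚ.<⇒≤ 2≤k)}})))
    where
    1≤e : 1 ℕ.≤ e
    1≤e = ℕₚ.n≢0⇒n>0 λ e≡0 → contradiction (subst (λ e → 1 ℕ.≤ e ℕ.* (k ℕ.* k)) e≡0 1≤n) λ ()

  prime-divisor : ∀ n → 2 ℕ.≤ n → ∃ λ p → Prime p × p ℕ∣.∣ n
  prime-divisor n 2≤n = go (PrimeFactorisation.factors f) (PrimeFactorisation.isFactorisation f) (PrimeFactorisation.factorsPrime f)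
    where
    f = factorise n {{ℕ.>-nonZero (ℕₚ.≤-trans (ℕ.s≤s ℕ.z≤n) 2≤n)}}
    go : ∀ ps → n ≡ product ps → All Prime ps → ∃ λ p → Prime p × p ℕ∣.∣ n
    go [] refl _ = contradiction 2≤n λ { (ℕ.s≤s ()) }
    go (p ∷ ps) eq (pp All.∷ _) = p , pp , ℕ∣.divides (product ps) (trans eq (ℕₚ.*-comm p _))

  prime[7] : Prime 7
  prime[7] = from-yes (prime? 7)

  -- Numbers not represented by binary and ternary forms over ℚ

  -- After clearing denominators, `nonrep` says that γ is not a value of x² + d y² over ℚ. The same
  -- shape recurs in `NonRep`.
  record BinaryChoice (N d : ℕ) : Set where
    field
      p γ : ℕ
      prime-p : Prime p
      p≤N : p ℕ.≤ N
      isGamma : IsGamma p γ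
      2≤γ : 2 ℕ.≤ γ
      nonrep : ∀ x y z → + γ * (z * z) ≡ x * x + + d * (y * y) → z ≡ 0ℤ

  module _ {p : ℕ} (pp : Prime p) where
    open PrimeLemmas pp

    -- If y were invertible modulo p, then x / y would be a square root of -a.
    norm-anisotropic : ∀ a → (∀ s → ¬ + p ∣ s * s + a) → ∀ x y → + p ∣ x * x + a * (y * y) → (+ p ∣ x) × (+ p ∣ y)
    norm-anisotropic a nr x y d = fx , fy
      where
      fy : + p ∣ y
      fy = decidable-stable (p∣? y) λ p∤y → let (z , dz) = inverse y p∤y in
        nr (x * z) (∣-resp (lem x y z a) (S.∣m∣n⇒∣m-n (∣-*ʳ (z * z) d) (∣-*ˡ (a * (y * z + 1ℤ)) dz)))
        where
        lem : ∀ x y z a → (x * x + a * (y * y)) * (z * z) - a * (y * z + 1ℤ) * (y * z - 1ℤ) ≡ x * z * (x * z) + a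
        lem = solve-∀
      fx : + p ∣ x
      fx = euclid² x (∣-resp (lem x (a * (y * y))) (S.∣m∣n⇒∣m-n d (∣-*ˡ a (∣-*ˡ y fy))))
        where
        lem : ∀ x t → x * x + t - t ≡ x * x
        lem = solve-∀

    cancel-p : ∀ x y → + p * x ≡ + p * y → x ≡ y
    cancel-p x y = ℤₚ.*-cancelˡ-≡ (+ p) x y

    cancel-p² : ∀ x y → x * (+ p * + p) ≡ y * (+ p * + p) → x ≡ y
    cancel-p² x y eq = cancel-p x y (cancel-p (+ p * x) (+ p * y) (trans (lem x (+ p)) (trans eq (sym (lem y (+ p))))))
      where
      lem : ∀ x p → p * (p * x) ≡ x * (p * p)
      lem = solve-∀

    -- Modulo p the equation reads γ z² ≡ x², so p divides z because γ is a non-residue, and then p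
    -- divides x. Dividing by p leaves u y² ≡ 0, so p divides y as well, and the whole solution can
    -- be divided by p.
    binary-ramified : ∀ γ → IsQNR p γ → ∀ u → ¬ + p ∣ u → ∀ x y z → + γ * (z * z) ≡ x * x + + p * u * (y * y) → z ≡ 0ℤ
    binary-ramified γ (p∤γ , nqr) u p∤u x₀ y₀ z₀ eq₀ = descent 1<p P step z₀ (x₀ , y₀ , eq₀)
      where
      P : ℤ → Set
      P z = ∃₂ λ x y → + γ * (z * z) ≡ x * x + + p * u * (y * y)
      step : ∀ z → P z → ∃ λ z′ → z ≡ z′ * + p × P z′
      step z (x , y , eq) = fin pz px py eq
        where
        pz : + p ∣ z
        pz = decidable-stable (p∣? z) λ p∤z → let (i , di) = inverse z p∤z in
          nqr (QR⇒IsQR (x * i , ∣-resp (trans (lem x y z i (+ p) u (+ γ)) (trans (cong (λ t → x * i * (x * i) + t * (i * i) - + γ -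
              (x * x + + p * u * (y * y)) * (i * i)) eq) (lem₂ (x * i) _ _)))
            (S.∣m∣n⇒∣m+n (∣-*ˡ (- u * (y * y) * (i * i)) S.∣-refl) (∣-*ˡ (+ γ * (z * i + 1ℤ)) di))))
          where
          lem : ∀ x y z i p u γ → (- u * (y * y) * (i * i)) * p + γ * (z * i + 1ℤ) * (z * i - 1ℤ) ≡ x * i * (x * i) + (γ * (z * z)) * (i * i) - γ -
              (x * x + p * u * (y * y)) * (i * i)
          lem = solve-∀
          lem₂ : ∀ q t γ → q * q + t - γ - t ≡ q * q - γ
          lem₂ = solve-∀
        px : + p ∣ x
        px = euclid² x (∣-resp (trans (cong (_- (+ p * u * (y * y))) eq) (lem (x * x) _))
          (S.∣m∣n⇒∣m-n (∣-*ˡ (+ γ) (∣-*ˡ z pz)) (∣-*ʳ (y * y) (∣-*ʳ u S.∣-refl))))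
          where
          lem : ∀ s t → s + t - t ≡ s
          lem = solve-∀
        py : + p ∣ y
        py = [ (λ d → contradiction d p∤u) , euclid² y ]′ (euclid u (y * y) (h pz px eq))
          where
          h : ∀ {x z} → + p ∣ z → + p ∣ x → + γ * (z * z) ≡ x * x + + p * u * (y * y) → + p ∣ u * (y * y)
          h (divides z refl) (divides x refl) eq = divides (+ γ * (z * z) - x * x) (cancel-p _ _
            (sym (trans (lem (+ γ) x z (+ p)) (trans (cong (_- x * + p * (x * + p)) eq) (lem₂ x (+ p) u (y * y))))))
            where
            lem : ∀ γ x z p → p * ((γ * (z * z) - x * x) * p) ≡ γ * (z * p * (z * p)) - x * p * (x * p)
            lem = solve-∀
            lem₂ : ∀ x p u t → x * p * (x * p) + p * u * t - x * p * (x * p) ≡ p * (u * t)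
            lem₂ = solve-∀
        fin : ∀ {x y z} → + p ∣ z → + p ∣ x → + p ∣ y → + γ * (z * z) ≡ x * x + + p * u * (y * y) → ∃ λ z′ → z ≡ z′ * + p × P z′
        fin (divides z refl) (divides x refl) (divides y refl) eq = z , refl , x , y , cancel-p² _ _ (trans (lem (+ γ) z (+ p)) (trans eq (lem₂ x y
            (+ p) u)))
          where
          lem : ∀ γ z p → γ * (z * z) * (p * p) ≡ γ * (z * p * (z * p))
          lem = solve-∀
          lem₂ : ∀ x y p u → x * p * (x * p) + p * u * (y * p * (y * p)) ≡ (x * x + p * u * (y * y)) * (p * p)
          lem₂ = solve-∀

    -- Here the prime itself is the number that is not represented: x² + f y² has even valuation at
    -- p whenever -f is not a square modulo p, but p z² has odd valuation.
    binary-inert : ∀ f → (∀ s → ¬ + p ∣ s * s + f) → ∀ x y z → + p * (z * z) ≡ x * x + f * (y * y) → z ≡ 0ℤ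
    binary-inert f nr x₀ y₀ z₀ eq₀ = descent 1<p P step z₀ (x₀ , y₀ , eq₀)
      where
      P : ℤ → Set
      P z = ∃₂ λ x y → + p * (z * z) ≡ x * x + f * (y * y)
      step : ∀ z → P z → ∃ λ z′ → z ≡ z′ * + p × P z′
      step z (x , y , eq) = fin (pz (proj₁ pxy) (proj₂ pxy) eq) (proj₁ pxy) (proj₂ pxy) eq
        where
        pxy = norm-anisotropic f nr x y (∣-resp eq (∣-*ʳ (z * z) S.∣-refl))
        pz : ∀ {x y} → + p ∣ x → + p ∣ y → + p * (z * z) ≡ x * x + f * (y * y) → + p ∣ z
        pz (divides x refl) (divides y refl) eq = euclid² z (divides (x * x + f * (y * y)) (cancel-p _ _ (trans eq (lem x y (+ p) f))))
          where
          lem : ∀ x y p f → x * p * (x * p) + f * (y * p * (y * p)) ≡ p * ((x * x + f * (y * y)) * p)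
          lem = solve-∀
        fin : ∀ {x y z} → + p ∣ z → + p ∣ x → + p ∣ y → + p * (z * z) ≡ x * x + f * (y * y) → ∃ λ z′ → z ≡ z′ * + p × P z′
        fin (divides z refl) (divides x refl) (divides y refl) eq = z , refl , x , y , cancel-p² _ _ (trans (lem z (+ p)) (trans eq (lem₂ x y
            (+ p) f)))
          where
          lem : ∀ z p → p * (z * z) * (p * p) ≡ p * (z * p * (z * p))
          lem = solve-∀
          lem₂ : ∀ x y p f → x * p * (x * p) + f * (y * p * (y * p)) ≡ (x * x + f * (y * y)) * (p * p)
          lem₂ = solve-∀

    ¬QR⇒no-root : ∀ a → ¬ QR (- a) → ∀ s → ¬ + p ∣ s * s + a
    ¬QR⇒no-root a nq s d = nq (s , ∣-resp (lem s a) d)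
      where
      lem : ∀ s a → s * s + a ≡ s * s - - a
      lem = solve-∀

  2≤7 : 2 ℕ.≤ 7
  2≤7 = ℕ.s≤s (ℕ.s≤s ℕ.z≤n)

  -- A square factor of d is absorbed into y. A squarefree d other than 1 and 2 has an odd prime
  -- factor, which divides it exactly once.
  binary-choice : ∀ N → 2 ℕ.≤ N → ∀ d → 1 ℕ.≤ d → d ℕ.≤ N → BinaryChoice N d
  binary-choice N 2≤N d 1≤d d≤N = go d 1≤d d≤N (<-wellFounded d)
    where
    open BinaryChoice
    -- The recorded prime is 2, which gives access to the value 7 of γ; the obstruction itself lives
    -- at the prime 7.
    small : ∀ d → (∀ s → ¬ + 7 ∣ s * s + + d) → BinaryChoice N d
    small d nr .p = 2
    small d nr .γ = 7
    small d nr .prime-p = prime[2]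
    small d nr .p≤N = 2≤N
    small d nr .isGamma = inj₁ (refl , refl)
    small d nr .2≤γ = 2≤7
    small d nr .nonrep = binary-inert prime[7] (+ d) nr
    7-1 : ∀ s → ¬ + 7 ∣ s * s + + 1
    7-1 = ¬QR⇒no-root prime[7] (+ 1) (from-no (PrimeLemmas.QR? prime[7] (- + 1)))
    7-2 : ∀ s → ¬ + 7 ∣ s * s + + 2
    7-2 = ¬QR⇒no-root prime[7] (+ 2) (from-no (PrimeLemmas.QR? prime[7] (- + 2)))
    ramified : ∀ {q} (pq : Prime q) → q ≢ 2 → ∀ u → 1 ℕ.≤ u ℕ.* q → u ℕ.* q ℕ.≤ N → ¬ q ℕ∣.∣ u → BinaryChoice N (u ℕ.* q)
    ramified {q} pq q≢2 u 1≤d d≤N q∤u = mk (PrimeLemmas.exists-gamma pq q≢2)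
      where
      mk : (∃ λ g → IsLeastQNR q g) → BinaryChoice N (u ℕ.* q)
      mk (g , lq) .p = q
      mk (g , lq) .γ = g
      mk (g , lq) .prime-p = pq
      mk (g , lq) .p≤N = ℕₚ.≤-trans (ℕ∣.∣⇒≤ {{ℕ.>-nonZero 1≤d}} (ℕ∣.divides u refl)) d≤N
      mk (g , lq) .isGamma = inj₂ (q≢2 , lq)
      mk (g , lq) .2≤γ = PrimeLemmas.2≤QNR pq (proj₁ (proj₂ lq))
      mk (g , lq) .nonrep x y z eq = binary-ramified pq g (proj₁ (proj₂ lq)) (+ u) (λ d → q∤u (S.∣⇒∣ᵤ d)) x y z
        (trans eq (cong (λ t → x * x + t * (y * y)) (trans (ℤₚ.pos-* u q) (ℤₚ.*-comm (+ u) (+ q)))))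
    sqfree : ∀ d → 1 ℕ.≤ d → d ℕ.≤ N → (∀ k → 2 ℕ.≤ k → ¬ (k ℕ.* k) ℕ∣.∣ d) → BinaryChoice N d
    sqfree (suc zero) _ _ _ = small 1 7-1
    sqfree (suc (suc zero)) _ _ _ = small 2 7-2
    sqfree d@(suc (suc (suc _))) 1≤d d≤N sf = case₁ (prime-divisor d (ℕ.s≤s (ℕ.s≤s ℕ.z≤n)))
      where
      exact : ∀ {q} → Prime q → q ≢ 2 → q ℕ∣.∣ d → BinaryChoice N d
      exact {q} pq q≢2 (ℕ∣.divides u eq) = subst (BinaryChoice N) (sym eq) (ramified pq q≢2 u (subst (1 ℕ.≤_) eq 1≤d) (subst (ℕ._≤ N) eq d≤N)
        λ { (ℕ∣.divides v refl) → sf q (PrimeLemmas.1<p pq) (ℕ∣.divides v (trans eq (ℕₚ.*-assoc v q q))) })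
      case₁ : (∃ λ q → Prime q × q ℕ∣.∣ d) → BinaryChoice N d
      case₁ (q , pq , q∣d@(ℕ∣.divides u eq)) with q ℕ.≟ 2
      ... | no q≢2 = exact pq q≢2 q∣d
      ... | yes refl = case₂ u eq
        where
        case₂ : ∀ u → d ≡ u ℕ.* 2 → BinaryChoice N d
        case₂ zero ()
        case₂ (suc zero) ()
        -- Here d = 2u, and squarefreeness of d makes u odd, so every prime factor of u is odd.
        case₂ u@(suc (suc _)) eq with prime-divisor u (ℕ.s≤s (ℕ.s≤s ℕ.z≤n))
        ... | r , pr , r∣u with r ℕ.≟ 2
        ... | no r≢2 = exact pr r≢2 (ℕ∣.∣-trans r∣u (ℕ∣.divides 2 (trans eq (ℕₚ.*-comm u 2))))
        ... | yes refl = contradiction (subst (4 ℕ∣.∣_) (sym eq) (ℕ∣.*-monoˡ-∣ 2 r∣u)) (sf 2 ℕₚ.≤-refl)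
    go : ∀ d → 1 ℕ.≤ d → d ℕ.≤ N → Acc ℕ._<_ d → BinaryChoice N d
    go d 1≤d d≤N (acc rec) with square-divisor? d 1≤d
    ... | inj₂ sf = sqfree d 1≤d d≤N sf
    ... | inj₁ (k , e , eq , 1≤e , e<d) = transfer (go e 1≤e (ℕₚ.≤-trans (ℕₚ.<⇒≤ e<d) d≤N) (rec e<d))
      where
      transfer : BinaryChoice N e → BinaryChoice N d
      transfer c .p = c .p
      transfer c .γ = c .γ
      transfer c .prime-p = c .prime-p
      transfer c .p≤N = c .p≤N
      transfer c .isGamma = c .isGamma
      transfer c .2≤γ = c .2≤γ
      transfer c .nonrep x y z eq′ = c .nonrep x (+ k * y) z (trans eq′ (cong (λ t → x * x + t)
        (trans (cong (_* (y * y)) (trans (cong +_ eq) (trans (ℤₚ.pos-* e (k ℕ.* k)) (cong (+ e *_) (ℤₚ.pos-* k k))))) (lem (+ e) (+ k) y))))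
        where
        lem : ∀ e k y → e * (k * k) * (y * y) ≡ e * (k * y * (k * y))
        lem = solve-∀

  -- n is not represented over ℚ by the form on the pure quaternions of (−a , −b / ℚ), up to sign the norm.
  record NonRep (a b n : ℤ) : Set where
    field
      vanish : ∀ x y z w → a * (x * x) + b * (y * y) + a * b * (z * z) ≡ n * (w * w) → w ≡ 0ℤ
  open NonRep

  -- −n is a square of ℚ_p: the one square class that a quaternion algebra ramified at p excludes.
  record NegSquareAt (p : ℕ) (n : ℤ) : Set where
    constructor negSquareAt
    field
      e u s : ℤ
      e≢0 : e ≢ 0ℤ
      n≡ : n ≡ e * e * u
      p∤u : ¬ + p ∣ u
      p∣u+s² : + p ∣ s * s + u

  -- The analogue at 2: a unit is a square in ℚ_2 exactly if it is 1 modulo 8, and -(8t + 7) is such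
  -- a unit.
  record NegSquareAt2 (n : ℤ) : Set where
    constructor negSquareAt2
    field
      e t : ℤ
      e≢0 : e ≢ 0ℤ
      n≡ : n ≡ e * e * (+ 8 * t + + 7)

  *-≢0 : ∀ {e w} → e ≢ 0ℤ → e * w ≡ 0ℤ → w ≡ 0ℤ
  *-≢0 {e} e≢0 eq = [ (λ e≡0 → contradiction e≡0 e≢0) , (λ w≡0 → w≡0) ]′ (ℤₚ.i*j≡0⇒i≡0∨j≡0 e eq)

  module _ {p : ℕ} (pp : Prime p) where
    open PrimeLemmas pp

    -- Modulo p the equation becomes (s w)² + a x² ≡ 0, because -u ≡ s². As -a is not a square, p
    -- divides w and x. Dividing by p then leaves c (y² + a z²) ≡ 0, and the same argument applies
    -- to y and z.
    anisotropic-at : ∀ a c → (∀ s → ¬ + p ∣ s * s + a) → ¬ + p ∣ c → ∀ {n} → NegSquareAt p n → NonRep a (+ p * c) n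
    anisotropic-at a c nr p∤c {n} (negSquareAt e u s e≢0 n≡ p∤u p∣) .vanish x₀ y₀ z₀ w₀ eq₀ =
      *-≢0 e≢0 (descent 1<p P step (e * w₀) (x₀ , y₀ , z₀ , trans eq₀ (trans (cong (_* (w₀ * w₀)) n≡) (lem e u w₀))))
      where
      lem : ∀ e u w → e * e * u * (w * w) ≡ u * (e * w * (e * w))
      lem = solve-∀
      E : ℤ → ℤ → ℤ → ℤ → Set
      E x y z w = a * (x * x) + + p * c * (y * y) + a * (+ p * c) * (z * z) ≡ u * (w * w)
      P : ℤ → Set
      P w = ∃ λ x → ∃₂ λ y z → E x y z w
      p∤s : ¬ + p ∣ s
      p∤s d = p∤u (∣-resp (l s u) (S.∣m∣n⇒∣m-n p∣ (∣-*ˡ s d)))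
        where
        l : ∀ s u → s * s + u - s * s ≡ u
        l = solve-∀
      step : ∀ w → P w → ∃ λ w′ → w ≡ w′ * + p × P w′
      step w (x , y , z , eq) = fin pw px (proj₁ pyz) (proj₂ pyz) eq
        where
        l₁ : ∀ s u w a x p c y z → (s * s + u) * (w * w) - p * (c * (y * y) + a * c * (z * z))
             ≡ s * w * (s * w) + a * (x * x) + (u * (w * w) - (a * (x * x) + p * c * (y * y) + a * (p * c) * (z * z)))
        l₁ = solve-∀
        l₁′ : ∀ t k → t + (k - k) ≡ t
        l₁′ = solve-∀
        pp-swpx : (+ p ∣ s * w) × (+ p ∣ x)
        pp-swpx = norm-anisotropic pp a nr (s * w) x (∣-resp
          (trans (l₁ s u w a x (+ p) c y z) (trans (cong (λ t → s * w * (s * w) + a * (x * x) + (u * (w * w) - t)) eq) (l₁′ _ (u * (w * w)))))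
          (S.∣m∣n⇒∣m-n (∣-*ʳ (w * w) p∣) (∣-*ʳ _ S.∣-refl)))
        px = proj₂ pp-swpx
        pw : + p ∣ w
        pw = [ (λ d → contradiction d p∤s) , (λ d → d) ]′ (euclid s w (proj₁ pp-swpx))
        pyz : (+ p ∣ y) × (+ p ∣ z)
        pyz = norm-anisotropic pp a nr y z ([ (λ d → contradiction d p∤c) , (λ d → d) ]′ (euclid c _ (h px pw eq)))
          where
          h : ∀ {x w} → + p ∣ x → + p ∣ w → E x y z w → + p ∣ c * (y * y + a * (z * z))
          h (divides x refl) (divides w refl) eq = divides (u * (w * w) - a * (x * x)) (cancel-p pp _ _
            (trans (l₂ a x (+ p) c y z) (trans (cong (_- a * (x * + p * (x * + p))) eq) (l₃ u w a x (+ p)))))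
            where
            l₂ : ∀ a x p c y z → p * (c * (y * y + a * (z * z))) ≡ a * (x * p * (x * p)) + p * c * (y * y) + a * (p * c) * (z * z) - a * (x * p *
                (x * p))
            l₂ = solve-∀
            l₃ : ∀ u w a x p → u * (w * p * (w * p)) - a * (x * p * (x * p)) ≡ p * ((u * (w * w) - a * (x * x)) * p)
            l₃ = solve-∀
        fin : ∀ {x y z w} → + p ∣ w → + p ∣ x → + p ∣ y → + p ∣ z → E x y z w → ∃ λ w′ → w ≡ w′ * + p × P w′
        fin (divides w refl) (divides x refl) (divides y refl) (divides z refl) eq =
          w , refl , x , y , z , cancel-p² pp _ _ (trans (l₂ a (+ p) c x y z) (trans eq (l₃ u w (+ p))))
          where
          l₂ : ∀ a p c x y z → (a * (x * x) + p * c * (y * y) + a * (p * c) * (z * z)) * (p * p)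
               ≡ a * (x * p * (x * p)) + p * c * (y * p * (y * p)) + a * (p * c) * (z * p * (z * p))
          l₂ = solve-∀
          l₃ : ∀ u w p → u * (w * p * (w * p)) ≡ u * (w * w) * (p * p)
          l₃ = solve-∀

    -- Up to squares k is a unit or p times a unit. The factor p is matched by a p in D, and the
    -- remaining unit is corrected by 1 or by the non-residue g.
    negSquare-multiple : p ≢ 2 → ∀ {g} → IsLeastQNR p g → ∀ k → 1 ℕ.≤ k →
                         ∃ λ D → 1 ℕ.≤ D × D ℕ.≤ p ℕ.* g × NegSquareAt p (+ D * + k)
    negSquare-multiple p≢2 {g} (1≤g , qnr , _) k 1≤k = go k 1≤k (<-wellFounded k)
      where
      1≤p : 1 ℕ.≤ p
      1≤p = ℕₚ.<⇒≤ 1<p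
      p∤g : ¬ + p ∣ + g
      p∤g d = proj₁ qnr (S.∣⇒∣ᵤ d)
      +p≢0 : + p ≢ 0ℤ
      +p≢0 eq = ℕₚ.<⇒≢ 1≤p (sym (ℤₚ.+-injective eq))
      residue : ∀ u → ¬ + p ∣ u → ∃ λ r → 1 ℕ.≤ r × r ℕ.≤ g × ¬ + p ∣ + r * u × ∃ λ s → + p ∣ s * s + + r * u
      residue u p∤u = [ one , gam ]′ (QR-index-two p≢2 qnr (- u) λ d → p∤u (∣-resp (ℤₚ.neg-involutive u) (S.∣m⇒∣-m d)))
        where
        one : (∃ λ x → + p ∣ x * x - - u) → _
        one (x , d) = 1 , ℕₚ.≤-refl , 1≤g , (λ d → p∤u (∣-resp (ℤₚ.*-identityˡ u) d)) , x , ∣-resp (l x u) d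
          where
          l : ∀ x u → x * x - - u ≡ x * x + 1ℤ * u
          l = solve-∀
        gam : (∃ λ x → + p ∣ + g * (x * x) - - u) → _
        gam (x , d) = g , 1≤g , ℕₚ.≤-refl , (λ d → [ p∤g , p∤u ]′ (euclid (+ g) u d)) , + g * x , ∣-resp (l (+ g) x u) (∣-*ˡ (+ g) d)
          where
          l : ∀ g x u → g * (g * (x * x) - - u) ≡ g * x * (g * x) + g * u
          l = solve-∀
      scale : ∀ e k → e ≢ 0ℤ → (∃ λ D → 1 ℕ.≤ D × D ℕ.≤ p ℕ.* g × NegSquareAt p (+ D * k)) →
              ∃ λ D → 1 ℕ.≤ D × D ℕ.≤ p ℕ.* g × NegSquareAt p (+ D * (k * (e * e)))
      scale e k e≢0 (D , 1≤D , D≤ , negSquareAt e′ u s e′≢0 n≡ p∤u p∣) =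
        D , 1≤D , D≤ , negSquareAt (e * e′) u s (λ eq → e′≢0 (*-≢0 e≢0 eq)) (trans (l (+ D) k e) (trans (cong (_* (e * e)) n≡) (l′ e e′ u))) p∤u p∣
        where
        l : ∀ D k e → D * (k * (e * e)) ≡ D * k * (e * e)
        l = solve-∀
        l′ : ∀ e e′ u → e′ * e′ * u * (e * e) ≡ e * e′ * (e * e′) * u
        l′ = solve-∀
      unit : ∀ k → ¬ + p ∣ + k → ∃ λ D → 1 ℕ.≤ D × D ℕ.≤ p ℕ.* g × NegSquareAt p (+ D * + k)
      unit k p∤k = mk (residue (+ k) p∤k)
        where
        mk : _ → _
        mk (r , 1≤r , r≤g , p∤ru , s , d) = r , 1≤r , ℕₚ.≤-trans r≤g (ℕₚ.m≤n*m g p) ,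
          negSquareAt 1ℤ (+ r * + k) s (λ ()) (sym (ℤₚ.*-identityˡ _)) p∤ru d
      uniformiser : ∀ k → ¬ + p ∣ + k → ∃ λ D → 1 ℕ.≤ D × D ℕ.≤ p ℕ.* g × NegSquareAt p (+ D * + (k ℕ.* p))
      uniformiser k p∤k = mk (residue (+ k) p∤k)
        where
        l : ∀ p r k → p * r * (k * p) ≡ p * p * (r * k)
        l = solve-∀
        mk : _ → _
        mk (r , 1≤r , r≤g , p∤ru , s , d) = p ℕ.* r , ℕₚ.*-mono-≤ 1≤p 1≤r , ℕₚ.*-monoʳ-≤ p r≤g ,
          negSquareAt (+ p) (+ r * + k) s +p≢0 (trans (cong₂ _*_ (ℤₚ.pos-* p r) (ℤₚ.pos-* k p)) (l (+ p) (+ r) (+ k))) p∤ru d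
      go : ∀ k → 1 ℕ.≤ k → Acc ℕ._<_ k → ∃ λ D → 1 ℕ.≤ D × D ℕ.≤ p ℕ.* g × NegSquareAt p (+ D * + k)
      go k 1≤k (acc rec) with p ℕ∣.∣? k
      ... | no p∤k = unit k (λ d → p∤k (S.∣⇒∣ᵤ d))
      ... | yes (ℕ∣.divides k₁ refl) with p ℕ∣.∣? k₁
      ... | no p∤k₁ = uniformiser k₁ (λ d → p∤k₁ (S.∣⇒∣ᵤ d))
      ... | yes (ℕ∣.divides k₂ refl) = subst (λ t → ∃ λ D → 1 ℕ.≤ D × D ℕ.≤ p ℕ.* g × NegSquareAt p (+ D * t)) eq (scale (+ p) (+ k₂) +p≢0
          (go k₂ 1≤k₂ (rec lt)))
        where
        1≤k₂ : 1 ℕ.≤ k₂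
        1≤k₂ = ℕₚ.n≢0⇒n>0 λ e → contradiction (subst (λ t → 1 ℕ.≤ t ℕ.* p ℕ.* p) e 1≤k) λ ()
        lt : k₂ ℕ.< k₂ ℕ.* p ℕ.* p
        lt = ℕₚ.<-≤-trans (ℕₚ.m<m*n k₂ p {{ℕ.>-nonZero 1≤k₂}} 1<p) (ℕₚ.m≤m*n (k₂ ℕ.* p) p)
        eq : + k₂ * (+ p * + p) ≡ + (k₂ ℕ.* p ℕ.* p)
        eq = sym (trans (ℤₚ.pos-* (k₂ ℕ.* p) p) (trans (cong (_* + p) (ℤₚ.pos-* k₂ p)) (ℤₚ.*-assoc (+ k₂) (+ p) (+ p))))

  -- The odd case records the square, since x² ≡ 1 modulo 8 is the form in which oddness enters
  -- `three-squares`.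
  data Parity (x : ℤ) : Set where
    even : ∀ y → x ≡ y * + 2 → Parity x
    odd  : ∀ t → x * x ≡ + 8 * t + + 1 → Parity x

  triangle : ∀ n → ∃ λ t → n * (n + 1ℤ) ≡ + 2 * t
  triangle n = go (n %ℕ 2) (n%ℕd<d n 2) (a≡a%ℕn+[a/ℕn]*n n 2)
    where
    q = n /ℕ 2
    l₀ : ∀ q → (+ 0 + q * + 2) * (+ 0 + q * + 2 + 1ℤ) ≡ + 2 * (q * (q * + 2 + 1ℤ))
    l₀ = solve-∀
    l₁ : ∀ q → (+ 1 + q * + 2) * (+ 1 + q * + 2 + 1ℤ) ≡ + 2 * ((+ 1 + q * + 2) * (q + 1ℤ))
    l₁ = solve-∀
    go : ∀ r → r ℕ.< 2 → n ≡ + r + q * + 2 → ∃ λ t → n * (n + 1ℤ) ≡ + 2 * t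
    go 0 _ eq = _ , trans (cong (λ n → n * (n + 1ℤ)) eq) (l₀ q)
    go 1 _ eq = _ , trans (cong (λ n → n * (n + 1ℤ)) eq) (l₁ q)
    go (suc (suc _)) (ℕ.s≤s (ℕ.s≤s ())) _

  parity : ∀ x → Parity x
  parity x = byRem (x %ℕ 2) (n%ℕd<d x 2) (a≡a%ℕn+[a/ℕn]*n x 2)
    where
    q = x /ℕ 2
    byRem : ∀ r → r ℕ.< 2 → x ≡ + r + q * + 2 → Parity x
    byRem 0 _ eq = even q (trans eq (ℤₚ.+-identityˡ _))
    byRem 1 _ eq = odd (proj₁ (triangle q)) (trans (cong (λ x → x * x) eq) (trans (l q) (trans (cong (λ t → + 4 * t + + 1) (proj₂ (triangle q))) (l′
        (proj₁ (triangle q))))))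
      where
      l : ∀ q → (+ 1 + q * + 2) * (+ 1 + q * + 2) ≡ + 4 * (q * (q + 1ℤ)) + + 1
      l = solve-∀
      l′ : ∀ t → + 4 * (+ 2 * t) + + 1 ≡ + 8 * t + + 1
      l′ = solve-∀
    byRem (suc (suc _)) (ℕ.s≤s (ℕ.s≤s ())) _

  -- Legendre's obstruction. Modulo 4 the variables x, y, z, w are all even or all odd; the all odd
  -- case would give 3 ≡ 7 modulo 8, and the all even case is the descent step.
  three-squares : ∀ {n} → NegSquareAt2 n → NonRep 1ℤ 1ℤ n
  three-squares {n} (negSquareAt2 e t e≢0 n≡) .vanish x₀ y₀ z₀ w₀ eq₀ =
    *-≢0 e≢0 (descent {2} (ℕ.s≤s (ℕ.s≤s ℕ.z≤n)) P step (e * w₀) (x₀ , y₀ , z₀ , trans (l₀ x₀ y₀ z₀) (trans eq₀ (trans (cong (_* (w₀ * w₀)) n≡) (l₁ e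
        (+ 8 * t + + 7) w₀)))))
    where
    u = + 8 * t + + 7
    l₀ : ∀ x y z → x * x + y * y + z * z ≡ 1ℤ * (x * x) + 1ℤ * (y * y) + 1ℤ * 1ℤ * (z * z)
    l₀ = solve-∀
    l₁ : ∀ e u w → e * e * u * (w * w) ≡ u * (e * w * (e * w))
    l₁ = solve-∀
    P : ℤ → Set
    P w = ∃ λ x → ∃₂ λ y z → x * x + y * y + z * z ≡ u * (w * w)
    halve : ∀ {x y z w} a b c d → x ≡ a * + 2 → y ≡ b * + 2 → z ≡ c * + 2 → w ≡ d * + 2 →
            x * x + y * y + z * z ≡ u * (w * w) → ∃ λ w′ → w ≡ w′ * + 2 × P w′
    halve a b c d refl refl refl refl eq = d , refl , a , b , c , ℤₚ.*-cancelʳ-≡ _ _ (+ 4) (trans (l a b c) (trans eq (l′ u d)))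
      where
      l : ∀ a b c → (a * a + b * b + c * c) * + 4 ≡ a * + 2 * (a * + 2) + b * + 2 * (b * + 2) + c * + 2 * (c * + 2)
      l = solve-∀
      l′ : ∀ u d → u * (d * + 2 * (d * + 2)) ≡ u * (d * d) * + 4
      l′ = solve-∀
    data Mod4 (i s : ℤ) : Set where
      mod4 : ∀ q → s ≡ + 4 * q + i → Mod4 i s
    sum-mod-4 : ∀ {X Y Z W} i j k l → Mod4 i X → Mod4 j Y → Mod4 k Z → Mod4 l W →
                X + Y + Z ≡ u * W → + 4 ∣ i + j + k - + 7 * l
    sum-mod-4 i j k l (mod4 A refl) (mod4 B refl) (mod4 C refl) (mod4 E refl) eq = divides (u * E + + 2 * (t * l) - (A + B + C))
      (trans (l₂ A B C i j k (+ 7 * l)) (trans (cong (λ s → s - + 4 * (A + B + C) - + 7 * l) eq) (l₃ t E l (A + B + C))))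
      where
      l₂ : ∀ A B C i j k v → i + j + k - v ≡ (+ 4 * A + i + (+ 4 * B + j) + (+ 4 * C + k)) - + 4 * (A + B + C) - v
      l₂ = solve-∀
      l₃ : ∀ t E l S → (+ 8 * t + + 7) * (+ 4 * E + l) - + 4 * S - + 7 * l ≡ ((+ 8 * t + + 7) * E + + 2 * (t * l) - S) * + 4
      l₃ = solve-∀
    even-sq : ∀ {x} y → x ≡ y * + 2 → Mod4 (+ 0) (x * x)
    even-sq y refl = mod4 (y * y) (l y)
      where
      l : ∀ y → y * + 2 * (y * + 2) ≡ + 4 * (y * y) + + 0
      l = solve-∀
    odd-sq : ∀ {s} k → s ≡ + 8 * k + + 1 → Mod4 (+ 1) s
    odd-sq k refl = mod4 (+ 2 * k) (l k)
      where
      l : ∀ k → + 8 * k + + 1 ≡ + 4 * (+ 2 * k) + + 1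
      l = solve-∀
    all-odd : ∀ {X Y Z W} a b c d → X ≡ + 8 * a + + 1 → Y ≡ + 8 * b + + 1 → Z ≡ + 8 * c + + 1 → W ≡ + 8 * d + + 1 →
              X + Y + Z ≡ u * W → + 8 ∣ + 4
    all-odd a b c d refl refl refl refl eq = divides ((a + b + c) - t - d * u)
      (trans (l a b c) (trans (cong (λ s → + 8 * (a + b + c) + + 7 - s) eq) (l′ (a + b + c) t d)))
      where
      l : ∀ a b c → + 4 ≡ + 8 * (a + b + c) + + 7 - (+ 8 * a + + 1 + (+ 8 * b + + 1) + (+ 8 * c + + 1))
      l = solve-∀
      l′ : ∀ s t d → + 8 * s + + 7 - (+ 8 * t + + 7) * (+ 8 * d + + 1) ≡ (s - t - d * (+ 8 * t + + 7)) * + 8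
      l′ = solve-∀
    4∤ : ∀ {A : Set} n → {False (4 ℕ∣.∣? n)} → ∀ {r} → abs r ≡ n → + 4 ∣ r → A
    4∤ n {ev} refl d = ⊥-elim (toWitnessFalse ev (S.∣⇒∣ᵤ d))
    step : ∀ w → P w → ∃ λ w′ → w ≡ w′ * + 2 × P w′
    step w (x , y , z , eq) = go (parity x) (parity y) (parity z) (parity w)
      where
      Goal = ∃ λ w′ → w ≡ w′ * + 2 × P w′
      mod₄ : ∀ i j k l → Mod4 i (x * x) → Mod4 j (y * y) → Mod4 k (z * z) → Mod4 l (w * w) → + 4 ∣ i + j + k - + 7 * l
      mod₄ i j k l e₁ e₂ e₃ e₄ = sum-mod-4 i j k l e₁ e₂ e₃ e₄ eq
      go : Parity x → Parity y → Parity z → Parity w → Goal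
      go (even a e₁) (even b e₂) (even c e₃) (even d e₄) = halve a b c d e₁ e₂ e₃ e₄ eq
      go (even a e₁) (even b e₂) (even c e₃) (odd d e₄) = 4∤ 7 refl (mod₄ (+ 0) (+ 0) (+ 0) (+ 1) (even-sq a e₁) (even-sq b e₂) (even-sq c e₃)
          (odd-sq d e₄))
      go (even a e₁) (even b e₂) (odd c e₃) (even d e₄) = 4∤ 1 refl (mod₄ (+ 0) (+ 0) (+ 1) (+ 0) (even-sq a e₁) (even-sq b e₂) (odd-sq c e₃)
          (even-sq d e₄))
      go (even a e₁) (even b e₂) (odd c e₃) (odd d e₄) = 4∤ 6 refl (mod₄ (+ 0) (+ 0) (+ 1) (+ 1) (even-sq a e₁) (even-sq b e₂) (odd-sq c e₃)
          (odd-sq d e₄))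
      go (even a e₁) (odd b e₂) (even c e₃) (even d e₄) = 4∤ 1 refl (mod₄ (+ 0) (+ 1) (+ 0) (+ 0) (even-sq a e₁) (odd-sq b e₂) (even-sq c e₃)
          (even-sq d e₄))
      go (even a e₁) (odd b e₂) (even c e₃) (odd d e₄) = 4∤ 6 refl (mod₄ (+ 0) (+ 1) (+ 0) (+ 1) (even-sq a e₁) (odd-sq b e₂) (even-sq c e₃)
          (odd-sq d e₄))
      go (even a e₁) (odd b e₂) (odd c e₃) (even d e₄) = 4∤ 2 refl (mod₄ (+ 0) (+ 1) (+ 1) (+ 0) (even-sq a e₁) (odd-sq b e₂) (odd-sq c e₃)
          (even-sq d e₄))
      go (even a e₁) (odd b e₂) (odd c e₃) (odd d e₄) = 4∤ 5 refl (mod₄ (+ 0) (+ 1) (+ 1) (+ 1) (even-sq a e₁) (odd-sq b e₂) (odd-sq c e₃)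
          (odd-sq d e₄))
      go (odd a e₁) (even b e₂) (even c e₃) (even d e₄) = 4∤ 1 refl (mod₄ (+ 1) (+ 0) (+ 0) (+ 0) (odd-sq a e₁) (even-sq b e₂) (even-sq c e₃)
          (even-sq d e₄))
      go (odd a e₁) (even b e₂) (even c e₃) (odd d e₄) = 4∤ 6 refl (mod₄ (+ 1) (+ 0) (+ 0) (+ 1) (odd-sq a e₁) (even-sq b e₂) (even-sq c e₃)
          (odd-sq d e₄))
      go (odd a e₁) (even b e₂) (odd c e₃) (even d e₄) = 4∤ 2 refl (mod₄ (+ 1) (+ 0) (+ 1) (+ 0) (odd-sq a e₁) (even-sq b e₂) (odd-sq c e₃)
          (even-sq d e₄))
      go (odd a e₁) (even b e₂) (odd c e₃) (odd d e₄) = 4∤ 5 refl (mod₄ (+ 1) (+ 0) (+ 1) (+ 1) (odd-sq a e₁) (even-sq b e₂) (odd-sq c e₃)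
          (odd-sq d e₄))
      go (odd a e₁) (odd b e₂) (even c e₃) (even d e₄) = 4∤ 2 refl (mod₄ (+ 1) (+ 1) (+ 0) (+ 0) (odd-sq a e₁) (odd-sq b e₂) (even-sq c e₃)
          (even-sq d e₄))
      go (odd a e₁) (odd b e₂) (even c e₃) (odd d e₄) = 4∤ 5 refl (mod₄ (+ 1) (+ 1) (+ 0) (+ 1) (odd-sq a e₁) (odd-sq b e₂) (even-sq c e₃)
          (odd-sq d e₄))
      go (odd a e₁) (odd b e₂) (odd c e₃) (even d e₄) = 4∤ 3 refl (mod₄ (+ 1) (+ 1) (+ 1) (+ 0) (odd-sq a e₁) (odd-sq b e₂) (odd-sq c e₃)
          (even-sq d e₄))
      go (odd a e₁) (odd b e₂) (odd c e₃) (odd d e₄) = contradiction (S.∣⇒∣ᵤ (all-odd a b c d e₁ e₂ e₃ e₄ eq)) (from-no (8 ℕ∣.∣? 4))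

  -- For odd k one r among 1, 3, 5, 7 satisfies r k ≡ 7 modulo 8. Factors 4 are squares, and twice
  -- an odd number is met by D = 2r.
  negSquare2-multiple : ∀ k → 1 ℕ.≤ k → ∃ λ D → 1 ℕ.≤ D × D ℕ.≤ 14 × NegSquareAt2 (+ D * + k)
  negSquare2-multiple k 1≤k = go k 1≤k (<-wellFounded k)
    where
    Result : ℤ → Set
    Result k = ∃ λ D → 1 ℕ.≤ D × D ℕ.≤ 14 × NegSquareAt2 (+ D * k)
    8-form : ∀ k → ¬ (2 ℕ∣.∣ k) → ∃ λ r → 1 ℕ.≤ r × r ℕ.≤ 7 × ∃ λ t → + r * + k ≡ + 8 * t + + 7
    8-form k 2∤k = byRem (+ k %ℕ 8) (n%ℕd<d (+ k) 8) (a≡a%ℕn+[a/ℕn]*n (+ k) 8)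
      where
      q = + k /ℕ 8
      even! : ∀ r → + k ≡ + 2 * + r + q * + 8 → ⊥
      even! r eq = 2∤k (S.∣⇒∣ᵤ {+ 2} {+ k} (divides (+ r + q * + 4) (trans eq (l (+ r) q))))
        where
        l : ∀ r q → + 2 * r + q * + 8 ≡ (r + q * + 4) * + 2
        l = solve-∀
      1≤s : ∀ {n} → 1 ℕ.≤ suc n
      1≤s = ℕ.s≤s ℕ.z≤n
      l₁ : ∀ q → + 7 * (+ 1 + q * + 8) ≡ + 8 * (+ 7 * q) + + 7
      l₁ = solve-∀
      l₃ : ∀ q → + 5 * (+ 3 + q * + 8) ≡ + 8 * (+ 1 + + 5 * q) + + 7
      l₃ = solve-∀
      l₅ : ∀ q → + 3 * (+ 5 + q * + 8) ≡ + 8 * (+ 1 + + 3 * q) + + 7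
      l₅ = solve-∀
      l₇ : ∀ q → + 1 * (+ 7 + q * + 8) ≡ + 8 * q + + 7
      l₇ = solve-∀
      byRem : ∀ r → r ℕ.< 8 → + k ≡ + r + q * + 8 → ∃ λ r → 1 ℕ.≤ r × r ℕ.≤ 7 × ∃ λ t → + r * + k ≡ + 8 * t + + 7
      byRem 0 _ eq = ⊥-elim (even! 0 eq)
      byRem 1 _ eq = 7 , 1≤s , ℕₚ.≤-refl , (+ 7 * q) , trans (cong (+ 7 *_) eq) (l₁ q)
      byRem 2 _ eq = ⊥-elim (even! 1 eq)
      byRem 3 _ eq = 5 , 1≤s , ℕₚ.m≤m+n 5 2 , (+ 1 + + 5 * q) , trans (cong (+ 5 *_) eq) (l₃ q)
      byRem 4 _ eq = ⊥-elim (even! 2 eq)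
      byRem 5 _ eq = 3 , 1≤s , ℕₚ.m≤m+n 3 4 , (+ 1 + + 3 * q) , trans (cong (+ 3 *_) eq) (l₅ q)
      byRem 6 _ eq = ⊥-elim (even! 3 eq)
      byRem 7 _ eq = 1 , 1≤s , ℕₚ.m≤m+n 1 6 , q , trans (cong (+ 1 *_) eq) (l₇ q)
      byRem (suc (suc (suc (suc (suc (suc (suc (suc r)))))))) lt _ = contradiction lt (ℕₚ.≤⇒≯ (ℕₚ.m≤m+n 8 r))
    scale : ∀ k → Result k → Result (k * + 4)
    scale k (D , 1≤D , D≤ , negSquareAt2 e t e≢0 n≡) = D , 1≤D , D≤ , negSquareAt2 (+ 2 * e) t (λ eq → e≢0 (*-≢0 {+ 2} (λ ()) eq))
      (trans (l (+ D) k) (trans (cong (_* + 4) n≡) (l′ e (+ 8 * t + + 7))))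
      where
      l : ∀ D k → D * (k * + 4) ≡ D * k * + 4
      l = solve-∀
      l′ : ∀ e u → e * e * u * + 4 ≡ + 2 * e * (+ 2 * e) * u
      l′ = solve-∀
    odd-case : ∀ k → ¬ 2 ℕ∣.∣ k → Result (+ k)
    odd-case k 2∤k = mk (8-form k 2∤k)
      where
      mk : _ → _
      mk (r , 1≤r , r≤7 , t , eq) = r , 1≤r , ℕₚ.≤-trans r≤7 (ℕₚ.m≤m+n 7 7) , negSquareAt2 1ℤ t (λ ()) (trans eq (sym (ℤₚ.*-identityˡ _)))
    twice-odd : ∀ k → ¬ 2 ℕ∣.∣ k → Result (+ k * + 2)
    twice-odd k 2∤k = mk (8-form k 2∤k)
      where
      l : ∀ r k → + 2 * r * (k * + 2) ≡ + 2 * + 2 * (r * k)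
      l = solve-∀
      mk : _ → _
      mk (r , 1≤r , r≤7 , t , eq) = 2 ℕ.* r , ℕₚ.≤-trans 1≤r (ℕₚ.m≤n*m r 2) , ℕₚ.*-monoʳ-≤ 2 r≤7 ,
        negSquareAt2 (+ 2) t (λ ()) (trans (cong (_* (+ k * + 2)) (ℤₚ.pos-* 2 r)) (trans (l (+ r) (+ k)) (cong (+ 2 * + 2 *_) eq)))
    go : ∀ k → 1 ℕ.≤ k → Acc ℕ._<_ k → Result (+ k)
    go k 1≤k (acc rec) with 2 ℕ∣.∣? k
    ... | no 2∤k = odd-case k 2∤k
    ... | yes (ℕ∣.divides k₁ refl) with 2 ℕ∣.∣? k₁
    ... | no 2∤k₁ = subst Result (sym (ℤₚ.pos-* k₁ 2)) (twice-odd k₁ 2∤k₁)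
    ... | yes (ℕ∣.divides k₂ refl) = subst Result eq (scale (+ k₂) (go k₂ 1≤k₂ (rec lt)))
      where
      1≤k₂ : 1 ℕ.≤ k₂
      1≤k₂ = ℕₚ.n≢0⇒n>0 λ e → contradiction (subst (λ t → 1 ℕ.≤ t ℕ.* 2 ℕ.* 2) e 1≤k) λ ()
      lt : k₂ ℕ.< k₂ ℕ.* 2 ℕ.* 2
      lt = ℕₚ.<-≤-trans (ℕₚ.m<m*n k₂ 2 {{ℕ.>-nonZero 1≤k₂}} (ℕ.s≤s (ℕ.s≤s ℕ.z≤n))) (ℕₚ.m≤m*n (k₂ ℕ.* 2) 2)
      eq : + k₂ * + 4 ≡ + (k₂ ℕ.* 2 ℕ.* 2)
      eq = sym (trans (cong +_ (ℕₚ.*-assoc k₂ 2 2)) (ℤₚ.pos-* k₂ 4))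

  -- The prime belongs to the quaternion algebra; only D reacts to `k`, which will be the
  -- determinant factor `m * d₃`.
  record TernaryChoice (N : ℕ) (a b : ℤ) : Set where
    field
      q δ : ℕ
      prime-q : Prime q
      q≤N : q ℕ.≤ N
      isGamma : IsGamma q δ
      choose : ∀ k → 1 ℕ.≤ k → ∃ λ D → 1 ℕ.≤ D × D ℕ.≤ q ℕ.* δ × NonRep a b (+ D * + k)

  -- Finding a ramified prime by descent on the pair (a, b)

  transfer : ∀ {N a b a′ b′} → (∀ n → NonRep a′ b′ n → NonRep a b n) → TernaryChoice N a′ b′ → TernaryChoice N a b
  transfer f c .TernaryChoice.q = c .TernaryChoice.q
  transfer f c .TernaryChoice.δ = c .TernaryChoice.δ
  transfer f c .TernaryChoice.prime-q = c .TernaryChoice.prime-q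
  transfer f c .TernaryChoice.q≤N = c .TernaryChoice.q≤N
  transfer f c .TernaryChoice.isGamma = c .TernaryChoice.isGamma
  transfer f c .TernaryChoice.choose k 1≤k = let (D , 1≤D , D≤ , nr) = c .TernaryChoice.choose k 1≤k in D , 1≤D , D≤ , f (+ D * + k) nr

  nonRep-swap : ∀ {a b} n → NonRep b a n → NonRep a b n
  nonRep-swap {a} {b} n nr .vanish x y z w eq = vanish nr y x z w (trans (l a b (x * x) (y * y) (z * z)) eq)
    where
    l : ∀ a b x y z → b * y + a * x + b * a * z ≡ a * x + b * y + a * b * z
    l = solve-∀

  nonRep-square : ∀ {a b} k n → NonRep a b n → NonRep a (b * (k * k)) n
  nonRep-square {a} {b} k n nr .vanish x y z w eq = vanish nr x (k * y) (k * z) w (trans (l a b k x y z) eq)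
    where
    l : ∀ a b k x y z → a * (x * x) + b * (k * y * (k * y)) + a * b * (k * z * (k * z)) ≡ a * (x * x) + b * (k * k) * (y * y) + a * (b * (k * k)) *
        (z * z)
    l = solve-∀

  -- Multiplication by t + √−a on y + z√−a, the norm form y² + a z² being multiplicative.
  nonRep-norm : ∀ {a b b′} t → b′ ≢ 0ℤ → t * t + a ≡ b′ * b → ∀ n → NonRep a b′ n → NonRep a b n
  nonRep-norm {a} {b} {b′} t b′≢0 eq n nr .vanish x y z w eq′ = *-≢0 b′≢0 (vanish nr (b′ * x) (t * y - a * z) (t * z + y) (b′ * w)
    (trans (l a b′ t x y z) (trans (cong (λ s → a * (b′ * x * (b′ * x)) + b′ * (s * (y * y + a * (z * z)))) eq) (trans (l′ a b b′ x y z) (trans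
        (cong (b′ * b′ *_) eq′) (l″ b′ n w))))))
    where
    l : ∀ a b t x y z → a * (b * x * (b * x)) + b * ((t * y - a * z) * (t * y - a * z)) + a * b * ((t * z + y) * (t * z + y))
        ≡ a * (b * x * (b * x)) + b * ((t * t + a) * (y * y + a * (z * z)))
    l = solve-∀
    l′ : ∀ a b c x y z → a * (c * x * (c * x)) + c * (c * b * (y * y + a * (z * z))) ≡ c * c * (a * (x * x) + b * (y * y) + a * b * (z * z))
    l′ = solve-∀
    l″ : ∀ c n w → c * c * (n * (w * w)) ≡ n * (c * w * (c * w))
    l″ = solve-∀

  -- If such a p divides b exactly once, the algebra (-a, -b) is ramified at p.
  Bad : ℕ → ℤ → Set
  Bad p a = ∀ s → ¬ + p ∣ s * s + a

  -- Chinese remaindering over the prime factors of a squarefree b.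
  root-or-bad-prime : ∀ a b → 1 ℕ.≤ b → (∀ k → 2 ℕ.≤ k → ¬ (k ℕ.* k) ℕ∣.∣ b) →
                      (∃ λ p → Prime p × p ℕ∣.∣ b × Bad p a) ⊎ (∃ λ t → + b ∣ t * t + a)
  root-or-bad-prime a b 1≤b sf = go b 1≤b (<-wellFounded b) sf
    where
    Result : ℕ → Set
    Result b = (∃ λ p → Prime p × p ℕ∣.∣ b × Bad p a) ⊎ (∃ λ t → + b ∣ t * t + a)
    glue : ∀ p c → Coprime c p → ∀ s t → + p ∣ s * s + a → + c ∣ t * t + a → ∃ λ T → + (c ℕ.* p) ∣ T * T + a
    glue p c cop s t d d′ = combine (bezout cop)
      where
      combine : (∃₂ λ x y → x * + c + y * + p ≡ 1ℤ) → ∃ λ τ → + (c ℕ.* p) ∣ τ * τ + a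
      combine (x , y , e) = τ , both dp dc
        where
        -- Since x c + y p = 1, this is s modulo p and t modulo c.
        τ = s * (x * + c) + t * (y * + p)
        l₁ : ∀ s t xc yp → s * xc + t * yp - s * (xc + yp) ≡ (t - s) * yp
        l₁ = solve-∀
        l₂ : ∀ s t xc yp → s * xc + t * yp - t * (xc + yp) ≡ (s - t) * xc
        l₂ = solve-∀
        l₃ : ∀ τ s a → (τ - s * 1ℤ) * (τ + s) + (s * s + a) ≡ τ * τ + a
        l₃ = solve-∀
        dp : + p ∣ τ * τ + a
        dp = ∣-resp (l₃ τ s a) (S.∣m∣n⇒∣m+n (∣-*ʳ (τ + s) (∣-resp
          (trans (sym (l₁ s t (x * + c) (y * + p))) (cong (λ u → τ - s * u) e)) (∣-*ˡ (t - s) (∣-*ˡ y S.∣-refl)))) d)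
        dc : + c ∣ τ * τ + a
        dc = ∣-resp (l₃ τ t a) (S.∣m∣n⇒∣m+n (∣-*ʳ (τ + t) (∣-resp
          (trans (sym (l₂ s t (x * + c) (y * + p))) (cong (λ u → τ - t * u) e)) (∣-*ˡ (s - t) (∣-*ˡ x S.∣-refl)))) d′)
        both : ∀ {E} → + p ∣ E → + c ∣ E → + (c ℕ.* p) ∣ E
        both {E} (divides k eq) (divides m eq′) = divides (k * x + m * y) (trans (sym (ℤₚ.*-identityʳ E)) (trans (cong (E *_) (sym e))
          (trans (ℤₚ.*-distribˡ-+ E (x * + c) (y * + p)) (trans (cong₂ (λ u v → u * (x * + c) + v * (y * + p)) eq eq′)
          (trans (l₄ k m x y (+ c) (+ p)) (cong ((k * x + m * y) *_) (sym (ℤₚ.pos-* c p))))))))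
          where
          l₄ : ∀ k m x y c p → k * p * (x * c) + m * c * (y * p) ≡ (k * x + m * y) * (c * p)
          l₄ = solve-∀
    go : ∀ b → 1 ℕ.≤ b → Acc ℕ._<_ b → (∀ k → 2 ℕ.≤ k → ¬ (k ℕ.* k) ℕ∣.∣ b) → Result b
    go (suc zero) _ _ _ = inj₂ (0ℤ , divides (0ℤ * 0ℤ + a) (sym (ℤₚ.*-identityʳ _)))
    go b@(suc (suc _)) _ (acc rec) sf = factor (prime-divisor b (ℕ.s≤s (ℕ.s≤s ℕ.z≤n)))
      where
      factor : (∃ λ p → Prime p × p ℕ∣.∣ b) → Result b
      factor (p , pp , p∣b@(ℕ∣.divides c eq)) = decide (QR? (- a))
        where
        open PrimeLemmas pp
        1≤c : 1 ℕ.≤ c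
        1≤c = ℕₚ.n≢0⇒n>0 λ e → contradiction (trans eq (cong (ℕ._* p) e)) λ ()
        c<b : c ℕ.< b
        c<b = subst (c ℕ.<_) (sym eq) (ℕₚ.m<m*n c p {{ℕ.>-nonZero 1≤c}} 1<p)
        p∤c : ¬ p ℕ∣.∣ c
        p∤c d = sf p 1<p (subst (p ℕ.* p ℕ∣.∣_) (sym eq) (ℕ∣.*-monoˡ-∣ p d))
        sf′ : ∀ k → 2 ℕ.≤ k → ¬ (k ℕ.* k) ℕ∣.∣ c
        sf′ k 2≤k d = sf k 2≤k (ℕ∣.∣-trans d (ℕ∣.divides p (trans eq (ℕₚ.*-comm c p))))
        decide : Dec (QR (- a)) → Result b
        decide (no nq) = inj₁ (p , pp , p∣b , ¬QR⇒no-root pp a nq)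
        decide (yes (s , d)) = [ bad , root ]′ (go c 1≤c (rec c<b) sf′)
          where
          l : ∀ s a → s * s - - a ≡ s * s + a
          l = solve-∀
          bad : _ → Result b
          bad (q , pq , q∣c , nr) = inj₁ (q , pq , ℕ∣.∣-trans q∣c (ℕ∣.divides p (trans eq (ℕₚ.*-comm c p))) , nr)
          root : _ → Result b
          root (t , d′) = inj₂ (subst (λ b → ∃ λ T → + b ∣ T * T + a) (sym eq) (glue p c (coprime p∤c) s t (∣-resp (l s a) d) d′))

  centred-root : ∀ a b → 1 ℕ.≤ b → ∀ t → + b ∣ t * t + + a → ∃ λ s → s ℕ.+ s ℕ.≤ b × b ℕ∣.∣ s ℕ.* s ℕ.+ a
  centred-root a b 1≤b t d = pick (ℕₚ.≤-total (r ℕ.+ r) b)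
    where
    instance _ = ℕ.>-nonZero 1≤b
    r = t %ℕ b
    r<b : r ℕ.< b
    r<b = n%ℕd<d t b
    toℕ∣ : ∀ s → + b ∣ + s * + s + + a → b ℕ∣.∣ s ℕ.* s ℕ.+ a
    toℕ∣ s d = S.∣⇒∣ᵤ (∣-resp (trans (cong (_+ + a) (sym (ℤₚ.pos-* s s))) (sym (ℤₚ.pos-+ (s ℕ.* s) a))) d)
    l : ∀ t r a → t * t + a - (t - r) * (t + r) ≡ r * r + a
    l = solve-∀
    dr : + b ∣ + r * + r + + a
    dr = ∣-resp (l t (+ r) (+ a)) (S.∣m∣n⇒∣m-n d (∣-*ʳ (t + + r) (%ℕ-∣ b t)))
    pick : (r ℕ.+ r ℕ.≤ b) ⊎ (b ℕ.≤ r ℕ.+ r) → ∃ λ s → s ℕ.+ s ℕ.≤ b × b ℕ∣.∣ s ℕ.* s ℕ.+ a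
    pick (inj₁ 2r≤b) = r , 2r≤b , toℕ∣ r dr
    -- The residue b - r is -r modulo b, so it solves the same congruence.
    pick (inj₂ b≤2r) = s , 2s≤b , toℕ∣ s ds
      where
      s = b ℕ.∸ r
      r+s≡b : r ℕ.+ s ≡ b
      r+s≡b = ℕₚ.m+[n∸m]≡n (ℕₚ.<⇒≤ r<b)
      s≤r : s ℕ.≤ r
      s≤r = ℕₚ.+-cancelˡ-≤ r s r (ℕₚ.≤-trans (ℕₚ.≤-reflexive r+s≡b) b≤2r)
      2s≤b : s ℕ.+ s ℕ.≤ b
      2s≤b = ℕₚ.≤-trans (ℕₚ.+-monoˡ-≤ s s≤r) (ℕₚ.≤-reflexive r+s≡b)
      l′ : ∀ r s a → r * r + a + (s - r) * (r + s) ≡ s * s + a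
      l′ = solve-∀
      ds : + b ∣ + s * + s + + a
      ds = ∣-resp (l′ (+ r) (+ s) (+ a)) (S.∣m∣n⇒∣m+n dr (∣-*ˡ (+ s - + r) (subst (λ n → + b ∣ n) (trans (cong +_ (sym r+s≡b))
          (ℤₚ.pos-+ r s)) S.∣-refl)))

  record NormStep (a b : ℕ) : Set where
    field
      s b′ : ℕ
      1≤b′ : 1 ℕ.≤ b′
      b′<b : b′ ℕ.< b
      eq : s ℕ.* s ℕ.+ a ≡ b′ ℕ.* b

  -- With 2s ≤ b and a ≤ b the quotient b′ = (s² + a) / b satisfies 4 b′ b ≤ b² + 4b, which is less
  -- than 4b² for b ≥ 2. It stays positive because a is.
  norm-step : ∀ a b → 1 ℕ.≤ a → a ℕ.≤ b → 2 ℕ.≤ b → ∀ t → + b ∣ t * t + + a → NormStep a b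
  norm-step a b 1≤a a≤b 2≤b t d = mk (centred-root a b (ℕₚ.≤-trans (ℕ.s≤s ℕ.z≤n) 2≤b) t d)
    where
    mk : (∃ λ s → s ℕ.+ s ℕ.≤ b × b ℕ∣.∣ s ℕ.* s ℕ.+ a) → NormStep a b
    mk (s , 2s≤b , ℕ∣.divides b′ eq) = record { s = s ; b′ = b′ ; 1≤b′ = 1≤b′ ; b′<b = ℕₚ.≰⇒> b≰b′ ; eq = eq }
      where
      1≤b′ : 1 ℕ.≤ b′
      1≤b′ = ℕₚ.n≢0⇒n>0 λ e → ℕₚ.<⇒≢ (ℕₚ.≤-trans 1≤a (ℕₚ.m≤n+m a (s ℕ.* s))) (sym (trans eq (cong (ℕ._* b) e)))
      open ℕₚ.≤-Reasoning
      l : ∀ s a → 4 ℕ.* (s ℕ.* s ℕ.+ a) ≡ (s ℕ.+ s) ℕ.* (s ℕ.+ s) ℕ.+ 4 ℕ.* a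
      l = solveℕ-∀
      l₂ : ∀ b → b ℕ.* b ℕ.+ 4 ℕ.* b ≡ (b ℕ.+ 4) ℕ.* b
      l₂ = solveℕ-∀
      b≰b′ : ¬ b ℕ.≤ b′
      b≰b′ b≤b′ = ℕₚ.<⇒≱ lt (ℕₚ.*-cancelʳ-≤ (4 ℕ.* b) (b ℕ.+ 4) b {{ℕ.>-nonZero (ℕₚ.≤-trans (ℕ.s≤s ℕ.z≤n) 2≤b)}} le)
        where
        le : 4 ℕ.* b ℕ.* b ℕ.≤ (b ℕ.+ 4) ℕ.* b
        le = begin
          4 ℕ.* b ℕ.* b                      ≡⟨ ℕₚ.*-assoc 4 b b ⟩
          4 ℕ.* (b ℕ.* b)                    ≤⟨ ℕₚ.*-monoʳ-≤ 4 (ℕₚ.*-monoˡ-≤ b b≤b′) ⟩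
          4 ℕ.* (b′ ℕ.* b)                   ≡⟨ cong (4 ℕ.*_) (sym eq) ⟩
          4 ℕ.* (s ℕ.* s ℕ.+ a)              ≡⟨ l s a ⟩
          (s ℕ.+ s) ℕ.* (s ℕ.+ s) ℕ.+ 4 ℕ.* a ≤⟨ ℕₚ.+-mono-≤ (ℕₚ.*-mono-≤ 2s≤b 2s≤b) (ℕₚ.*-monoʳ-≤ 4 a≤b) ⟩
          b ℕ.* b ℕ.+ 4 ℕ.* b                ≡⟨ l₂ b ⟩
          (b ℕ.+ 4) ℕ.* b                    ∎
        lt : b ℕ.+ 4 ℕ.< 4 ℕ.* b
        lt = begin-strict
          b ℕ.+ 4       <⟨ ℕₚ.+-monoʳ-< b (ℕₚ.≤-trans (ℕₚ.m≤m+n 5 1) (ℕₚ.*-monoʳ-≤ 3 2≤b)) ⟩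
          b ℕ.+ 3 ℕ.* b ∎

  -- The same s is a root of -a modulo the new b′, so the reduction can be repeated without looking
  -- at primes again.
  norm-step-divides : ∀ {a b} (st : NormStep a b) → + (NormStep.b′ st) ∣ + (NormStep.s st) * + (NormStep.s st) + + a
  norm-step-divides {a} {b} st = subst (λ z → + b′ ∣ z) (trans (cong +_ (sym eq)) (trans (ℤₚ.pos-+ (s ℕ.* s) a) (cong (_+ + a) (ℤₚ.pos-* s s))))
    (S.∣ᵤ⇒∣ (ℕ∣.m∣m*n b))
    where open NormStep st

  norm-step-transfer : ∀ {a b N} (st : NormStep a b) → TernaryChoice N (+ a) (+ (NormStep.b′ st)) → TernaryChoice N (+ a) (+ b)
  norm-step-transfer {a} {b} st = transfer (nonRep-norm (+ s) (λ e → ℕₚ.<⇒≢ 1≤b′ (sym (ℤₚ.+-injective e)))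
    (trans (cong (_+ + a) (sym (ℤₚ.pos-* s s))) (trans (sym (ℤₚ.pos-+ (s ℕ.* s) a)) (trans (cong +_ eq) (ℤₚ.pos-* b′ b)))))
    where open NormStep st

  square-transfer : ∀ {a N} b k → TernaryChoice N a (+ b) → TernaryChoice N a (+ (b ℕ.* (k ℕ.* k)))
  square-transfer {a} {N} b k c = subst (TernaryChoice N a) (sym (trans (ℤₚ.pos-* b (k ℕ.* k)) (cong (+ b *_) (ℤₚ.pos-* k k)))) (transfer
      (nonRep-square (+ k)) c)

  module _ (N : ℕ) (2≤N : 2 ℕ.≤ N) where

    bad-prime-choice : ∀ a b {p} → 1 ℕ.≤ b → (∀ k → 2 ℕ.≤ k → ¬ (k ℕ.* k) ℕ∣.∣ b) → p ℕ.≤ N → Prime p → p ℕ∣.∣ b → Bad p (+ a) → TernaryChoice N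
        (+ a) (+ b)
    bad-prime-choice a b {p} 1≤b sf p≤N pp (ℕ∣.divides c eq) bad = mk (exists-gamma p≢2)
      where
      open PrimeLemmas pp
      -- The prime 2 is never bad, because a² + a is even.
      p≢2 : p ≢ 2
      p≢2 refl = two (triangle (+ a))
        where
        l : ∀ a → a * (a + 1ℤ) ≡ a * a + a
        l = solve-∀
        two : (∃ λ t → + a * (+ a + 1ℤ) ≡ + 2 * t) → ⊥
        two (t , e) = bad (+ a) (divides t (trans (sym (l (+ a))) (trans e (ℤₚ.*-comm (+ 2) t))))
      p∤c : ¬ + p ∣ + c
      p∤c d = sf p 1<p (subst (p ℕ.* p ℕ∣.∣_) (sym eq) (ℕ∣.*-monoˡ-∣ p (S.∣⇒∣ᵤ d)))
      +b≡ : + p * + c ≡ + b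
      +b≡ = trans (ℤₚ.*-comm (+ p) (+ c)) (trans (sym (ℤₚ.pos-* c p)) (cong +_ (sym eq)))
      mk : (∃ λ g → IsLeastQNR p g) → TernaryChoice N (+ a) (+ b)
      mk (g , lq) .TernaryChoice.q = p
      mk (g , lq) .TernaryChoice.δ = g
      mk (g , lq) .TernaryChoice.prime-q = pp
      mk (g , lq) .TernaryChoice.q≤N = p≤N
      mk (g , lq) .TernaryChoice.isGamma = inj₂ (p≢2 , lq)
      mk (g , lq) .TernaryChoice.choose k 1≤k = let (D , 1≤D , D≤ , ns) = negSquare-multiple pp p≢2 lq k 1≤k in
        D , 1≤D , D≤ , subst (λ β → NonRep (+ a) β (+ D * + k)) +b≡ (anisotropic-at pp (+ a) (+ c) bad p∤c ns)

    -- Hamilton's quaternions (-1, -1 / ℚ), the terminal case of the descent, are ramified at 2.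
    unit-choice : TernaryChoice N 1ℤ 1ℤ
    unit-choice .TernaryChoice.q = 2
    unit-choice .TernaryChoice.δ = 7
    unit-choice .TernaryChoice.prime-q = prime[2]
    unit-choice .TernaryChoice.q≤N = 2≤N
    unit-choice .TernaryChoice.isGamma = inj₁ (refl , refl)
    unit-choice .TernaryChoice.choose k 1≤k = let (D , 1≤D , D≤ , ns) = negSquare2-multiple k 1≤k in D , 1≤D , D≤ , three-squares ns

    -- Descent on a + b: the larger entry loses a square factor, exhibits a bad prime, or is lowered
    -- by `norm-step`. No entry ever exceeds N, so neither does any prime that is found.
    ternary-choice-small : ∀ a b → 1 ℕ.≤ a → 1 ℕ.≤ b → a ℕ.≤ N → b ℕ.≤ N → TernaryChoice N (+ a) (+ b)
    ternary-choice-small a b 1≤a 1≤b a≤N b≤N = go a b 1≤a 1≤b a≤N b≤N refl (<-wellFounded (a ℕ.+ b))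
      where
      go : ∀ a b → 1 ℕ.≤ a → 1 ℕ.≤ b → a ℕ.≤ N → b ℕ.≤ N → ∀ {n} → a ℕ.+ b ≡ n → Acc ℕ._<_ n → TernaryChoice N (+ a) (+ b)
      ordered : ∀ a b → 1 ℕ.≤ a → 1 ℕ.≤ b → a ℕ.≤ N → b ℕ.≤ N → ∀ {n} → a ℕ.+ b ≡ n → Acc ℕ._<_ n → a ℕ.≤ b → TernaryChoice N (+ a) (+ b)
      ordered a (suc zero) 1≤a _ _ _ _ _ a≤1 = subst (λ a → TernaryChoice N (+ a) 1ℤ) (ℕₚ.≤-antisym 1≤a a≤1) unit-choice
      ordered a b@(suc (suc _)) 1≤a 1≤b a≤N b≤N refl (acc rec) a≤b = [ square , sqfree ]′ (square-divisor? b 1≤b)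
        where
        2≤b : 2 ℕ.≤ b
        2≤b = ℕ.s≤s (ℕ.s≤s ℕ.z≤n)
        square : (∃₂ λ k e → b ≡ e ℕ.* (k ℕ.* k) × 1 ℕ.≤ e × e ℕ.< b) → TernaryChoice N (+ a) (+ b)
        square (k , e , eq , 1≤e , e<b) = subst (λ b → TernaryChoice N (+ a) (+ b)) (sym eq)
          (square-transfer e k (go a e 1≤a 1≤e a≤N (ℕₚ.≤-trans (ℕₚ.<⇒≤ e<b) b≤N) refl (rec (ℕₚ.+-monoʳ-< a e<b))))
        sqfree : (∀ k → 2 ℕ.≤ k → ¬ (k ℕ.* k) ℕ∣.∣ b) → TernaryChoice N (+ a) (+ b)
        sqfree sf = [ bad , root ]′ (root-or-bad-prime (+ a) b 1≤b sf)
          where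
          bad : (∃ λ p → Prime p × p ℕ∣.∣ b × Bad p (+ a)) → TernaryChoice N (+ a) (+ b)
          bad (p , pp , p∣b , nr) = bad-prime-choice a b 1≤b sf (ℕₚ.≤-trans (ℕ∣.∣⇒≤ p∣b) b≤N) pp p∣b nr
          root : (∃ λ t → + b ∣ t * t + + a) → TernaryChoice N (+ a) (+ b)
          root (t , d) = norm-step-transfer st (go a b′ 1≤a 1≤b′ a≤N (ℕₚ.≤-trans (ℕₚ.<⇒≤ b′<b) b≤N) refl (rec (ℕₚ.+-monoʳ-< a b′<b)))
            where
            st = norm-step a b 1≤a a≤b 2≤b t d
            open NormStep st
      go a b 1≤a 1≤b a≤N b≤N eq ac with ℕₚ.≤-total a b
      ... | inj₁ a≤b = ordered a b 1≤a 1≤b a≤N b≤N eq ac a≤b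
      ... | inj₂ b≤a = transfer nonRep-swap (ordered b a 1≤b 1≤a b≤N a≤N (trans (ℕₚ.+-comm b a) eq) ac b≤a)

    -- Only the primes of b need to be bounded: reducing the binary form [b, 2t, (t²+a)/b] replaces b
    -- by a number below a without any further condition at a prime.
    ternary-choice : ∀ a b → 1 ℕ.≤ a → 1 ℕ.≤ b → a ℕ.≤ N → (∀ p → Prime p → p ℕ∣.∣ b → p ℕ.≤ N) → TernaryChoice N (+ a) (+ b)
    ternary-choice a b 1≤a 1≤b a≤N primes≤N = go b 1≤b primes≤N (<-wellFounded b)
      where
      reduce : ∀ b → 1 ℕ.≤ b → Acc ℕ._<_ b → ∀ t → + b ∣ t * t + + a → TernaryChoice N (+ a) (+ b)
      reduce b 1≤b (acc rec) t d with b ℕ.≤? N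
      ... | yes b≤N = ternary-choice-small a b 1≤a 1≤b a≤N b≤N
      ... | no b≰N = norm-step-transfer st (reduce b′ 1≤b′ (rec b′<b) (+ s) (norm-step-divides st))
        where
        N<b = ℕₚ.≰⇒> b≰N
        st = norm-step a b 1≤a (ℕₚ.≤-trans a≤N (ℕₚ.<⇒≤ N<b)) (ℕₚ.≤-trans 2≤N (ℕₚ.<⇒≤ N<b)) t d
        open NormStep st
      go : ∀ b → 1 ℕ.≤ b → (∀ p → Prime p → p ℕ∣.∣ b → p ℕ.≤ N) → Acc ℕ._<_ b → TernaryChoice N (+ a) (+ b)
      go b 1≤b primes≤N (acc rec) = [ square , sqfree ]′ (square-divisor? b 1≤b)
        where
        square : (∃₂ λ k e → b ≡ e ℕ.* (k ℕ.* k) × 1 ℕ.≤ e × e ℕ.< b) → TernaryChoice N (+ a) (+ b)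
        square (k , e , eq , 1≤e , e<b) = subst (λ b → TernaryChoice N (+ a) (+ b)) (sym eq)
          (square-transfer e k (go e 1≤e (λ p pp p∣e → primes≤N p pp (ℕ∣.∣-trans p∣e (ℕ∣.divides (k ℕ.* k) (trans eq (ℕₚ.*-comm e (k ℕ.* k))))))
              (rec e<b)))
        sqfree : (∀ k → 2 ℕ.≤ k → ¬ (k ℕ.* k) ℕ∣.∣ b) → TernaryChoice N (+ a) (+ b)
        sqfree sf = [ bad , root ]′ (root-or-bad-prime (+ a) b 1≤b sf)
          where
          bad : (∃ λ p → Prime p × p ℕ∣.∣ b × Bad p (+ a)) → TernaryChoice N (+ a) (+ b)
          bad (p , pp , p∣b , nr) = bad-prime-choice a b 1≤b sf (primes≤N p pp p∣b) pp p∣b nr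
          root : (∃ λ t → + b ∣ t * t + + a) → TernaryChoice N (+ a) (+ b)
          root (t , d) = reduce b 1≤b (acc rec) t d

  -- Minors of symmetric matrices

  minor₂ : ℤ → ℤ → ℤ → ℤ
  minor₂ a b e = a * b - e * e

  minor₃ : ℤ → ℤ → ℤ → ℤ → ℤ → ℤ → ℤ
  minor₃ a b c e f g = a * (b * c - g * g) - e * (e * c - g * f) + f * (e * g - b * f)

  -- The vectors (u₁ , u₂ , minor₂) and (n₁ , n₂ , n₃ , minor₃) are the last columns of the adjugates of
  -- the symmetric matrices with diagonals a b c, a b c d and off-diagonal entries
  -- e = 12, f = 13, g = 23, h = 14, i = 24, j = 34.
  u₁ u₂ : (a b e f g : ℤ) → ℤ
  u₁ a b e f g = e * g - b * f
  u₂ a b e f g = e * f - a * g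

  n₁ n₂ n₃ : (a b c e f g h i j : ℤ) → ℤ
  n₁ a b c e f g h i j = - (h * (b * c - g * g) - e * (i * c - g * j) + f * (i * g - b * j))
  n₂ a b c e f g h i j = - (a * (i * c - g * j) - h * (e * c - g * f) + f * (e * j - i * f))
  n₃ a b c e f g h i j = - (a * (b * j - i * g) - e * (e * j - i * f) + h * (e * g - b * f))

  minor₄ : (a b c d e f g h i j : ℤ) → ℤ
  minor₄ a b c d e f g h i j = h * n₁ a b c e f g h i j + i * n₂ a b c e f g h i j + j * n₃ a b c e f g h i j + d * minor₃ a b c e f g

  -- As in the identities below, the polynomial identity is proved with the minors written out,
  -- which is the form that the ring solver normalises.
  u-row₁ : ∀ a b e f g → a * u₁ a b e f g + e * u₂ a b e f g + f * minor₂ a b e ≡ 0ℤ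
  u-row₁ = expanded
    where
    expanded : ∀ a b e f g → a * (e * g - b * f) + e * (e * f - a * g) + f * (a * b - e * e) ≡ 0ℤ
    expanded = solve-∀

  u-row₂ : ∀ a b e f g → e * u₁ a b e f g + b * u₂ a b e f g + g * minor₂ a b e ≡ 0ℤ
  u-row₂ = expanded
    where
    expanded : ∀ a b e f g → e * (e * g - b * f) + b * (e * f - a * g) + g * (a * b - e * e) ≡ 0ℤ
    expanded = solve-∀

  u-row₃ : ∀ a b c e f g → f * u₁ a b e f g + g * u₂ a b e f g + c * minor₂ a b e ≡ minor₃ a b c e f g
  u-row₃ = expanded
    where
    expanded : ∀ a b c e f g → f * (e * g - b * f) + g * (e * f - a * g) + c * (a * b - e * e) ≡ (a * (b * c - g * g) - e * (e * c - g * f) + f *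
        (e * g - b * f))
    expanded = solve-∀

  n-row₁ : ∀ a b c e f g h i j → a * n₁ a b c e f g h i j + e * n₂ a b c e f g h i j + f * n₃ a b c e f g h i j + h * minor₃ a b c e f g ≡ 0ℤ
  n-row₁ = expanded
    where
    expanded : ∀ a b c e f g h i j → a * - (h * (b * c - g * g) - e * (i * c - g * j) + f * (i * g - b * j)) + e * - (a * (i * c - g * j) - h *
        (e * c - g * f) + f * (e * j - i * f)) + f * - (a * (b * j - i * g) - e * (e * j - i * f) + h * (e * g - b * f)) + h * (a *
        (b * c - g * g) - e * (e * c - g * f) + f * (e * g - b * f)) ≡ 0ℤ
    expanded = solve-∀

  n-row₂ : ∀ a b c e f g h i j → e * n₁ a b c e f g h i j + b * n₂ a b c e f g h i j + g * n₃ a b c e f g h i j + i * minor₃ a b c e f g ≡ 0ℤ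
  n-row₂ = expanded
    where
    expanded : ∀ a b c e f g h i j → e * - (h * (b * c - g * g) - e * (i * c - g * j) + f * (i * g - b * j)) + b * - (a * (i * c - g * j) - h *
        (e * c - g * f) + f * (e * j - i * f)) + g * - (a * (b * j - i * g) - e * (e * j - i * f) + h * (e * g - b * f)) + i * (a *
        (b * c - g * g) - e * (e * c - g * f) + f * (e * g - b * f)) ≡ 0ℤ
    expanded = solve-∀

  n-row₃ : ∀ a b c e f g h i j → f * n₁ a b c e f g h i j + g * n₂ a b c e f g h i j + c * n₃ a b c e f g h i j + j * minor₃ a b c e f g ≡ 0ℤ
  n-row₃ = expanded
    where
    expanded : ∀ a b c e f g h i j → f * - (h * (b * c - g * g) - e * (i * c - g * j) + f * (i * g - b * j)) + g * - (a * (i * c - g * j) - h *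
        (e * c - g * f) + f * (e * j - i * f)) + c * - (a * (b * j - i * g) - e * (e * j - i * f) + h * (e * g - b * f)) + j * (a *
        (b * c - g * g) - e * (e * c - g * f) + f * (e * g - b * f)) ≡ 0ℤ
    expanded = solve-∀

  -- Sylvester's identity with pivot a.
  pivot₃ : ∀ a b c e f g → a * minor₃ a b c e f g ≡ minor₂ a b e * (a * c - f * f) - u₂ a b e f g * u₂ a b e f g
  pivot₃ = expanded
    where
    expanded : ∀ a b c e f g → a * (a * (b * c - g * g) - e * (e * c - g * f) + f * (e * g - b * f)) ≡ (a * b - e * e) * (a * c - f * f) -
        (e * f - a * g) * (e * f - a * g)
    expanded = solve-∀

  -- Lagrange's diagonalisation by successive completion of squares, freed of denominators. Up to
  -- the factor `a * minor₂` the form becomes d₂ X² + Y² + β Z² with β = a d₃, which is similar to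
  -- the form of `NonRep d₂ β`.
  ternary-diagonal : ∀ a b c e f g x y z →
    a * minor₂ a b e * (x * (a * x + e * y + f * z) + y * (e * x + b * y + g * z) + z * (f * x + g * y + c * z))
    ≡ minor₂ a b e * ((a * x + e * y + f * z) * (a * x + e * y + f * z))
      + (minor₂ a b e * y - u₂ a b e f g * z) * (minor₂ a b e * y - u₂ a b e f g * z) + a * minor₃ a b c e f g * (z * z)
  ternary-diagonal = expanded
    where
    expanded : ∀ a b c e f g x y z →
      a * (a * b - e * e) * (x * (a * x + e * y + f * z) + y * (e * x + b * y + g * z) + z * (f * x + g * y + c * z))
      ≡ (a * b - e * e) * ((a * x + e * y + f * z) * (a * x + e * y + f * z))
        + ((a * b - e * e) * y - (e * f - a * g) * z) * ((a * b - e * e) * y - (e * f - a * g) * z) + a * (a * (b * c - g * g) - e *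
            (e * c - g * f) + f * (e * g - b * f)) * (z * z)
    expanded = solve-∀

  -- This and the four identities that follow are instances of one fact: a 2×2 minor of the adjugate
  -- is the determinant times the complementary minor of the matrix.
  jacobi₃-₁ : ∀ a b c e f g → u₁ a b e f g * u₁ a b e f g ≡ minor₂ b c g * minor₂ a b e - minor₃ a b c e f g * b
  jacobi₃-₁ = expanded
    where
    expanded : ∀ a b c e f g → (e * g - b * f) * (e * g - b * f) ≡ (b * c - g * g) * (a * b - e * e) - (a * (b * c - g * g) - e *
        (e * c - g * f) + f * (e * g - b * f)) * b
    expanded = solve-∀

  jacobi₃-₂ : ∀ a b c e f g → u₂ a b e f g * u₂ a b e f g ≡ minor₂ a c f * minor₂ a b e - minor₃ a b c e f g * a
  jacobi₃-₂ = expanded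
    where
    expanded : ∀ a b c e f g → (e * f - a * g) * (e * f - a * g) ≡ (a * c - f * f) * (a * b - e * e) - (a * (b * c - g * g) - e *
        (e * c - g * f) + f * (e * g - b * f)) * a
    expanded = solve-∀

  jacobi₄-₁ : ∀ a b c d e f g h i j → n₁ a b c e f g h i j * n₁ a b c e f g h i j ≡ minor₃ b c d g i j * minor₃ a b c e f g - minor₄ a b c d e f g h
      i j * minor₂ b c g
  jacobi₄-₁ = expanded
    where
    expanded : ∀ a b c d e f g h i j → - (h * (b * c - g * g) - e * (i * c - g * j) + f * (i * g - b * j)) * - (h * (b * c - g * g) - e *
        (i * c - g * j) + f * (i * g - b * j)) ≡ (b * (c * d - j * j) - g * (g * d - j * i) + i * (g * j - c * i)) * (a * (b * c - g * g) - e *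
        (e * c - g * f) + f * (e * g - b * f)) - (h * - (h * (b * c - g * g) - e * (i * c - g * j) + f * (i * g - b * j)) + i * - (a *
        (i * c - g * j) - h * (e * c - g * f) + f * (e * j - i * f)) + j * - (a * (b * j - i * g) - e * (e * j - i * f) + h * (e * g - b * f)) + d *
        (a * (b * c - g * g) - e * (e * c - g * f) + f * (e * g - b * f))) * (b * c - g * g)
    expanded = solve-∀

  jacobi₄-₂ : ∀ a b c d e f g h i j → n₂ a b c e f g h i j * n₂ a b c e f g h i j ≡ minor₃ a c d f h j * minor₃ a b c e f g - minor₄ a b c d e f g h
      i j * minor₂ a c f
  jacobi₄-₂ = expanded
    where
    expanded : ∀ a b c d e f g h i j → - (a * (i * c - g * j) - h * (e * c - g * f) + f * (e * j - i * f)) * - (a * (i * c - g * j) - h *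
        (e * c - g * f) + f * (e * j - i * f)) ≡ (a * (c * d - j * j) - f * (f * d - j * h) + h * (f * j - c * h)) * (a * (b * c - g * g) - e *
        (e * c - g * f) + f * (e * g - b * f)) - (h * - (h * (b * c - g * g) - e * (i * c - g * j) + f * (i * g - b * j)) + i * - (a *
        (i * c - g * j) - h * (e * c - g * f) + f * (e * j - i * f)) + j * - (a * (b * j - i * g) - e * (e * j - i * f) + h * (e * g - b * f)) + d *
        (a * (b * c - g * g) - e * (e * c - g * f) + f * (e * g - b * f))) * (a * c - f * f)
    expanded = solve-∀

  jacobi₄-₃ : ∀ a b c d e f g h i j → n₃ a b c e f g h i j * n₃ a b c e f g h i j ≡ minor₃ a b d e h i * minor₃ a b c e f g - minor₄ a b c d e f g h
      i j * minor₂ a b e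
  jacobi₄-₃ = expanded
    where
    expanded : ∀ a b c d e f g h i j → - (a * (b * j - i * g) - e * (e * j - i * f) + h * (e * g - b * f)) * - (a * (b * j - i * g) - e *
        (e * j - i * f) + h * (e * g - b * f)) ≡ (a * (b * d - i * i) - e * (e * d - i * h) + h * (e * i - b * h)) * (a * (b * c - g * g) - e *
        (e * c - g * f) + f * (e * g - b * f)) - (h * - (h * (b * c - g * g) - e * (i * c - g * j) + f * (i * g - b * j)) + i * - (a *
        (i * c - g * j) - h * (e * c - g * f) + f * (e * j - i * f)) + j * - (a * (b * j - i * g) - e * (e * j - i * f) + h * (e * g - b * f)) + d *
        (a * (b * c - g * g) - e * (e * c - g * f) + f * (e * g - b * f))) * (a * b - e * e)
    expanded = solve-∀

  sqrt-irrational : ∀ D → Squarefree D → D ≢ 1 → ∀ x y → x ℕ.* x ≡ D ℕ.* (y ℕ.* y) → y ≡ 0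
  sqrt-irrational D sf D≢1 x zero eq = refl
  sqrt-irrational D sf D≢1 x y@(suc _) eq = ⊥-elim (D≢1 (go (GCD.gcd[m,n]∣m x y) (GCD.gcd[m,n]∣n x y)))
    where
    g = GCD.gcd x y
    instance
      g≢0 : NonZero g
      g≢0 = ℕ.≢-nonZero (GCD.gcd[m,n]≢0 x y (inj₂ λ ()))
    cop : Coprime (x ℕ./ g) (y ℕ./ g)
    cop = Cop.coprime-/gcd x y
    go : g ℕ∣.∣ x → g ℕ∣.∣ y → D ≡ 1
    go g∣x g∣y = trans D≡x² (cong (λ t → t ℕ.* t) x′≡1)
      where
      open import Data.Nat.Tactic.RingSolver renaming (solve-∀ to solveℕ-∀)
      x′ = x ℕ./ g
      y′ = y ℕ./ g
      l₁ : ∀ g x → g ℕ.* g ℕ.* (x ℕ.* x) ≡ (g ℕ.* x) ℕ.* (g ℕ.* x)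
      l₁ = solveℕ-∀
      l₂ : ∀ D g y → D ℕ.* ((g ℕ.* y) ℕ.* (g ℕ.* y)) ≡ g ℕ.* g ℕ.* (D ℕ.* (y ℕ.* y))
      l₂ = solveℕ-∀
      eq′ : x′ ℕ.* x′ ≡ D ℕ.* (y′ ℕ.* y′)
      eq′ = ℕₚ.*-cancelˡ-≡ _ _ (g ℕ.* g) {{ℕₚ.m*n≢0 g g}} (trans (l₁ g x′) (trans (cong (λ t → t ℕ.* t) (ℕ.m*[n/m]≡n g∣x))
        (trans eq (trans (cong (λ t → D ℕ.* (t ℕ.* t)) (sym (ℕ.m*[n/m]≡n g∣y))) (l₂ D g y′)))))
      y′∣x′² : y′ ℕ∣.∣ x′ ℕ.* x′
      y′∣x′² = ℕ∣.divides (D ℕ.* y′) (trans eq′ (sym (ℕₚ.*-assoc D y′ y′)))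
      y′≡1 : y′ ≡ 1
      y′≡1 = cop (Cop.coprime-divisor (Cop.sym cop) y′∣x′² , ℕ∣.∣-refl)
      D≡x² : D ≡ x′ ℕ.* x′
      D≡x² = sym (trans eq′ (trans (cong (λ t → D ℕ.* (t ℕ.* t)) y′≡1) (ℕₚ.*-identityʳ D)))
      x′≡1 : x′ ≡ 1
      x′≡1 = sf x′ (subst (ℕ∣._∣ D) D≡x² ℕ∣.∣-refl)

  squarefree[2] : Squarefree 2
  squarefree[2] zero (ℕ∣.divides q eq) = contradiction (trans eq (ℕₚ.*-zeroʳ q)) λ ()
  squarefree[2] (suc zero) _ = refl
  squarefree[2] (suc (suc k)) d = contradiction (ℕₚ.≤-trans (ℕₚ.*-mono-≤ {2} {suc (suc k)} {2} (ℕ.s≤s (ℕ.s≤s ℕ.z≤n)) (ℕ.s≤s (ℕ.s≤s ℕ.z≤n)))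
      (ℕ∣.∣⇒≤ d)) λ { (ℕ.s≤s (ℕ.s≤s ())) }

  -- The choice of C and D for an integral Gram matrix

  module _ (m : ℕ) (φ : ℕ → ℕ → ℤ) where

    diag : ℕ → ℤ
    diag c = + m * + c

    gram₂ : ℤ
    gram₂ = minor₂ (diag 1) (diag 2) (φ 1 2)

    gram₃ : ℕ → ℤ
    gram₃ C = minor₃ (diag 1) (diag 2) (diag C) (φ 1 2) (φ 1 C) (φ 2 C)

    gram₄ : ℕ → ℕ → ℤ
    gram₄ C D = minor₄ (diag 1) (diag 2) (diag C) (diag D) (φ 1 2) (φ 1 C) (φ 2 C) (φ 1 D) (φ 2 D) (φ C D)

    -- One record serves both G and A, because their diagonals agree. A minor is claimed to be
    -- nonzero only where the smaller ones are positive: only there are C and D obtained from the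
    -- forms x² + d y² and `NonRep`.
    record Selection : Set where
      field
        p γ C q δ D : ℕ
        prime-p : Prime p
        p≤ : p ℕ.≤ 2 ℕ.* m ℕ.^ 2
        isGamma-p : IsGamma p γ
        2≤C : 2 ℕ.≤ C
        C≤γ : C ℕ.≤ γ
        prime-q : Prime q
        q≤ : q ℕ.≤ 2 ℕ.* C ℕ.* m ℕ.^ 3
        isGamma-q : IsGamma q δ
        1≤D : 1 ℕ.≤ D
        D≤qδ : D ℕ.≤ q ℕ.* δ
        gram₂≢0 : gram₂ ≢ 0ℤ
        gram₃≢0 : 0ℤ ℤ.< gram₂ → gram₃ C ≢ 0ℤ
        gram₄≢0 : 0ℤ ℤ.< gram₂ → 0ℤ ℤ.< gram₃ C → gram₄ C D ≢ 0ℤ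

  abs-pos : ∀ {x} → 0ℤ ℤ.< x → + abs x ≡ x
  abs-pos {+ _} _ = refl
  abs-pos { -[1+ _ ]} ()

  abs-≥1 : ∀ {x} → 0ℤ ℤ.< x → 1 ℕ.≤ abs x
  abs-≥1 {+ zero} (ℤ.+<+ ())
  abs-≥1 {+ suc _} _ = ℕ.s≤s ℕ.z≤n
  abs-≥1 { -[1+ _ ]} ()

  pos-≢0 : ∀ {x} → 0ℤ ℤ.< x → x ≢ 0ℤ
  pos-≢0 lt refl = ℤₚ.<-irrefl refl lt

  0≤sq : ∀ x → 0ℤ ℤ.≤ x * x
  0≤sq x = subst (0ℤ ℤ.≤_) (trans (ℤₚ.pos-* (abs x) (abs x)) (lem x)) (ℤ.+≤+ ℕ.z≤n)
    where
    lem : ∀ x → + abs x * + abs x ≡ x * x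
    lem (+ n) = refl
    lem -[1+ n ] = refl

  minor₂-≤ : ∀ a b e → minor₂ a b e ℤ.≤ a * b
  minor₂-≤ a b e = subst (minor₂ a b e ℤ.≤_) (ℤₚ.+-identityʳ (a * b)) (ℤₚ.+-monoʳ-≤ (a * b) (ℤₚ.neg-mono-≤ (0≤sq e)))

  -- An inequality of Hadamard type: dropping the squares u² and f² from `pivot₃` leaves it.
  minor₃-≤ : ∀ a b c e f g → 0ℤ ℤ.< a → 0ℤ ℤ.≤ minor₂ a b e → minor₃ a b c e f g ℤ.≤ minor₂ a b e * c
  minor₃-≤ a b c e f g 0<a 0≤d = ℤₚ.*-cancelˡ-≤-pos (minor₃ a b c e f g) (minor₂ a b e * c) a {{ℤ.positive 0<a}} (begin
    a * minor₃ a b c e f g                                   ≡⟨ pivot₃ a b c e f g ⟩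
    minor₂ a b e * (a * c - f * f) - u * u                   ≤⟨ ℤₚ.+-monoʳ-≤ (minor₂ a b e * (a * c - f * f)) (ℤₚ.neg-mono-≤ (0≤sq u)) ⟩
    minor₂ a b e * (a * c - f * f) - 0ℤ                      ≡⟨ ℤₚ.+-identityʳ _ ⟩
    minor₂ a b e * (a * c - f * f)                           ≤⟨ ℤₚ.*-monoˡ-≤-nonNeg (minor₂ a b e) {{ℤ.nonNegative 0≤d}} (minor₂-≤ a c f) ⟩
    minor₂ a b e * (a * c)                                   ≡⟨ l (minor₂ a b e) a c ⟩
    a * (minor₂ a b e * c)                                   ∎)
    where
    open ℤₚ.≤-Reasoning
    u = u₂ a b e f g
    l : ∀ d a c → d * (a * c) ≡ a * (d * c)
    l = solve-∀

  gram₂-nonzero : ∀ m → 1 ℕ.≤ m → ∀ φ → gram₂ m φ ≢ 0ℤ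
  gram₂-nonzero m 1≤m φ eq = ℕₚ.<⇒≢ 1≤m (sym (sqrt-irrational 2 squarefree[2] (λ ()) (abs e) m
    (trans (sym (ℤₚ.abs-* e e)) (trans (cong abs e²) (trans (ℤₚ.abs-* (+ 2) (+ m * + m)) (cong (2 ℕ.*_) (ℤₚ.abs-* (+ m) (+ m))))))))
    where
    e = φ 1 2
    l : ∀ m e → e * e ≡ + 2 * (m * m) - (m * + 1 * (m * + 2) - e * e)
    l = solve-∀
    e² : e * e ≡ + 2 * (+ m * + m)
    e² = trans (l (+ m) e) (trans (cong (λ t → + 2 * (+ m * + m) - t) eq) (ℤₚ.+-identityʳ _))

  -- If the minor vanished, `pivot₃` would say d₂ (m² C - f²) = u². Multiplied by d₂ this is C (m
  -- d₂)² = (d₂ f)² + d₂ u², a forbidden representation of C.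
  gram₃-nonzero : ∀ m → 1 ℕ.≤ m → ∀ φ C → (∀ x y z → + C * (z * z) ≡ x * x + gram₂ m φ * (y * y) → z ≡ 0ℤ) →
                  gram₂ m φ ≢ 0ℤ → gram₃ m φ C ≢ 0ℤ
  gram₃-nonzero m 1≤m φ C nonrep d₂≢0 eq = d₂≢0 (*-≢0 {+ m} (λ e → ℕₚ.<⇒≢ 1≤m (sym (ℤₚ.+-injective e)))
    (nonrep (d₂ * f) u (+ m * d₂) (trans (l d₂ (+ m) (+ C) f u) (trans (cong (λ t → d₂ * (t + u * u) + d₂ * f * (d₂ * f)) pivot≡0) (l′ d₂ f u)))))
    where
    d₂ = gram₂ m φ
    f = φ 1 C
    g = φ 2 C
    u = u₂ (diag m φ 1) (diag m φ 2) (φ 1 2) f g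
    l : ∀ d m C f u → C * (m * d * (m * d)) ≡ d * ((d * (m * + 1 * (m * C) - f * f) - u * u) + u * u) + d * f * (d * f)
    l = solve-∀
    l′ : ∀ d f u → d * (0ℤ + u * u) + d * f * (d * f) ≡ d * f * (d * f) + d * (u * u)
    l′ = solve-∀
    pivot≡0 : d₂ * (+ m * + 1 * (+ m * + C) - f * f) - u * u ≡ 0ℤ
    pivot≡0 = trans (sym (pivot₃ (diag m φ 1) (diag m φ 2) (diag m φ C) (φ 1 2) f g)) (trans (cong (diag m φ 1 *_) eq) (ℤₚ.*-zeroʳ (diag m φ 1)))

  -- If the determinant vanished, the ternary form would take the value m D d₃² at (n₁, n₂, n₃), by
  -- the rows of the adjugate. Through `ternary-diagonal`, multiplied by d₂ β, this becomes a
  -- representation of D β by the form of `NonRep d₂ β`, with last coordinate d₂ β ≠ 0.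
  gram₄-nonzero : ∀ m φ C D → NonRep (gram₂ m φ) (diag m φ 1 * gram₃ m φ C) (+ D * (diag m φ 1 * gram₃ m φ C)) →
                  gram₂ m φ ≢ 0ℤ → diag m φ 1 * gram₃ m φ C ≢ 0ℤ → gram₄ m φ C D ≢ 0ℤ
  gram₄-nonzero m φ C D nr d₂≢0 β≢0 eq = β≢0 (*-≢0 d₂≢0 (vanish nr (β * z) (d₂ * L₁) L₂ (d₂ * β)
    (trans (l₁ d₂ β L₁ L₂ z) (trans (cong (d₂ * β *_) (sym diagonal)) (trans (cong (λ t → d₂ * β * (diag m φ 1 * d₂ * t)) value) (l₂ d₂ (+ m) d₃
        (+ D)))))))
    where
    a = diag m φ 1
    b = diag m φ 2
    c = diag m φ C
    d = diag m φ D
    e = φ 1 2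
    f = φ 1 C
    g = φ 2 C
    h = φ 1 D
    i = φ 2 D
    j = φ C D
    d₂ = gram₂ m φ
    d₃ = gram₃ m φ C
    β = a * d₃
    x = n₁ a b c e f g h i j
    y = n₂ a b c e f g h i j
    z = n₃ a b c e f g h i j
    L₁ = a * x + e * y + f * z
    L₂ = d₂ * y - u₂ a b e f g * z
    X = x * (a * x + e * y + f * z) + y * (e * x + b * y + g * z) + z * (f * x + g * y + c * z)
    diagonal : a * d₂ * X ≡ d₂ * (L₁ * L₁) + L₂ * L₂ + a * d₃ * (z * z)
    diagonal = ternary-diagonal a b c e f g x y z
    l₁ : ∀ d β L₁ L₂ z → d * (β * z * (β * z)) + β * (d * L₁ * (d * L₁)) + d * β * (L₂ * L₂) ≡ d * β * (d * (L₁ * L₁) + L₂ * L₂ + β * (z * z))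
    l₁ = solve-∀
    l₂ : ∀ d₂ m d₃ D → d₂ * (m * + 1 * d₃) * (m * + 1 * d₂ * (m * D * (d₃ * d₃))) ≡ D * (m * + 1 * d₃) * (d₂ * (m * + 1 * d₃) * (d₂ * (m * + 1 * d₃)))
    l₂ = solve-∀
    row : ∀ {s t} → s + t ≡ 0ℤ → s ≡ - t
    row {s} {t} eq = trans (l₃ s t) (trans (cong (_- t) eq) (ℤₚ.+-identityˡ (- t)))
      where
      l₃ : ∀ s t → s ≡ s + t - t
      l₃ = solve-∀
    l₄ : ∀ x y z h i j d d₃ → x * - (h * d₃) + y * - (i * d₃) + z * - (j * d₃) ≡ d * (d₃ * d₃) - d₃ * (h * x + i * y + j * z + d * d₃)
    l₄ = solve-∀
    value : X ≡ d * (d₃ * d₃)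
    value = trans (cong₂ _+_ (cong₂ _+_ (cong (x *_) (row (n-row₁ a b c e f g h i j))) (cong (y *_) (row (n-row₂ a b c e f g h i j)))) (cong (z *_)
        (row (n-row₃ a b c e f g h i j))))
      (trans (l₄ x y z h i j d d₃) (trans (cong (λ t → d * (d₃ * d₃) - d₃ * t) eq) (trans (cong (λ t → d * (d₃ * d₃) - t) (ℤₚ.*-zeroʳ d₃))
          (ℤₚ.+-identityʳ _))))

  module _ (m : ℕ) (1≤m : 1 ℕ.≤ m) (φ : ℕ → ℕ → ℤ) where

    private
      N₁ : ℕ
      N₁ = 2 ℕ.* m ℕ.^ 2
      2≤N₁ : 2 ℕ.≤ N₁
      2≤N₁ = ℕₚ.*-monoʳ-≤ 2 (ℕₚ.^-monoˡ-≤ 2 1≤m)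
      d₂ = gram₂ m φ
      m≢0 : NonZero m
      m≢0 = ℕ.>-nonZero 1≤m

      BinaryPart : Set
      BinaryPart = ∃ λ d → BinaryChoice N₁ d × (0ℤ ℤ.< d₂ → + d ≡ d₂)

      d₂≤ : 0ℤ ℤ.< d₂ → abs d₂ ℕ.≤ N₁
      d₂≤ 0<d = ℤₚ.drop‿+≤+ (subst₂ ℤ._≤_ (sym (abs-pos 0<d)) eq (minor₂-≤ (diag m φ 1) (diag m φ 2) (φ 1 2)))
        where
        l : ∀ m → m * + 1 * (m * + 2) ≡ + 2 * (m * (m * + 1))
        l = solve-∀
        eq : + m * + 1 * (+ m * + 2) ≡ + (2 ℕ.* (m ℕ.* (m ℕ.* 1)))
        eq = trans (l (+ m)) (sym (trans (ℤₚ.pos-* 2 (m ℕ.* (m ℕ.* 1))) (cong (+ 2 *_) (trans (ℤₚ.pos-* m (m ℕ.* 1)) (cong (+ m *_)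
            (ℤₚ.pos-* m 1))))))

      binaryPart : Dec (0ℤ ℤ.< d₂) → BinaryPart
      binaryPart (yes 0<d) = abs d₂ , binary-choice N₁ 2≤N₁ (abs d₂) (abs-≥1 0<d) (d₂≤ 0<d) , λ _ → abs-pos 0<d
      -- When d₂ is not positive nothing is promised about the form, and the choice for d = 1 merely
      -- supplies admissible values.
      binaryPart (no ¬0<d) = 1 , binary-choice N₁ 2≤N₁ 1 ℕₚ.≤-refl (ℕₚ.<⇒≤ 2≤N₁) , λ 0<d → contradiction 0<d ¬0<d

      module _ (C : ℕ) (2≤C : 2 ℕ.≤ C) where
        N₂ : ℕ
        N₂ = 2 ℕ.* C ℕ.* m ℕ.^ 3
        N₁≤N₂ : N₁ ℕ.≤ N₂
        N₁≤N₂ = ℕₚ.*-mono-≤ (ℕₚ.*-monoʳ-≤ 2 (ℕₚ.<⇒≤ 2≤C)) (ℕₚ.^-monoʳ-≤ m {{m≢0}} (ℕₚ.n≤1+n 2))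
        2≤N₂ : 2 ℕ.≤ N₂
        2≤N₂ = ℕₚ.≤-trans 2≤N₁ N₁≤N₂
        m≤N₂ : m ℕ.≤ N₂
        m≤N₂ = ℕₚ.≤-trans (ℕₚ.≤-trans (ℕₚ.m≤m*n m (m ℕ.* 1) {{ℕₚ.m*n≢0 m 1 {{m≢0}}}}) (ℕₚ.m≤n*m (m ℕ.^ 2) 2)) N₁≤N₂
        d₃ = gram₃ m φ C
        β = diag m φ 1 * d₃

        TernaryPart : Set
        TernaryPart = ∃₂ λ q δ → ∃ λ D → Prime q × q ℕ.≤ N₂ × IsGamma q δ × 1 ℕ.≤ D × D ℕ.≤ q ℕ.* δ ×
                      (0ℤ ℤ.< d₂ → 0ℤ ℤ.< d₃ → NonRep d₂ β (+ D * β))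

        fromChoice : ∀ {a b} (t : TernaryChoice N₂ a b) → ∀ k → 1 ℕ.≤ k →
                     (0ℤ ℤ.< d₂ → 0ℤ ℤ.< d₃ → a ≡ d₂ × b ≡ β × + k ≡ β) → TernaryPart
        fromChoice t k 1≤k h = let (D , 1≤D , D≤ , nr) = TernaryChoice.choose t k 1≤k in
          TernaryChoice.q t , TernaryChoice.δ t , D , TernaryChoice.prime-q t , TernaryChoice.q≤N t , TernaryChoice.isGamma t , 1≤D , D≤ ,
          λ 0<d₂ 0<d₃ → let (e₁ , e₂ , e₃) = h 0<d₂ 0<d₃ in subst₂ (λ a b → NonRep a b (+ D * β)) e₁ e₂ (subst (λ k → NonRep _ _ (+ D * k)) e₃ nr)

        d₃≤ : 0ℤ ℤ.< d₂ → 0ℤ ℤ.< d₃ → abs d₃ ℕ.≤ N₂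
        d₃≤ 0<d₂ 0<d₃ = ℤₚ.drop‿+≤+ (begin
          + abs d₃                                ≡⟨ abs-pos 0<d₃ ⟩
          d₃                                      ≤⟨ minor₃-≤ _ _ _ (φ 1 2) (φ 1 C) (φ 2 C) 0<diag (ℤₚ.<⇒≤ 0<d₂) ⟩
          d₂ * (+ m * + C)                        ≡⟨ cong₂ _*_ (sym (abs-pos 0<d₂)) (sym (ℤₚ.pos-* m C)) ⟩
          + abs d₂ * + (m ℕ.* C)                  ≡⟨ sym (ℤₚ.pos-* (abs d₂) (m ℕ.* C)) ⟩
          + (abs d₂ ℕ.* (m ℕ.* C))                ≤⟨ ℤ.+≤+ (ℕₚ.*-monoˡ-≤ (m ℕ.* C) (d₂≤ 0<d₂)) ⟩
          + (N₁ ℕ.* (m ℕ.* C))                    ≡⟨ cong +_ (l m C) ⟩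
          + N₂                                    ∎)
          where
          open ℤₚ.≤-Reasoning
          open import Data.Nat.Tactic.RingSolver renaming (solve-∀ to solveℕ-∀)
          0<diag : 0ℤ ℤ.< diag m φ 1
          0<diag = subst (0ℤ ℤ.<_) (sym (ℤₚ.*-identityʳ (+ m))) (ℤ.+<+ 1≤m)
          l : ∀ m C → 2 ℕ.* (m ℕ.* (m ℕ.* 1)) ℕ.* (m ℕ.* C) ≡ 2 ℕ.* C ℕ.* (m ℕ.* (m ℕ.* (m ℕ.* 1)))
          l = solveℕ-∀

        ternaryPart : Dec (0ℤ ℤ.< d₂ × 0ℤ ℤ.< d₃) → TernaryPart
        ternaryPart (no ¬pos) = fromChoice (unit-choice N₂ 2≤N₂) 1 ℕₚ.≤-refl λ p q → contradiction (p , q) ¬pos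
        ternaryPart (yes (0<d₂ , 0<d₃)) = fromChoice
          (ternary-choice N₂ 2≤N₂ (abs d₂) b (abs-≥1 0<d₂) 1≤b (ℕₚ.≤-trans (d₂≤ 0<d₂) N₁≤N₂) primes) b 1≤b
          λ _ _ → abs-pos 0<d₂ , +b≡β , +b≡β
          where
          -- This b may exceed `N₂`, but each of its prime factors divides m or d₃, and these are at
          -- most `N₂`.
          b = m ℕ.* abs d₃
          +b≡β : + b ≡ β
          +b≡β = trans (ℤₚ.pos-* m (abs d₃)) (cong₂ _*_ (sym (ℤₚ.*-identityʳ (+ m))) (abs-pos 0<d₃))
          1≤b : 1 ℕ.≤ b
          1≤b = ℕₚ.*-mono-≤ 1≤m (abs-≥1 0<d₃)
          primes : ∀ p → Prime p → p ℕ∣.∣ b → p ℕ.≤ N₂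
          primes p pp p∣b with euclidsLemma m (abs d₃) pp p∣b
          ... | inj₁ p∣m = ℕₚ.≤-trans (ℕ∣.∣⇒≤ {{m≢0}} p∣m) m≤N₂
          ... | inj₂ p∣d = ℕₚ.≤-trans (ℕ∣.∣⇒≤ {{ℕ.>-nonZero (abs-≥1 0<d₃)}} p∣d) (d₃≤ 0<d₂ 0<d₃)

    selection : Selection m φ
    selection = mk (binaryPart (0ℤ ℤ.<? d₂))
      where
      mk : BinaryPart → Selection m φ
      mk (d , bc , d≡) = mk′ (ternaryPart C 2≤C ((0ℤ ℤ.<? d₂) ×-dec (0ℤ ℤ.<? gram₃ m φ C)))
        where
        C = BinaryChoice.γ bc
        2≤C = BinaryChoice.2≤γ bc
        mk′ : TernaryPart C 2≤C → Selection m φ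
        mk′ (q , δ , D , prime-q , q≤ , isGamma-q , 1≤D , D≤ , nr) = record
          { p = BinaryChoice.p bc ; γ = C ; C = C ; q = q ; δ = δ ; D = D
          ; prime-p = BinaryChoice.prime-p bc ; p≤ = BinaryChoice.p≤N bc ; isGamma-p = BinaryChoice.isGamma bc
          ; 2≤C = 2≤C ; C≤γ = ℕₚ.≤-refl
          ; prime-q = prime-q ; q≤ = q≤ ; isGamma-q = isGamma-q ; 1≤D = 1≤D ; D≤qδ = D≤
          ; gram₂≢0 = gram₂-nonzero m 1≤m φ
          ; gram₃≢0 = λ 0<d₂ → gram₃-nonzero m 1≤m φ C (subst (λ t → ∀ x y z → + C * (z * z) ≡ x * x + t * (y * y) → z ≡ 0ℤ) (d≡ 0<d₂)
              (BinaryChoice.nonrep bc)) (gram₂-nonzero m 1≤m φ)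
          ; gram₄≢0 = λ 0<d₂ 0<d₃ → gram₄-nonzero m φ C D (nr 0<d₂ 0<d₃) (gram₂-nonzero m 1≤m φ)
              λ e → pos-≢0 0<d₃ (*-≢0 {diag m φ 1} (λ e′ → ℕₚ.<⇒≢ 1≤m (sym (ℤₚ.+-injective (trans (sym (ℤₚ.*-identityʳ (+ m))) e′)))) e)
          }

  -- Numerical estimates for the adjugate columns

  0≤-* : ∀ {x y} → 0ℤ ℤ.≤ x → 0ℤ ℤ.≤ y → 0ℤ ℤ.≤ x * y
  0≤-* {x} {y} p q = subst (ℤ._≤ x * y) (ℤₚ.*-zeroʳ x) (ℤₚ.*-monoˡ-≤-nonNeg x {{ℤ.nonNegative p}} q)

  0<-* : ∀ {x y} → 0ℤ ℤ.< x → 0ℤ ℤ.< y → 0ℤ ℤ.< x * y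
  0<-* {x} {y} p q = subst (ℤ._< x * y) (ℤₚ.*-zeroʳ x) (ℤₚ.*-monoˡ-<-pos x {{ℤ.positive p}} q)

  *-monoˡ : ∀ {z x y} → 0ℤ ℤ.≤ z → x ℤ.≤ y → z * x ℤ.≤ z * y
  *-monoˡ {z} p = ℤₚ.*-monoˡ-≤-nonNeg z {{ℤ.nonNegative p}}

  0<⇒1≤ : ∀ {x} → 0ℤ ℤ.< x → 1ℤ ℤ.≤ x
  0<⇒1≤ = ℤₚ.i<j⇒suc[i]≤j

  +≤ : ∀ {m n} → m ℕ.≤ n → + m ℤ.≤ + n
  +≤ = ℤ.+≤+

  absorb : ∀ {P T X X₀} → 0ℤ ℤ.< P → 0ℤ ℤ.< T → X ℤ.≤ X₀ → 0ℤ ℤ.≤ X₀ → P * X ℤ.≤ P * T * X₀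
  absorb {P} {T} {X} {X₀} 0<P 0<T X≤ 0≤X₀ = begin
    P * X        ≤⟨ *-monoˡ (ℤₚ.<⇒≤ 0<P) X≤ ⟩
    P * X₀       ≡⟨ cong (P *_) (sym (ℤₚ.*-identityˡ X₀)) ⟩
    P * (1ℤ * X₀) ≤⟨ *-monoˡ (ℤₚ.<⇒≤ 0<P) (ℤₚ.*-monoʳ-≤-nonNeg X₀ {{ℤ.nonNegative 0≤X₀}} (0<⇒1≤ 0<T)) ⟩
    P * (T * X₀) ≡⟨ sym (ℤₚ.*-assoc P T X₀) ⟩
    P * T * X₀   ∎
    where open ℤₚ.≤-Reasoning

  -- P is a positive leading minor, -T the next one, and S the squared length of the adjugate
  -- column, which Jacobi's identities bring to the form P X + T Y. As P and T are integers ≥ 1,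
  -- both terms are at most P T times their numerical bounds.
  combine : ∀ {P T X Y X₀ Y₀ S} k K → 0ℤ ℤ.< P → 0ℤ ℤ.< T → X ℤ.≤ + X₀ → Y ℤ.≤ + Y₀ → S ≡ P * X + T * Y → k ℕ.* (X₀ ℕ.+ Y₀) ℕ.≤ K →
            + k * S ℤ.≤ + K * (P * T)
  combine {P} {T} {X} {Y} {X₀} {Y₀} k K 0<P 0<T X≤ Y≤ refl num = begin
    + k * (P * X + T * Y)                     ≤⟨ *-monoˡ {+ k} (+≤ ℕ.z≤n) (ℤₚ.+-mono-≤ (absorb 0<P 0<T X≤ (+≤ ℕ.z≤n)) (absorb 0<T 0<P Y≤
        (+≤ ℕ.z≤n))) ⟩
    + k * (P * T * + X₀ + T * P * + Y₀)       ≡⟨ l (+ k) P T (+ X₀) (+ Y₀) ⟩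
    P * T * (+ k * (+ X₀ + + Y₀))             ≡⟨ cong (P * T *_) (sym (trans (ℤₚ.pos-* k (X₀ ℕ.+ Y₀)) (cong (+ k *_) (ℤₚ.pos-+ X₀ Y₀)))) ⟩
    P * T * + (k ℕ.* (X₀ ℕ.+ Y₀))             ≤⟨ *-monoˡ (ℤₚ.<⇒≤ (0<-* 0<P 0<T)) (+≤ num) ⟩
    P * T * + K                               ≡⟨ ℤₚ.*-comm (P * T) (+ K) ⟩
    + K * (P * T)                             ∎
    where
    open ℤₚ.≤-Reasoning
    l : ∀ k P T X Y → k * (P * T * X + T * P * Y) ≡ P * T * (k * (X + Y))
    l = solve-∀

  module _ (m : ℕ) (1≤m : 1 ℕ.≤ m) where

    private
      ⟨_⟩ : ℕ → ℤ
      ⟨ c ⟩ = + m * + c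

      0<⟨⟩ : ∀ {c} → 1 ℕ.≤ c → 0ℤ ℤ.< ⟨ c ⟩
      0<⟨⟩ p = 0<-* (ℤ.+<+ 1≤m) (ℤ.+<+ p)

      ⟨⟩≡ : ∀ c → ⟨ c ⟩ ≡ + (m ℕ.* c)
      ⟨⟩≡ c = sym (ℤₚ.pos-* m c)

      ⟨⟩⟨⟩≡ : ∀ c d → ⟨ c ⟩ * ⟨ d ⟩ ≡ + (m ℕ.* c ℕ.* (m ℕ.* d))
      ⟨⟩⟨⟩≡ c d = trans (cong₂ _*_ (⟨⟩≡ c) (⟨⟩≡ d)) (sym (ℤₚ.pos-* (m ℕ.* c) (m ℕ.* d)))

      neg-pos : ∀ {x} → x ℤ.< 0ℤ → 0ℤ ℤ.< - x
      neg-pos p = ℤₚ.neg-mono-< p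

      minor₂≤ : ∀ c d e → minor₂ ⟨ c ⟩ ⟨ d ⟩ e ℤ.≤ + (m ℕ.* c ℕ.* (m ℕ.* d))
      minor₂≤ c d e = subst (minor₂ ⟨ c ⟩ ⟨ d ⟩ e ℤ.≤_) (⟨⟩⟨⟩≡ c d) (minor₂-≤ ⟨ c ⟩ ⟨ d ⟩ e)

      minor₃≤ : ∀ c d x e f g → 1 ℕ.≤ c → 0ℤ ℤ.≤ minor₂ ⟨ c ⟩ ⟨ d ⟩ e → minor₃ ⟨ c ⟩ ⟨ d ⟩ ⟨ x ⟩ e f g ℤ.≤ + (m ℕ.* c ℕ.* (m ℕ.* d) ℕ.* (m ℕ.* x))
      minor₃≤ c d x e f g 1≤c 0≤d = begin
        minor₃ ⟨ c ⟩ ⟨ d ⟩ ⟨ x ⟩ e f g             ≤⟨ minor₃-≤ ⟨ c ⟩ ⟨ d ⟩ ⟨ x ⟩ e f g (0<⟨⟩ 1≤c) 0≤d ⟩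
        minor₂ ⟨ c ⟩ ⟨ d ⟩ e * ⟨ x ⟩               ≡⟨ cong (minor₂ ⟨ c ⟩ ⟨ d ⟩ e *_) (⟨⟩≡ x) ⟩
        minor₂ ⟨ c ⟩ ⟨ d ⟩ e * + (m ℕ.* x)         ≤⟨ ℤₚ.*-monoʳ-≤-nonNeg (+ (m ℕ.* x)) (minor₂≤ c d e) ⟩
        + (m ℕ.* c ℕ.* (m ℕ.* d)) * + (m ℕ.* x)   ≡⟨ sym (ℤₚ.pos-* (m ℕ.* c ℕ.* (m ℕ.* d)) (m ℕ.* x)) ⟩
        + (m ℕ.* c ℕ.* (m ℕ.* d) ℕ.* (m ℕ.* x))   ∎
        where open ℤₚ.≤-Reasoning

      m≤m² : m ℕ.≤ m ℕ.^ 2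
      m≤m² = ℕₚ.≤-trans (ℕₚ.≤-reflexive (sym (ℕₚ.*-identityʳ m))) (ℕₚ.*-monoʳ-≤ m (ℕₚ.≤-trans 1≤m (ℕₚ.≤-reflexive (sym (ℕₚ.*-identityʳ m)))))

    -- For n + 1 vectors `√Δ-bound` requires the factor 2^n m, here 2m. The estimate amounts to 6m²
    -- + 2m, and 8m² is what 4 C m² covers for every C ≥ 2.
    size₂ : ∀ e → let a = ⟨ 1 ⟩ ; b = ⟨ 2 ⟩ in minor₂ a b e ℤ.< 0ℤ →
            + (2 ℕ.* m) * (a * a + ((- e) * (- e) + 0ℤ)) ℤ.≤ + (8 ℕ.* m ℕ.^ 2) * (a * - minor₂ a b e)
    size₂ e d<0 = combine (2 ℕ.* m) (8 ℕ.* m ℕ.^ 2) (0<⟨⟩ ℕₚ.≤-refl) (neg-pos d<0) (ℤₚ.≤-reflexive (trans (cong₂ _+_ (⟨⟩≡ 2) (⟨⟩≡ 1)) (sym (ℤₚ.pos-+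
        (m ℕ.* 2) (m ℕ.* 1)))))
      (ℤₚ.≤-refl {1ℤ}) (l ⟨ 1 ⟩ ⟨ 2 ⟩ e) num
      where
      l : ∀ a b e → a * a + ((- e) * (- e) + 0ℤ) ≡ a * (b + a) + - (a * b - e * e) * 1ℤ
      l = solve-∀
      open ℕₚ.≤-Reasoning
      l₁ : ∀ m → 2 ℕ.* m ℕ.* (m ℕ.* 2 ℕ.+ m ℕ.* 1 ℕ.+ 1) ≡ 6 ℕ.* (m ℕ.* (m ℕ.* 1)) ℕ.+ 2 ℕ.* m
      l₁ = solveℕ-∀
      l₂ : ∀ q → 6 ℕ.* q ℕ.+ 2 ℕ.* q ≡ 8 ℕ.* q
      l₂ = solveℕ-∀
      num : 2 ℕ.* m ℕ.* (m ℕ.* 2 ℕ.+ m ℕ.* 1 ℕ.+ 1) ℕ.≤ 8 ℕ.* m ℕ.^ 2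
      num = begin
        2 ℕ.* m ℕ.* (m ℕ.* 2 ℕ.+ m ℕ.* 1 ℕ.+ 1) ≡⟨ l₁ m ⟩
        6 ℕ.* m ℕ.^ 2 ℕ.+ 2 ℕ.* m               ≤⟨ ℕₚ.+-monoʳ-≤ (6 ℕ.* m ℕ.^ 2) (ℕₚ.*-monoʳ-≤ 2 m≤m²) ⟩
        6 ℕ.* m ℕ.^ 2 ℕ.+ 2 ℕ.* m ℕ.^ 2         ≡⟨ l₂ (m ℕ.^ 2) ⟩
        8 ℕ.* m ℕ.^ 2                           ∎

    module _ (C : ℕ) (2≤C : 2 ℕ.≤ C) where

      private
        q = C ℕ.* m ℕ.^ 2
        2m²≤q : 2 ℕ.* m ℕ.^ 2 ℕ.≤ q
        2m²≤q = ℕₚ.*-monoˡ-≤ (m ℕ.^ 2) 2≤C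

      size₃ : ∀ e f g → let a = ⟨ 1 ⟩ ; b = ⟨ 2 ⟩ ; c = ⟨ C ⟩ ; d = minor₂ a b e in 0ℤ ℤ.< d → minor₃ a b c e f g ℤ.< 0ℤ →
              + (4 ℕ.* m) * (d * d + (u₂ a b e f g * u₂ a b e f g + (u₁ a b e f g * u₁ a b e f g + 0ℤ))) ℤ.≤ + (36 ℕ.* C ℕ.* m ℕ.^ 3) *
                  (d * - minor₃ a b c e f g)
      size₃ e f g 0<d d₃<0 = combine (4 ℕ.* m) (36 ℕ.* C ℕ.* m ℕ.^ 3) 0<d (neg-pos d₃<0)
        (ℤₚ.+-mono-≤ (minor₂≤ 1 2 e) (ℤₚ.+-mono-≤ (minor₂≤ 1 C f) (minor₂≤ 2 C g)))
        (ℤₚ.≤-reflexive (trans (cong₂ _+_ (⟨⟩≡ 2) (⟨⟩≡ 1)) (sym (ℤₚ.pos-+ (m ℕ.* 2) (m ℕ.* 1)))))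
        (trans (cong₂ (λ s t → d * d + (s + (t + 0ℤ))) (jacobi₃-₂ a b c e f g) (jacobi₃-₁ a b c e f g)) (l d (minor₂ a c f) (minor₂ b c g)
            (minor₃ a b c e f g) a b)) num
        where
        a = ⟨ 1 ⟩
        b = ⟨ 2 ⟩
        c = ⟨ C ⟩
        d = minor₂ a b e
        l : ∀ d y x t a b → d * d + (y * d - t * a + (x * d - t * b + 0ℤ)) ≡ d * (d + (y + x)) + - t * (b + a)
        l = solve-∀
        open ℕₚ.≤-Reasoning
        l₁ : ∀ m C → (m ℕ.* 1 ℕ.* (m ℕ.* 2) ℕ.+ (m ℕ.* 1 ℕ.* (m ℕ.* C) ℕ.+ m ℕ.* 2 ℕ.* (m ℕ.* C)) ℕ.+ (m ℕ.* 2 ℕ.+ m ℕ.* 1)) ≡ 3 ℕ.* (C ℕ.* (m ℕ.*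
            (m ℕ.* 1))) ℕ.+ 2 ℕ.* (m ℕ.* (m ℕ.* 1)) ℕ.+ 3 ℕ.* m
        l₁ = solveℕ-∀
        l₂ : ∀ m C → 4 ℕ.* m ℕ.* (3 ℕ.* (C ℕ.* (m ℕ.* (m ℕ.* 1))) ℕ.+ C ℕ.* (m ℕ.* (m ℕ.* 1)) ℕ.+ 3 ℕ.* (C ℕ.* (m ℕ.* (m ℕ.* 1)))) ≡ 28 ℕ.* (C ℕ.*
            (m ℕ.* (m ℕ.* (m ℕ.* 1))))
        l₂ = solveℕ-∀
        num : 4 ℕ.* m ℕ.* (m ℕ.* 1 ℕ.* (m ℕ.* 2) ℕ.+ (m ℕ.* 1 ℕ.* (m ℕ.* C) ℕ.+ m ℕ.* 2 ℕ.* (m ℕ.* C)) ℕ.+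
            (m ℕ.* 2 ℕ.+ m ℕ.* 1)) ℕ.≤ 36 ℕ.* C ℕ.* m ℕ.^ 3
        num = begin
          4 ℕ.* m ℕ.* (m ℕ.* 1 ℕ.* (m ℕ.* 2) ℕ.+ (m ℕ.* 1 ℕ.* (m ℕ.* C) ℕ.+ m ℕ.* 2 ℕ.* (m ℕ.* C)) ℕ.+ (m ℕ.* 2 ℕ.+ m ℕ.* 1)) ≡⟨ cong (4 ℕ.* m ℕ.*_)
              (l₁ m C) ⟩
          4 ℕ.* m ℕ.* (3 ℕ.* q ℕ.+ 2 ℕ.* m ℕ.^ 2 ℕ.+ 3 ℕ.* m) ≤⟨ ℕₚ.*-monoʳ-≤ (4 ℕ.* m) (ℕₚ.+-mono-≤ (ℕₚ.+-monoʳ-≤ (3 ℕ.* q) 2m²≤q) (ℕₚ.*-monoʳ-≤ 3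
              (ℕₚ.≤-trans m≤m² (ℕₚ.≤-trans (ℕₚ.m≤n*m (m ℕ.^ 2) 2) 2m²≤q)))) ⟩
          4 ℕ.* m ℕ.* (3 ℕ.* q ℕ.+ q ℕ.+ 3 ℕ.* q)            ≡⟨ l₂ m C ⟩
          -- 36 is the leading coefficient of the cubic in the conclusion.
          28 ℕ.* (C ℕ.* m ℕ.^ 3)                             ≤⟨ ℕₚ.*-monoˡ-≤ (C ℕ.* m ℕ.^ 3) (ℕₚ.m≤m+n 28 8) ⟩
          36 ℕ.* (C ℕ.* m ℕ.^ 3)                             ≡⟨ sym (ℕₚ.*-assoc 36 C (m ℕ.^ 3)) ⟩
          36 ℕ.* C ℕ.* m ℕ.^ 3                               ∎

      module _ (D : ℕ) (1≤D : 1 ℕ.≤ D) where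

        private
          r = C ℕ.* D ℕ.* m ℕ.^ 3
          m²≤m³ : m ℕ.^ 2 ℕ.≤ m ℕ.^ 3
          m²≤m³ = ℕₚ.*-monoʳ-≤ m m≤m²′
            where
            m≤m²′ : m ℕ.* 1 ℕ.≤ m ℕ.^ 2
            m≤m²′ = ℕₚ.≤-trans (ℕₚ.≤-reflexive (ℕₚ.*-identityʳ m)) m≤m²
          2D≤CD : 2 ℕ.* D ℕ.≤ C ℕ.* D
          2D≤CD = ℕₚ.*-monoˡ-≤ D 2≤C
          C≤CD : C ℕ.≤ C ℕ.* D
          C≤CD = ℕₚ.m≤m*n C D {{ℕ.>-nonZero 1≤D}}

        size₄ : ∀ e f g h i j → let a = ⟨ 1 ⟩ ; b = ⟨ 2 ⟩ ; c = ⟨ C ⟩ ; d = ⟨ D ⟩ ; t = minor₃ a b c e f g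
                                    n₁ = n₁ a b c e f g h i j ; n₂ = n₂ a b c e f g h i j ; n₃ = n₃ a b c e f g h i j in
                0ℤ ℤ.< minor₂ a b e → 0ℤ ℤ.< t → minor₄ a b c d e f g h i j ℤ.< 0ℤ →
                + (8 ℕ.* m) * (t * t + (n₃ * n₃ + (n₂ * n₂ + (n₁ * n₁ + 0ℤ)))) ℤ.≤ + (192 ℕ.* C ℕ.* D ℕ.* m ℕ.^ 4) *
                    (t * - minor₄ a b c d e f g h i j)
        size₄ e f g h i j 0<d₂ 0<t d₄<0 = combine (8 ℕ.* m) (192 ℕ.* C ℕ.* D ℕ.* m ℕ.^ 4) 0<t (neg-pos d₄<0)
          (ℤₚ.+-mono-≤ (minor₃≤ 1 2 C e f g ℕₚ.≤-refl (ℤₚ.<⇒≤ 0<d₂)) (ℤₚ.+-mono-≤ (minor₃≤ 1 2 D e h i ℕₚ.≤-refl (ℤₚ.<⇒≤ 0<d₂))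
            (ℤₚ.+-mono-≤ (minor₃≤ 1 C D f h j ℕₚ.≤-refl (0≤minor a (minor₂ a c f) (u₂ a b e f g) (0<⟨⟩ ℕₚ.≤-refl) (jacobi₃-₂ a b c e f g)))
                (minor₃≤ 2 C D g i j (ℕ.s≤s ℕ.z≤n) (0≤minor b (minor₂ b c g) (u₁ a b e f g) (0<⟨⟩ (ℕ.s≤s ℕ.z≤n)) (jacobi₃-₁ a b c e f g))))))
          (ℤₚ.+-mono-≤ (minor₂≤ 1 2 e) (ℤₚ.+-mono-≤ (minor₂≤ 1 C f) (minor₂≤ 2 C g)))
          (trans (cong₂ (λ s t′ → t * t + (s + t′)) (jacobi₄-₃ a b c d e f g h i j) (cong₂ (λ s t → s + (t + 0ℤ)) (jacobi₄-₂ a b c d e f g h i j)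
              (jacobi₄-₁ a b c d e f g h i j)))
            (l t (minor₃ a b d e h i) (minor₃ a c d f h j) (minor₃ b c d g i j) (minor₄ a b c d e f g h i j) (minor₂ a b e) (minor₂ a c f)
                (minor₂ b c g))) num
          where
          a = ⟨ 1 ⟩
          b = ⟨ 2 ⟩
          c = ⟨ C ⟩
          d = ⟨ D ⟩
          t = minor₃ a b c e f g
          l : ∀ t z y x s M₃ M₂ M₁ → t * t + (z * t - s * M₃ + (y * t - s * M₂ + (x * t - s * M₁ + 0ℤ))) ≡ t * (t + (z + (y + x))) + - s * (M₃ +
              (M₂ + M₁))
          l = solve-∀
          -- A principal minor M outside the leading chain satisfies M d₂ = u² + t x by Jacobi's
          -- identity, and t and d₂ are positive.
          0≤minor : ∀ x M u → 0ℤ ℤ.< x → u * u ≡ M * minor₂ a b e - t * x → 0ℤ ℤ.≤ M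
          0≤minor x M u 0<x eq = ℤₚ.*-cancelʳ-≤-pos 0ℤ M (minor₂ a b e) {{ℤ.positive 0<d₂}}
            (subst₂ ℤ._≤_ (sym (ℤₚ.*-zeroˡ (minor₂ a b e))) (trans (cong (_+ t * x) eq) (l′ (M * minor₂ a b e) (t * x))) (ℤₚ.+-mono-≤ (0≤sq u)
                (ℤₚ.<⇒≤ (0<-* 0<t 0<x))))
            where
            l′ : ∀ p q → p - q + q ≡ p
            l′ = solve-∀
          open ℕₚ.≤-Reasoning
          X₀ = m ℕ.* 1 ℕ.* (m ℕ.* 2) ℕ.* (m ℕ.* C) ℕ.+ (m ℕ.* 1 ℕ.* (m ℕ.* 2) ℕ.* (m ℕ.* D) ℕ.+ (m ℕ.* 1 ℕ.* (m ℕ.* C) ℕ.* (m ℕ.* D) ℕ.+ m ℕ.* 2 ℕ.*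
              (m ℕ.* C) ℕ.* (m ℕ.* D)))
          Y₀ = m ℕ.* 1 ℕ.* (m ℕ.* 2) ℕ.+ (m ℕ.* 1 ℕ.* (m ℕ.* C) ℕ.+ m ℕ.* 2 ℕ.* (m ℕ.* C))
          l₁ : ∀ m C D → (m ℕ.* 1 ℕ.* (m ℕ.* 2) ℕ.* (m ℕ.* C) ℕ.+ (m ℕ.* 1 ℕ.* (m ℕ.* 2) ℕ.* (m ℕ.* D) ℕ.+ (m ℕ.* 1 ℕ.* (m ℕ.* C) ℕ.*
              (m ℕ.* D) ℕ.+ m ℕ.* 2 ℕ.* (m ℕ.* C) ℕ.* (m ℕ.* D))))
               ≡ 2 ℕ.* C ℕ.* (m ℕ.* (m ℕ.* (m ℕ.* 1))) ℕ.+ (2 ℕ.* D) ℕ.* (m ℕ.* (m ℕ.* (m ℕ.* 1))) ℕ.+ 3 ℕ.* (C ℕ.* D ℕ.* (m ℕ.* (m ℕ.* (m ℕ.* 1))))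
          l₁ = solveℕ-∀
          l₁′ : ∀ m C → m ℕ.* 1 ℕ.* (m ℕ.* 2) ℕ.+ (m ℕ.* 1 ℕ.* (m ℕ.* C) ℕ.+ m ℕ.* 2 ℕ.* (m ℕ.* C)) ≡ 2 ℕ.* (m ℕ.* (m ℕ.* 1)) ℕ.+ 3 ℕ.* (C ℕ.*
              (m ℕ.* (m ℕ.* 1)))
          l₁′ = solveℕ-∀
          l₂ : ∀ r → 2 ℕ.* r ℕ.+ r ℕ.+ 3 ℕ.* r ℕ.+ (r ℕ.+ 3 ℕ.* r) ≡ 10 ℕ.* r
          l₂ = solveℕ-∀
          l₃ : ∀ m C D → 8 ℕ.* m ℕ.* (10 ℕ.* (C ℕ.* D ℕ.* (m ℕ.* (m ℕ.* (m ℕ.* 1))))) ≡ 80 ℕ.* (C ℕ.* D ℕ.* (m ℕ.* (m ℕ.* (m ℕ.* (m ℕ.* 1)))))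
          l₃ = solveℕ-∀
          q≤r : q ℕ.≤ r
          q≤r = ℕₚ.*-mono-≤ C≤CD m²≤m³
          X₀≤ : X₀ ℕ.≤ 2 ℕ.* r ℕ.+ r ℕ.+ 3 ℕ.* r
          X₀≤ = begin
            X₀ ≡⟨ l₁ m C D ⟩
            2 ℕ.* C ℕ.* m ℕ.^ 3 ℕ.+ 2 ℕ.* D ℕ.* m ℕ.^ 3 ℕ.+ 3 ℕ.* r ≤⟨ ℕₚ.+-monoˡ-≤ (3 ℕ.* r) (ℕₚ.+-mono-≤ (ℕₚ.≤-trans (ℕₚ.≤-reflexive
                (ℕₚ.*-assoc 2 C (m ℕ.^ 3))) (ℕₚ.*-monoʳ-≤ 2 (ℕₚ.*-monoˡ-≤ (m ℕ.^ 3) C≤CD))) (ℕₚ.*-monoˡ-≤ (m ℕ.^ 3) 2D≤CD)) ⟩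
            2 ℕ.* r ℕ.+ r ℕ.+ 3 ℕ.* r ∎
          Y₀≤ : Y₀ ℕ.≤ r ℕ.+ 3 ℕ.* r
          Y₀≤ = begin
            Y₀ ≡⟨ l₁′ m C ⟩
            2 ℕ.* m ℕ.^ 2 ℕ.+ 3 ℕ.* q ≤⟨ ℕₚ.+-mono-≤ (ℕₚ.≤-trans 2m²≤q q≤r) (ℕₚ.*-monoʳ-≤ 3 q≤r) ⟩
            r ℕ.+ 3 ℕ.* r ∎
          num : 8 ℕ.* m ℕ.* (X₀ ℕ.+ Y₀) ℕ.≤ 192 ℕ.* C ℕ.* D ℕ.* m ℕ.^ 4
          num = begin
            8 ℕ.* m ℕ.* (X₀ ℕ.+ Y₀)                                     ≤⟨ ℕₚ.*-monoʳ-≤ (8 ℕ.* m) (ℕₚ.+-mono-≤ X₀≤ Y₀≤) ⟩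
            8 ℕ.* m ℕ.* (2 ℕ.* r ℕ.+ r ℕ.+ 3 ℕ.* r ℕ.+ (r ℕ.+ 3 ℕ.* r)) ≡⟨ cong (8 ℕ.* m ℕ.*_) (l₂ r) ⟩
            8 ℕ.* m ℕ.* (10 ℕ.* r)                                      ≡⟨ l₃ m C D ⟩
            -- 192 is the leading coefficient of the quartic in the conclusion.
            80 ℕ.* (C ℕ.* D ℕ.* m ℕ.^ 4)                                ≤⟨ ℕₚ.*-monoˡ-≤ (C ℕ.* D ℕ.* m ℕ.^ 4) (ℕₚ.m≤m+n 80 112) ⟩
            192 ℕ.* (C ℕ.* D ℕ.* m ℕ.^ 4)                               ≡⟨ sym (trans (cong (ℕ._* m ℕ.^ 4) (ℕₚ.*-assoc 192 C D)) (ℕₚ.*-assoc 192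
                (C ℕ.* D) (m ℕ.^ 4))) ⟩
            192 ℕ.* C ℕ.* D ℕ.* m ℕ.^ 4                                 ∎

-- Ordered rings and quadratic forms

-- The two models are ℚ and its quadratic extension F. The map `ι` also provides the integer
-- coefficients of the ring solver, so that solving identities never computes with rationals.
record OrderedRing : Set₁ where
  infixl 6 _+_
  infixl 7 _*_
  infix 8 -_
  field
    A : Set
    _+_ _*_ : A → A → A
    -_ : A → A
    0# 1# : A
    isCommutativeRing : IsCommutativeRing _≡_ _+_ _*_ -_ 0# 1#
    ι : ℤ → A
    ι-+ : ∀ x y → ι (x ℤ.+ y) ≡ ι x + ι y
    ι-* : ∀ x y → ι (x ℤ.* y) ≡ ι x * ι y
    ι-neg : ∀ x → ι (ℤ.- x) ≡ - ι x
    ι-0 : ι 0ℤ ≡ 0#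
    ι-1 : ι 1ℤ ≡ 1#
    Pos : A → Set
    pos-+ : ∀ {x y} → Pos x → Pos y → Pos (x + y)
    pos-* : ∀ {x y} → Pos x → Pos y → Pos (x * y)
    trichotomy : ∀ x → Pos x ⊎ x ≡ 0# ⊎ Pos (- x)
    ¬pos-0 : ¬ Pos 0#
    ι-pos : ∀ {z} → 0ℤ ℤ.< z → Pos (ι z)

module OrderedRingProperties (R : OrderedRing) where
  open OrderedRing R public
  open IsCommutativeRing isCommutativeRing public using (+-assoc; +-comm; *-assoc; *-comm; +-identityˡ; +-identityʳ; *-identityˡ; *-identityʳ; zeroˡ;
      zeroʳ; distribˡ; distribʳ; -‿inverseˡ; -‿inverseʳ)

  commutativeRing : CommutativeRing _ _
  commutativeRing = record { isCommutativeRing = isCommutativeRing }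

  morphism : ℤ.+-*-rawRing ACR.-Raw-AlmostCommutative⟶ ACR.fromCommutativeRing commutativeRing
  morphism = record { ⟦_⟧ = ι ; +-homo = ι-+ ; *-homo = ι-* ; -‿homo = ι-neg ; 0-homo = ι-0 ; 1-homo = ι-1 }

  ι-≟ : ∀ x y → Maybe (ι x ≡ ι y)
  ι-≟ x y with x ℤ.≟ y
  ... | yes refl = just refl
  ... | no _ = nothing

  open Solver ℤ.+-*-rawRing (ACR.fromCommutativeRing commutativeRing) morphism ι-≟ public using (solve; con; _:+_; _:*_; _:-_; :-_; _:=_)

  infixl 6 _-_
  _-_ : A → A → A
  x - y = x + (- y)

  Nonneg : A → Set
  Nonneg x = Pos x ⊎ x ≡ 0#

  infix 4 _≤_ _<_
  -- A record and not a synonym for `Nonneg (y - x)`, so that unification can read off `x` and `y`.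
  record _≤_ (x y : A) : Set where
    constructor ≤-mk
    field ≤-diff : Nonneg (y - x)
  open _≤_ public

  record _<_ (x y : A) : Set where
    constructor <-mk
    field <-diff : Pos (y - x)
  open _<_ public

  nonneg-+ : ∀ {x y} → Nonneg x → Nonneg y → Nonneg (x + y)
  nonneg-+ (inj₁ p) (inj₁ q) = inj₁ (pos-+ p q)
  nonneg-+ {x} (inj₁ p) (inj₂ refl) = inj₁ (subst Pos (sym (+-identityʳ x)) p)
  nonneg-+ {y = y} (inj₂ refl) q = subst Nonneg (sym (+-identityˡ y)) q

  nonneg-* : ∀ {x y} → Nonneg x → Nonneg y → Nonneg (x * y)
  nonneg-* (inj₁ p) (inj₁ q) = inj₁ (pos-* p q)
  nonneg-* {x} (inj₁ p) (inj₂ refl) = inj₂ (zeroʳ x)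
  nonneg-* {y = y} (inj₂ refl) q = inj₂ (zeroˡ y)

  pos-nonneg-+ : ∀ {x y} → Pos x → Nonneg y → Pos (x + y)
  pos-nonneg-+ p (inj₁ q) = pos-+ p q
  pos-nonneg-+ {x} p (inj₂ refl) = subst Pos (sym (+-identityʳ x)) p

  ≤-by : ∀ {x y z} → Nonneg z → y - x ≡ z → x ≤ y
  ≤-by p eq = ≤-mk (subst Nonneg (sym eq) p)

  <-by : ∀ {x y z} → Pos z → y - x ≡ z → x < y
  <-by p eq = <-mk (subst Pos (sym eq) p)

  x-0 : ∀ x → x - 0# ≡ x
  x-0 x = trans (cong (λ t → x + - t) (sym ι-0)) (trans (solve 1 (λ x → x :- con 0ℤ := x) refl x) refl)

  nonneg⇒0≤ : ∀ {x} → Nonneg x → 0# ≤ x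
  nonneg⇒0≤ {x} p = ≤-by p (x-0 x)

  0≤⇒nonneg : ∀ {x} → 0# ≤ x → Nonneg x
  0≤⇒nonneg {x} (≤-mk p) = subst Nonneg (x-0 x) p

  pos⇒0< : ∀ {x} → Pos x → 0# < x
  pos⇒0< {x} p = <-by p (x-0 x)

  0<⇒pos : ∀ {x} → 0# < x → Pos x
  0<⇒pos {x} (<-mk p) = subst Pos (x-0 x) p

  ≤-refl : ∀ {x} → x ≤ x
  ≤-refl {x} = ≤-mk (inj₂ (-‿inverseʳ x))

  ≤-reflexive : ∀ {x y} → x ≡ y → x ≤ y
  ≤-reflexive refl = ≤-refl

  ≤-trans : ∀ {x y z} → x ≤ y → y ≤ z → x ≤ z
  ≤-trans {x} {y} {z} (≤-mk p) (≤-mk q) = ≤-by (nonneg-+ p q) (solve 3 (λ x y z → z :- x := (y :- x) :+ (z :- y)) refl x y z)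

  <-≤-trans : ∀ {x y z} → x < y → y ≤ z → x < z
  <-≤-trans {x} {y} {z} (<-mk p) (≤-mk q) = <-by (pos-nonneg-+ p q) (solve 3 (λ x y z → z :- x := (y :- x) :+ (z :- y)) refl x y z)

  ≤-<-trans : ∀ {x y z} → x ≤ y → y < z → x < z
  ≤-<-trans {x} {y} {z} (≤-mk p) (<-mk q) = <-by (pos-nonneg-+ q p) (solve 3 (λ x y z → z :- x := (z :- y) :+ (y :- x)) refl x y z)

  <⇒≤ : ∀ {x y} → x < y → x ≤ y
  <⇒≤ (<-mk p) = ≤-mk (inj₁ p)

  <-irrefl : ∀ {x} → ¬ x < x
  <-irrefl {x} (<-mk p) = ¬pos-0 (subst Pos (-‿inverseʳ x) p)

  <⇒≱ : ∀ {x y} → x < y → ¬ y ≤ x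
  <⇒≱ p q = <-irrefl (<-≤-trans p q)

  ≤⊎> : ∀ x y → x ≤ y ⊎ y < x
  ≤⊎> x y with trichotomy (y - x)
  ... | inj₁ p = inj₁ (≤-mk (inj₁ p))
  ... | inj₂ (inj₁ p) = inj₁ (≤-mk (inj₂ p))
  ... | inj₂ (inj₂ p) = inj₂ (<-by p (solve 2 (λ x y → x :- y := :- (y :- x)) refl x y))

  +-mono-≤ : ∀ {x y u v} → x ≤ y → u ≤ v → x + u ≤ y + v
  +-mono-≤ {x} {y} {u} {v} (≤-mk p) (≤-mk q) = ≤-by (nonneg-+ p q) (solve 4 (λ x y u v → (y :+ v) :- (x :+ u) := (y :- x) :+ (v :- u)) refl x y u v)

  *-monoˡ-≤ : ∀ {z x y} → 0# ≤ z → x ≤ y → z * x ≤ z * y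
  *-monoˡ-≤ {z} {x} {y} 0≤z (≤-mk p) = ≤-by (nonneg-* (0≤⇒nonneg 0≤z) p) (solve 3 (λ z x y → z :* y :- z :* x := z :* (y :- x)) refl z x y)

  *-monoˡ-< : ∀ {z x y} → 0# < z → x < y → z * x < z * y
  *-monoˡ-< {z} {x} {y} 0<z (<-mk p) = <-by (pos-* (0<⇒pos 0<z) p) (solve 3 (λ z x y → z :* y :- z :* x := z :* (y :- x)) refl z x y)

  *-monoʳ-≤ : ∀ {z x y} → 0# ≤ z → x ≤ y → x * z ≤ y * z
  *-monoʳ-≤ {z} {x} {y} 0≤z p = subst₂ _≤_ (*-comm z x) (*-comm z y) (*-monoˡ-≤ 0≤z p)

  *-mono-≤ : ∀ {x y u v} → 0# ≤ x → 0# ≤ v → x ≤ y → u ≤ v → x * u ≤ y * v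
  *-mono-≤ 0≤x 0≤v p q = ≤-trans (*-monoˡ-≤ 0≤x q) (*-monoʳ-≤ 0≤v p)

  0≤-+ : ∀ {x y} → 0# ≤ x → 0# ≤ y → 0# ≤ x + y
  0≤-+ p q = nonneg⇒0≤ (nonneg-+ (0≤⇒nonneg p) (0≤⇒nonneg q))

  0≤-* : ∀ {x y} → 0# ≤ x → 0# ≤ y → 0# ≤ x * y
  0≤-* p q = nonneg⇒0≤ (nonneg-* (0≤⇒nonneg p) (0≤⇒nonneg q))

  0<-* : ∀ {x y} → 0# < x → 0# < y → 0# < x * y
  0<-* p q = pos⇒0< (pos-* (0<⇒pos p) (0<⇒pos q))

  nonneg-sq : ∀ x → Nonneg (x * x)
  nonneg-sq x with trichotomy x
  ... | inj₁ p = inj₁ (pos-* p p)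
  ... | inj₂ (inj₁ refl) = inj₂ (zeroˡ 0#)
  ... | inj₂ (inj₂ p) = inj₁ (subst Pos (solve 1 (λ x → (:- x) :* (:- x) := x :* x) refl x) (pos-* p p))

  0≤-sq : ∀ x → 0# ≤ x * x
  0≤-sq x = nonneg⇒0≤ (nonneg-sq x)

  *-cancel-≤ : ∀ {z x y} → 0# < z → z * x ≤ z * y → x ≤ y
  *-cancel-≤ {z} {x} {y} 0<z p = [ (λ q → q) , (λ y<x → contradiction p (<⇒≱ (*-monoˡ-< 0<z y<x))) ]′ (≤⊎> x y)

  *-zero-pos : ∀ {z x} → 0# < z → z * x ≡ 0# → x ≡ 0#
  *-zero-pos {z} {x} 0<z eq with trichotomy x
  ... | inj₁ p = contradiction (subst Pos eq (pos-* (0<⇒pos 0<z) p)) ¬pos-0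
  ... | inj₂ (inj₁ p) = p
  ... | inj₂ (inj₂ p) = contradiction (subst Pos (trans (solve 2 (λ z x → z :* (:- x) := (:- (z :* x))) refl z x) (trans (cong -_ eq) neg-0)) (pos-*
      (0<⇒pos 0<z) p)) ¬pos-0
    where
    neg-0 : - 0# ≡ 0#
    neg-0 = trans (sym (+-identityˡ (- 0#))) (-‿inverseʳ 0#)

  sq-≤0 : ∀ {x} → x * x ≤ 0# → x ≡ 0#
  sq-≤0 {x} p with trichotomy x
  ... | inj₁ q = contradiction p (<⇒≱ (pos⇒0< (pos-* q q)))
  ... | inj₂ (inj₁ q) = q
  ... | inj₂ (inj₂ q) = contradiction p (<⇒≱ (pos⇒0< (subst Pos (solve 1 (λ x → (:- x) :* (:- x) := x :* x) refl x) (pos-* q q))))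

  ι-nonneg : ∀ {z} → 0ℤ ℤ.≤ z → Nonneg (ι z)
  ι-nonneg {ℤ.+ zero} _ = inj₂ ι-0
  ι-nonneg {ℤ.+ suc n} _ = inj₁ (ι-pos (ℤ.+<+ (ℕ.s≤s ℕ.z≤n)))
  ι-nonneg {ℤ.-[1+ n ]} ()

  ι-sub : ∀ x y → ι (x ℤ.- y) ≡ ι x - ι y
  ι-sub x y = trans (ι-+ x (ℤ.- y)) (cong (ι x +_) (ι-neg y))

  ι-mono-≤ : ∀ {x y} → x ℤ.≤ y → ι x ≤ ι y
  ι-mono-≤ {x} {y} p = ≤-by (ι-nonneg (ℤₚ.i≤j⇒0≤j-i p)) (sym (ι-sub y x))

  ι-mono-< : ∀ {x y} → x ℤ.< y → ι x < ι y
  ι-mono-< {x} {y} p = <-by (ι-pos (subst (ℤ._< y ℤ.- x) (ℤₚ.+-inverseʳ x) (ℤₚ.+-monoˡ-< (ℤ.- x) p))) (sym (ι-sub y x))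

  ι-cancel-≤ : ∀ {x y} → ι x ≤ ι y → x ℤ.≤ y
  ι-cancel-≤ {x} {y} p with x ℤ.≤? y
  ... | yes q = q
  ... | no ¬q = contradiction p (<⇒≱ (ι-mono-< (ℤₚ.≰⇒> ¬q)))

  ι-injective : ∀ {x y} → ι x ≡ ι y → x ≡ y
  ι-injective eq = ℤₚ.≤-antisym (ι-cancel-≤ (≤-reflexive eq)) (ι-cancel-≤ (≤-reflexive (sym eq)))

  ι-0< : ∀ {z} → 0ℤ ℤ.< z → 0# < ι z
  ι-0< p = pos⇒0< (ι-pos p)

  ι-0≤ : ∀ {z} → 0ℤ ℤ.≤ z → 0# ≤ ι z
  ι-0≤ p = nonneg⇒0≤ (ι-nonneg p)

  ∑ : ∀ {n} → (Fin n → A) → A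
  ∑ {zero} f = 0#
  ∑ {suc n} f = f zero + ∑ (f ∘ suc)

  ∑-cong : ∀ {n} {f g : Fin n → A} → (∀ i → f i ≡ g i) → ∑ f ≡ ∑ g
  ∑-cong {zero} eq = refl
  ∑-cong {suc n} eq = cong₂ _+_ (eq zero) (∑-cong (eq ∘ suc))

  ∑-zero : ∀ {n} {f : Fin n → A} → (∀ i → f i ≡ 0#) → ∑ f ≡ 0#
  ∑-zero {zero} eq = refl
  ∑-zero {suc n} eq = trans (cong₂ _+_ (eq zero) (∑-zero (eq ∘ suc))) (+-identityˡ 0#)

  ∑-+ : ∀ {n} (f g : Fin n → A) → ∑ (λ i → f i + g i) ≡ ∑ f + ∑ g
  ∑-+ {zero} f g = sym (+-identityˡ 0#)
  ∑-+ {suc n} f g = trans (cong (f zero + g zero +_) (∑-+ (f ∘ suc) (g ∘ suc)))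
    (solve 4 (λ a b c d → a :+ b :+ (c :+ d) := a :+ c :+ (b :+ d)) refl (f zero) (g zero) (∑ (f ∘ suc)) (∑ (g ∘ suc)))

  ∑-* : ∀ {n} c (f : Fin n → A) → ∑ (λ i → c * f i) ≡ c * ∑ f
  ∑-* {zero} c f = sym (zeroʳ c)
  ∑-* {suc n} c f = trans (cong (c * f zero +_) (∑-* c (f ∘ suc))) (sym (distribˡ c (f zero) (∑ (f ∘ suc))))

  ∑-swap : ∀ {n k} (f : Fin n → Fin k → A) → ∑ (λ i → ∑ (f i)) ≡ ∑ (λ j → ∑ (λ i → f i j))
  ∑-swap {zero} {k} f = sym (∑-zero {k} λ _ → refl)
  ∑-swap {suc n} f = trans (cong (∑ (f zero) +_) (∑-swap (f ∘ suc))) (sym (∑-+ (f zero) (λ j → ∑ (λ i → f (suc i) j))))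

  ∑-split : ∀ k {n} (f : Fin (k ℕ.+ n) → A) → ∑ f ≡ ∑ (λ i → f (i ↑ˡ n)) + ∑ (λ j → f (k ↑ʳ j))
  ∑-split zero f = sym (+-identityˡ (∑ f))
  ∑-split (suc k) f = trans (cong (f zero +_) (∑-split k (f ∘ suc))) (sym (+-assoc (f zero) _ _))

  Matrix : ℕ → Set
  Matrix n = Fin n → Fin n → A

  quad : ∀ {n} → Matrix n → (Fin n → A) → (Fin n → A) → A
  quad β c d = ∑ λ i → ∑ λ j → c i * d j * β i j

  _·_ : ∀ {n} → Matrix n → (Fin n → A) → Fin n → A
  (β · d) i = ∑ λ j → d j * β i j

  quad-· : ∀ {n} (β : Matrix n) c d → quad β c d ≡ ∑ λ i → c i * (β · d) i
  quad-· β c d = ∑-cong λ i → trans (∑-cong λ j → *-assoc (c i) (d j) (β i j)) (∑-* (c i) (λ j → d j * β i j))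

  quad-sym : ∀ {n} (β : Matrix n) → (∀ i j → β i j ≡ β j i) → ∀ c d → quad β c d ≡ quad β d c
  quad-sym β s c d = trans (∑-swap (λ i j → c i * d j * β i j)) (∑-cong λ j → ∑-cong λ i → cong₂ _*_ (*-comm (c i) (d j)) (s i j))

  quad-cong : ∀ {n} {β γ : Matrix n} {c c′ d d′} → (∀ i j → β i j ≡ γ i j) → (∀ i → c i ≡ c′ i) → (∀ i → d i ≡ d′ i) → quad β c d ≡ quad γ c′ d′
  quad-cong e₁ e₂ e₃ = ∑-cong λ i → ∑-cong λ j → cong₂ _*_ (cong₂ _*_ (e₂ i) (e₃ j)) (e₁ i j)

  quad-linˡ : ∀ {n} (β : Matrix n) x y c c′ d → quad β (λ i → x * c i + y * c′ i) d ≡ x * quad β c d + y * quad β c′ d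
  quad-linˡ β x y c c′ d = trans (quad-· β _ d) (trans (∑-cong (λ i → l x y (c i) (c′ i) ((β · d) i)))
    (trans (∑-+ (λ i → x * (c i * (β · d) i)) (λ i → y * (c′ i * (β · d) i))) (cong₂ _+_ (trans (∑-* x (λ i → c i * (β · d) i)) (cong (x *_) (sym
        (quad-· β c d)))) (trans (∑-* y (λ i → c′ i * (β · d) i)) (cong (y *_) (sym (quad-· β c′ d)))))))
    where
    l : ∀ x y c d e → (x * c + y * d) * e ≡ x * (c * e) + y * (d * e)
    l = solve 5 (λ x y c d e → (x :* c :+ y :* d) :* e := x :* (c :* e) :+ y :* (d :* e)) refl

  quad-square : ∀ {n} (β : Matrix n) → (∀ i j → β i j ≡ β j i) → ∀ x y c d →
                quad β (λ i → x * c i + y * d i) (λ i → x * c i + y * d i) ≡ x * x * quad β c c + ι (ℤ.+ 2) *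
                    (x * y) * quad β c d + y * y * quad β d d
  quad-square β s x y c d = trans (quad-linˡ β x y c d e) (trans (cong₂ (λ u v → x * u + y * v) (trans (quad-sym β s c e) (quad-linˡ β x y c d c))
      (trans (quad-sym β s d e) (quad-linˡ β x y c d d)))
    (trans (cong (λ t → x * (x * quad β c c + y * t) + y * (x * quad β c d + y * quad β d d)) (quad-sym β s d c)) (l x y (quad β c c) (quad β c d)
        (quad β d d))))
    where
    e = λ i → x * c i + y * d i
    l : ∀ x y p q r → x * (x * p + y * q) + y * (x * q + y * r) ≡ x * x * p + ι (ℤ.+ 2) * (x * y) * q + y * y * r
    l = solve 5 (λ x y p q r → x :* (x :* p :+ y :* q) :+ y :* (x :* q :+ y :* r) := x :* x :* p :+ con (ℤ.+ 2) :* (x :* y) :* q :+ y :* y :* r) refl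

  tail² : ∀ {n} {B : Set} → (Fin (suc n) → Fin (suc n) → B) → Fin n → Fin n → B
  tail² β i j = β (suc i) (suc j)

  infixr 5 _◂_
  _◂_ : ∀ {n} {B : Set} → B → (Fin n → B) → Fin (suc n) → B
  (x ◂ f) zero = x
  (x ◂ f) (suc i) = f i

  ιᴹ : ∀ {n} → (Fin n → Fin n → ℤ) → Matrix n
  ιᴹ M i j = ι (M i j)

  ιⱽ : ∀ {n} → (Fin n → ℤ) → Fin n → A
  ιⱽ n i = ι (n i)

  -- The vector has coordinates in A although the matrix is integral, because the relations to be
  -- excluded have coefficients in F.
  PosDef : ∀ {n} → (Fin n → Fin n → ℤ) → Set
  PosDef M = ∀ y → quad (ιᴹ M) y y ≤ 0# → ∀ i → y i ≡ 0#

  quad-0◂ : ∀ {n} (β : Matrix (suc n)) z d → quad β (0# ◂ z) d ≡ ∑ λ i → z i * (β · d) (suc i)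
  quad-0◂ β z d = trans (quad-· β (0# ◂ z) d) (trans (cong (_+ ∑ (λ i → z i * (β · d) (suc i))) (zeroˡ _)) (+-identityˡ _))

  quad-0◂0◂ : ∀ {n} (β : Matrix (suc n)) z → quad β (0# ◂ z) (0# ◂ z) ≡ quad (tail² β) z z
  quad-0◂0◂ β z = trans (quad-0◂ β z (0# ◂ z)) (trans (∑-cong λ i → cong (z i *_) (trans (cong (_+ (tail² β · z) i) (zeroˡ _)) (+-identityˡ _)))
      (sym (quad-· (tail² β) z z)))

  -- Completing the square along u. The hypotheses say M u = (d, 0, ..., 0), so u is orthogonal to
  -- every vector with first coordinate 0. Writing u₀ y = (0, z) + y₀ u gives u₀² q(y) = q(z) + y₀²
  -- u₀ d, a sum in which the last term is nonnegative.
  posDef-step : ∀ {n} (M : Fin (suc n) → Fin (suc n) → ℤ) → (∀ i j → M i j ≡ M j i) → (u : Fin (suc n) → ℤ) → 0ℤ ℤ.< u zero →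
                (∀ i → (ιᴹ M · ιⱽ u) (suc i) ≡ 0#) → ∀ {d} → 0ℤ ℤ.< d → (ιᴹ M · ιⱽ u) zero ≡ ι d → PosDef (tail² M) → PosDef M
  posDef-step {n} M s u 0<u rows {d} 0<d row₀ pd y q≤0 = all
    where
    N = ι (u zero)
    0<N : 0# < N
    0<N = ι-0< 0<u
    z : Fin n → A
    z i = N * y (suc i) + (- y zero) * ι (u (suc i))
    y₀ = y zero
    sᴬ : ∀ i j → ιᴹ M i j ≡ ιᴹ M j i
    sᴬ i j = cong ι (s i j)
    0∙z : quad (ιᴹ M) (0# ◂ z) (ιⱽ u) ≡ 0#
    0∙z = trans (quad-0◂ (ιᴹ M) z (ιⱽ u)) (∑-zero λ i → trans (cong (z i *_) (rows i)) (zeroʳ (z i)))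
    u∙u : quad (ιᴹ M) (ιⱽ u) (ιⱽ u) ≡ N * ι d
    u∙u = trans (quad-· (ιᴹ M) (ιⱽ u) (ιⱽ u)) (trans (cong₂ (λ a b → N * a + b) row₀ (∑-zero λ i → trans (cong (ι (u (suc i)) *_) (rows i))
        (zeroʳ _))) (+-identityʳ _))
    decompose : ∀ i → N * y i + 0# * y i ≡ 1# * (0# ◂ z) i + y₀ * ι (u i)
    decompose zero = subst₂ (λ o e → N * y zero + o * y zero ≡ e * o + y₀ * N) ι-0 ι-1 (solve 2
        (λ N y → N :* y :+ con 0ℤ :* y := con 1ℤ :* con 0ℤ :+ y :* N) refl N y₀)
    decompose (suc i) = subst₂ (λ o e → N * y (suc i) + o * y (suc i) ≡ e * z i + y₀ * ι (u (suc i))) ι-0 ι-1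
      (solve 4 (λ N y y₀ u → N :* y :+ con 0ℤ :* y := con 1ℤ :* (N :* y :+ (:- y₀) :* u) :+ y₀ :* u) refl N (y (suc i)) y₀ (ι (u (suc i))))
    qy = quad (ιᴹ M) y y
    qz = quad (tail² (ιᴹ M)) z z
    identity : N * N * qy ≡ qz + y₀ * y₀ * (N * ι d)
    identity = begin
      N * N * qy                                                                  ≡⟨ subst (λ o → N * N * qy ≡ N * N * qy + ι (ℤ.+ 2) *
          (N * o) * qy + o * o * qy) ι-0 (solve 2 (λ N q → N :* N :* q := N :* N :* q :+ con (ℤ.+ 2) :*
          (N :* con 0ℤ) :* q :+ con 0ℤ :* con 0ℤ :* q) refl N qy) ⟩
      N * N * qy + ι (ℤ.+ 2) * (N * 0#) * qy + 0# * 0# * qy                       ≡⟨ sym (quad-square (ιᴹ M) sᴬ N 0# y y) ⟩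
      quad (ιᴹ M) (λ i → N * y i + 0# * y i) (λ i → N * y i + 0# * y i)           ≡⟨ quad-cong {β = ιᴹ M} (λ _ _ → refl) decompose decompose ⟩
      quad (ιᴹ M) (λ i → 1# * (0# ◂ z) i + y₀ * ι (u i)) (λ i → 1# * (0# ◂ z) i + y₀ * ι (u i)) ≡⟨ quad-square (ιᴹ M) sᴬ 1# y₀ (0# ◂ z) (ιⱽ u) ⟩
      1# * 1# * quad (ιᴹ M) (0# ◂ z) (0# ◂ z) + ι (ℤ.+ 2) * (1# * y₀) * quad (ιᴹ M) (0# ◂ z) (ιⱽ u) + y₀ * y₀ * quad (ιᴹ M) (ιⱽ u) (ιⱽ u)
        ≡⟨ cong₂ _+_ (cong₂ (λ a b → 1# * 1# * a + ι (ℤ.+ 2) * (1# * y₀) * b) (quad-0◂0◂ (ιᴹ M) z) 0∙z) (cong (y₀ * y₀ *_) u∙u) ⟩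
      1# * 1# * qz + ι (ℤ.+ 2) * (1# * y₀) * 0# + y₀ * y₀ * (N * ι d)
        ≡⟨ subst₂ (λ o e → e * e * qz + ι (ℤ.+ 2) * (e * y₀) * o + y₀ * y₀ * (N * ι d) ≡ qz + y₀ * y₀ * (N * ι d)) ι-0 ι-1
             (solve 3 (λ q y w → con 1ℤ :* con 1ℤ :* q :+ con (ℤ.+ 2) :* (con 1ℤ :* y) :* con 0ℤ :+ y :* y :* w := q :+ y :* y :* w) refl qz y₀
                 (N * ι d)) ⟩
      qz + y₀ * y₀ * (N * ι d) ∎
      where open ≡-Reasoning
    0<Nd : 0# < N * ι d
    0<Nd = 0<-* 0<N (ι-0< 0<d)
    sum≤0 : qz + y₀ * y₀ * (N * ι d) ≤ 0#
    sum≤0 = subst₂ _≤_ identity (zeroʳ (N * N)) (*-monoˡ-≤ (0≤-sq N) q≤0)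
    tail≥0 : 0# ≤ y₀ * y₀ * (N * ι d)
    tail≥0 = 0≤-* (0≤-sq y₀) (<⇒≤ 0<Nd)
    qz≤0 : qz ≤ 0#
    qz≤0 = ≤-trans (subst (_≤ qz + y₀ * y₀ * (N * ι d)) (+-identityʳ qz) (+-mono-≤ ≤-refl tail≥0)) sum≤0
    z≡0 : ∀ i → z i ≡ 0#
    z≡0 = pd z qz≤0
    qz≡0 : qz ≡ 0#
    qz≡0 = ∑-zero λ i → ∑-zero λ j → trans (cong (λ t → t * z j * ι (M (suc i) (suc j))) (z≡0 i)) (trans (cong (_* ι (M (suc i) (suc j))) (zeroˡ
        (z j))) (zeroˡ _))
    y₀≡0 : y₀ ≡ 0#
    y₀≡0 = sq-≤0 (*-cancel-≤ 0<Nd (subst₂ _≤_ (trans (cong (_+ y₀ * y₀ * (N * ι d)) qz≡0) (trans (+-identityˡ _) (*-comm _ _))) (sym (zeroʳ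
        (N * ι d))) sum≤0))
    all : ∀ i → y i ≡ 0#
    all zero = y₀≡0
    all (suc i) = *-zero-pos 0<N (trans (subst (λ t → N * y (suc i) ≡ z i + t * ι (u (suc i))) y₀≡0 (solve 4 (λ N y y₀ u → N :* y := N :* y :+
        (:- y₀) :* u :+ y₀ :* u) refl N (y (suc i)) y₀ (ι (u (suc i)))))
      (trans (cong₂ _+_ (z≡0 i) (zeroˡ _)) (+-identityˡ 0#)))

-- Ordered quadratic extensions

IsNonsquare : (R : OrderedRing) → OrderedRing.A R → Set
IsNonsquare R δ = ∀ a b → a * a ≡ δ * b * b → b ≡ 0#
  where open OrderedRing R

module QuadraticExtension (R : OrderedRing) (δ : OrderedRing.A R) (0<δ : OrderedRing.Pos R δ) (irr : IsNonsquare R δ) where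

  open OrderedRingProperties R

  K : Set
  K = A × A

  infixl 6 _⊕_
  infixl 7 _⊗_
  _⊕_ _⊗_ : K → K → K
  (a , b) ⊕ (c , d) = (a + c) , (b + d)
  (a , b) ⊗ (c , d) = (a * c + δ * b * d) , (a * d + b * c)

  ⊖_ : K → K
  ⊖ (a , b) = (- a) , (- b)

  0K 1K : K
  0K = 0# , 0#
  1K = 1# , 0#

  ιK : ℤ → K
  ιK z = ι z , 0#

  ≡K : ∀ {a b c d : A} → a ≡ c → b ≡ d → (a , b) ≡ (c , d)
  ≡K = cong₂ _,_

  ⊗-assoc : ∀ x y z → (x ⊗ y) ⊗ z ≡ x ⊗ (y ⊗ z)
  ⊗-assoc (a , b) (c , d) (e , f) = ≡K
    (solve 7 (λ D a b c d e f → (a :* c :+ D :* b :* d) :* e :+ D :* (a :* d :+ b :* c) :* f := a :* (c :* e :+ D :* d :* f) :+ D :* b :*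
        (c :* f :+ d :* e)) refl δ a b c d e f)
    (solve 7 (λ D a b c d e f → (a :* c :+ D :* b :* d) :* f :+ (a :* d :+ b :* c) :* e := a :* (c :* f :+ d :* e) :+ b :*
        (c :* e :+ D :* d :* f)) refl δ a b c d e f)

  ⊗-comm : ∀ x y → x ⊗ y ≡ y ⊗ x
  ⊗-comm (a , b) (c , d) = ≡K
    (solve 5 (λ D a b c d → a :* c :+ D :* b :* d := c :* a :+ D :* d :* b) refl δ a b c d)
    (solve 4 (λ a b c d → a :* d :+ b :* c := c :* b :+ d :* a) refl a b c d)

  ⊗-distribˡ : ∀ x y z → x ⊗ (y ⊕ z) ≡ (x ⊗ y) ⊕ (x ⊗ z)
  ⊗-distribˡ (a , b) (c , d) (e , f) = ≡K
    (solve 7 (λ D a b c d e f → a :* (c :+ e) :+ D :* b :* (d :+ f) := (a :* c :+ D :* b :* d) :+ (a :* e :+ D :* b :* f)) refl δ a b c d e f)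
    (solve 6 (λ a b c d e f → a :* (d :+ f) :+ b :* (c :+ e) := (a :* d :+ b :* c) :+ (a :* f :+ b :* e)) refl a b c d e f)

  ⊗-distribʳ : ∀ x y z → (y ⊕ z) ⊗ x ≡ (y ⊗ x) ⊕ (z ⊗ x)
  ⊗-distribʳ x y z = trans (⊗-comm (y ⊕ z) x) (trans (⊗-distribˡ x y z) (cong₂ _⊕_ (⊗-comm x y) (⊗-comm x z)))

  ⊗-identityˡ : ∀ x → 1K ⊗ x ≡ x
  ⊗-identityˡ (a , b) = subst₂ (λ o e → (e * a + δ * o * b , e * b + o * a) ≡ (a , b)) ι-0 ι-1
    (≡K (solve 3 (λ D a b → con 1ℤ :* a :+ D :* con 0ℤ :* b := a) refl δ a b) (solve 2 (λ a b → con 1ℤ :* b :+ con 0ℤ :* a := b) refl a b))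

  K-isCommutativeRing : IsCommutativeRing _≡_ _⊕_ _⊗_ ⊖_ 0K 1K
  K-isCommutativeRing = record
    { isRing = record
      { +-isAbelianGroup = record
        { isGroup = record
          { isMonoid = record
            { isSemigroup = record
              { isMagma = record { isEquivalence = isEquivalence ; ∙-cong = cong₂ _⊕_ }
              ; assoc = λ x y z → ≡K (+-assoc _ _ _) (+-assoc _ _ _) }
            ; identity = (λ x → ≡K (+-identityˡ _) (+-identityˡ _)) , (λ x → ≡K (+-identityʳ _) (+-identityʳ _)) }
          ; inverse = (λ x → ≡K (-‿inverseˡ _) (-‿inverseˡ _)) , (λ x → ≡K (-‿inverseʳ _) (-‿inverseʳ _))
          ; ⁻¹-cong = cong ⊖_ }
        ; comm = λ x y → ≡K (+-comm _ _) (+-comm _ _) }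
      ; *-cong = cong₂ _⊗_
      ; *-assoc = ⊗-assoc
      ; *-identity = ⊗-identityˡ , (λ x → trans (⊗-comm x 1K) (⊗-identityˡ x))
      ; distrib = ⊗-distribˡ , ⊗-distribʳ }
    ; *-comm = ⊗-comm }

  N : K → A
  N (a , b) = a * a - δ * b * b

  -- The sign of a + b√δ is that of the dominating summand: a if the norm is positive, b√δ if it is
  -- negative.
  PosK : K → Set
  PosK x = (Pos (proj₁ x) × Pos (N x)) ⊎ (Pos (proj₂ x) × Pos (- N x))

  Pos-neg : ∀ {x} → Pos x → ¬ Pos (- x)
  Pos-neg {x} p q = ¬pos-0 (subst Pos (-‿inverseʳ x) (pos-+ p q))

  N-⊖ : ∀ x → N (⊖ x) ≡ N x
  N-⊖ (a , b) = solve 3 (λ D a b → (:- a) :* (:- a) :- D :* (:- b) :* (:- b) := a :* a :- D :* b :* b) refl δ a b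

  N-⊗ : ∀ x y → N (x ⊗ y) ≡ N x * N y
  N-⊗ (a , b) (c , d) = solve 5 (λ D a b c d → (a :* c :+ D :* b :* d) :* (a :* c :+ D :* b :* d) :- D :* (a :* d :+ b :* c) :* (a :* d :+ b :* c)
     := (a :* a :- D :* b :* b) :* (c :* c :- D :* d :* d)) refl δ a b c d

  ¬PosK-both : ∀ x → PosK x → ¬ PosK (⊖ x)
  ¬PosK-both x (inj₁ (p , n)) (inj₁ (q , _)) = Pos-neg p q
  ¬PosK-both x (inj₁ (p , n)) (inj₂ (q , n′)) = Pos-neg n (subst (λ t → Pos (- t)) (N-⊖ x) n′)
  ¬PosK-both x (inj₂ (p , n)) (inj₁ (q , n′)) = Pos-neg (subst Pos (N-⊖ x) n′) n
  ¬PosK-both x (inj₂ (p , n)) (inj₂ (q , _)) = Pos-neg p q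

  neg-0 : - 0# ≡ 0#
  neg-0 = trans (sym (+-identityˡ (- 0#))) (-‿inverseʳ 0#)

  ¬PosK-0 : ¬ PosK 0K
  ¬PosK-0 (inj₁ (p , _)) = ¬pos-0 p
  ¬PosK-0 (inj₂ (p , _)) = ¬pos-0 p

  -- If u + v were negative, u - v = 2u - (u + v) would be positive and the product u² - v²
  -- negative.
  dominates : ∀ {u v} → Pos u → Pos (u * u - v * v) → Pos (u + v)
  dominates {u} {v} 0<u 0<d with trichotomy (u + v)
  ... | inj₁ p = p
  ... | inj₂ (inj₁ e) = contradiction (subst Pos (trans (solve 2 (λ u v → u :* u :- v :* v := (u :- v) :* (u :+ v)) refl u v) (trans (cong
      ((u - v) *_) e) (zeroʳ _))) 0<d) ¬pos-0
  ... | inj₂ (inj₂ n) = contradiction 0<d (λ p → Pos-neg p (subst Pos (solve 2 (λ u v → ((u :+ u) :+ (:- (u :+ v))) :* (:- (u :+ v)) := :-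
      (u :* u :- v :* v)) refl u v) (pos-* (pos-+ (pos-+ 0<u 0<u) n) n)))

  pos-sq : ∀ {x} → Pos x → Pos (x * x)
  pos-sq p = pos-* p p

  -- For N > 0 the rational part dominates, for N < 0 the irrational one; in every case the product of
  -- the dominating parts dominates the other cross term.
  PosK-⊗ : ∀ x y → PosK x → PosK y → PosK (x ⊗ y)
  PosK-⊗ x@(a , b) y@(c , d) (inj₁ (a>0 , n)) (inj₁ (c>0 , n′)) = inj₁ (dominates (pos-* a>0 c>0)
      (subst Pos (solve 5 (λ D a b c d → (a :* a :- D :* b :* b) :* (c :* c) :+ (c :* c :- D :* d :* d) :* (a :* a) :- (a :* a :- D :* b :* b) :*
          (c :* c :- D :* d :* d) := a :* c :* (a :* c) :- D :* b :* d :* (D :* b :* d)) refl δ a b c d)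
        main) , subst Pos (sym (N-⊗ x y)) (pos-* n n′))
    where
    main : Pos (N x * (c * c) + N y * (a * a) - N x * N y)
    main = subst Pos (solve 5 (λ D a b c d → (a :* a :- D :* b :* b) :* (D :* (d :* d)) :+ (c :* c :- D :* d :* d) :* (a :* a) :=
        (a :* a :- D :* b :* b) :* (c :* c) :+ (c :* c :- D :* d :* d) :* (a :* a) :- (a :* a :- D :* b :* b) :*
        (c :* c :- D :* d :* d)) refl δ a b c d)
      (subst Pos (+-comm _ _) (pos-nonneg-+ (pos-* n′ (pos-sq a>0)) (nonneg-* (inj₁ n) (nonneg-* (inj₁ 0<δ) (nonneg-sq d)))))
  PosK-⊗ x@(a , b) y@(c , d) (inj₁ (a>0 , n)) (inj₂ (d>0 , n′)) = inj₂ (dominates (pos-* a>0 d>0) main ,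
      subst Pos (trans (solve 2 (λ p q → p :* (:- q) := :- (p :* q)) refl (N x) (N y)) (cong -_ (sym (N-⊗ x y)))) (pos-* n n′))
    where
    main : Pos (a * d * (a * d) - b * c * (b * c))
    main = subst Pos (solve 5 (λ D a b c d → (a :* a :- D :* b :* b) :* (d :* d) :+ (:- (c :* c :- D :* d :* d)) :* (b :* b) := a :* d :*
        (a :* d) :- b :* c :* (b :* c)) refl δ a b c d)
      (pos-nonneg-+ (pos-* n (pos-sq d>0)) (nonneg-* (inj₁ n′) (nonneg-sq b)))
  PosK-⊗ x@(a , b) y@(c , d) (inj₂ (b>0 , n)) (inj₁ (c>0 , n′)) = inj₂ (subst Pos (+-comm _ _) (dominates (pos-* b>0 c>0) main) ,
      subst Pos (trans (solve 2 (λ p q → (:- p) :* q := :- (p :* q)) refl (N x) (N y)) (cong -_ (sym (N-⊗ x y)))) (pos-* n n′))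
    where
    main : Pos (b * c * (b * c) - a * d * (a * d))
    main = subst Pos (solve 5 (λ D a b c d → (c :* c :- D :* d :* d) :* (b :* b) :+ (:- (a :* a :- D :* b :* b)) :* (d :* d) := b :* c :*
        (b :* c) :- a :* d :* (a :* d)) refl δ a b c d)
      (pos-nonneg-+ (pos-* n′ (pos-sq b>0)) (nonneg-* (inj₁ n) (nonneg-sq d)))
  PosK-⊗ x@(a , b) y@(c , d) (inj₂ (b>0 , n)) (inj₂ (d>0 , n′)) = inj₁ (subst Pos (+-comm _ _) (dominates (pos-* (pos-* 0<δ b>0) d>0) main) ,
      subst Pos (trans (solve 2 (λ p q → (:- p) :* (:- q) := p :* q) refl (N x) (N y)) (sym (N-⊗ x y))) (pos-* n n′))
    where
    main : Pos (δ * b * d * (δ * b * d) - a * c * (a * c))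
    main = subst Pos (solve 5 (λ D a b c d → (:- (a :* a :- D :* b :* b)) :* (D :* (d :* d)) :+ (:- (c :* c :- D :* d :* d)) :*
        (a :* a) := D :* b :* d :* (D :* b :* d) :- a :* c :* (a :* c)) refl δ a b c d)
      (pos-nonneg-+ (pos-* n (pos-* 0<δ (pos-sq d>0))) (nonneg-* (inj₁ n′) (nonneg-sq a)))

  sq≡0 : ∀ {x} → x * x ≡ 0# → x ≡ 0#
  sq≡0 e = sq-≤0 (≤-reflexive e)

  PosK-trichotomy : ∀ x → PosK x ⊎ x ≡ 0K ⊎ PosK (⊖ x)
  PosK-trichotomy x@(a , b) with trichotomy (N x)
  ... | inj₁ n = [ (λ p → inj₁ (inj₁ (p , n))) , [ (λ e → contradiction n (¬n e)) , (λ p → inj₂ (inj₂ (inj₁ (p , subst Pos (sym (N-⊖ x)) n)))) ]′ ]′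
      (trichotomy a)
    where
    ¬n : a ≡ 0# → ¬ Pos (N x)
    ¬n refl n = contradiction (nonneg-* (inj₁ 0<δ) (nonneg-sq b)) λ
      { (inj₁ p) → Pos-neg p (subst Pos e n)
      ; (inj₂ z) → ¬pos-0 (subst Pos (trans e (trans (cong -_ z) neg-0)) n) }
      where
      e : 0# * 0# - δ * b * b ≡ - (δ * (b * b))
      e = subst (λ o → o * o - δ * b * b ≡ - (δ * (b * b))) ι-0 (solve 2 (λ D b → con 0ℤ :* con 0ℤ :- D :* b :* b := :- (D :* (b :* b))) refl δ b)
  ... | inj₂ (inj₁ z) = inj₂ (inj₁ (≡K (sq≡0 (trans a² (trans (cong (λ t → δ * t * t) b≡0) (zeroʳ _)))) b≡0))
    where
    a² : a * a ≡ δ * b * b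
    a² = trans (solve 2 (λ p q → p := p :- q :+ q) refl (a * a) (δ * b * b)) (trans (cong (_+ δ * b * b) z) (+-identityˡ _))
    b≡0 = irr a b a²
  ... | inj₂ (inj₂ n) = [ (λ p → inj₁ (inj₂ (p , n))) , [ (λ e → contradiction n (¬n e)) , (λ p → inj₂ (inj₂ (inj₂ (p , subst (λ t → Pos (- t)) (sym
      (N-⊖ x)) n)))) ]′ ]′ (trichotomy b)
    where
    ¬n : b ≡ 0# → ¬ Pos (- N x)
    ¬n refl n = contradiction (nonneg-sq a) λ
      { (inj₁ p) → Pos-neg p (subst Pos (cong -_ e) n)
      ; (inj₂ z) → ¬pos-0 (subst Pos (trans (cong -_ (trans e z)) neg-0) n) }
      where
      e : a * a - δ * 0# * 0# ≡ a * a
      e = subst (λ o → a * a - δ * o * o ≡ a * a) ι-0 (solve 2 (λ D a → a :* a :- D :* con 0ℤ :* con 0ℤ := a :* a) refl δ a)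

  -- The case of addition in which one summand is rational. The norm changes by q (q + 2a).
  PosK-shift : ∀ q x → Pos q → PosK x → PosK ((q , 0#) ⊕ x)
  PosK-shift q x@(a , b) q>0 (inj₁ (a>0 , n)) = inj₁ (pos-+ q>0 a>0 , subst Pos e (pos-+ n (pos-* q>0 (pos-+ q>0 (pos-+ a>0 a>0)))))
    where
    e : N x + q * (q + (a + a)) ≡ (q + a) * (q + a) - δ * (0# + b) * (0# + b)
    e = subst (λ o → N x + q * (q + (a + a)) ≡ (q + a) * (q + a) - δ * (o + b) * (o + b)) ι-0
      (solve 4 (λ D q a b → a :* a :- D :* b :* b :+ q :* (q :+ (a :+ a)) := (q :+ a) :* (q :+ a) :- D :* (con 0ℤ :+ b) :*
          (con 0ℤ :+ b)) refl δ q a b)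
  PosK-shift q x@(a , b) q>0 (inj₂ (b>0 , n)) with trichotomy (N ((q , 0#) ⊕ x))
  ... | inj₂ (inj₂ n′) = inj₂ (subst Pos (sym (+-identityˡ b)) b>0 , n′)
  ... | inj₂ (inj₁ z) = contradiction (subst Pos (irr (q + a) b (trans (l (q + a) b) (trans (cong (_+ δ * b * b) (trans (cong (λ t → (q + a) *
      (q + a) - δ * t * t) (sym (+-identityˡ b))) z)) (+-identityˡ _)))) b>0) ¬pos-0
    where
    l : ∀ a b → a * a ≡ a * a - δ * b * b + δ * b * b
    l a b = solve 2 (λ p q → p := p :- q :+ q) refl (a * a) (δ * b * b)
  ... | inj₁ n′ with trichotomy (q + a)
  ... | inj₁ p = inj₁ (p , n′)
  ... | inj₂ (inj₁ e) = contradiction (nonneg-* (inj₁ 0<δ) (nonneg-sq (0# + b))) λ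
      { (inj₁ p) → Pos-neg p (subst Pos e′ n′)
      ; (inj₂ z) → ¬pos-0 (subst Pos (trans e′ (trans (cong -_ z) neg-0)) n′) }
    where
    e′ : (q + a) * (q + a) - δ * (0# + b) * (0# + b) ≡ - (δ * ((0# + b) * (0# + b)))
    e′ = trans (cong (λ t → t * t - δ * (0# + b) * (0# + b)) (trans e (sym ι-0))) (solve 2 (λ D b → con 0ℤ :* con 0ℤ :- D :* b :* b := :- (D :*
        (b :* b))) refl δ (0# + b))
  -- With q + a < 0 also q + 2a < 0, so the norm decreases and cannot pass from negative to
  -- positive.
  ... | inj₂ (inj₂ m) = contradiction (pos-+ n n′) λ p → Pos-neg p (subst Pos e (pos-* q>0 (pos-+ q>0 (pos-+ m m))))
    where
    e : q * (q + (- (q + a) + - (q + a))) ≡ - (- N x + ((q + a) * (q + a) - δ * (0# + b) * (0# + b)))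
    e = subst (λ o → q * (q + (- (q + a) + - (q + a))) ≡ - (- N x + ((q + a) * (q + a) - δ * (o + b) * (o + b)))) ι-0
      (solve 4 (λ D q a b → q :* (q :+ (:- (q :+ a) :+ :- (q :+ a))) := :- (:- (a :* a :- D :* b :* b) :+ ((q :+ a) :* (q :+ a) :- D :*
          (con 0ℤ :+ b) :* (con 0ℤ :+ b)))) refl δ q a b)

  -- The conjugate of x, with the sign that makes it positive; the product is the absolute value of
  -- the norm.
  cofactor : ∀ x → PosK x → ∃ λ y → ∃ λ q → PosK y × Pos q × y ⊗ x ≡ (q , 0#)
  cofactor x@(a , b) (inj₁ (a>0 , n)) = (a , - b) , N x , inj₁ (a>0 , subst Pos (solve 3 (λ D a b → a :* a :- D :* b :* b := a :* a :- D :*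
      (:- b) :* (:- b)) refl δ a b) n) , n ,
    ≡K (solve 3 (λ D a b → a :* a :+ D :* (:- b) :* b := a :* a :- D :* b :* b) refl δ a b) (trans (solve 2 (λ a b → a :* b :+
        (:- b) :* a := con 0ℤ) refl a b) ι-0)
  cofactor x@(a , b) (inj₂ (b>0 , n)) = (- a , b) , - N x , inj₂ (b>0 , subst Pos (solve 3 (λ D a b → :- (a :* a :- D :* b :* b) := :- ((:- a) :*
      (:- a) :- D :* b :* b)) refl δ a b) n) , n ,
    ≡K (solve 3 (λ D a b → (:- a) :* a :+ D :* b :* b := :- (a :* a :- D :* b :* b)) refl δ a b) (trans (solve 2 (λ a b →
        (:- a) :* b :+ b :* a := con 0ℤ) refl a b) ι-0)

  ⊗-⊖ : ∀ x y → x ⊗ (⊖ y) ≡ ⊖ (x ⊗ y)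
  ⊗-⊖ (a , b) (c , d) = ≡K (solve 5 (λ D a b c d → a :* (:- c) :+ D :* b :* (:- d) := :- (a :* c :+ D :* b :* d)) refl δ a b c d) (solve 4
      (λ a b c d → a :* (:- d) :+ b :* (:- c) := :- (a :* d :+ b :* c)) refl a b c d)

  -- With y x = q > 0 rational, y (x + z) = q + y z, and x + z has the sign of this product.
  PosK-⊕ : ∀ x z → PosK x → PosK z → PosK (x ⊕ z)
  PosK-⊕ x z px pz = go (cofactor x px)
    where
    go : (∃ λ y → ∃ λ q → PosK y × Pos q × y ⊗ x ≡ (q , 0#)) → PosK (x ⊕ z)
    go (y , q , py , pq , e) = [ (λ p → p) , [ (λ e′ → contradiction (subst PosK (trans (cong (y ⊗_) e′) (y⊗0 y)) prod) ¬PosK-0)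
                                             , (λ p → contradiction (subst PosK (⊗-⊖ y (x ⊕ z)) (PosK-⊗ y (⊖ (x ⊕ z)) py p)) (¬PosK-both (y ⊗
                                                 (x ⊕ z)) prod)) ]′ ]′ (PosK-trichotomy (x ⊕ z))
      where
      prod : PosK (y ⊗ (x ⊕ z))
      prod = subst PosK (trans (cong (_⊕ (y ⊗ z)) (sym e)) (sym (⊗-distribˡ y x z))) (PosK-shift q (y ⊗ z) pq (PosK-⊗ y z py pz))
      y⊗0 : ∀ y → y ⊗ 0K ≡ 0K
      y⊗0 (a , b) = ≡K (trans (cong₂ _+_ (zeroʳ a) (zeroʳ (δ * b))) (+-identityˡ 0#)) (trans (cong₂ _+_ (zeroʳ a) (zeroʳ b)) (+-identityˡ 0#))

  orderedRing : OrderedRing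
  orderedRing = record
    { A = K ; _+_ = _⊕_ ; _*_ = _⊗_ ; -_ = ⊖_ ; 0# = 0K ; 1# = 1K ; isCommutativeRing = K-isCommutativeRing
    ; ι = ιK ; ι-+ = λ x y → ≡K (ι-+ x y) (sym (+-identityˡ 0#))
    ; ι-* = λ x y → ≡K (trans (ι-* x y) (sym (trans (cong (ι x * ι y +_) (zeroʳ (δ * 0#))) (+-identityʳ _)))) (sym (trans (cong₂ _+_ (zeroʳ (ι x))
        (zeroˡ (ι y))) (+-identityˡ 0#)))
    ; ι-neg = λ x → ≡K (ι-neg x) (sym neg-0) ; ι-0 = ≡K ι-0 refl ; ι-1 = ≡K ι-1 refl
    ; Pos = PosK ; pos-+ = λ {x} {y} → PosK-⊕ x y ; pos-* = λ {x} {y} → PosK-⊗ x y ; trichotomy = PosK-trichotomy ; ¬pos-0 = ¬PosK-0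
    ; ι-pos = λ {z} p → inj₁ (ι-pos p , subst (λ o → Pos (ι z * ι z - δ * o * o)) ι-0 (subst Pos (solve 2
        (λ D z → z :* z := z :* z :- D :* con 0ℤ :* con 0ℤ) refl δ (ι z)) (pos-sq (ι-pos p))))
    }

-- Linear dependence and Gram matrices

module LinearAlgebra (R : OrderedRing) where
  open OrderedRingProperties R

  _≟0 : ∀ x → Dec (x ≡ 0#)
  x ≟0 with trichotomy x
  ... | inj₁ p = no λ { refl → ¬pos-0 p }
  ... | inj₂ (inj₁ e) = yes e
  ... | inj₂ (inj₂ p) = no λ { refl → ¬pos-0 (subst Pos (trans (sym (+-identityˡ (- 0#))) (-‿inverseʳ 0#)) p) }

  pos-square : ∀ {x} → x ≢ 0# → 0# < x * x
  pos-square {x} x≢0 with nonneg-sq x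
  ... | inj₁ p = pos⇒0< p
  ... | inj₂ e = contradiction (sq-≤0 (≤-reflexive e)) x≢0

  no-zero-divisors : ∀ {x y} → x ≢ 0# → y ≢ 0# → x * y ≢ 0#
  no-zero-divisors {x} {y} x≢0 y≢0 e = y≢0 (*-zero-pos (pos-square x≢0) (trans (*-assoc x x y) (trans (cong (x *_) e) (zeroʳ x))))

  basis₀ : ∀ {n} → Fin (suc n) → A
  basis₀ zero = 1#
  basis₀ (suc _) = 0#

  1≢0 : 1# ≢ 0#
  1≢0 e = ¬pos-0 (subst Pos (trans ι-1 e) (ι-pos {1ℤ} (ℤ.+<+ (ℕ.s≤s ℕ.z≤n))))

  -- Elimination without division. With a pivot p in the first row, p times a later row minus a
  -- multiple of the first row vanishes in the column `t₀`; that column is dropped and the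
  -- dependence found for the rest is extended back.
  dependent : ∀ {n r} → r ℕ.< n → (M : Fin n → Fin r → A) → Σ (Fin n → A) λ c → (∃ λ i → c i ≢ 0#) × (∀ t → ∑ (λ i → c i * M i t) ≡ 0#)
  dependent {suc n} {r} r<n M with Finₚ.any? (λ t → ¬? (M zero t ≟0))
  ... | no none = basis₀ , (zero , 1≢0) , λ t → trans (cong₂ _+_ (trans (*-identityˡ _) (decidable-stable (M zero t ≟0) λ neq → none (t , neq)))
      (∑-zero λ i → zeroˡ (M (suc i) t))) (+-identityˡ 0#)
  dependent {suc n} {suc r} (ℕ.s≤s r<n) M | yes (t₀ , p≢0) = extend (dependent r<n M′)
    where
    p = M zero t₀
    row : Fin n → Fin (suc r) → A
    row i t = p * M (suc i) t - M (suc i) t₀ * M zero t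
    M′ : Fin n → Fin r → A
    M′ i s = row i (punchIn t₀ s)
    extend : (Σ (Fin n → A) λ c → (∃ λ i → c i ≢ 0#) × (∀ s → ∑ (λ i → c i * M′ i s) ≡ 0#)) → Σ (Fin (suc n) → A) λ c → (∃ λ i → c i ≢ 0#) ×
        (∀ t → ∑ (λ i → c i * M i t) ≡ 0#)
    extend (c , (i , ci≢0) , null) = c⁺ , (suc i , no-zero-divisors p≢0 ci≢0) , λ t → trans (combine t) (rows t)
      where
      c⁺ : Fin (suc n) → A
      c⁺ zero = - ∑ (λ i → c i * M (suc i) t₀)
      c⁺ (suc i) = p * c i
      combine : ∀ t → ∑ (λ i → c⁺ i * M i t) ≡ ∑ (λ i → c i * row i t)
      combine t = sym (trans (∑-cong λ i → l (c i) p (M (suc i) t) (M (suc i) t₀) (M zero t))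
        (trans (∑-+ (λ i → (- M zero t) * (c i * M (suc i) t₀)) (λ i → p * c i * M (suc i) t)) (cong (_+ ∑ (λ i → p * c i * M (suc i) t))
          (trans (∑-* (- M zero t) (λ i → c i * M (suc i) t₀)) (solve 2 (λ x s → (:- x) :* s := (:- s) :* x) refl (M zero t) (∑ (λ i → c i * M
              (suc i) t₀)))))))
        where
        l : ∀ c p x y z → c * (p * x - y * z) ≡ (- z) * (c * y) + p * c * x
        l = solve 5 (λ c p x y z → c :* (p :* x :- y :* z) := (:- z) :* (c :* y) :+ p :* c :* x) refl
      rows : ∀ t → ∑ (λ i → c i * row i t) ≡ 0#
      rows t with t₀ Fin.≟ t
      ... | yes refl = ∑-zero λ i → trans (cong (c i *_) (trans (cong (λ u → p * M (suc i) t₀ - u) (*-comm (M (suc i) t₀) p)) (-‿inverseʳ _)))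
          (zeroʳ (c i))
      ... | no t₀≢t = subst (λ t → ∑ (λ i → c i * row i t) ≡ 0#) (Finₚ.punchIn-punchOut t₀≢t) (null (punchOut t₀≢t))

  module _ {d : ℕ} (G : Matrix d) (G-sym : ∀ i j → G i j ≡ G j i) where

    lin : ∀ {n} → (Fin n → A) → (Fin n → Fin d → A) → Fin d → A
    lin c z t = ∑ λ i → c i * z i t

    quad-linearˡ : ∀ {n} (c : Fin n → A) z y → quad G (lin c z) y ≡ ∑ λ i → c i * quad G (z i) y
    quad-linearˡ c z y = trans (quad-· G (lin c z) y) (trans (∑-cong λ t → pull t) (trans (∑-swap (λ t i → c i * (z i t * (G · y) t)))
      (∑-cong λ i → trans (∑-* (c i) (λ t → z i t * (G · y) t)) (cong (c i *_) (sym (quad-· G (z i) y))))))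
      where
      pull : ∀ t → lin c z t * (G · y) t ≡ ∑ λ i → c i * (z i t * (G · y) t)
      pull t = trans (*-comm _ _) (trans (sym (∑-* ((G · y) t) (λ i → c i * z i t))) (∑-cong λ i → solve 3 (λ g c z → g :* (c :* z) := c :*
          (z :* g)) refl ((G · y) t) (c i) (z i t)))

    quad-lin : ∀ {n} (c : Fin n → A) z → quad G (lin c z) (lin c z) ≡ quad (λ i j → quad G (z i) (z j)) c c
    quad-lin c z = trans (quad-linearˡ c z (lin c z)) (trans (∑-cong λ i → cong (c i *_) (trans (quad-sym G G-sym (z i) (lin c z)) (quad-linearˡ c z
        (z i))))
      (sym (trans (quad-· (λ i j → quad G (z i) (z j)) c c) (∑-cong λ i → cong (c i *_) (∑-cong λ j → cong (c j *_) (quad-sym G G-sym (z i)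
          (z j)))))))

    quad-lin-null : ∀ {n} (c : Fin n → A) z → (∀ t → lin c z t ≡ 0#) → ∀ y → ∑ (λ i → c i * quad G (z i) y) ≡ 0#
    quad-lin-null c z null y = trans (sym (quad-linearˡ c z y)) (∑-zero λ i → ∑-zero λ j → trans (cong (λ t → t * y j * G i j) (null i)) (trans
        (cong (_* G i j) (zeroˡ (y j))) (zeroˡ _)))

-- Semidefinite Gram matrices under both embeddings

∑ℤ : ∀ {n} → (Fin n → ℤ) → ℤ
∑ℤ {zero} f = 0ℤ
∑ℤ {suc n} f = f zero ℤ.+ ∑ℤ (f ∘ suc)

-- What the argument uses of the lattice. `skew x y` is (β - β′)/√Δ for β = `b x y`, and the
-- semidefiniteness is demanded for all coefficients in the field, under both embeddings.
record Setting : Set₁ where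
  field
    R : OrderedRing
  open OrderedRingProperties R public
  field
    conj : A → A
    conj-* : ∀ x y → conj (x * y) ≡ conj x * conj y
    conj-ι : ∀ z → conj (ι z) ≡ ι z
    √Δ : A
    Δ : ℤ
    0<√Δ : 0# < √Δ
    √Δ² : √Δ * √Δ ≡ ι Δ
    X : Set
    b : X → X → A
    b-sym : ∀ x y → b x y ≡ b y x
    psd : ∀ {n} (z : Fin n → X) c → 0# ≤ quad (λ i j → b (z i) (z j)) c c
    psd′ : ∀ {n} (z : Fin n → X) c → 0# ≤ quad (λ i j → conj (b (z i) (z j))) c c
    skew : X → X → ℤ
    skew-≡ : ∀ x y → b x y ≡ conj (b x y) + √Δ * ι (skew x y)
    rational : ∀ x y → skew x y ≡ 0ℤ → ∃ λ u → b x y ≡ ι u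

module SettingProperties (S : Setting) where
  open Setting S

  ι-∑ : ∀ {n} (f : Fin n → ℤ) → ι (∑ℤ f) ≡ ∑ (ι ∘ f)
  ι-∑ {zero} f = ι-0
  ι-∑ {suc n} f = trans (ι-+ (f zero) (∑ℤ (f ∘ suc))) (cong (ι (f zero) +_) (ι-∑ (f ∘ suc)))

  _·ℤ_ : ∀ {n} → (Fin n → Fin n → ℤ) → (Fin n → ℤ) → Fin n → ℤ
  (M ·ℤ u) i = ∑ℤ λ j → u j ℤ.* M i j

  ι-· : ∀ {n} (M : Fin n → Fin n → ℤ) u i → (ιᴹ M · ιⱽ u) i ≡ ι ((M ·ℤ u) i)
  ι-· M u i = sym (trans (ι-∑ λ j → u j ℤ.* M i j) (∑-cong λ j → ι-* (u j) (M i j)))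

  cancel-√Δ : ∀ {p q} → √Δ * p ≡ √Δ * q → p ≡ q
  cancel-√Δ {p} {q} eq = trans (solve 2 (λ p q → p := p :- q :+ q) refl p q) (trans (cong (_+ q) (*-zero-pos 0<√Δ
    (trans (solve 3 (λ s p q → s :* (p :- q) := s :* p :- s :* q) refl √Δ p q) (trans (cong (_- √Δ * q) eq) (-‿inverseʳ (√Δ * q)))))) (+-identityˡ q))

  skew-unique : ∀ x y a → b x y ≡ conj (b x y) + √Δ * ι a → skew x y ≡ a
  skew-unique x y a eq = ι-injective (cancel-√Δ (trans (solve 2 (λ u v → v := u :+ v :- u) refl (conj (b x y)) (√Δ * ι (skew x y)))
    (trans (cong (_- conj (b x y)) (trans (sym (skew-≡ x y)) eq)) (solve 2 (λ u v → u :+ v :- u := v) refl (conj (b x y)) (√Δ * ι a)))))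

  skew-sym : ∀ x y → skew x y ≡ skew y x
  skew-sym x y = skew-unique x y (skew y x) (trans (b-sym x y) (trans (skew-≡ y x) (cong (λ t → conj t + √Δ * ι (skew y x)) (b-sym y x))))

  -- At (-q, p) the form takes the value p (p r - q²).
  square-bound : ∀ p q r → (∀ x y → 0# ≤ x * x * p + ι (ℤ.+ 2) * (x * y) * q + y * y * r) → 0# < p → q * q ≤ p * r
  square-bound p q r psd₂ 0<p = *-cancel-≤ 0<p (≤-by (0≤⇒nonneg (psd₂ (- q) p))
    (solve 3 (λ p q r → p :* (p :* r) :- p :* (q :* q) := (:- q) :* (:- q) :* p :+ con (ℤ.+ 2) :* ((:- q) :* p) :* q :+ p :* p :* r) refl p q r))

  pair : ∀ {B : Set} → B → B → Fin 2 → B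
  pair x y zero = x
  pair x y (suc zero) = y

  quad-pair : ∀ (β : Matrix 2) → β (suc zero) zero ≡ β zero (suc zero) → ∀ x y →
              quad β (pair x y) (pair x y) ≡ x * x * β zero zero + ι (ℤ.+ 2) * (x * y) * β zero (suc zero) + y * y * β (suc zero) (suc zero)
  quad-pair β s x y = trans (cong (λ t → x * x * β zero zero + (x * y * β zero (suc zero) + 0#) + (y * x * t + (y * y * β (suc zero)
      (suc zero) + 0#) + 0#)) s)
    (subst (λ o → x * x * β zero zero + (x * y * β zero (suc zero) + o) + (y * x * β zero (suc zero) + (y * y * β (suc zero)
        (suc zero) + o) + o) ≡ x * x * β zero zero + ι (ℤ.+ 2) * (x * y) * β zero (suc zero) + y * y * β (suc zero) (suc zero)) ι-0
      (solve 5 (λ x y p q r → x :* x :* p :+ (x :* y :* q :+ con 0ℤ) :+ (y :* x :* q :+ (y :* y :* r :+ con 0ℤ) :+ con 0ℤ) := x :* x :* p :+ con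
          (ℤ.+ 2) :* (x :* y) :* q :+ y :* y :* r) refl
        x y (β zero zero) (β zero (suc zero)) (β (suc zero) (suc zero))))

  cauchy-schwarz : ∀ x y → 0# < b x x → b x y * b x y ≤ b x x * b y y
  cauchy-schwarz x y = square-bound (b x x) (b x y) (b y y) λ s t →
    subst (0# ≤_) (quad-pair (λ i j → b (pair x y i) (pair x y j)) (b-sym y x) s t) (psd (pair x y) (pair s t))

  cauchy-schwarz′ : ∀ x y → 0# < conj (b x x) → conj (b x y) * conj (b x y) ≤ conj (b x x) * conj (b y y)
  cauchy-schwarz′ x y = square-bound (conj (b x x)) (conj (b x y)) (conj (b y y)) λ s t →
    subst (0# ≤_) (quad-pair (λ i j → conj (b (pair x y i) (pair x y j))) (cong conj (b-sym y x)) s t) (psd′ (pair x y) (pair s t))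

  0≤Δ : 0ℤ ℤ.≤ Δ
  0≤Δ = ι-cancel-≤ (subst₂ _≤_ (sym ι-0) √Δ² (0≤-sq √Δ))

  1≤sq : ∀ a → a ≢ 0ℤ → 1ℤ ℤ.≤ a ℤ.* a
  1≤sq (ℤ.+ zero) a≢0 = contradiction refl a≢0
  1≤sq (ℤ.+ suc n) _ = ℤ.+≤+ (ℕ.s≤s ℕ.z≤n)
  1≤sq ℤ.-[1+ n ] _ = ℤ.+≤+ (ℕ.s≤s ℕ.z≤n)

  -- If the skew part is nonzero, its square is at least 1, and Δ ≤ (β - β′)² ≤ 2 (β² + β′²) ≤ 4K.
  -- This is the factor 4 in all the bounds on Δ.
  integral-or-small : ∀ x y K → 0# < b x x → 0# < conj (b x x) → b x x * b y y ≤ K → conj (b x x) * conj (b y y) ≤ K →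
                      skew x y ≡ 0ℤ ⊎ ι Δ ≤ ι (ℤ.+ 4) * K
  integral-or-small x y K 0<b 0<b′ le le′ with skew x y ℤ.≟ 0ℤ
  ... | yes eq = inj₁ eq
  ... | no neq = inj₂ (≤-trans (subst₂ _≤_ (trans (cong (_* ι Δ) ι-1) (*-identityˡ (ι Δ))) refl (*-monoʳ-≤ (ι-0≤ 0≤Δ) (ι-mono-≤ (1≤sq a neq)))) main)
    where
    a = skew x y
    β = b x y
    β′ = conj (b x y)
    diff : (β - β′) * (β - β′) ≡ ι (a ℤ.* a) * ι Δ
    diff = trans (cong (λ t → (t - β′) * (t - β′)) (skew-≡ x y)) (trans (solve 3 (λ β s a → (β :+ s :* a :- β) :* (β :+ s :* a :- β) := a :* a :*
        (s :* s)) refl β′ √Δ (ι a))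
      (cong₂ _*_ (sym (ι-* a a)) √Δ²))
    parallelogram : (β - β′) * (β - β′) ≤ ι (ℤ.+ 2) * (β * β + β′ * β′)
    parallelogram = ≤-by (nonneg-sq (β + β′)) (solve 2 (λ u v → con (ℤ.+ 2) :* (u :* u :+ v :* v) :- (u :- v) :* (u :- v) := (u :+ v) :*
        (u :+ v)) refl β β′)
    main : ι (a ℤ.* a) * ι Δ ≤ ι (ℤ.+ 4) * K
    main = subst₂ _≤_ diff (solve 1 (λ K → con (ℤ.+ 2) :* (K :+ K) := con (ℤ.+ 4) :* K) refl K)
      (≤-trans parallelogram (*-monoˡ-≤ (ι-0≤ {ℤ.+ 2} (ℤ.+≤+ ℕ.z≤n)) (+-mono-≤ (≤-trans (cauchy-schwarz x y 0<b) le) (≤-trans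
          (cauchy-schwarz′ x y 0<b′) le′))))

  module _ {n : ℕ} (β : Matrix (suc n)) (s : ∀ i j → β i j ≡ β j i) (nn : ∀ c → 0# ≤ quad β c c) where

    -- q(x + y) ≤ 2 q(x) + 2 q(y), because q(x - y) ≥ 0.
    quad-tail-bound : ∀ c → quad β c c ≤ ι (ℤ.+ 2) * (c zero * c zero * β zero zero) + ι (ℤ.+ 2) * quad (tail² β) (c ∘ suc) (c ∘ suc)
    quad-tail-bound c = ≤-by (0≤⇒nonneg (nn (λ i → c₀ * e i + - 1# * t i))) (trans (cong₂ _-_ (cong (λ u → ι (ℤ.+ 2) * (c₀ * c₀ * u) + ι
        (ℤ.+ 2) * quad (tail² β) t′ t′) (sym qe)) (trans qc (quad-square β s c₀ 1# e t)))
      (trans (cong (λ u → ι (ℤ.+ 2) * (c₀ * c₀ * quad β e e) + ι (ℤ.+ 2) * u - (c₀ * c₀ * quad β e e + ι (ℤ.+ 2) *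
          (c₀ * 1#) * quad β e t + 1# * 1# * quad β t t)) (sym (quad-0◂0◂ β t′)))
      (trans (subst (λ o → ι (ℤ.+ 2) * (c₀ * c₀ * p) + ι (ℤ.+ 2) * r - (c₀ * c₀ * p + ι (ℤ.+ 2) * (c₀ * o) * q + o * o * r) ≡ c₀ * c₀ * p + ι
          (ℤ.+ 2) * (c₀ * - o) * q + (- o) * (- o) * r) ι-1
          (solve 4 (λ c p q r → con (ℤ.+ 2) :* (c :* c :* p) :+ con (ℤ.+ 2) :* r :- (c :* c :* p :+ con (ℤ.+ 2) :*
              (c :* con 1ℤ) :* q :+ con 1ℤ :* con 1ℤ :* r) := c :* c :* p :+ con (ℤ.+ 2) :* (c :* (:- con 1ℤ)) :* q :+ (:- con 1ℤ) :*
              (:- con 1ℤ) :* r) refl c₀ p q r))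
        (sym (quad-square β s c₀ (- 1#) e t)))))
      where
      c₀ = c zero
      t′ = c ∘ suc
      e t : Fin (suc n) → A
      e = 1# ◂ λ _ → 0#
      t = 0# ◂ t′
      p = quad β e e
      q = quad β e t
      r = quad β t t
      e-row : ∀ d → quad β e d ≡ (β · d) zero
      e-row d = trans (quad-· β e d) (trans (cong₂ _+_ (*-identityˡ _) (∑-zero λ i → zeroˡ ((β · d) (suc i)))) (+-identityʳ _))
      qe : p ≡ β zero zero
      qe = trans (e-row e) (trans (cong₂ _+_ (*-identityˡ _) (∑-zero λ i → zeroˡ (β zero (suc i)))) (+-identityʳ _))
      split : ∀ i → c i ≡ c₀ * e i + 1# * t i
      split zero = sym (trans (cong₂ _+_ (*-identityʳ c₀) (zeroʳ 1#)) (+-identityʳ c₀))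
      split (suc i) = sym (trans (cong₂ _+_ (zeroʳ c₀) (*-identityˡ (c (suc i)))) (+-identityˡ (c (suc i))))
      qc : quad β c c ≡ quad β (λ i → c₀ * e i + 1# * t i) (λ i → c₀ * e i + 1# * t i)
      qc = quad-cong {β = β} (λ _ _ → refl) split split

  sumSq : ∀ {n} → (Fin n → A) → A
  sumSq c = ∑ λ i → c i * c i

  0≤sumSq : ∀ {n} (c : Fin n → A) → 0# ≤ sumSq c
  0≤sumSq {zero} c = ≤-refl
  0≤sumSq {suc n} c = 0≤-+ (0≤-sq (c zero)) (0≤sumSq (c ∘ suc))

  -- Each coordinate split off by `quad-tail-bound` doubles the constant. The trace would give n + 1
  -- in place of 2^n, but the cruder factor still fits under 8, 36 and 192.
  quad-bound : ∀ {n} (β : Matrix (suc n)) → (∀ i j → β i j ≡ β j i) → (∀ c → 0# ≤ quad β c c) → ∀ K → 0# ≤ K → (∀ i → β i i ≤ K) →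
               ∀ c → quad β c c ≤ ι (ℤ.+ (2 ℕ.^ n)) * K * sumSq c
  quad-bound {zero} β s nn K 0≤K β≤K c = subst₂ _≤_ (sym (trans (+-identityʳ _) (+-identityʳ _)))
    (trans (*-comm _ K) (cong₂ _*_ (sym (trans (cong (_* K) ι-1) (*-identityˡ K))) (sym (+-identityʳ _)))) (*-monoˡ-≤ (0≤-sq (c zero)) (β≤K zero))
  quad-bound {suc n} β s nn K 0≤K β≤K c = ≤-trans (quad-tail-bound β s nn c) (≤-trans (+-mono-≤ (*-monoˡ-≤ 0≤2 (*-monoˡ-≤ (0≤-sq (c zero))
      (β≤K zero)))
      (*-monoˡ-≤ 0≤2 (quad-bound (tail² β) (λ i j → s (suc i) (suc j)) nn-tail K 0≤K (β≤K ∘ suc) (c ∘ suc))))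
    (≤-by (0≤⇒nonneg (0≤-* (0≤-* 0≤2 (0≤-sq (c zero))) (0≤-* 0≤K (ι-0≤ (ℤₚ.i≤j⇒0≤j-i (ℤ.+≤+ (ℕ.>-nonZero⁻¹ (2 ℕ.^ n) {{2^n≢0}})))))))
      (trans (cong₂ _-_ (cong (λ t → t * K * sumSq c) (trans (cong ι (ℤₚ.pos-* 2 (2 ℕ.^ n))) (ι-* (ℤ.+ 2) (ℤ.+ (2 ℕ.^ n))))) refl)
        (trans (solve 4 (λ k x y P → con (ℤ.+ 2) :* P :* k :* (x :* x :+ y) :- (con (ℤ.+ 2) :* (x :* x :* k) :+ con (ℤ.+ 2) :* (P :* k :* y)) := con
            (ℤ.+ 2) :* (x :* x) :* (k :* (P :- con 1ℤ)))
          refl K (c zero) (sumSq (c ∘ suc)) (ι (ℤ.+ (2 ℕ.^ n)))) (cong (λ t → ι (ℤ.+ 2) * (c zero * c zero) * (K * t)) (sym (ι-sub (ℤ.+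
              (2 ℕ.^ n)) 1ℤ)))))))
    where
    2^n≢0 = ℕₚ.m^n≢0 2 n
    0≤2 : 0# ≤ ι (ℤ.+ 2)
    0≤2 = ι-0≤ {ℤ.+ 2} (ℤ.+≤+ ℕ.z≤n)
    nn-tail : ∀ d → 0# ≤ quad (tail² β) d d
    nn-tail d = subst (0# ≤_) (quad-0◂0◂ β d) (nn (0# ◂ d))

  quad-split-matrix : ∀ {n} {β γ δ : Matrix n} x → (∀ i j → β i j ≡ γ i j + x * δ i j) → ∀ c → quad β c c ≡ quad γ c c + x * quad δ c c
  quad-split-matrix {β = β} {γ} {δ} x eq c =
    trans (∑-cong λ i → trans (∑-cong λ j → trans (cong (c i * c j *_) (eq i j)) (l (c i * c j) (γ i j) x (δ i j)))
        (trans (∑-+ (λ j → c i * c j * γ i j) (λ j → x * (c i * c j * δ i j))) (cong (∑ (λ j → c i * c j * γ i j) +_) (∑-* x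
            (λ j → c i * c j * δ i j)))))
      (trans (∑-+ (λ i → ∑ (λ j → c i * c j * γ i j)) (λ i → x * ∑ (λ j → c i * c j * δ i j))) (cong (quad γ c c +_) (∑-* x
          (λ i → ∑ λ j → c i * c j * δ i j))))
    where
    l : ∀ u g x d → u * (g + x * d) ≡ u * g + x * (u * d)
    l = solve 4 (λ u g x d → u :* (g :+ x :* d) := u :* g :+ x :* (u :* d)) refl

  -- The skew part of the Gram matrix is √Δ times an integral matrix; a vector on which the latter is
  -- negative is bounded by the conjugate Gram matrix, whose diagonal is small.
  size-bound : ∀ {n} (z : Fin (suc n) → X) (u : Fin (suc n) → ℤ) → let a = λ i j → skew (z i) (z j) in
               (∀ i → (a ·ℤ u) (suc i) ≡ 0ℤ) → ∀ d → (a ·ℤ u) zero ≡ d → ∀ K → 0# ≤ K → (∀ i → conj (b (z i) (z i)) ≤ K) →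
               √Δ * ι (u zero ℤ.* (ℤ.- d)) ≤ ι (ℤ.+ (2 ℕ.^ n)) * K * sumSq (ιⱽ u)
  size-bound {n} z u rows d row₀ K 0≤K diag≤K = ≤-trans step (quad-bound β′ (λ i j → cong conj (b-sym (z i) (z j))) (psd′ z) K 0≤K diag≤K (ιⱽ u))
    where
    a = λ i j → skew (z i) (z j)
    β β′ : Matrix (suc n)
    β i j = b (z i) (z j)
    β′ i j = conj (b (z i) (z j))
    u∙u : quad (ιᴹ a) (ιⱽ u) (ιⱽ u) ≡ ι (u zero ℤ.* d)
    u∙u = trans (quad-· (ιᴹ a) (ιⱽ u) (ιⱽ u)) (trans (cong₂ _+_ (trans (cong (ι (u zero) *_) (trans (ι-· a u zero) (cong ι row₀))) (sym (ι-*
        (u zero) d)))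
      (∑-zero λ i → trans (cong (ι (u (suc i)) *_) (trans (ι-· a u (suc i)) (trans (cong ι (rows i)) ι-0))) (zeroʳ _))) (+-identityʳ _))
    total : quad β (ιⱽ u) (ιⱽ u) ≡ quad β′ (ιⱽ u) (ιⱽ u) + √Δ * ι (u zero ℤ.* d)
    total = trans (quad-split-matrix √Δ (λ i j → skew-≡ (z i) (z j)) (ιⱽ u)) (cong (λ t → quad β′ (ιⱽ u) (ιⱽ u) + √Δ * t) u∙u)
    step : √Δ * ι (u zero ℤ.* (ℤ.- d)) ≤ quad β′ (ιⱽ u) (ιⱽ u)
    step = ≤-by (0≤⇒nonneg (subst (0# ≤_) total (psd z (ιⱽ u)))) (trans (cong (λ t → quad β′ (ιⱽ u) (ιⱽ u) - √Δ * t) (trans (cong ι (sym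
        (ℤₚ.neg-distribʳ-* (u zero) d))) (ι-neg (u zero ℤ.* d))))
      (solve 3 (λ q s t → q :- s :* (:- t) := q :+ s :* t) refl (quad β′ (ιⱽ u) (ιⱽ u)) √Δ (ι (u zero ℤ.* d))))

  quad-right : ∀ k {n} (β : Matrix (k ℕ.+ n)) → (∀ i j → β (i ↑ˡ n) j ≡ 0#) → (∀ i j → β i (j ↑ˡ n) ≡ 0#) → ∀ c →
               quad β c c ≡ quad (λ i j → β (k ↑ʳ i) (k ↑ʳ j)) (c ∘ (k ↑ʳ_)) (c ∘ (k ↑ʳ_))
  quad-right k {n} β l r c = trans (∑-split k _) (trans (cong₂ _+_ (∑-zero λ i → ∑-zero λ j → trans (cong (c (i ↑ˡ n) * c j *_) (l i j)) (zeroʳ _))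
      (∑-cong λ i → trans (∑-split k (λ j → c (k ↑ʳ i) * c j * β (k ↑ʳ i) j)) (trans (cong (_+ ∑ (λ j → c (k ↑ʳ i) * c (k ↑ʳ j) * β (k ↑ʳ i)
          (k ↑ʳ j))) (∑-zero λ j → trans (cong (c (k ↑ʳ i) * c (j ↑ˡ n) *_) (r (k ↑ʳ i) j)) (zeroʳ _))) (+-identityˡ _))))
    (+-identityˡ _))

  quad-left : ∀ k {n} (β : Matrix (k ℕ.+ n)) c → (∀ i → c (k ↑ʳ i) ≡ 0#) →
              quad β c c ≡ quad (λ i j → β (i ↑ˡ n) (j ↑ˡ n)) (c ∘ (_↑ˡ n)) (c ∘ (_↑ˡ n))
  quad-left k {n} β c c≡0 = trans (∑-split k _) (trans (cong₂ _+_
      (∑-cong λ i → trans (∑-split k (λ j → c (i ↑ˡ n) * c j * β (i ↑ˡ n) j)) (trans (cong (∑ (λ j → c (i ↑ˡ n) * c (j ↑ˡ n) * β (i ↑ˡ n)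
          (j ↑ˡ n)) +_) (∑-zero λ j → trans (cong (λ t → c (i ↑ˡ n) * t * β (i ↑ˡ n) (k ↑ʳ j)) (c≡0 j)) (trans (cong (_* β (i ↑ˡ n) (k ↑ʳ j))
          (zeroʳ _)) (zeroˡ _)))) (+-identityʳ _)))
      (∑-zero λ i → ∑-zero λ j → trans (cong (λ t → t * c j * β (k ↑ʳ i) j) (c≡0 i)) (trans (cong (_* β (k ↑ʳ i) j) (zeroˡ _)) (zeroˡ _))))
    (+-identityʳ _))

  join : ∀ {k n} → (Fin k → X) → (Fin n → X) → Fin (k ℕ.+ n) → X
  join {k} v w = [ v , w ]′ ∘ splitAt k

  join-ˡ : ∀ {k n} (v : Fin k → X) (w : Fin n → X) i → join v w (i ↑ˡ n) ≡ v i
  join-ˡ {k} {n} v w i = cong [ v , w ]′ (Finₚ.splitAt-↑ˡ k i n)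

  join-ʳ : ∀ {k n} (v : Fin k → X) (w : Fin n → X) i → join v w (k ↑ʳ i) ≡ w i
  join-ʳ {k} {n} v w i = cong [ v , w ]′ (Finₚ.splitAt-↑ʳ k n i)

  independence : ∀ {k n} (v : Fin k → X) (w : Fin n → X) (g : Fin k → Fin k → ℤ) →
                 (∀ i j → b (v i) (v j) ≡ ι (g i j)) → (∀ i j → skew (v i) (w j) ≡ 0ℤ) →
                 PosDef g → PosDef (λ i j → skew (w i) (w j)) →
                 ∀ c → (∀ i → ((λ i j → b (join v w i) (join v w j)) · c) i ≡ 0#) → ∀ i → c i ≡ 0#
  independence {k} {n} v w g bv≡ vw≡0 pd-v pd-w c null i = subst (λ i → c i ≡ 0#) (Finₚ.join-splitAt k n i) (each (splitAt k i))
    where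
    z = join v w
    β β′ σ : Matrix (k ℕ.+ n)
    β i j = b (z i) (z j)
    β′ i j = conj (b (z i) (z j))
    σ i j = ι (skew (z i) (z j))
    qβ≡0 : quad β c c ≡ 0#
    qβ≡0 = trans (quad-· β c c) (∑-zero λ i → trans (cong (c i *_) (null i)) (zeroʳ (c i)))
    vv≡0 : ∀ i j → skew (v i) (v j) ≡ 0ℤ
    vv≡0 i j = skew-unique (v i) (v j) 0ℤ (trans (bv≡ i j) (sym (trans (cong₂ (λ s t → conj s + √Δ * t) (bv≡ i j) ι-0) (trans (cong₂ _+_ (conj-ι
        (g i j)) (zeroʳ √Δ)) (+-identityʳ (ι (g i j)))))))
    rowˡ : ∀ i j → skew (v i) (z j) ≡ 0ℤ
    rowˡ i j = subst (λ j → skew (v i) (z j) ≡ 0ℤ) (Finₚ.join-splitAt k n j) (go (splitAt k j))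
      where
      go : ∀ s → skew (v i) (z (Fin.join k n s)) ≡ 0ℤ
      go (inj₁ j) = trans (cong (skew (v i)) (join-ˡ v w j)) (vv≡0 i j)
      go (inj₂ j) = trans (cong (skew (v i)) (join-ʳ v w j)) (vw≡0 i j)
    σ-left : ∀ i j → σ (i ↑ˡ n) j ≡ 0#
    σ-left i j = trans (cong ι (trans (cong (λ x → skew x (z j)) (join-ˡ v w i)) (rowˡ i j))) ι-0
    σ-right : ∀ i j → σ i (j ↑ˡ n) ≡ 0#
    σ-right i j = trans (cong ι (skew-sym (z i) (z (j ↑ˡ n)))) (σ-left j i)
    y = c ∘ (k ↑ʳ_)
    qσ : quad σ c c ≡ quad (ιᴹ (λ i j → skew (w i) (w j))) y y
    qσ = trans (quad-right k σ σ-left σ-right c) (quad-cong (λ i j → cong ι (cong₂ skew (join-ʳ v w i) (join-ʳ v w j))) (λ _ → refl) (λ _ → refl))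
    -- The form of β vanishes at c and is the conjugate form, which is nonnegative, plus `√Δ` times
    -- the form of σ. As σ vanishes against every v, its form depends on y only.
    qσ≤0 : quad σ c c ≤ 0#
    qσ≤0 = *-cancel-≤ 0<√Δ (≤-by (0≤⇒nonneg (psd′ z c)) (trans (cong₂ _-_ (trans (zeroʳ √Δ) (trans (sym qβ≡0) (quad-split-matrix √Δ (λ i j → skew-≡
        (z i) (z j)) c))) refl)
      (solve 2 (λ u v → u :+ v :- v := u) refl (quad β′ c c) (√Δ * quad σ c c))))
    y≡0 : ∀ j → y j ≡ 0#
    y≡0 = pd-w y (subst (_≤ 0#) qσ qσ≤0)
    x≡0 : ∀ i → c (i ↑ˡ n) ≡ 0#
    x≡0 = pd-v (c ∘ (_↑ˡ n)) (≤-reflexive (trans (quad-cong (λ i j → sym (trans (cong₂ b (join-ˡ v w i) (join-ˡ v w j)) (bv≡ i j))) (λ _ → refl)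
        (λ _ → refl)) (trans (sym (quad-left k β c y≡0)) qβ≡0)))
    each : ∀ s → c (Fin.join k n s) ≡ 0#
    each (inj₁ i) = x≡0 i
    each (inj₂ j) = y≡0 j

open NumberTheory using (Selection; selection; sqrt-irrational; minor₂; minor₃; gram₂; gram₃; gram₄; u₁; u₂; n₁; n₂; n₃;
  u-row₁; u-row₂; u-row₃; n-row₁; n-row₂; n-row₃; size₂; size₃; size₄; +≤) renaming (0<-* to 0<-*ℤ)

-- The vectors v_c and w_c and their integral matrices G and A

module Families (S : Setting) (m : ℕ) (1≤m : 1 ℕ.≤ m) (v w : ℕ → Setting.X S) (α : ℕ → Setting.A S)
  (2≤√Δ : Setting._≤_ S (Setting.ι S (ℤ.+ 2)) (Setting.√Δ S))
  (v-norm : ∀ c → 1 ℕ.≤ c → Setting.b S (v c) (v c) ≡ Setting.ι S (ℤ.+ m ℤ.* ℤ.+ c))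
  (w-norm : ∀ c → 1 ℕ.≤ c → Setting.b S (w c) (w c) ≡ Setting._*_ S (Setting.ι S (ℤ.+ m)) (α c))
  (α-skew : ∀ c → α c ≡ Setting._+_ S (Setting.conj S (α c)) (Setting._*_ S (Setting.√Δ S) (Setting.ι S (ℤ.+ c))))
  (0<α′ : ∀ c → 1 ℕ.≤ c → Setting._<_ S (Setting.0# S) (Setting.conj S (α c)))
  (α′≤1 : ∀ c → Setting._≤_ S (Setting.conj S (α c)) (Setting.1# S)) where

  open Setting S
  open SettingProperties S

  -- C and D are selected from `φv` before any inner product is known to be a rational integer, so
  -- the function is total, with default 0.
  φv : ℕ → ℕ → ℤ
  φv c d with skew (v c) (v d) ℤ.≟ 0ℤ
  ... | yes eq = proj₁ (rational (v c) (v d) eq)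
  ... | no _ = 0ℤ

  φv-≡ : ∀ c d → skew (v c) (v d) ≡ 0ℤ → b (v c) (v d) ≡ ι (φv c d)
  φv-≡ c d eq with skew (v c) (v d) ℤ.≟ 0ℤ
  ... | yes eq′ = proj₂ (rational (v c) (v d) eq′)
  ... | no neq = contradiction eq neq

  φw : ℕ → ℕ → ℤ
  φw c d = skew (w c) (w d)

  ⟨_⟩ : ℕ → ℤ
  ⟨ c ⟩ = ℤ.+ m ℤ.* ℤ.+ c

  module _ (φ : ℕ → ℕ → ℤ) where

    -- The older vector is the first argument of `φ`, in agreement with `gram₃` and `gram₄`; the
    -- same entry fills both triangles.
    gram : ∀ {n} → (Fin n → ℕ) → Fin n → Fin n → ℤ
    gram cs zero zero = ⟨ cs zero ⟩
    gram cs zero (suc j) = φ (cs (suc j)) (cs zero)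
    gram cs (suc i) zero = φ (cs (suc i)) (cs zero)
    gram cs (suc i) (suc j) = gram (cs ∘ suc) i j

    gram-sym : ∀ {n} (cs : Fin n → ℕ) i j → gram cs i j ≡ gram cs j i
    gram-sym cs zero zero = refl
    gram-sym cs zero (suc j) = refl
    gram-sym cs (suc i) zero = refl
    gram-sym cs (suc i) (suc j) = gram-sym (cs ∘ suc) i j

  ε : {B : Set} → Fin 0 → B
  ε ()

  -- Families are listed with the newest vector first, so that their tails are the earlier families.
  cs₁ : Fin 1 → ℕ
  cs₁ = 1 ◂ ε

  cs₂ : Fin 2 → ℕ
  cs₂ = 2 ◂ cs₁

  cs₃ : ℕ → Fin 3 → ℕ
  cs₃ C = C ◂ cs₂

  cs₄ : ℕ → ℕ → Fin 4 → ℕ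
  cs₄ C D = D ◂ cs₃ C

  -- k₂, k₃, k₄ are the adjugate columns that the earlier vectors of the family annihilate.
  module Kernel (φ : ℕ → ℕ → ℤ) where

    e = φ 1 2

    k₂ : Fin 2 → ℤ
    k₂ = ⟨ 1 ⟩ ◂ ℤ.- e ◂ ε

    private
      r₂ : ∀ x y p q → x ℤ.* q ℤ.+ (y ℤ.* p ℤ.+ 0ℤ) ≡ p ℤ.* y ℤ.+ q ℤ.* x
      r₂ = solve-∀
      r₃ : ∀ x y z p q r → x ℤ.* r ℤ.+ (y ℤ.* q ℤ.+ (z ℤ.* p ℤ.+ 0ℤ)) ≡ p ℤ.* z ℤ.+ q ℤ.* y ℤ.+ r ℤ.* x
      r₃ = solve-∀
      r₄ : ∀ x y z t p q r s → x ℤ.* s ℤ.+ (y ℤ.* r ℤ.+ (z ℤ.* q ℤ.+ (t ℤ.* p ℤ.+ 0ℤ))) ≡ p ℤ.* t ℤ.+ q ℤ.* z ℤ.+ r ℤ.* y ℤ.+ s ℤ.* x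
      r₄ = solve-∀
      s₂ : ∀ a e → a ℤ.* (ℤ.- e) ℤ.+ e ℤ.* a ≡ 0ℤ
      s₂ = solve-∀
      t₂ : ∀ a b e → e ℤ.* (ℤ.- e) ℤ.+ b ℤ.* a ≡ a ℤ.* b ℤ.- e ℤ.* e
      t₂ = solve-∀

    k₂-rows : ∀ i → (gram φ cs₂ ·ℤ k₂) (suc i) ≡ 0ℤ
    k₂-rows zero = trans (r₂ ⟨ 1 ⟩ (ℤ.- e) ⟨ 1 ⟩ e) (s₂ ⟨ 1 ⟩ e)

    k₂-row₀ : (gram φ cs₂ ·ℤ k₂) zero ≡ gram₂ m φ
    k₂-row₀ = trans (r₂ ⟨ 1 ⟩ (ℤ.- e) e ⟨ 2 ⟩) (t₂ ⟨ 1 ⟩ ⟨ 2 ⟩ e)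

    module _ (C : ℕ) where
      f = φ 1 C
      g = φ 2 C

      k₃ : Fin 3 → ℤ
      k₃ = gram₂ m φ ◂ u₂ ⟨ 1 ⟩ ⟨ 2 ⟩ e f g ◂ u₁ ⟨ 1 ⟩ ⟨ 2 ⟩ e f g ◂ ε

      k₃-rows : ∀ i → (gram φ (cs₃ C) ·ℤ k₃) (suc i) ≡ 0ℤ
      k₃-rows zero = trans (r₃ _ (k₃ (suc zero)) (k₃ (suc (suc zero))) e ⟨ 2 ⟩ g) (u-row₂ ⟨ 1 ⟩ ⟨ 2 ⟩ e f g)
      k₃-rows (suc zero) = trans (r₃ _ (k₃ (suc zero)) (k₃ (suc (suc zero))) ⟨ 1 ⟩ e f) (u-row₁ ⟨ 1 ⟩ ⟨ 2 ⟩ e f g)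

      k₃-row₀ : (gram φ (cs₃ C) ·ℤ k₃) zero ≡ gram₃ m φ C
      k₃-row₀ = trans (r₃ _ (k₃ (suc zero)) (k₃ (suc (suc zero))) f g ⟨ C ⟩) (u-row₃ ⟨ 1 ⟩ ⟨ 2 ⟩ ⟨ C ⟩ e f g)

      module _ (D : ℕ) where
        h = φ 1 D
        i = φ 2 D
        j = φ C D

        N₁ = n₁ ⟨ 1 ⟩ ⟨ 2 ⟩ ⟨ C ⟩ e f g h i j
        N₂ = n₂ ⟨ 1 ⟩ ⟨ 2 ⟩ ⟨ C ⟩ e f g h i j
        N₃ = n₃ ⟨ 1 ⟩ ⟨ 2 ⟩ ⟨ C ⟩ e f g h i j

        k₄ : Fin 4 → ℤ
        k₄ = gram₃ m φ C ◂ N₃ ◂ N₂ ◂ N₁ ◂ ε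

        k₄-rows : ∀ i → (gram φ (cs₄ C D) ·ℤ k₄) (suc i) ≡ 0ℤ
        k₄-rows zero = trans (r₄ (gram₃ m φ C) N₃ N₂ N₁ f g ⟨ C ⟩ j) (n-row₃ ⟨ 1 ⟩ ⟨ 2 ⟩ ⟨ C ⟩ e f g h i j)
        k₄-rows (suc zero) = trans (r₄ (gram₃ m φ C) N₃ N₂ N₁ e ⟨ 2 ⟩ g i) (n-row₂ ⟨ 1 ⟩ ⟨ 2 ⟩ ⟨ C ⟩ e f g h i j)
        k₄-rows (suc (suc zero)) = trans (r₄ (gram₃ m φ C) N₃ N₂ N₁ ⟨ 1 ⟩ e f h) (n-row₁ ⟨ 1 ⟩ ⟨ 2 ⟩ ⟨ C ⟩ e f g h i j)

        k₄-row₀ : (gram φ (cs₄ C D) ·ℤ k₄) zero ≡ gram₄ m φ C D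
        k₄-row₀ = r₄ (gram₃ m φ C) N₃ N₂ N₁ h i j ⟨ D ⟩

  0<⟨1⟩ : 0ℤ ℤ.< ⟨ 1 ⟩
  0<⟨1⟩ = 0<-*ℤ (ℤ.+<+ 1≤m) (ℤ.+<+ ℕₚ.≤-refl)

  module _ (φ : ℕ → ℕ → ℤ) where
    open Kernel φ

    posDef-by : ∀ {n} (cs : Fin (suc n) → ℕ) (u : Fin (suc n) → ℤ) → 0ℤ ℤ.< u zero → (∀ i → (gram φ cs ·ℤ u) (suc i) ≡ 0ℤ) →
                ∀ {d} → 0ℤ ℤ.< d → (gram φ cs ·ℤ u) zero ≡ d → PosDef (gram φ (cs ∘ suc)) → PosDef (gram φ cs)
    posDef-by cs u 0<u rows 0<d row₀ = posDef-step (gram φ cs) (gram-sym φ cs) u 0<u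
      (λ i → trans (ι-· (gram φ cs) u (suc i)) (trans (cong ι (rows i)) ι-0)) 0<d (trans (ι-· (gram φ cs) u zero) (cong ι row₀))

    posDef₁ : PosDef (gram φ cs₁)
    posDef₁ = posDef-by cs₁ (1ℤ ◂ ε) (ℤ.+<+ ℕₚ.≤-refl) (λ ()) 0<⟨1⟩ (l ⟨ 1 ⟩) λ _ _ ()
      where
      l : ∀ a → 1ℤ ℤ.* a ℤ.+ 0ℤ ≡ a
      l = solve-∀

    posDef₂ : 0ℤ ℤ.< gram₂ m φ → PosDef (gram φ cs₂)
    posDef₂ 0<d = posDef-by cs₂ k₂ 0<⟨1⟩ k₂-rows 0<d k₂-row₀ posDef₁

    posDef₃ : ∀ C → 0ℤ ℤ.< gram₂ m φ → 0ℤ ℤ.< gram₃ m φ C → PosDef (gram φ (cs₃ C))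
    posDef₃ C 0<d₂ 0<d₃ = posDef-by (cs₃ C) (k₃ C) 0<d₂ (k₃-rows C) 0<d₃ (k₃-row₀ C) (posDef₂ 0<d₂)

    posDef₄ : ∀ C D → 0ℤ ℤ.< gram₂ m φ → 0ℤ ℤ.< gram₃ m φ C → 0ℤ ℤ.< gram₄ m φ C D → PosDef (gram φ (cs₄ C D))
    posDef₄ C D 0<d₂ 0<d₃ 0<d₄ = posDef-by (cs₄ C D) (k₄ C D) 0<d₃ (k₄-rows C D) 0<d₄ (k₄-row₀ C D) (posDef₃ C 0<d₂ 0<d₃)

  neg⊎pos : ∀ {x} → x ≢ 0ℤ → x ℤ.< 0ℤ ⊎ 0ℤ ℤ.< x
  neg⊎pos {ℤ.+ zero} neq = contradiction refl neq
  neg⊎pos {ℤ.+ suc _} _ = inj₂ (ℤ.+<+ (ℕ.s≤s ℕ.z≤n))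
  neg⊎pos {ℤ.-[1+ _ ]} _ = inj₁ ℤ.-<+

  Integral : ∀ {n} → (Fin n → ℕ) → Set
  Integral {zero} cs = ⊤
  Integral {suc n} cs = 1 ℕ.≤ cs zero × (∀ j → skew (v (cs (suc j))) (v (cs zero)) ≡ 0ℤ) × Integral (cs ∘ suc)

  gram-v : ∀ {n} (cs : Fin n → ℕ) → Integral cs → ∀ i j → b (v (cs i)) (v (cs j)) ≡ ι (gram φv cs i j)
  gram-v cs (1≤c , skew≡0 , ints) zero zero = v-norm (cs zero) 1≤c
  gram-v cs (1≤c , skew≡0 , ints) zero (suc j) = trans (b-sym _ _) (φv-≡ (cs (suc j)) (cs zero) (skew≡0 j))
  gram-v cs (1≤c , skew≡0 , ints) (suc i) zero = φv-≡ (cs (suc i)) (cs zero) (skew≡0 i)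
  gram-v cs (1≤c , skew≡0 , ints) (suc i) (suc j) = gram-v (cs ∘ suc) ints i j

  -- G u = (d, 0, ..., 0), so the semidefinite form takes the value u₀ d at u.
  minor-nonneg : ∀ {n} (cs : Fin (suc n) → ℕ) → Integral cs → (u : Fin (suc n) → ℤ) → 0ℤ ℤ.< u zero → (∀ i → (gram φv cs ·ℤ u) (suc i) ≡ 0ℤ) →
                 ∀ {d} → (gram φv cs ·ℤ u) zero ≡ d → d ≢ 0ℤ → 0ℤ ℤ.< d
  minor-nonneg cs ints u 0<u rows {d} row₀ d≢0 = [ (λ d<0 → ⊥-elim (ℤₚ.<⇒≱ (ud<0 d<0) 0≤ud)) , (λ 0<d → 0<d) ]′ (neg⊎pos d≢0)
    where
    z = v ∘ cs
    q : quad (λ i j → b (z i) (z j)) (ιⱽ u) (ιⱽ u) ≡ ι (u zero ℤ.* d)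
    q = trans (quad-cong {c = ιⱽ u} {ιⱽ u} {ιⱽ u} {ιⱽ u} (gram-v cs ints) (λ _ → refl) (λ _ → refl)) (trans (quad-· (ιᴹ (gram φv cs)) (ιⱽ u) (ιⱽ u))
      (trans (cong₂ _+_ (trans (cong (ι (u zero) *_) (trans (ι-· (gram φv cs) u zero) (cong ι row₀))) (sym (ι-* (u zero) d)))
        (∑-zero λ i → trans (cong (ι (u (suc i)) *_) (trans (ι-· (gram φv cs) u (suc i)) (trans (cong ι (rows i)) ι-0))) (zeroʳ _))) (+-identityʳ _)))
    0≤ud : 0ℤ ℤ.≤ u zero ℤ.* d
    0≤ud = ι-cancel-≤ (subst₂ _≤_ (sym ι-0) q (psd z (ιⱽ u)))
    ud<0 : d ℤ.< 0ℤ → u zero ℤ.* d ℤ.< 0ℤ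
    ud<0 d<0 = subst (u zero ℤ.* d ℤ.<_) (ℤₚ.*-zeroʳ (u zero)) (ℤₚ.*-monoˡ-<-pos (u zero) {{ℤ.positive 0<u}} d<0)

  -- α_c exceeds its conjugate by c √Δ, so the skew part of m α_c is m c. This is why A has the same
  -- diagonal as G.
  gram-w : ∀ {n} (cs : Fin n → ℕ) → (∀ i → 1 ℕ.≤ cs i) → ∀ i j → skew (w (cs i)) (w (cs j)) ≡ gram φw cs i j
  gram-w cs 1≤cs zero zero = skew-unique _ _ _ (trans (w-norm c (1≤cs zero)) (trans (cong (ι (ℤ.+ m) *_) (α-skew c))
    (trans (solve 4 (λ m a s c → m :* (a :+ s :* c) := m :* a :+ s :* (m :* c)) refl (ι (ℤ.+ m)) (conj (α c)) √Δ (ι (ℤ.+ c)))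
      (cong₂ (λ p q → p + √Δ * q) (trans (cong (_* conj (α c)) (sym (conj-ι (ℤ.+ m)))) (trans (sym (conj-* (ι (ℤ.+ m)) (α c))) (cong conj (sym
          (w-norm c (1≤cs zero)))))) (sym (ι-* (ℤ.+ m) (ℤ.+ c)))))))
    where c = cs zero
  gram-w cs 1≤cs zero (suc j) = skew-sym (w (cs zero)) (w (cs (suc j)))
  gram-w cs 1≤cs (suc i) zero = refl
  gram-w cs 1≤cs (suc i) (suc j) = gram-w (cs ∘ suc) (1≤cs ∘ suc) i j

  ∑ℤ-cong : ∀ {n} {f g : Fin n → ℤ} → (∀ i → f i ≡ g i) → ∑ℤ f ≡ ∑ℤ g
  ∑ℤ-cong {zero} eq = refl
  ∑ℤ-cong {suc n} eq = cong₂ ℤ._+_ (eq zero) (∑ℤ-cong (eq ∘ suc))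

  0≤ι : ∀ n → 0# ≤ ι (ℤ.+ n)
  0≤ι n = ι-0≤ (ℤ.+≤+ ℕ.z≤n)

  -- `size-bound` with K = m, since the conjugate of Q(w_c) is m α_c′ ≤ m; the positive factor u₀
  -- (-d) is then cancelled.
  √Δ-bound : ∀ {n} (cs : Fin (suc n) → ℕ) → (∀ i → 1 ℕ.≤ cs i) → (u : Fin (suc n) → ℤ) → 0ℤ ℤ.< u zero → (∀ i → (gram φw cs ·ℤ u) (suc i) ≡ 0ℤ) →
             ∀ {d} → (gram φw cs ·ℤ u) zero ≡ d → d ℤ.< 0ℤ → ∀ K →
             ℤ.+ (2 ℕ.^ n ℕ.* m) ℤ.* ∑ℤ (λ i → u i ℤ.* u i) ℤ.≤ ℤ.+ K ℤ.* (u zero ℤ.* ℤ.- d) → √Δ ≤ ι (ℤ.+ K)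
  √Δ-bound {n} cs 1≤cs u 0<u rows {d} row₀ d<0 K le = *-cancel-≤ (ι-0< (0<-*ℤ 0<u (ℤₚ.neg-mono-< d<0)))
    (subst₂ _≤_ (*-comm √Δ _) (trans (ι-* (ℤ.+ K) P) (*-comm _ _)) (≤-trans (size-bound z u rows′ d row₀′ (ι (ℤ.+ m)) (0≤ι m) diag≤)
      (subst (_≤ ι (ℤ.+ K ℤ.* P)) eq (ι-mono-≤ le))))
    where
    z = w ∘ cs
    P = u zero ℤ.* ℤ.- d
    eq : ι (ℤ.+ (2 ℕ.^ n ℕ.* m) ℤ.* ∑ℤ (λ i → u i ℤ.* u i)) ≡ ι (ℤ.+ (2 ℕ.^ n)) * ι (ℤ.+ m) * sumSq (ιⱽ u)
    eq = trans (ι-* (ℤ.+ (2 ℕ.^ n ℕ.* m)) (∑ℤ (λ i → u i ℤ.* u i))) (cong₂ _*_ (trans (cong ι (ℤₚ.pos-* (2 ℕ.^ n) m)) (ι-* (ℤ.+ (2 ℕ.^ n)) (ℤ.+ m)))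
      (trans (ι-∑ λ i → u i ℤ.* u i) (∑-cong λ i → ι-* (u i) (u i))))
    conv : ∀ i → ((λ i j → skew (z i) (z j)) ·ℤ u) i ≡ (gram φw cs ·ℤ u) i
    conv i = ∑ℤ-cong λ j → cong (u j ℤ.*_) (gram-w cs 1≤cs i j)
    rows′ : ∀ i → ((λ i j → skew (z i) (z j)) ·ℤ u) (suc i) ≡ 0ℤ
    rows′ i = trans (conv (suc i)) (rows i)
    row₀′ : ((λ i j → skew (z i) (z j)) ·ℤ u) zero ≡ d
    row₀′ = trans (conv zero) row₀
    diag≤ : ∀ i → conj (b (z i) (z i)) ≤ ι (ℤ.+ m)
    diag≤ i = subst₂ _≤_ (sym (trans (cong conj (w-norm (cs i) (1≤cs i))) (trans (conj-* (ι (ℤ.+ m)) (α (cs i))) (cong (_* conj (α (cs i))) (conj-ι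
        (ℤ.+ m))))))
      (*-identityʳ _) (*-monoˡ-≤ (0≤ι m) (α′≤1 (cs i)))

  module _ (σ : Selection m φw) where
    open Selection σ

    private
      1≤C = ℕₚ.<⇒≤ 2≤C

    1≤cs₂ : ∀ i → 1 ℕ.≤ cs₂ i
    1≤cs₂ zero = ℕ.s≤s ℕ.z≤n
    1≤cs₂ (suc zero) = ℕₚ.≤-refl

    1≤cs₃ : ∀ i → 1 ℕ.≤ cs₃ C i
    1≤cs₃ zero = 1≤C
    1≤cs₃ (suc i) = 1≤cs₂ i

    1≤cs₄ : ∀ i → 1 ℕ.≤ cs₄ C D i
    1≤cs₄ zero = 1≤D
    1≤cs₄ (suc i) = 1≤cs₃ i

    open Kernel φw

    w-gram₂>0 : ι (ℤ.+ (8 ℕ.* m ℕ.^ 2)) < √Δ → 0ℤ ℤ.< gram₂ m φw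
    w-gram₂>0 big = [ (λ d<0 → contradiction (√Δ-bound cs₂ 1≤cs₂ k₂ 0<⟨1⟩ k₂-rows k₂-row₀ d<0 (8 ℕ.* m ℕ.^ 2) (size₂ m 1≤m e d<0)) (<⇒≱ big)) ,
        (λ p → p) ]′ (neg⊎pos gram₂≢0)

    w-gram₃>0 : 0ℤ ℤ.< gram₂ m φw → ι (ℤ.+ (36 ℕ.* C ℕ.* m ℕ.^ 3)) < √Δ → 0ℤ ℤ.< gram₃ m φw C
    w-gram₃>0 0<d₂ big = [ (λ d<0 → contradiction (√Δ-bound (cs₃ C) 1≤cs₃ (k₃ C) 0<d₂ (k₃-rows C) (k₃-row₀ C) d<0 (36 ℕ.* C ℕ.* m ℕ.^ 3)
        (size₃ m 1≤m C 2≤C e (f C) (g C) 0<d₂ d<0)) (<⇒≱ big)) , (λ p → p) ]′ (neg⊎pos (gram₃≢0 0<d₂))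

    w-gram₄>0 : 0ℤ ℤ.< gram₂ m φw → 0ℤ ℤ.< gram₃ m φw C → ι (ℤ.+ (192 ℕ.* C ℕ.* D ℕ.* m ℕ.^ 4)) < √Δ → 0ℤ ℤ.< gram₄ m φw C D
    w-gram₄>0 0<d₂ 0<d₃ big = [ (λ d<0 → contradiction (√Δ-bound (cs₄ C D) 1≤cs₄ (k₄ C D) 0<d₃ (k₄-rows C D) (k₄-row₀ C D) d<0
        (192 ℕ.* C ℕ.* D ℕ.* m ℕ.^ 4)
      (size₄ m 1≤m C 2≤C D 1≤D e (f C) (g C) (h C D) (i C D) (j C D) 0<d₂ 0<d₃ d<0)) (<⇒≱ big)) , (λ p → p) ]′ (neg⊎pos (gram₄≢0 0<d₂ 0<d₃))

  module _ (σ : Selection m φv) where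
    open Selection σ
    open Kernel φv

    v-gram₂>0 : Integral cs₂ → 0ℤ ℤ.< gram₂ m φv
    v-gram₂>0 ints = minor-nonneg cs₂ ints k₂ 0<⟨1⟩ k₂-rows k₂-row₀ gram₂≢0

    v-posDef₃ : Integral (cs₃ C) → 0ℤ ℤ.< gram₃ m φv C × PosDef (gram φv (cs₃ C))
    v-posDef₃ ints = 0<d₃ , posDef₃ φv C 0<d₂ 0<d₃
      where
      0<d₂ = v-gram₂>0 (proj₂ (proj₂ ints))
      0<d₃ = minor-nonneg (cs₃ C) ints (k₃ C) 0<d₂ (k₃-rows C) (k₃-row₀ C) (gram₃≢0 0<d₂)

    v-posDef₄ : Integral (cs₄ C D) → PosDef (gram φv (cs₄ C D))
    v-posDef₄ ints = posDef₄ φv C D 0<d₂ 0<d₃ (minor-nonneg (cs₄ C D) ints (k₄ C D) 0<d₃ (k₄-rows C D) (k₄-row₀ C D) (gram₄≢0 0<d₂ 0<d₃))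
      where
      0<d₂ = v-gram₂>0 (proj₂ (proj₂ (proj₂ (proj₂ ints))))
      0<d₃ = proj₁ (v-posDef₃ (proj₂ (proj₂ ints)))

  -- Independence read off from the Gram matrix: a linear relation between the vectors is sent to 0
  -- by it.
  Independent : ∀ {k n} → (Fin k → ℕ) → (Fin n → ℕ) → Set
  Independent cv cw = let z = join (v ∘ cv) (w ∘ cw) in ∀ c → (∀ i → ((λ i j → b (z i) (z j)) · c) i ≡ 0#) → ∀ i → c i ≡ 0#

  independent : ∀ {k n} (cv : Fin k → ℕ) (cw : Fin n → ℕ) → Integral cv → PosDef (gram φv cv) → (∀ i → 1 ℕ.≤ cw i) → PosDef (gram φw cw) →
                (∀ i j → skew (v (cv i)) (w (cw j)) ≡ 0ℤ) → Independent cv cw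
  independent cv cw ints pd-v 1≤cw pd-w vw≡0 = independence (v ∘ cv) (w ∘ cw) (gram φv cv) (gram-v cv ints) vw≡0 pd-v
    λ y le → pd-w y (subst (_≤ 0#) (quad-cong {c = y} {y} {y} {y} (λ i j → cong ι (gram-w cw 1≤cw i j)) (λ _ → refl) (λ _ → refl)) le)

  0<ι⟨⟩ : ∀ {c} → 1 ℕ.≤ c → 0# < ι ⟨ c ⟩
  0<ι⟨⟩ 1≤c = ι-0< (0<-*ℤ (ℤ.+<+ 1≤m) (ℤ.+<+ 1≤c))

  √Δ*c≤α : ∀ c → 1 ℕ.≤ c → √Δ * ι (ℤ.+ c) ≤ α c
  √Δ*c≤α c 1≤c = subst₂ _≤_ (+-identityˡ _) (sym (α-skew c)) (+-mono-≤ (<⇒≤ (0<α′ c 1≤c)) ≤-refl)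

  α′≤α : ∀ c → conj (α c) ≤ α c
  α′≤α c = subst₂ _≤_ (+-identityʳ _) (sym (α-skew c)) (+-mono-≤ ≤-refl (0≤-* (<⇒≤ 0<√Δ) (0≤ι c)))

  0≤α : ∀ c → 1 ℕ.≤ c → 0# ≤ α c
  0≤α c 1≤c = ≤-trans (0≤-* (<⇒≤ 0<√Δ) (0≤ι c)) (√Δ*c≤α c 1≤c)

  1≤√Δ : 1# ≤ √Δ
  1≤√Δ = ≤-trans (subst (_≤ ι (ℤ.+ 2)) ι-1 (ι-mono-≤ (+≤ (ℕ.s≤s ℕ.z≤n)))) 2≤√Δ

  -- The floors vary with c, but 0 < α_c′ ≤ 1 ≤ √Δ places α_c between c √Δ and (c + 1) √Δ.
  α-mono : ∀ c d → 1 ℕ.≤ c → c ℕ.≤ d → α c ≤ α d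
  α-mono c d 1≤c c≤d with c ℕ.≟ d
  ... | yes refl = ≤-refl
  ... | no c≢d = ≤-trans (subst₂ _≤_ (sym (α-skew c)) eq (+-mono-≤ (≤-trans (α′≤1 c) 1≤√Δ) ≤-refl))
    (≤-trans (*-monoˡ-≤ (<⇒≤ 0<√Δ) (ι-mono-≤ (+≤ (ℕₚ.≤∧≢⇒< c≤d c≢d)))) (√Δ*c≤α d (ℕₚ.≤-trans 1≤c c≤d)))
    where
    eq : √Δ + √Δ * ι (ℤ.+ c) ≡ √Δ * ι (ℤ.+ (suc c))
    eq = trans (solve 2 (λ s c → s :+ s :* c := s :* (con 1ℤ :+ c)) refl √Δ (ι (ℤ.+ c))) (cong (√Δ *_) (sym (ι-+ 1ℤ (ℤ.+ c))))

  private
    l₄ : ∀ m E → ℤ.+ (4 ℕ.* E ℕ.* m ℕ.^ 2) ≡ ℤ.+ 4 ℤ.* (ℤ.+ (m ℕ.* E) ℤ.* ℤ.+ m)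
    l₄ m E = trans (cong ℤ.+_ (l m E)) (trans (ℤₚ.pos-* 4 (m ℕ.* E ℕ.* m)) (cong (ℤ.+ 4 ℤ.*_) (ℤₚ.pos-* (m ℕ.* E) m)))
      where
      l : ∀ m E → 4 ℕ.* E ℕ.* (m ℕ.* (m ℕ.* 1)) ≡ 4 ℕ.* (m ℕ.* E ℕ.* m)
      l = solveℕ-∀

  v-v-integral : ∀ c d E → 1 ℕ.≤ c → 1 ℕ.≤ d → c ℕ.* d ℕ.≤ E → ι (ℤ.+ (4 ℕ.* E ℕ.* m ℕ.^ 2)) < ι Δ → skew (v c) (v d) ≡ 0ℤ
  v-v-integral c d E 1≤c 1≤d cd≤E big = [ (λ eq → eq) , (λ small → contradiction (≤-trans small le) (<⇒≱ big)) ]′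
    (integral-or-small (v c) (v d) (ι ⟨ c ⟩ * ι ⟨ d ⟩) (subst (0# <_) (sym (v-norm c 1≤c)) (0<ι⟨⟩ 1≤c)) (subst (0# <_) (sym (conj-v c 1≤c))
        (0<ι⟨⟩ 1≤c))
      (≤-reflexive (cong₂ _*_ (v-norm c 1≤c) (v-norm d 1≤d))) (≤-reflexive (cong₂ _*_ (conj-v c 1≤c) (conj-v d 1≤d))))
    where
    conj-v : ∀ c → 1 ℕ.≤ c → conj (b (v c) (v c)) ≡ ι ⟨ c ⟩
    conj-v c 1≤c = trans (cong conj (v-norm c 1≤c)) (conj-ι ⟨ c ⟩)
    eq : ⟨ c ⟩ ℤ.* ⟨ d ⟩ ≡ ℤ.+ (m ℕ.* (c ℕ.* d) ℕ.* m)
    eq = trans (cong₂ ℤ._*_ (sym (ℤₚ.pos-* m c)) (sym (ℤₚ.pos-* m d))) (trans (sym (ℤₚ.pos-* (m ℕ.* c) (m ℕ.* d))) (cong ℤ.+_ (l m c d)))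
      where
      l : ∀ m c d → m ℕ.* c ℕ.* (m ℕ.* d) ≡ m ℕ.* (c ℕ.* d) ℕ.* m
      l = solveℕ-∀
    le : ι (ℤ.+ 4) * (ι ⟨ c ⟩ * ι ⟨ d ⟩) ≤ ι (ℤ.+ (4 ℕ.* E ℕ.* m ℕ.^ 2))
    le = subst₂ _≤_ (cong (ι (ℤ.+ 4) *_) (trans (cong ι (sym eq)) (ι-* ⟨ c ⟩ ⟨ d ⟩))) (trans (sym (ι-* (ℤ.+ 4) (ℤ.+ (m ℕ.* E) ℤ.* ℤ.+ m))) (cong ι
        (sym (l₄ m E))))
      (*-monoˡ-≤ (0≤ι 4) (ι-mono-≤ (subst (ℤ.+ (m ℕ.* (c ℕ.* d) ℕ.* m) ℤ.≤_) (ℤₚ.pos-* (m ℕ.* E) m) (+≤ (ℕₚ.*-monoˡ-≤ m (ℕₚ.*-monoʳ-≤ m cd≤E))))))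

  -- The upper bounds `E` and `d′` let one hypothesis serve all pairs of two families.
  v-w-integral : ∀ c d E d′ → 1 ℕ.≤ c → 1 ℕ.≤ d → c ℕ.≤ E → d ℕ.≤ d′ → ι (ℤ.+ (4 ℕ.* E ℕ.* m ℕ.^ 2)) * α d′ < ι Δ → skew (v c) (w d) ≡ 0ℤ
  v-w-integral c d E d′ 1≤c 1≤d c≤E d≤d′ big = [ (λ eq → eq) , (λ small → contradiction (≤-trans small le) (<⇒≱ big)) ]′
    (integral-or-small (v c) (w d) (ι ⟨ c ⟩ * (ι (ℤ.+ m) * α d)) (subst (0# <_) (sym (v-norm c 1≤c)) (0<ι⟨⟩ 1≤c)) (subst (0# <_) (sym conj-v)
        (0<ι⟨⟩ 1≤c))
      (≤-reflexive (cong₂ _*_ (v-norm c 1≤c) (w-norm d 1≤d)))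
      (subst (_≤ ι ⟨ c ⟩ * (ι (ℤ.+ m) * α d)) (sym (cong₂ _*_ conj-v (trans (cong conj (w-norm d 1≤d)) (trans (conj-* (ι (ℤ.+ m)) (α d)) (cong
          (_* conj (α d)) (conj-ι (ℤ.+ m)))))))
        (*-monoˡ-≤ (<⇒≤ (0<ι⟨⟩ 1≤c)) (*-monoˡ-≤ (0≤ι m) (α′≤α d)))))
    where
    conj-v : conj (b (v c) (v c)) ≡ ι ⟨ c ⟩
    conj-v = trans (cong conj (v-norm c 1≤c)) (conj-ι ⟨ c ⟩)
    le : ι (ℤ.+ 4) * (ι ⟨ c ⟩ * (ι (ℤ.+ m) * α d)) ≤ ι (ℤ.+ (4 ℕ.* E ℕ.* m ℕ.^ 2)) * α d′
    le = subst (ι (ℤ.+ 4) * (ι ⟨ c ⟩ * (ι (ℤ.+ m) * α d)) ≤_)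
      (trans (solve 4 (λ f e m a → f :* (e :* (m :* a)) := f :* (e :* m) :* a) refl (ι (ℤ.+ 4)) (ι (ℤ.+ (m ℕ.* E))) (ι (ℤ.+ m)) (α d′))
        (cong (_* α d′) (trans (cong (ι (ℤ.+ 4) *_) (sym (ι-* (ℤ.+ (m ℕ.* E)) (ℤ.+ m)))) (trans (sym (ι-* (ℤ.+ 4) (ℤ.+ (m ℕ.* E) ℤ.* ℤ.+ m)))
            (cong ι (sym (l₄ m E)))))))
      (*-monoˡ-≤ (0≤ι 4) (*-mono-≤ (<⇒≤ (0<ι⟨⟩ 1≤c)) (0≤-* (0≤ι m) (0≤α d′ (ℕₚ.≤-trans 1≤d d≤d′)))
        (ι-mono-≤ (subst (ℤ._≤ ℤ.+ (m ℕ.* E)) (ℤₚ.pos-* m c) (+≤ (ℕₚ.*-monoʳ-≤ m c≤E)))) (*-monoˡ-≤ (0≤ι m) (α-mono d d′ 1≤d d≤d′))))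

  module Ranks (σv : Selection m φv) (σw : Selection m φw) where

    open Selection σv using () renaming (C to C₁; D to D₁; 2≤C to 2≤C₁; 1≤D to 1≤D₁)
    open Selection σw using () renaming (C to C₂; D to D₂; 2≤C to 2≤C₂; 1≤D to 1≤D₂)

    private
      1≤C₁ = ℕₚ.<⇒≤ 2≤C₁
      1≤C₂ = ℕₚ.<⇒≤ 2≤C₂
      1≤2 : 1 ℕ.≤ 2
      1≤2 = ℕ.s≤s ℕ.z≤n
      1≤1 : 1 ℕ.≤ 1
      1≤1 = ℕₚ.≤-refl

    _<Δ·_ : ℕ → A → Set
    E <Δ· x = ι (ℤ.+ (4 ℕ.* E ℕ.* m ℕ.^ 2)) * x < ι Δ

    ι2≤α : ∀ d → 1 ℕ.≤ d → ι (ℤ.+ 2) ≤ α d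
    ι2≤α d 1≤d = ≤-trans 2≤√Δ (≤-trans (subst (_≤ √Δ * ι (ℤ.+ d)) (trans (cong (√Δ *_) ι-1) (*-identityʳ √Δ)) (*-monoˡ-≤ (<⇒≤ 0<√Δ) (ι-mono-≤
        (+≤ 1≤d)))) (√Δ*c≤α d 1≤d))

    -- The pair v_2, v_C requires Δ > 4·2C m². The factor 2 is paid for by α_d ≥ √Δ ≥ 2.
    double : ∀ E d → 1 ℕ.≤ d → E <Δ· α d → ι (ℤ.+ (4 ℕ.* (E ℕ.* 2) ℕ.* m ℕ.^ 2)) < ι Δ
    double E d 1≤d = ≤-<-trans (subst (_≤ ι (ℤ.+ (4 ℕ.* E ℕ.* m ℕ.^ 2)) * α d) eq (*-monoˡ-≤ (0≤ι (4 ℕ.* E ℕ.* m ℕ.^ 2)) (ι2≤α d 1≤d)))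
      where
      l : ∀ E q → 4 ℕ.* E ℕ.* q ℕ.* 2 ≡ 4 ℕ.* (E ℕ.* 2) ℕ.* q
      l = solveℕ-∀
      eq : ι (ℤ.+ (4 ℕ.* E ℕ.* m ℕ.^ 2)) * ι (ℤ.+ 2) ≡ ι (ℤ.+ (4 ℕ.* (E ℕ.* 2) ℕ.* m ℕ.^ 2))
      eq = trans (sym (ι-* (ℤ.+ (4 ℕ.* E ℕ.* m ℕ.^ 2)) (ℤ.+ 2))) (cong ι (trans (sym (ℤₚ.pos-* (4 ℕ.* E ℕ.* m ℕ.^ 2) 2)) (cong ℤ.+_ (l E (m ℕ.^ 2)))))

    integral₃ : ι (ℤ.+ (4 ℕ.* (C₁ ℕ.* 2) ℕ.* m ℕ.^ 2)) < ι Δ → Integral (cs₃ C₁)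
    integral₃ big = 1≤C₁ , (λ { zero → v-v-integral 2 C₁ _ 1≤2 1≤C₁ (ℕₚ.≤-reflexive (ℕₚ.*-comm 2 C₁)) big
                             ; (suc zero) → v-v-integral 1 C₁ _ 1≤1 1≤C₁ (ℕₚ.≤-trans (ℕₚ.≤-reflexive (ℕₚ.*-identityˡ C₁)) (ℕₚ.m≤m*n C₁ 2)) big }) ,
      1≤2 , (λ { zero → v-v-integral 1 2 _ 1≤1 1≤2 (ℕₚ.*-monoˡ-≤ 2 1≤C₁) big }) , 1≤1 , (λ ()) , tt

    integral₄ : ι (ℤ.+ (4 ℕ.* (C₁ ℕ.* 2) ℕ.* m ℕ.^ 2)) < ι Δ → ι (ℤ.+ (4 ℕ.* (C₁ ℕ.* D₁) ℕ.* m ℕ.^ 2)) < ι Δ → Integral (cs₄ C₁ D₁)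
    integral₄ big big′ = 1≤D₁ , (λ { zero → v-v-integral C₁ D₁ _ 1≤C₁ 1≤D₁ ℕₚ.≤-refl big′
                                  ; (suc zero) → v-v-integral 2 D₁ _ 1≤2 1≤D₁ (ℕₚ.*-monoˡ-≤ D₁ 2≤C₁) big′
                                  ; (suc (suc zero)) → v-v-integral 1 D₁ _ 1≤1 1≤D₁ (ℕₚ.*-monoˡ-≤ D₁ 1≤C₁) big′ }) , integral₃ big

    cs₃≤ : ∀ i → cs₃ C₁ i ℕ.≤ C₁
    cs₃≤ zero = ℕₚ.≤-refl
    cs₃≤ (suc zero) = 2≤C₁
    cs₃≤ (suc (suc zero)) = 1≤C₁

    1≤cs₃ᵛ : ∀ i → 1 ℕ.≤ cs₃ C₁ i
    1≤cs₃ᵛ zero = 1≤C₁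
    1≤cs₃ᵛ (suc i) = 1≤cs₂ σw i

    cs₃ʷ≤ : ∀ j → cs₃ C₂ j ℕ.≤ C₂
    cs₃ʷ≤ zero = ℕₚ.≤-refl
    cs₃ʷ≤ (suc zero) = 2≤C₂
    cs₃ʷ≤ (suc (suc zero)) = 1≤C₂

    -- Positivity of the binary minor of A costs no further alternative: √Δ ≤ 8m² ≤ 4 C₁ m² and √Δ ≤
    -- α_2 would multiply to Δ ≤ 4 C₁ m² α_2.
    √Δ>8m² : C₁ <Δ· α 2 → ι (ℤ.+ (8 ℕ.* m ℕ.^ 2)) < √Δ
    √Δ>8m² big = [ (λ small → contradiction (bound small) (<⇒≱ big)) , (λ lt → lt) ]′ (≤⊎> √Δ (ι (ℤ.+ (8 ℕ.* m ℕ.^ 2))))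
      where
      E = 4 ℕ.* C₁ ℕ.* m ℕ.^ 2
      l : ∀ q → 8 ℕ.* q ≡ 4 ℕ.* 2 ℕ.* q
      l = solveℕ-∀
      8m²≤E : 8 ℕ.* m ℕ.^ 2 ℕ.≤ E
      8m²≤E = ℕₚ.≤-trans (ℕₚ.≤-reflexive (l (m ℕ.^ 2))) (ℕₚ.*-monoˡ-≤ (m ℕ.^ 2) (ℕₚ.*-monoʳ-≤ 4 2≤C₁))
      √Δ≤α₂ : √Δ ≤ α 2
      √Δ≤α₂ = ≤-trans (subst (_≤ √Δ * ι (ℤ.+ 2)) (trans (cong (√Δ *_) ι-1) (*-identityʳ √Δ)) (*-monoˡ-≤ (<⇒≤ 0<√Δ) (ι-mono-≤ (+≤ 1≤2))))
          (√Δ*c≤α 2 1≤2)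
      bound : √Δ ≤ ι (ℤ.+ (8 ℕ.* m ℕ.^ 2)) → ι Δ ≤ ι (ℤ.+ E) * α 2
      bound small = subst (_≤ ι (ℤ.+ E) * α 2) √Δ² (*-mono-≤ (<⇒≤ 0<√Δ) (0≤α 2 1≤2) (≤-trans small (ι-mono-≤ (+≤ 8m²≤E))) √Δ≤α₂)

    α₂<αC : ∀ {E} → E <Δ· α C₂ → E <Δ· α 2
    α₂<αC {E} = ≤-<-trans (*-monoˡ-≤ (0≤ι (4 ℕ.* E ℕ.* m ℕ.^ 2)) (α-mono 2 C₂ 1≤2 2≤C₂))

    -- Ranks 3, 4, 5, 6, 7 are exceeded by 3+1, 3+2, 3+3, 4+3 and 4+4 independent vectors v and w.
    rank-3 : C₁ <Δ· α 1 → Independent (cs₃ C₁) cs₁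
    rank-3 big = independent (cs₃ C₁) cs₁ ints (proj₂ (v-posDef₃ σv ints)) (λ { zero → 1≤1 }) (posDef₁ φw)
      λ { i zero → v-w-integral (cs₃ C₁ i) 1 C₁ 1 (1≤cs₃ᵛ i) 1≤1 (cs₃≤ i) 1≤1 big }
      where ints = integral₃ (double C₁ 1 1≤1 big)

    rank-4 : C₁ <Δ· α 2 → Independent (cs₃ C₁) cs₂
    rank-4 big = independent (cs₃ C₁) cs₂ ints (proj₂ (v-posDef₃ σv ints)) (1≤cs₂ σw) (posDef₂ φw (w-gram₂>0 σw (√Δ>8m² big)))
      λ { i zero → v-w-integral (cs₃ C₁ i) 2 C₁ 2 (1≤cs₃ᵛ i) 1≤2 (cs₃≤ i) ℕₚ.≤-refl big
        ; i (suc zero) → v-w-integral (cs₃ C₁ i) 1 C₁ 2 (1≤cs₃ᵛ i) 1≤1 (cs₃≤ i) 1≤2 big }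
      where ints = integral₃ (double C₁ 2 1≤2 big)

    w-posDef₃ : C₁ <Δ· α C₂ → ι (ℤ.+ (36 ℕ.* C₂ ℕ.* m ℕ.^ 3)) < √Δ → 0ℤ ℤ.< gram₂ m φw × 0ℤ ℤ.< gram₃ m φw C₂
    w-posDef₃ big big₃ = 0<d₂ , w-gram₃>0 σw 0<d₂ big₃
      where 0<d₂ = w-gram₂>0 σw (√Δ>8m² (α₂<αC {C₁} big))

    rank-5 : C₁ <Δ· α C₂ → ι (ℤ.+ (36 ℕ.* C₂ ℕ.* m ℕ.^ 3)) < √Δ → Independent (cs₃ C₁) (cs₃ C₂)
    rank-5 big big₃ = independent (cs₃ C₁) (cs₃ C₂) ints (proj₂ (v-posDef₃ σv ints)) (1≤cs₃ σw) (posDef₃ φw C₂ (proj₁ pw) (proj₂ pw))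
      λ i j → v-w-integral (cs₃ C₁ i) (cs₃ C₂ j) C₁ C₂ (1≤cs₃ᵛ i) (1≤cs₃ σw j) (cs₃≤ i) (cs₃ʷ≤ j) big
      where
      ints = integral₃ (double C₁ C₂ 1≤C₂ big)
      pw = w-posDef₃ big big₃

    rank-6 : C₁ <Δ· α C₂ → ι (ℤ.+ (36 ℕ.* C₂ ℕ.* m ℕ.^ 3)) < √Δ → ι (ℤ.+ (4 ℕ.* (C₁ ℕ.* D₁) ℕ.* m ℕ.^ 2)) < ι Δ → D₁ <Δ· α C₂ → Independent
        (cs₄ C₁ D₁) (cs₃ C₂)
    rank-6 big big₃ bigCD bigD = independent (cs₄ C₁ D₁) (cs₃ C₂) ints (v-posDef₄ σv ints) (1≤cs₃ σw) (posDef₃ φw C₂ (proj₁ pw) (proj₂ pw))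
      λ { zero j → v-w-integral D₁ (cs₃ C₂ j) D₁ C₂ 1≤D₁ (1≤cs₃ σw j) ℕₚ.≤-refl (cs₃ʷ≤ j) bigD
        ; (suc i) j → v-w-integral (cs₃ C₁ i) (cs₃ C₂ j) C₁ C₂ (1≤cs₃ᵛ i) (1≤cs₃ σw j) (cs₃≤ i) (cs₃ʷ≤ j) big }
      where
      ints = integral₄ (double C₁ C₂ 1≤C₂ big) bigCD
      pw = w-posDef₃ big big₃

    rank-7 : C₁ <Δ· α C₂ → C₁ <Δ· α D₂ → D₁ <Δ· α C₂ → D₁ <Δ· α D₂ → ι (ℤ.+ (36 ℕ.* C₂ ℕ.* m ℕ.^ 3)) < √Δ → ι (ℤ.+
        (192 ℕ.* C₂ ℕ.* D₂ ℕ.* m ℕ.^ 4)) < √Δ →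
             ι (ℤ.+ (4 ℕ.* (C₁ ℕ.* D₁) ℕ.* m ℕ.^ 2)) < ι Δ → Independent (cs₄ C₁ D₁) (cs₄ C₂ D₂)
    rank-7 bigCC bigCD bigDC bigDD big₃ big₄ bigCD′ = independent (cs₄ C₁ D₁) (cs₄ C₂ D₂) ints (v-posDef₄ σv ints) (1≤cs₄ σw)
      (posDef₄ φw C₂ D₂ (proj₁ pw) (proj₂ pw) (w-gram₄>0 σw (proj₁ pw) (proj₂ pw) big₄))
      λ { zero zero → v-w-integral D₁ D₂ D₁ D₂ 1≤D₁ 1≤D₂ ℕₚ.≤-refl ℕₚ.≤-refl bigDD
        ; zero (suc j) → v-w-integral D₁ (cs₃ C₂ j) D₁ C₂ 1≤D₁ (1≤cs₃ σw j) ℕₚ.≤-refl (cs₃ʷ≤ j) bigDC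
        ; (suc i) zero → v-w-integral (cs₃ C₁ i) D₂ C₁ D₂ (1≤cs₃ᵛ i) 1≤D₂ (cs₃≤ i) ℕₚ.≤-refl bigCD
        ; (suc i) (suc j) → v-w-integral (cs₃ C₁ i) (cs₃ C₂ j) C₁ C₂ (1≤cs₃ᵛ i) (1≤cs₃ σw j) (cs₃≤ i) (cs₃ʷ≤ j) bigCC }
      where
      ints = integral₄ (double C₁ C₂ 1≤C₂ bigCC) bigCD′
      pw = w-posDef₃ bigCC big₃

    -- The operations of the concrete field are parameters, related to those of S by propositional
    -- equalities, so that no normalisation of rational numbers takes place in the bounds.
    module Bounds (nat : ℕ → A) (nat≡ : ∀ n → nat n ≡ ι (ℤ.+ n)) (mul add : A → A → A) (mul≡ : ∀ x y → mul x y ≡ x * y)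
        (add≡ : ∀ x y → add x y ≡ x + y)
      (ρ : A) (ρ≡ : ρ ≡ √Δ) (pow : ℕ → A) (pow-suc : ∀ k → pow (suc k) ≡ mul ρ (pow k)) (0≤pow₀ : 0# ≤ pow 0)
      (mx : A → A → A) (mx-upper : ∀ x y → x ≤ mx x y × y ≤ mx x y)
      (_⊑_ : A → A → Set) (≤⇒⊑ : ∀ x y → x ≤ y → x ⊑ y)
      (Δ′ : ℕ) (Δ≡ : Δ ≡ ℤ.+ Δ′)
      (RankLe : ℕ → Set) (dependence : ∀ {r n} → RankLe r → r ℕ.< n → (z : Fin n → X) → Σ (Fin n → A) λ c → (∃ λ i → c i ≢ 0#) × (∀ i → ((λ i j → b
          (z i) (z j)) · c) i ≡ 0#))
      where

      Small : ℕ → A → Set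
      Small E x = nat Δ′ ⊑ mul (nat (4 ℕ.* E ℕ.* m ℕ.^ 2)) x

      natΔ≡ : nat Δ′ ≡ ι Δ
      natΔ≡ = trans (nat≡ Δ′) (cong ι (sym Δ≡))

      small⊎big : ∀ E x → Small E x ⊎ E <Δ· x
      small⊎big E x = [ (λ p → inj₁ (≤⇒⊑ _ _ (subst₂ _≤_ (sym natΔ≡) (sym (trans (mul≡ _ x) (cong (_* x) (nat≡
          (4 ℕ.* E ℕ.* m ℕ.^ 2))))) p))) , inj₂ ]′ (≤⊎> (ι Δ) (ι (ℤ.+ (4 ℕ.* E ℕ.* m ℕ.^ 2)) * x))

      rank-bound : ∀ {k n r} (cv : Fin k → ℕ) (cw : Fin n → ℕ) → Independent cv cw → RankLe r → ¬ r ℕ.< k ℕ.+ n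
      rank-bound cv cw ind rk r<n = let (c , (i , c≢0) , null) = dependence rk r<n (join (v ∘ cv) (w ∘ cw)) in c≢0 (ind c null i)

      0≤ρ : 0# ≤ ρ
      0≤ρ = subst (0# ≤_) (sym ρ≡) (<⇒≤ 0<√Δ)

      pow-suc′ : ∀ k → pow (suc k) ≡ √Δ * pow k
      pow-suc′ k = trans (pow-suc k) (trans (mul≡ ρ (pow k)) (cong (_* pow k) ρ≡))

      0≤pow : ∀ k → 0# ≤ pow k
      0≤pow zero = 0≤pow₀
      0≤pow (suc k) = subst (0# ≤_) (sym (pow-suc′ k)) (0≤-* (<⇒≤ 0<√Δ) (0≤pow k))

      0≤nat : ∀ n → 0# ≤ nat n
      0≤nat n = subst (0# ≤_) (sym (nat≡ n)) (0≤ι n)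

      0≤mul : ∀ {x y} → 0# ≤ x → 0# ≤ y → 0# ≤ mul x y
      0≤mul 0≤x 0≤y = subst (0# ≤_) (sym (mul≡ _ _)) (0≤-* 0≤x 0≤y)

      pow-≤ : ∀ k K → √Δ ≤ ι (ℤ.+ K) → pow (suc k) ≤ mul (nat K) (pow k)
      pow-≤ k K le = subst₂ _≤_ (sym (pow-suc′ k)) (sym (trans (mul≡ (nat K) (pow k)) (cong (_* pow k) (nat≡ K)))) (*-monoʳ-≤ (0≤pow k) le)

      ≤-add : ∀ {x y z} → x ≤ y → 0# ≤ z → x ≤ add y z
      ≤-add {x} {y} {z} x≤y 0≤z = subst₂ _≤_ (+-identityʳ x) (sym (add≡ y z)) (+-mono-≤ x≤y 0≤z)

      Cubic : Set
      Cubic = pow 3 ⊑ add (add (mul (nat (36 ℕ.* C₂ ℕ.* m ℕ.^ 3)) (pow 2)) (mul (nat (18 ℕ.* C₂ ℕ.* m ℕ.^ 3)) ρ)) (nat (m ℕ.^ 3))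

      -- Multiplying √Δ ≤ 36 C₂ m³ by √Δ² bounds the cube by the leading term, and the remaining
      -- terms are nonnegative. The quartic arises in the same way.
      cubic⊎big : Cubic ⊎ ι (ℤ.+ (36 ℕ.* C₂ ℕ.* m ℕ.^ 3)) < √Δ
      cubic⊎big = [ (λ le → inj₁ (≤⇒⊑ _ _ (≤-add (≤-add (pow-≤ 2 (36 ℕ.* C₂ ℕ.* m ℕ.^ 3) le) (0≤mul (0≤nat _) 0≤ρ)) (0≤nat _)))) , inj₂ ]′ (≤⊎> √Δ
          (ι (ℤ.+ (36 ℕ.* C₂ ℕ.* m ℕ.^ 3))))

      Quartic : Set
      Quartic = pow 4 ⊑ add (add (add (mul (nat (192 ℕ.* C₂ ℕ.* D₂ ℕ.* m ℕ.^ 4)) (pow 3)) (mul (nat (144 ℕ.* C₂ ℕ.* D₂ ℕ.* m ℕ.^ 4)) (pow 2)))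
                                    (mul (nat (96 ℕ.* (C₂ ℕ.⊔ D₂) ℕ.* m ℕ.^ 4)) ρ)) (nat (m ℕ.^ 4))

      quartic⊎big : Quartic ⊎ ι (ℤ.+ (192 ℕ.* C₂ ℕ.* D₂ ℕ.* m ℕ.^ 4)) < √Δ
      quartic⊎big = [ (λ le → inj₁ (≤⇒⊑ _ _ (≤-add (≤-add (≤-add (pow-≤ 3 (192 ℕ.* C₂ ℕ.* D₂ ℕ.* m ℕ.^ 4) le) (0≤mul (0≤nat _) (0≤pow 2))) (0≤mul
          (0≤nat _) 0≤ρ)) (0≤nat _)))) , inj₂ ]′
        (≤⊎> √Δ (ι (ℤ.+ (192 ℕ.* C₂ ℕ.* D₂ ℕ.* m ℕ.^ 4))))

      big-mono : ∀ {E E′ x y} → E ℕ.≤ E′ → 0# ≤ y → x ≤ y → E′ <Δ· y → E <Δ· x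
      big-mono {E} E≤E′ 0≤y x≤y = ≤-<-trans (*-mono-≤ (0≤ι (4 ℕ.* E ℕ.* m ℕ.^ 2)) 0≤y (ι-mono-≤ (+≤ (ℕₚ.*-monoˡ-≤ (m ℕ.^ 2)
          (ℕₚ.*-monoʳ-≤ 4 E≤E′)))) x≤y)

      product-big : D₁ <Δ· ι (ℤ.+ C₁) → ι (ℤ.+ (4 ℕ.* (C₁ ℕ.* D₁) ℕ.* m ℕ.^ 2)) < ι Δ
      product-big = subst (_< ι Δ) (trans (sym (ι-* (ℤ.+ (4 ℕ.* D₁ ℕ.* m ℕ.^ 2)) (ℤ.+ C₁))) (cong ι (trans (sym (ℤₚ.pos-*
          (4 ℕ.* D₁ ℕ.* m ℕ.^ 2) C₁)) (cong ℤ.+_ (l C₁ D₁ (m ℕ.^ 2))))))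
        where
        l : ∀ C D q → 4 ℕ.* D ℕ.* q ℕ.* C ≡ 4 ℕ.* (C ℕ.* D) ℕ.* q
        l = solveℕ-∀

      bound-3 : RankLe 3 → Small C₁ (α 1)
      bound-3 rk = [ (λ small → small) , (λ big → contradiction ℕₚ.≤-refl (rank-bound (cs₃ C₁) cs₁ (rank-3 big) rk)) ]′ (small⊎big C₁ (α 1))

      bound-4 : RankLe 4 → Small C₁ (α 2)
      bound-4 rk = [ (λ small → small) , (λ big → contradiction ℕₚ.≤-refl (rank-bound (cs₃ C₁) cs₂ (rank-4 big) rk)) ]′ (small⊎big C₁ (α 2))

      bound-5 : RankLe 5 → Small C₁ (α C₂) ⊎ Cubic
      bound-5 rk = [ inj₁ , (λ big → [ inj₂ , (λ big₃ → contradiction ℕₚ.≤-refl (rank-bound (cs₃ C₁) (cs₃ C₂)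
          (rank-5 big big₃) rk)) ]′ cubic⊎big) ]′ (small⊎big C₁ (α C₂))

      -- The maximum stands for two conditions on v_D: its entry C₁ concerns the product with v_C,
      -- its entry α_C the products with the w's.
      bound-6 : RankLe 6 → Small C₁ (α C₂) ⊎ Cubic ⊎ Small D₁ (mx (nat C₁) (α C₂))
      bound-6 rk = [ inj₁ , (λ big → [ (λ c → inj₂ (inj₁ c)) , (λ big₃ → [ (λ s → inj₂ (inj₂ s)) , (λ bigM →
          contradiction ℕₚ.≤-refl (rank-bound (cs₄ C₁ D₁) (cs₃ C₂) (rank-6 big big₃
            (product-big (big-mono (ℕₚ.≤-refl {D₁}) 0≤M C₁≤M bigM)) (big-mono (ℕₚ.≤-refl {D₁}) 0≤M (proj₂ (mx-upper _ _)) bigM)) rk)) ]′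
                (small⊎big D₁ M)) ]′ cubic⊎big) ]′ (small⊎big C₁ (α C₂))
        where
        M = mx (nat C₁) (α C₂)
        C₁≤M : ι (ℤ.+ C₁) ≤ M
        C₁≤M = subst (_≤ M) (nat≡ C₁) (proj₁ (mx-upper (nat C₁) (α C₂)))
        0≤M : 0# ≤ M
        0≤M = ≤-trans (0≤ι C₁) C₁≤M

      -- The two maxima combine four conditions, one for each pairing of C₁, D₁ with α_C, α_D, and
      -- the first alternative concerns the product of v_C and v_D.
      bound-7 : RankLe 7 → (Δ′ ℕ.≤ 4 ℕ.* C₁ ℕ.* D₁ ℕ.* m ℕ.^ 2) ⊎ Small (C₁ ℕ.⊔ D₁) (mx (α C₂) (α D₂)) ⊎ Cubic ⊎ Quartic
      bound-7 rk with Δ′ ℕ.≤? 4 ℕ.* C₁ ℕ.* D₁ ℕ.* m ℕ.^ 2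
      ... | yes Δ≤ = inj₁ Δ≤
      ... | no Δ≰ = inj₂ ([ inj₁ , (λ bigM → inj₂ ([ inj₁ , (λ big₃ → inj₂ ([ (λ q → q) , (λ big₄ → contradiction ℕₚ.≤-refl (rank-bound (cs₄ C₁ D₁)
          (cs₄ C₂ D₂)
          (rank-7 (big-mono C≤E 0≤M αC≤M bigM) (big-mono C≤E 0≤M αD≤M bigM) (big-mono D≤E 0≤M αC≤M bigM) (big-mono D≤E 0≤M αD≤M bigM)
            big₃ big₄ bigCD) rk)) ]′ quartic⊎big)) ]′ cubic⊎big)) ]′ (small⊎big E M))
        where
        E = C₁ ℕ.⊔ D₁
        C≤E = ℕₚ.m≤m⊔n C₁ D₁
        D≤E = ℕₚ.m≤n⊔m C₁ D₁
        M = mx (α C₂) (α D₂)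
        αC≤M = proj₁ (mx-upper (α C₂) (α D₂))
        αD≤M = proj₂ (mx-upper (α C₂) (α D₂))
        0≤M : 0# ≤ M
        0≤M = ≤-trans (0≤α C₂ 1≤C₂) αC≤M
        bigCD : ι (ℤ.+ (4 ℕ.* (C₁ ℕ.* D₁) ℕ.* m ℕ.^ 2)) < ι Δ
        bigCD = ι-mono-< (subst₂ ℤ._<_ (cong ℤ.+_ (cong (ℕ._* m ℕ.^ 2) (ℕₚ.*-assoc 4 C₁ D₁))) (sym Δ≡) (ℤ.+<+ (ℕₚ.≰⇒> Δ≰)))

open import Defs

-- ℚ and F as ordered rings

ℚ<⇒≱ : ∀ {x y} → x ℚ.< y → ¬ y ℚ.≤ x
ℚ<⇒≱ lt le = ℚₚ.<-irrefl refl (ℚₚ.<-≤-trans lt le)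

-- The quotient `z / 1` is normalised by a gcd and does not reduce for a variable z; this form is in
-- lowest terms already, so the operations compute on it.
mkℤ : ℤ → ℚ
mkℤ z = mkℚ z 0 (Cop.sym (Cop.1-coprimeTo ℤ.∣ z ∣))

ℤ→ℚ-mk : ∀ z → ℤ→ℚ z ≡ mkℤ z
ℤ→ℚ-mk z = ℚₚ.↥p/↧p≡p (mkℤ z)

ℤ→ℚ-+ : ∀ x y → ℤ→ℚ (x ℤ.+ y) ≡ ℤ→ℚ x ℚ.+ ℤ→ℚ y
ℤ→ℚ-+ x y = sym (trans (cong₂ ℚ._+_ (ℤ→ℚ-mk x) (ℤ→ℚ-mk y)) (cong ℤ→ℚ (cong₂ ℤ._+_ (ℤₚ.*-identityʳ x) (ℤₚ.*-identityʳ y))))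

ℤ→ℚ-* : ∀ x y → ℤ→ℚ (x ℤ.* y) ≡ ℤ→ℚ x ℚ.* ℤ→ℚ y
ℤ→ℚ-* x y = sym (cong₂ ℚ._*_ (ℤ→ℚ-mk x) (ℤ→ℚ-mk y))

ℤ→ℚ-neg : ∀ x → ℤ→ℚ (ℤ.- x) ≡ ℚ.- ℤ→ℚ x
ℤ→ℚ-neg x = trans (ℤ→ℚ-mk (ℤ.- x)) (sym (trans (cong ℚ.-_ (ℤ→ℚ-mk x)) (lem x)))
  where
  lem : ∀ x → ℚ.- mkℤ x ≡ mkℤ (ℤ.- x)
  lem (ℤ.+ zero) = refl
  lem (ℤ.+ suc n) = refl
  lem ℤ.-[1+ n ] = refl

ℚ-orderedRing : OrderedRing
ℚ-orderedRing = record
  { A = ℚ ; _+_ = ℚ._+_ ; _*_ = ℚ._*_ ; -_ = ℚ.-_ ; 0# = 0ℚ ; 1# = 1ℚ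
  ; isCommutativeRing = ℚₚ.+-*-isCommutativeRing
  ; ι = ℤ→ℚ ; ι-+ = ℤ→ℚ-+ ; ι-* = ℤ→ℚ-* ; ι-neg = ℤ→ℚ-neg ; ι-0 = refl ; ι-1 = refl
  ; Pos = λ x → 0ℚ ℚ.< x
  ; pos-+ = λ {x} {y} p q → ℚₚ.+-mono-< {0ℚ} {x} {0ℚ} {y} p q
  ; pos-* = λ {x} {y} p q → subst (ℚ._< x ℚ.* y) (ℚₚ.*-zeroʳ x) (ℚₚ.*-monoʳ-<-pos x {{ℚ.positive p}} q)
  ; trichotomy = tri
  ; ¬pos-0 = ℚₚ.<-irrefl refl
  ; ι-pos = λ {z} p → subst (0ℚ ℚ.<_) (sym (ℤ→ℚ-mk z)) (ℚ.*<* (subst₂ ℤ._<_ refl (sym (ℤₚ.*-identityʳ z)) p))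
  }
  where
  tri : ∀ x → 0ℚ ℚ.< x ⊎ x ≡ 0ℚ ⊎ 0ℚ ℚ.< ℚ.- x
  tri x with ℚₚ.<-cmp 0ℚ x
  ... | tri< p _ _ = inj₁ p
  ... | tri≈ _ p _ = inj₂ (inj₁ (sym p))
  ... | tri> _ _ p = inj₂ (inj₂ (ℚₚ.neg-antimono-< p))

denominator-clear : ∀ p → p ℚ.* ℤ→ℚ (↧ p) ≡ ℤ→ℚ (↥ p)
denominator-clear p@(mkℚ n d-1 _) = trans (cong (p ℚ.*_) (ℤ→ℚ-mk (↧ p))) (trans (ℚₚ.toℚᵘ-injective (ℚᵘₚ.≃-trans (ℚₚ.toℚᵘ-homo-* p (mkℤ (↧ p)))
    (ℚᵘ.*≡* (lem n (↧ p))))) (sym (ℤ→ℚ-mk n)))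
  where
  lem : ∀ n d → n ℤ.* d ℤ.* 1ℤ ≡ n ℤ.* (d ℤ.* 1ℤ)
  lem = solve-∀

module ℚO = OrderedRingProperties ℚ-orderedRing

ℚ-irrational : ∀ D → Squarefree D → D ≢ 1 → ∀ a b → a ℚ.* a ≡ ℕ→ℚ D ℚ.* b ℚ.* b → b ≡ 0ℚ
ℚ-irrational D sf D≢1 a b eq = ℚO.*-zero-pos (ℚO.ι-0< {↧ b} (ℤ.+<+ (ℕ.s≤s ℕ.z≤n))) (trans (ℚₚ.*-comm (ι db) b) (trans (denominator-clear b)
    (cong ι nb≡0)))
  where
  open ℚO using (ι; ι-*)
  na = ↥ a
  nb = ↥ b
  da = ↧ a
  db = ↧ b
  scaled : ι (na ℤ.* db) ℚ.* ι (na ℤ.* db) ≡ ι (ℤ.+ D) ℚ.* (ι (nb ℤ.* da) ℚ.* ι (nb ℤ.* da))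
  scaled = trans (cong (λ t → t ℚ.* t) (trans (ι-* na db) (cong (ℚ._* ι db) (sym (denominator-clear a)))))
    (trans (l₁ a (ι da) (ι db)) (trans (cong (ℚ._* (ι da ℚ.* ι db ℚ.* (ι da ℚ.* ι db))) eq) (trans (l₂ (ι (ℤ.+ D)) b (ι da) (ι db))
      (cong (λ t → ι (ℤ.+ D) ℚ.* (t ℚ.* t)) (sym (trans (ι-* nb da) (cong (ℚ._* ι da) (sym (denominator-clear b)))))))))
    where
    open ℚO using (solve; _:=_; _:*_)
    l₁ : ∀ a d e → (a ℚ.* d ℚ.* e) ℚ.* (a ℚ.* d ℚ.* e) ≡ a ℚ.* a ℚ.* (d ℚ.* e ℚ.* (d ℚ.* e))
    l₁ = solve 3 (λ a d e → (a :* d :* e) :* (a :* d :* e) := a :* a :* (d :* e :* (d :* e))) refl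
    l₂ : ∀ D b d e → D ℚ.* b ℚ.* b ℚ.* (d ℚ.* e ℚ.* (d ℚ.* e)) ≡ D ℚ.* ((b ℚ.* e ℚ.* d) ℚ.* (b ℚ.* e ℚ.* d))
    l₂ = solve 4 (λ D b d e → D :* b :* b :* (d :* e :* (d :* e)) := D :* ((b :* e :* d) :* (b :* e :* d))) refl
  ints : (na ℤ.* db) ℤ.* (na ℤ.* db) ≡ ℤ.+ D ℤ.* ((nb ℤ.* da) ℤ.* (nb ℤ.* da))
  ints = ℚO.ι-injective (trans (ι-* (na ℤ.* db) (na ℤ.* db)) (trans scaled (sym (trans (ι-* (ℤ.+ D) ((nb ℤ.* da) ℤ.* (nb ℤ.* da))) (cong (ι
      (ℤ.+ D) ℚ.*_) (ι-* (nb ℤ.* da) (nb ℤ.* da)))))))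
  nbda≡0 : ℤ.∣ nb ℤ.* da ∣ ≡ 0
  nbda≡0 = sqrt-irrational D sf D≢1 ℤ.∣ na ℤ.* db ∣ ℤ.∣ nb ℤ.* da ∣
    (trans (sym (ℤₚ.abs-* (na ℤ.* db) (na ℤ.* db))) (trans (cong ℤ.∣_∣ ints) (trans (ℤₚ.abs-* (ℤ.+ D) ((nb ℤ.* da) ℤ.* (nb ℤ.* da))) (cong (D ℕ.*_)
        (ℤₚ.abs-* (nb ℤ.* da) (nb ℤ.* da))))))
  nb≡0 : nb ≡ 0ℤ
  nb≡0 = [ (λ e → e) , (λ ()) ]′ (ℤₚ.i*j≡0⇒i≡0∨j≡0 nb {da} (ℤₚ.∣i∣≡0⇒i≡0 nbda≡0))

module RealQuadratic (D : ℕ) (1≤D : 1 ℕ.≤ D) (D≢1 : D ≢ 1) (sf : Squarefree D) where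

  open Field D

  δ = ℕ→ℚ D

  module K = QuadraticExtension ℚ-orderedRing δ (ℚO.ι-pos {ℤ.+ D} (ℤ.+<+ 1≤D)) (ℚ-irrational D sf D≢1)

  to : F → ℚ × ℚ
  to x = re x , im x

  from : ℚ × ℚ → F
  from (a , b) = a +√ b

  -- `F` has the same operations as the pairs of `K`, up to the renaming of the constructor, so each
  -- law is an image under `from`.
  F-isCommutativeRing : IsCommutativeRing _≡_ _+F_ _*F_ (λ x → -F x) 0F (ℤ→F 1ℤ)
  F-isCommutativeRing = record
    { isRing = record
      { +-isAbelianGroup = record
        { isGroup = record
          { isMonoid = record
            { isSemigroup = record
              { isMagma = record { isEquivalence = isEquivalence ; ∙-cong = cong₂ _+F_ }
              ; assoc = λ x y z → cong from (P.+-assoc (to x) (to y) (to z)) }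
            ; identity = (λ x → cong from (P.+-identityˡ (to x))) , (λ x → cong from (P.+-identityʳ (to x))) }
          ; inverse = (λ x → cong from (P.-‿inverseˡ (to x))) , (λ x → cong from (P.-‿inverseʳ (to x)))
          ; ⁻¹-cong = cong (λ x → -F x) }
        ; comm = λ x y → cong from (P.+-comm (to x) (to y)) }
      ; *-cong = cong₂ _*F_
      ; *-assoc = λ x y z → cong from (P.*-assoc (to x) (to y) (to z))
      ; *-identity = (λ x → cong from (P.*-identityˡ (to x))) , (λ x → cong from (P.*-identityʳ (to x)))
      ; distrib = (λ x y z → cong from (P.distribˡ (to x) (to y) (to z))) , (λ x y z → cong from (P.distribʳ (to x) (to y) (to z))) }
    ; *-comm = λ x y → cong from (P.*-comm (to x) (to y)) }
    where module P = IsCommutativeRing K.K-isCommutativeRing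

  private module KO = OrderedRing K.orderedRing

  F-orderedRing : OrderedRing
  F-orderedRing = record
    { A = F ; _+_ = _+F_ ; _*_ = _*F_ ; -_ = λ x → -F x ; 0# = 0F ; 1# = ℤ→F 1ℤ ; isCommutativeRing = F-isCommutativeRing
    ; ι = ℤ→F ; ι-+ = λ x y → cong from (KO.ι-+ x y) ; ι-* = λ x y → cong from (KO.ι-* x y) ; ι-neg = λ x → cong from
        (KO.ι-neg x) ; ι-0 = refl ; ι-1 = refl
    ; Pos = λ x → KO.Pos (to x) ; pos-+ = λ {x} {y} → KO.pos-+ {to x} {to y} ; pos-* = λ {x} {y} → KO.pos-* {to x} {to y}
    ; trichotomy = λ x → [ inj₁ , [ (λ e → inj₂ (inj₁ (cong from e))) , (λ p → inj₂ (inj₂ p)) ]′ ]′ (KO.trichotomy (to x))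
    ; ¬pos-0 = KO.¬pos-0 ; ι-pos = KO.ι-pos }

  module FO = OrderedRingProperties F-orderedRing

  <ᵇ-sound : ∀ x y → T (not (y ℚ.≤ᵇ x)) → x ℚ.< y
  <ᵇ-sound x y t = ℚₚ.≰⇒> λ le → T-not (y ℚ.≤ᵇ x) t (ℚₚ.≤⇒≤ᵇ le)
    where
    T-not : ∀ b → T (not b) → ¬ T b
    T-not false _ ()

  <ᵇ-complete : ∀ x y → x ℚ.< y → T (not (y ℚ.≤ᵇ x))
  <ᵇ-complete x y lt = T-not (y ℚ.≤ᵇ x) λ t → ℚ<⇒≱ lt (ℚₚ.≤ᵇ⇒≤ t)
    where
    T-not : ∀ b → ¬ T b → T (not b)
    T-not false _ = _
    T-not true nt = nt _

  ∧-split : ∀ {x y} → T (x ∧ y) → T x × T y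
  ∧-split = Equivalence.to T-∧

  ∧-join : ∀ {x y} → T x → T y → T (x ∧ y)
  ∧-join p q = Equivalence.from T-∧ (p , q)

  ∨-split : ∀ {x y} → T (x ∨ y) → T x ⊎ T y
  ∨-split = Equivalence.to T-∨

  ∨-join : ∀ {x y} → T x ⊎ T y → T (x ∨ y)
  ∨-join = Equivalence.from T-∨

  ℚ-pos-diff : ∀ {x y} → x ℚ.< y → 0ℚ ℚ.< y ℚ.- x
  ℚ-pos-diff {x} {y} lt = subst (ℚ._< y ℚ.- x) (ℚₚ.+-inverseʳ x) (ℚₚ.+-monoˡ-< (ℚ.- x) lt)

  ℚ-diff-pos : ∀ {x y} → 0ℚ ℚ.< y ℚ.- x → x ℚ.< y
  ℚ-diff-pos {x} {y} lt = subst₂ ℚ._<_ (ℚₚ.+-identityˡ x) (l y x) (ℚₚ.+-monoˡ-< x lt)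
    where
    l : ∀ y x → (y ℚ.- x) ℚ.+ x ≡ y
    l = ℚO.solve 2 (λ y x → (y ℚO.:- x) ℚO.:+ x ℚO.:= y) refl

  -- By trichotomy the sign of the norm need not be discussed: -x has no positive coordinate, so it
  -- cannot be positive.
  pos-of-nonneg : ∀ a b → 0ℚ ℚ.≤ a → 0ℚ ℚ.≤ b → ¬ (a ≡ 0ℚ × b ≡ 0ℚ) → FO.Pos (a +√ b)
  pos-of-nonneg a b 0≤a 0≤b neq = [ (λ p → p) , [ (λ e → contradiction (cong re e , cong im e) neq) , (λ n → ⊥-elim (bad n)) ]′ ]′ (FO.trichotomy
      (a +√ b))
    where
    flip : ∀ {x} → 0ℚ ℚ.< ℚ.- x → ¬ 0ℚ ℚ.≤ x
    flip {x} lt le = ℚ<⇒≱ lt (ℚₚ.neg-antimono-≤ le)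
    bad : FO.Pos (-F (a +√ b)) → ⊥
    bad (inj₁ (p , _)) = flip p 0≤a
    bad (inj₂ (p , _)) = flip p 0≤b

  posᵇ-sound : ∀ x → T (posᵇ x) → FO.Pos x
  posᵇ-sound (a +√ b) t = [ case₁ , (λ t → [ case₂ , (λ t → [ case₃ , case₄ ]′ (∨-split t)) ]′ (∨-split t)) ]′ (∨-split t)
    where
    case₁ : T (not (a ℚ.≤ᵇ 0ℚ) ∧ (0ℚ ℚ.≤ᵇ b)) → FO.Pos (a +√ b)
    case₁ t = pos-of-nonneg a b (ℚₚ.<⇒≤ 0<a) (ℚₚ.≤ᵇ⇒≤ (proj₂ (∧-split t))) λ { (e , _) → ℚₚ.<-irrefl (sym e) 0<a }
      where 0<a = <ᵇ-sound 0ℚ a (proj₁ (∧-split t))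
    case₂ : T ((0ℚ ℚ.≤ᵇ a) ∧ not (b ℚ.≤ᵇ 0ℚ)) → FO.Pos (a +√ b)
    case₂ t = pos-of-nonneg a b (ℚₚ.≤ᵇ⇒≤ (proj₁ (∧-split t))) (ℚₚ.<⇒≤ 0<b) λ { (_ , e) → ℚₚ.<-irrefl (sym e) 0<b }
      where 0<b = <ᵇ-sound 0ℚ b (proj₂ (∧-split {0ℚ ℚ.≤ᵇ a} t))
    case₃ : T (not (a ℚ.≤ᵇ 0ℚ) ∧ not (0ℚ ℚ.≤ᵇ b) ∧ not ((a ℚ.* a) ℚ.≤ᵇ (δ ℚ.* b ℚ.* b))) → FO.Pos (a +√ b)
    case₃ t = inj₁ (<ᵇ-sound 0ℚ a (proj₁ (∧-split t)) , ℚ-pos-diff (<ᵇ-sound (δ ℚ.* b ℚ.* b) (a ℚ.* a) (proj₂ (∧-split {not (0ℚ ℚ.≤ᵇ b)} (proj₂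
        (∧-split {not (a ℚ.≤ᵇ 0ℚ)} t))))))
    neg-sub : ∀ p q → p ℚ.- q ≡ ℚ.- (q ℚ.- p)
    neg-sub = ℚO.solve 2 (λ p q → p ℚO.:- q ℚO.:= ℚO.:- (q ℚO.:- p)) refl
    case₄ : T (not (0ℚ ℚ.≤ᵇ a) ∧ not (b ℚ.≤ᵇ 0ℚ) ∧ not ((δ ℚ.* b ℚ.* b) ℚ.≤ᵇ (a ℚ.* a))) → FO.Pos (a +√ b)
    case₄ t = inj₂ (<ᵇ-sound 0ℚ b (proj₁ (∧-split (proj₂ (∧-split {not (0ℚ ℚ.≤ᵇ a)} t)))) ,
      subst (0ℚ ℚ.<_) (neg-sub (δ ℚ.* b ℚ.* b) (a ℚ.* a)) (ℚ-pos-diff (<ᵇ-sound (a ℚ.* a) (δ ℚ.* b ℚ.* b) (proj₂ (∧-split {not (b ℚ.≤ᵇ 0ℚ)} (proj₂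
          (∧-split {not (0ℚ ℚ.≤ᵇ a)} t)))))))

  posᵇ-complete : ∀ x → FO.Pos x → T (posᵇ x)
  posᵇ-complete (a +√ b) (inj₁ (0<a , n)) with b ℚₚ.<? 0ℚ
  ... | no b≮0 = ∨-join (inj₁ (∧-join (<ᵇ-complete 0ℚ a 0<a) (ℚₚ.≤⇒≤ᵇ (ℚₚ.≮⇒≥ b≮0))))
  ... | yes b<0 = ∨-join {not (a ℚ.≤ᵇ 0ℚ) ∧ (0ℚ ℚ.≤ᵇ b)} (inj₂ (∨-join {(0ℚ ℚ.≤ᵇ a) ∧ not (b ℚ.≤ᵇ 0ℚ)} (inj₂ (∨-join (inj₁ (∧-join
      (<ᵇ-complete 0ℚ a 0<a) (∧-join (<ᵇ-complete b 0ℚ b<0) (<ᵇ-complete (δ ℚ.* b ℚ.* b) (a ℚ.* a) (ℚ-diff-pos n)))))))))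
  posᵇ-complete (a +√ b) (inj₂ (0<b , n)) with a ℚₚ.<? 0ℚ
  ... | no a≮0 = ∨-join {not (a ℚ.≤ᵇ 0ℚ) ∧ (0ℚ ℚ.≤ᵇ b)} (inj₂ (∨-join (inj₁ (∧-join (ℚₚ.≤⇒≤ᵇ (ℚₚ.≮⇒≥ a≮0)) (<ᵇ-complete 0ℚ b 0<b)))))
  ... | yes a<0 = ∨-join {not (a ℚ.≤ᵇ 0ℚ) ∧ (0ℚ ℚ.≤ᵇ b)} (inj₂ (∨-join {(0ℚ ℚ.≤ᵇ a) ∧ not (b ℚ.≤ᵇ 0ℚ)} (inj₂ (∨-join {not (a ℚ.≤ᵇ 0ℚ) ∧ not
      (0ℚ ℚ.≤ᵇ b) ∧ not ((a ℚ.* a) ℚ.≤ᵇ (δ ℚ.* b ℚ.* b))}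
      (inj₂ (∧-join (<ᵇ-complete a 0ℚ a<0) (∧-join (<ᵇ-complete 0ℚ b 0<b) (<ᵇ-complete (a ℚ.* a) (δ ℚ.* b ℚ.* b) (ℚ-diff-pos (subst (0ℚ ℚ.<_)
          (neg-sub (a ℚ.* a) (δ ℚ.* b ℚ.* b)) n))))))))))
    where
    neg-sub : ∀ p q → ℚ.- (p ℚ.- q) ≡ q ℚ.- p
    neg-sub = ℚO.solve 2 (λ p q → ℚO.:- (p ℚO.:- q) ℚO.:= q ℚO.:- p) refl

  nonnegᵇ-sound : ∀ x → T (nonnegᵇ x) → FO.Nonneg x
  nonnegᵇ-sound x@(a +√ b) t = [ (λ t → inj₁ (posᵇ-sound x t)) , (λ t → inj₂ (zero! t)) ]′ (∨-split {posᵇ x} t)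
    where
    zero! : T ((a ℚ.≤ᵇ 0ℚ) ∧ (0ℚ ℚ.≤ᵇ a) ∧ (b ℚ.≤ᵇ 0ℚ) ∧ (0ℚ ℚ.≤ᵇ b)) → x ≡ 0F
    zero! t = cong₂ _+√_ (ℚₚ.≤-antisym (ℚₚ.≤ᵇ⇒≤ (proj₁ t₁)) (ℚₚ.≤ᵇ⇒≤ (proj₁ t₂))) (ℚₚ.≤-antisym (ℚₚ.≤ᵇ⇒≤ (proj₁ t₃)) (ℚₚ.≤ᵇ⇒≤ (proj₂ t₃)))
      where
      t₁ = ∧-split {a ℚ.≤ᵇ 0ℚ} t
      t₂ = ∧-split {0ℚ ℚ.≤ᵇ a} (proj₂ t₁)
      t₃ = ∧-split {b ℚ.≤ᵇ 0ℚ} (proj₂ t₂)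

  nonnegᵇ-complete : ∀ x → FO.Nonneg x → T (nonnegᵇ x)
  nonnegᵇ-complete x (inj₁ p) = ∨-join (inj₁ (posᵇ-complete x p))
  nonnegᵇ-complete x (inj₂ refl) = _

  ≤F-sound : ∀ {x y} → x ≤F y → x FO.≤ y
  ≤F-sound {x} {y} t = FO.≤-mk (nonnegᵇ-sound (y -F x) t)

  ≤F-complete : ∀ {x y} → x FO.≤ y → x ≤F y
  ≤F-complete {x} {y} p = nonnegᵇ-complete (y -F x) (FO.≤-diff p)

  <F-sound : ∀ {x y} → x <F y → x FO.< y
  <F-sound {x} {y} t = FO.<-mk (posᵇ-sound (y -F x) t)

  <F-complete : ∀ {x y} → x FO.< y → x <F y
  <F-complete {x} {y} p = posᵇ-complete (y -F x) (FO.<-diff p)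

-- The integers of F and the elements α_c

module Integers (D : ℕ) (1≤D : 1 ℕ.≤ D) (D≢1 : D ≢ 1) (sf : Squarefree D) where

  open Field D public
  open RealQuadratic D 1≤D D≢1 sf public using (δ; F-orderedRing; posᵇ-sound; ≤F-sound; ≤F-complete; <F-sound; <F-complete)
  open OrderedRingProperties F-orderedRing public

  conj-+ : ∀ x y → conj (x + y) ≡ conj x + conj y
  conj-+ (a +√ b) (c +√ d) = cong₂ _+√_ refl (ℚₚ.neg-distrib-+ b d)

  conj-* : ∀ x y → conj (x * y) ≡ conj x * conj y
  conj-* (a +√ b) (c +√ d) = cong₂ _+√_
    (ℚO.solve 5 (λ D a b c d → a ℚO.:* c ℚO.:+ D ℚO.:* b ℚO.:* d ℚO.:= a ℚO.:* c ℚO.:+ D ℚO.:* (ℚO.:- b) ℚO.:* (ℚO.:- d)) refl δ a b c d)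
    (ℚO.solve 4 (λ a b c d → ℚO.:- (a ℚO.:* d ℚO.:+ b ℚO.:* c) ℚO.:= a ℚO.:* (ℚO.:- d) ℚO.:+ (ℚO.:- b) ℚO.:* c) refl a b c d)

  conj-ι : ∀ z → conj (ι z) ≡ ι z
  conj-ι z = refl

  conj-involutive : ∀ x → conj (conj x) ≡ x
  conj-involutive (a +√ b) = cong (a +√_) (ℚO.solve 1 (λ b → ℚO.:- (ℚO.:- b) ℚO.:= b) refl b)

  -- The facts common to both residue cases of D. `norm` is minus the norm of ω, that is (D - 1)/4
  -- or D, and hence a natural number.
  record Constants (Δ : ℕ) (ω √Δ : F) : Set where
    field
      √Δ>0 : Pos √Δ
      √Δ²≡Δ : √Δ * √Δ ≡ ι (ℤ.+ Δ)
      4≤Δ : 4 ℕ.≤ Δ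
      ω≡ : ω ≡ conj ω + √Δ
      trace norm : ℕ
      trace≡ : ω + conj ω ≡ ι (ℤ.+ trace)
      trace≤1 : trace ℕ.≤ 1
      ω²≡ : ω * ω ≡ ι (ℤ.+ norm) + ι (ℤ.+ trace) * ω
      InO-√D : ∃₂ λ u v → 0ℚ +√ 1ℚ ≡ ι u + ι v * ω

  -- The Boolean is a variable so that a single match reduces the conditionals in Δ, ω and √Δ
  -- together.
  constants′ : ∀ b → (T b → D ℕ.% 4 ≡ 1) → Constants (if b then D else 4 ℕ.* D) (if b then (½ +√ ½) else (0ℚ +√ 1ℚ)) (if b then (0ℚ +√ 1ℚ) else
      (0ℚ +√ ((ℤ.+ 2) ℚ./ 1)))
  constants′ true D%4 = record
    { √Δ>0 = posᵇ-sound (0ℚ +√ 1ℚ) _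
    ; √Δ²≡Δ = cong₂ _+√_ (ℚO.solve 1 (λ D → ℚO.con 0ℤ ℚO.:* ℚO.con 0ℤ ℚO.:+ D ℚO.:* ℚO.con 1ℤ ℚO.:* ℚO.con 1ℤ ℚO.:= D) refl δ) refl
    ; 4≤Δ = bound D D≢1 (D%4 _)
    ; ω≡ = refl
    ; trace = 1 ; norm = D ℕ./ 4
    ; trace≡ = refl
    ; trace≤1 = ℕₚ.≤-refl
    ; ω²≡ = cong₂ _+√_ (trans (cong (λ δ → ½ ℚ.* ½ ℚ.+ δ ℚ.* ½ ℚ.* ½) δ≡) (trans (l₁ ½ k) l₂)) refl
    -- √D = -1 + 2ω.
    ; InO-√D = ℤ.- 1ℤ , ℤ.+ 2 , cong₂ _+√_ (sym (cong (λ t → ℤ→ℚ (ℤ.- 1ℤ) ℚ.+ (ℤ→ℚ (ℤ.+ 2) ℚ.* ½ ℚ.+ t ℚ.* ½)) (ℚₚ.*-zeroʳ δ))) refl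
    }
    where
    bound : ∀ D → D ≢ 1 → D ℕ.% 4 ≡ 1 → 4 ℕ.≤ D
    bound (suc zero) D≢1 _ = contradiction refl D≢1
    bound (suc (suc (suc (suc D)))) _ _ = ℕ.s≤s (ℕ.s≤s (ℕ.s≤s (ℕ.s≤s ℕ.z≤n)))
    k = ℤ→ℚ (ℤ.+ (D ℕ./ 4))
    δ≡ : δ ≡ ℤ→ℚ 1ℤ ℚ.+ k ℚ.* ℤ→ℚ (ℤ.+ 4)
    δ≡ = trans (cong ℤ→ℚ (trans (cong ℤ.+_ (trans (ℕ.m≡m%n+[m/n]*n D 4) (cong (ℕ._+ D ℕ./ 4 ℕ.* 4) (D%4 _)))) (cong (λ t → 1ℤ ℤ.+ t) (ℤₚ.pos-*
        (D ℕ./ 4) 4))))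
      (trans (ℤ→ℚ-+ 1ℤ (ℤ.+ (D ℕ./ 4) ℤ.* ℤ.+ 4)) (cong (λ t → ℤ→ℚ 1ℤ ℚ.+ t) (ℤ→ℚ-* (ℤ.+ (D ℕ./ 4)) (ℤ.+ 4))))
    l₁ : ∀ h k → h ℚ.* h ℚ.+ (ℤ→ℚ 1ℤ ℚ.+ k ℚ.* ℤ→ℚ (ℤ.+ 4)) ℚ.* h ℚ.* h ≡ k ℚ.* (ℤ→ℚ (ℤ.+ 4) ℚ.* (h ℚ.* h)) ℚ.+ ℤ→ℚ (ℤ.+ 2) ℚ.* (h ℚ.* h)
    l₁ = ℚO.solve 2 (λ h k → h ℚO.:* h ℚO.:+ (ℚO.con 1ℤ ℚO.:+ k ℚO.:* ℚO.con (ℤ.+ 4)) ℚO.:* h ℚO.:* h ℚO.:= k ℚO.:* (ℚO.con (ℤ.+ 4) ℚO.:*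
        (h ℚO.:* h)) ℚO.:+ ℚO.con (ℤ.+ 2) ℚO.:* (h ℚO.:* h)) refl
    l₂ : k ℚ.* (ℤ→ℚ (ℤ.+ 4) ℚ.* (½ ℚ.* ½)) ℚ.+ ℤ→ℚ (ℤ.+ 2) ℚ.* (½ ℚ.* ½) ≡ k ℚ.+ (ℤ→ℚ 1ℤ ℚ.* ½ ℚ.+ δ ℚ.* 0ℚ ℚ.* ½)
    l₂ = cong₂ ℚ._+_ (ℚₚ.*-identityʳ k) (sym (trans (cong (λ t → ½ ℚ.+ t ℚ.* ½) (ℚₚ.*-zeroʳ δ)) refl))
  constants′ false _ = record
    { √Δ>0 = posᵇ-sound (0ℚ +√ ((ℤ.+ 2) ℚ./ 1)) _
    ; √Δ²≡Δ = cong₂ _+√_ (trans (ℚO.solve 1 (λ D → ℚO.con 0ℤ ℚO.:* ℚO.con 0ℤ ℚO.:+ D ℚO.:* ℚO.con (ℤ.+ 2) ℚO.:* ℚO.con (ℤ.+ 2) ℚO.:= ℚO.con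
        (ℤ.+ 4) ℚO.:* D) refl δ)
        (trans (sym (ℤ→ℚ-* (ℤ.+ 4) (ℤ.+ D))) (cong ℤ→ℚ (sym (ℤₚ.pos-* 4 D))))) refl
    ; 4≤Δ = ℕₚ.*-monoʳ-≤ 4 1≤D
    ; ω≡ = refl
    ; trace = 0 ; norm = D
    ; trace≡ = refl
    ; trace≤1 = ℕ.z≤n
    ; ω²≡ = cong₂ _+√_ (ℚO.solve 1 (λ D → ℚO.con 0ℤ ℚO.:* ℚO.con 0ℤ ℚO.:+ D ℚO.:* ℚO.con 1ℤ ℚO.:* ℚO.con 1ℤ ℚO.:= D ℚO.:+
        (ℚO.con 0ℤ ℚO.:* ℚO.con 0ℤ ℚO.:+ D ℚO.:* ℚO.con 0ℤ ℚO.:* ℚO.con 1ℤ)) refl δ) refl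
    ; InO-√D = 0ℤ , 1ℤ , cong₂ _+√_ (sym (cong (λ t → 0ℚ ℚ.+ (0ℚ ℚ.+ t ℚ.* 1ℚ)) (ℚₚ.*-zeroʳ δ))) refl
    }

  constants : Constants Δ ω √Δ
  constants = constants′ is1mod4 (ℕₚ.≡ᵇ⇒≡ (D ℕ.% 4) 1)

  open Constants constants public

  0<√Δ : 0# < √Δ
  0<√Δ = pos⇒0< √Δ>0

  0≤ι : ∀ n → 0# ≤ ι (ℤ.+ n)
  0≤ι n = ι-0≤ {ℤ.+ n} (ℤ.+≤+ ℕ.z≤n)

  2≤√Δ : ι (ℤ.+ 2) ≤ √Δ
  2≤√Δ = [ (λ p → p) , (λ lt → contradiction (ι-mono-≤ {ℤ.+ 4} {ℤ.+ Δ} (ℤ.+≤+ 4≤Δ)) (<⇒≱ (small lt))) ]′ (≤⊎> (ι (ℤ.+ 2)) √Δ)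
    where
    small : √Δ < ι (ℤ.+ 2) → ι (ℤ.+ Δ) < ι (ℤ.+ 4)
    small lt = subst₂ _<_ √Δ²≡Δ (sym (ι-* (ℤ.+ 2) (ℤ.+ 2))) (<-≤-trans (*-monoˡ-< 0<√Δ lt) (*-monoʳ-≤ (0≤ι 2) (<⇒≤ lt)))

  InO-ι : ∀ z → InO (ι z)
  InO-ι z = z , 0ℤ , sym (trans (cong (ι z +_) (zeroˡ ω)) (+-identityʳ (ι z)))

  InO-+ : ∀ {x y} → InO x → InO y → InO (x + y)
  InO-+ (u , v , refl) (u′ , v′ , refl) = u ℤ.+ u′ , v ℤ.+ v′ ,
    trans (solve 5 (λ a b c d w → a :+ b :* w :+ (c :+ d :* w) := a :+ c :+ (b :+ d) :* w) refl (ι u) (ι v) (ι u′) (ι v′) ω)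
      (sym (cong₂ (λ p q → p + q * ω) (ι-+ u u′) (ι-+ v v′)))

  InO-* : ∀ {x y} → InO x → InO y → InO (x * y)
  InO-* (u , v , refl) (u′ , v′ , refl) = u ℤ.* u′ ℤ.+ v ℤ.* v′ ℤ.* ℤ.+ norm , u ℤ.* v′ ℤ.+ v ℤ.* u′ ℤ.+ v ℤ.* v′ ℤ.* ℤ.+ trace ,
    trans (solve 5 (λ a b c d w → (a :+ b :* w) :* (c :+ d :* w) := a :* c :+ (a :* d :+ b :* c) :* w :+ b :* d :* (w :* w)) refl (ι u) (ι v) (ι u′)
        (ι v′) ω)
      (trans (cong (λ t → ι u * ι u′ + (ι u * ι v′ + ι v * ι u′) * ω + ι v * ι v′ * t) ω²≡)
        (trans (solve 7 (λ a b c d w n t → a :* c :+ (a :* d :+ b :* c) :* w :+ b :* d :* (n :+ t :* w) := a :* c :+ b :* d :* n :+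
            (a :* d :+ b :* c :+ b :* d :* t) :* w) refl (ι u) (ι v) (ι u′) (ι v′) ω (ι (ℤ.+ norm)) (ι (ℤ.+ trace)))
          (sym (cong₂ (λ p q → p + q * ω)
            (trans (ι-+ (u ℤ.* u′) (v ℤ.* v′ ℤ.* ℤ.+ norm)) (cong₂ _+_ (ι-* u u′) (trans (ι-* (v ℤ.* v′) (ℤ.+ norm)) (cong (_* ι (ℤ.+ norm))
                (ι-* v v′)))))
            (trans (ι-+ (u ℤ.* v′ ℤ.+ v ℤ.* u′) (v ℤ.* v′ ℤ.* ℤ.+ trace)) (cong₂ _+_ (trans (ι-+ (u ℤ.* v′) (v ℤ.* u′)) (cong₂ _+_ (ι-* u v′)
                (ι-* v u′)))
              (trans (ι-* (v ℤ.* v′) (ℤ.+ trace)) (cong (_* ι (ℤ.+ trace)) (ι-* v v′)))))))))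

  InO-∑ : ∀ {n} {f : Fin n → F} → (∀ i → InO (f i)) → InO (∑ f)
  InO-∑ {zero} h = InO-ι 0ℤ
  InO-∑ {suc n} h = InO-+ (h zero) (InO-∑ (h ∘ suc))

  InO-ω : InO ω
  InO-ω = 0ℤ , 1ℤ , sym (trans (+-identityˡ _) (*-identityˡ ω))

  floor-search : ∀ k x lo → ι lo ≤ x → x < ι (lo ℤ.+ ℤ.+ k) → ∃ λ n → ι n ≤ x × x < ι (n ℤ.+ 1ℤ)
  floor-search zero x lo le lt = contradiction le (<⇒≱ (subst (λ t → x < ι t) (ℤₚ.+-identityʳ lo) lt))
  floor-search (suc k) x lo le lt = [ (λ le′ → floor-search k x (lo ℤ.+ 1ℤ) le′ (subst (λ t → x < ι t) (sym (ℤₚ.+-assoc lo 1ℤ (ℤ.+ k))) lt)) ,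
      (λ lt′ → lo , le , lt′) ]′ (≤⊎> (ι (lo ℤ.+ 1ℤ)) x)

  √Δ≤Δ : √Δ ≤ ι (ℤ.+ Δ)
  √Δ≤Δ = subst₂ _≤_ (*-identityʳ √Δ) √Δ²≡Δ (*-monoˡ-≤ (<⇒≤ 0<√Δ) (≤-trans (ι-mono-≤ {1ℤ} {ℤ.+ 2} (ℤ.+≤+ (ℕ.s≤s ℕ.z≤n))) 2≤√Δ))

  cω : ℕ → F
  cω c = ℕ→F c * ω

  conj-cω : ∀ c → conj (cω c) ≡ ι (ℤ.+ c) * conj ω
  conj-cω c = conj-* (ι (ℤ.+ c)) ω

  cω-skew : ∀ c → cω c ≡ conj (cω c) + √Δ * ι (ℤ.+ c)
  cω-skew c = trans (cong (ι (ℤ.+ c) *_) ω≡) (trans (solve 3 (λ c w s → c :* (w :+ s) := c :* w :+ s :* c) refl (ι (ℤ.+ c)) (conj ω) √Δ) (cong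
      (_+ √Δ * ι (ℤ.+ c)) (sym (conj-cω c))))

  2conj-ω : ι (ℤ.+ 2) * conj ω ≡ ι (ℤ.+ trace) - √Δ
  2conj-ω = trans (solve 2 (λ w s → con (ℤ.+ 2) :* w := (w :+ s) :+ w :- s) refl (conj ω) √Δ) (cong (_- √Δ) (trans (cong (_+ conj ω)
      (sym ω≡)) trace≡))

  conj-ω<1 : conj ω < ι 1ℤ
  conj-ω<1 = [ (λ le → contradiction (bad le) (<⇒≱ (<-≤-trans trace-√Δ<1 (ι-mono-≤ {1ℤ} {ℤ.+ 2} (ℤ.+≤+ (ℕ.s≤s ℕ.z≤n)))))) , (λ lt → lt) ]′ (≤⊎>
      (ι 1ℤ) (conj ω))
    where
    bad : ι 1ℤ ≤ conj ω → ι (ℤ.+ 2) ≤ ι (ℤ.+ trace) - √Δ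
    bad le = subst₂ _≤_ (*-identityʳ (ι (ℤ.+ 2))) 2conj-ω (*-monoˡ-≤ (0≤ι 2) le)
    trace-√Δ<1 : ι (ℤ.+ trace) - √Δ < ι 1ℤ
    trace-√Δ<1 = <-≤-trans (<-by √Δ>0 (solve 2 (λ t s → t :- (t :- s) := s) refl (ι (ℤ.+ trace)) √Δ)) (ι-mono-≤ {ℤ.+ trace} {1ℤ} (ℤ.+≤+ trace≤1))

  -Δ≤conj-ω : - ι (ℤ.+ Δ) ≤ conj ω
  -Δ≤conj-ω = *-cancel-≤ (ι-0< {ℤ.+ 2} (ℤ.+<+ (ℕ.s≤s ℕ.z≤n))) (subst (ι (ℤ.+ 2) * - ι (ℤ.+ Δ) ≤_) (sym 2conj-ω)
    (≤-by (nonneg-+ (0≤⇒nonneg (0≤ι trace)) (nonneg-+ (≤-diff √Δ≤Δ) (0≤⇒nonneg (0≤ι Δ))))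
      (solve 3 (λ t s d → t :- s :- con (ℤ.+ 2) :* (:- d) := t :+ (d :- s :+ d)) refl (ι (ℤ.+ trace)) √Δ (ι (ℤ.+ Δ)))))

  -- A linear search over integers. It starts at -cΔ and ends at c + 1, because -Δ ≤ ω′ < 1.
  floor : ∀ c → ∃ λ n → ι n ≤ conj (cω c) × conj (cω c) < ι (n ℤ.+ 1ℤ)
  floor c = floor-search (c ℕ.* Δ ℕ.+ suc c) (conj (cω c)) (ℤ.- (ℤ.+ (c ℕ.* Δ))) lower upper
    where
    lower : ι (ℤ.- (ℤ.+ (c ℕ.* Δ))) ≤ conj (cω c)
    lower = subst₂ _≤_ (trans (solve 2 (λ c d → c :* (:- d) := :- (c :* d)) refl (ι (ℤ.+ c)) (ι (ℤ.+ Δ))) (sym (trans (ι-neg (ℤ.+ (c ℕ.* Δ)))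
        (cong -_ (trans (cong ι (ℤₚ.pos-* c Δ)) (ι-* (ℤ.+ c) (ℤ.+ Δ)))))))
      (sym (conj-cω c)) (*-monoˡ-≤ (0≤ι c) -Δ≤conj-ω)
    eq : ℤ.- (ℤ.+ (c ℕ.* Δ)) ℤ.+ ℤ.+ (c ℕ.* Δ ℕ.+ suc c) ≡ ℤ.+ suc c
    eq = trans (cong (λ t → ℤ.- (ℤ.+ (c ℕ.* Δ)) ℤ.+ t) (ℤₚ.pos-+ (c ℕ.* Δ) (suc c))) (trans (sym (ℤₚ.+-assoc (ℤ.- (ℤ.+ (c ℕ.* Δ))) (ℤ.+ (c ℕ.* Δ))
        (ℤ.+ suc c))) (trans (cong (ℤ._+ ℤ.+ suc c) (ℤₚ.+-inverseˡ (ℤ.+ (c ℕ.* Δ)))) (ℤₚ.+-identityˡ (ℤ.+ suc c))))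
    upper : conj (cω c) < ι (ℤ.- (ℤ.+ (c ℕ.* Δ)) ℤ.+ ℤ.+ (c ℕ.* Δ ℕ.+ suc c))
    upper = subst₂ _<_ (sym (conj-cω c)) (cong ι (sym eq)) (≤-<-trans (subst (ι (ℤ.+ c) * conj ω ≤_) (*-identityʳ (ι (ℤ.+ c))) (*-monoˡ-≤ (0≤ι c)
        (<⇒≤ conj-ω<1))) (ι-mono-< {ℤ.+ c} {ℤ.+ suc c} (ℤ.+<+ (ℕₚ.n<1+n c))))

  ⌊cω′⌋ : ℕ → ℤ
  ⌊cω′⌋ c = proj₁ (floor c)

  α : ℕ → F
  α c = cω c - ι (⌊cω′⌋ c)

  α-IsCω : ∀ c → IsCω c (α c)
  α-IsCω c = ⌊cω′⌋ c , (≤F-complete (proj₁ (proj₂ (floor c))) , <F-complete (proj₂ (proj₂ (floor c)))) , refl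

  conj-α : ∀ c → conj (α c) ≡ conj (cω c) - ι (⌊cω′⌋ c)
  conj-α c = conj-+ (cω c) (- ι (⌊cω′⌋ c))

  α-skew : ∀ c → α c ≡ conj (α c) + √Δ * ι (ℤ.+ c)
  α-skew c = trans (cong (_- ι (⌊cω′⌋ c)) (cω-skew c)) (trans (solve 3 (λ p q n → p :+ q :- n := p :- n :+ q) refl (conj (cω c)) (√Δ * ι (ℤ.+ c)) (ι
      (⌊cω′⌋ c))) (cong (_+ √Δ * ι (ℤ.+ c)) (sym (conj-α c))))

  0<√Δc : ∀ c → 1 ℕ.≤ c → 0# < √Δ * ι (ℤ.+ c)
  0<√Δc c 1≤c = 0<-* 0<√Δ (ι-0< {ℤ.+ c} (ℤ.+<+ 1≤c))

  0≤α′ : ∀ c → Nonneg (conj (α c))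
  0≤α′ c = subst Nonneg (sym (conj-α c)) (≤-diff (proj₁ (proj₂ (floor c))))

  -- Strictness: α_c′ = 0 would give α_c = 0, hence c √Δ = 0.
  0<α′ : ∀ c → 1 ℕ.≤ c → 0# < conj (α c)
  0<α′ c 1≤c = [ pos⇒0< , (λ e → contradiction (0<√Δc c 1≤c) (subst (λ t → ¬ 0# < t) (sym (zero! e)) <-irrefl)) ]′ (0≤α′ c)
    where
    zero! : conj (α c) ≡ 0# → √Δ * ι (ℤ.+ c) ≡ 0#
    zero! e = trans (sym (+-identityˡ _)) (trans (cong (_+ √Δ * ι (ℤ.+ c)) (sym e)) (trans (sym (α-skew c)) (trans (sym (conj-involutive (α c)))
        (cong conj e))))

  α′≤1 : ∀ c → conj (α c) ≤ 1#
  α′≤1 c = subst (_≤ 1#) (sym (conj-α c)) (≤-by (inj₁ (<-diff (proj₂ (proj₂ (floor c)))))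
    (trans (solve 2 (λ x n → con 1ℤ :- (x :- n) := n :+ con 1ℤ :- x) refl (conj (cω c)) (ι (⌊cω′⌋ c))) (cong (_- conj (cω c)) (sym (ι-+
        (⌊cω′⌋ c) 1ℤ)))))

  InO-α : ∀ c → InO (α c)
  InO-α c = InO-+ (InO-* (InO-ι (ℤ.+ c)) InO-ω) (subst InO (ι-neg (⌊cω′⌋ c)) (InO-ι (ℤ.- ⌊cω′⌋ c)))

  TotPos-α : ∀ c → 1 ℕ.≤ c → TotPos (α c)
  TotPos-α c 1≤c = <F-complete (subst (0# <_) (sym (α-skew c)) (pos⇒0< (pos-+ (0<⇒pos (0<α′ c 1≤c)) (0<⇒pos (0<√Δc c 1≤c))))) , <F-complete
      (0<α′ c 1≤c)

  TotPos-ι : ∀ c → 1 ℕ.≤ c → TotPos (ι (ℤ.+ c))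
  TotPos-ι c 1≤c = <F-complete (ι-0< {ℤ.+ c} (ℤ.+<+ 1≤c)) , <F-complete (ι-0< {ℤ.+ c} (ℤ.+<+ 1≤c))

-- From the lattice to the abstract setting

module FromLattice (D : ℕ) (1≤D : 1 ℕ.≤ D) (D≢1 : D ≢ 1) (sf : Squarefree D)
  (V : Field.QuadSpace D) (L : Field.QuadSpace.Lattice V)
  (classical : Field.QuadSpace.Lattice.Classical L) (totPosDef : Field.QuadSpace.Lattice.TotPosDef L) where

  open Integers D 1≤D D≢1 sf
  open LinearAlgebra F-orderedRing
  open QuadSpace V renaming (sym to G-sym)
  open Lattice L

  ΣF≡∑ : ∀ {n} (f : Fin n → F) → ΣF f ≡ ∑ f
  ΣF≡∑ {zero} f = refl
  ΣF≡∑ {suc n} f = cong (f zero +_) (ΣF≡∑ (f ∘ suc))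

  Q≡quad : ∀ v → Q v ≡ quad G v v
  Q≡quad v = trans (ΣF≡∑ _) (∑-cong λ i → trans (ΣF≡∑ _) (∑-cong λ j → solve 3 (λ g x y → g :* x :* y := x :* y :* g) refl (G i j) (v i) (v j)))

  half : F
  half = ½ +√ 0ℚ

  half-double : ∀ x → half * (ι (ℤ.+ 2) * x) ≡ x
  half-double x = trans (sym (*-assoc half (ι (ℤ.+ 2)) x)) (trans (cong (_* x) h2) (*-identityˡ x))
    where
    h2 : half * ι (ℤ.+ 2) ≡ ι 1ℤ
    h2 = cong₂ _+√_ (cong (λ t → 1ℚ ℚ.+ t ℚ.* 0ℚ) (ℚₚ.*-zeroʳ δ)) refl

  B≡quad : ∀ v w → B v w ≡ quad G v w
  B≡quad v w = trans (cong (half *_) diff) (half-double (quad G v w))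
    where
    e : ∀ i → (v +V w) i ≡ ι 1ℤ * v i + ι 1ℤ * w i
    e i = sym (cong₂ _+_ (*-identityˡ (v i)) (*-identityˡ (w i)))
    diff : Q (v +V w) - Q v - Q w ≡ ι (ℤ.+ 2) * quad G v w
    diff = trans (cong₂ _-_ (cong₂ _-_ (trans (Q≡quad (v +V w)) (trans (quad-cong {β = G} (λ _ _ → refl) e e) (quad-square G G-sym (ι 1ℤ)
        (ι 1ℤ) v w))) (Q≡quad v)) (Q≡quad w))
      (solve 3 (λ p q r → con 1ℤ :* con 1ℤ :* p :+ con (ℤ.+ 2) :* (con 1ℤ :* con 1ℤ) :* q :+ con 1ℤ :* con 1ℤ :* r :- p :- r := con
          (ℤ.+ 2) :* q) refl (quad G v v) (quad G v w) (quad G w w))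

  X : Set
  X = Σ (Vec dim) _∈L

  b : X → X → F
  b x y = quad G (proj₁ x) (proj₁ y)

  ∑-reassoc : ∀ {n r} (c : Fin n → F) (M : Fin n → Fin r → F) (x : Fin r → F) → ∑ (λ i → c i * ∑ (λ t → M i t * x t)) ≡ ∑ (λ t → ∑
      (λ i → c i * M i t) * x t)
  ∑-reassoc c M x = trans (∑-cong λ i → sym (∑-* (c i) (λ t → M i t * x t))) (trans (∑-swap (λ i t → c i * (M i t * x t)))
    (∑-cong λ t → trans (∑-cong λ i → solve 3 (λ c m x → c :* (m :* x) := x :* (c :* m)) refl (c i) (M i t) (x t)) (trans (∑-* (x t)
        (λ i → c i * M i t)) (*-comm (x t) _))))

  lin-∈L : ∀ {n} (c : Fin n → F) → (∀ i → InO (c i)) → (z : Fin n → X) → lin G G-sym c (proj₁ ∘ z) ∈L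
  lin-∈L c c∈O z = (λ j → ∑ λ i → c i * coef i j) , (λ j → InO-∑ λ i → InO-* (c∈O i) (proj₁ (proj₂ (proj₂ (z i))) j)) ,
    λ t → trans (∑-cong λ i → cong (c i *_) (trans (proj₂ (proj₂ (proj₂ (z i))) t) (ΣF≡∑ _))) (trans (∑-reassoc c coef (λ j → gen j t)) (sym
        (ΣF≡∑ _)))
    where
    coef = λ i → proj₁ (proj₂ (z i))

  denominator : ∀ x → ∃ λ N → 0ℤ ℤ.< N × InO (ι N * x)
  denominator x@(p +√ q) = ↧ p ℤ.* ↧ q , ℤ.+<+ (ℕ.s≤s ℕ.z≤n) , subst InO (sym eq) (InO-+ (InO-ι (↥ p ℤ.* ↧ q)) (InO-* (InO-ι (↥ q ℤ.* ↧ p)) InO-√D))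
    where
    dp = ℤ→ℚ (↧ p)
    dq = ℤ→ℚ (↧ q)
    z = 0ℚ
    eq₁ : ℤ→ℚ (↥ p ℤ.* ↧ q) ≡ p ℚ.* dp ℚ.* dq
    eq₁ = trans (ℤ→ℚ-* (↥ p) (↧ q)) (cong (ℚ._* dq) (sym (denominator-clear p)))
    eq₂ : ℤ→ℚ (↥ q ℤ.* ↧ p) ≡ q ℚ.* dq ℚ.* dp
    eq₂ = trans (ℤ→ℚ-* (↥ q) (↧ p)) (cong (ℚ._* dp) (sym (denominator-clear q)))
    l₁ : ∀ p q d e D → d ℚ.* e ℚ.* p ℚ.+ D ℚ.* 0ℚ ℚ.* q ≡ p ℚ.* d ℚ.* e ℚ.+ (q ℚ.* e ℚ.* d ℚ.* 0ℚ ℚ.+ D ℚ.* 0ℚ ℚ.* 1ℚ)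
    l₁ = ℚO.solve 5 (λ p q d e D → d ℚO.:* e ℚO.:* p ℚO.:+ D ℚO.:* ℚO.con 0ℤ ℚO.:* q ℚO.:= p ℚO.:* d ℚO.:* e ℚO.:+
        (q ℚO.:* e ℚO.:* d ℚO.:* ℚO.con 0ℤ ℚO.:+ D ℚO.:* ℚO.con 0ℤ ℚO.:* ℚO.con 1ℤ)) refl
    l₂ : ∀ p q d e → d ℚ.* e ℚ.* q ℚ.+ 0ℚ ℚ.* p ≡ 0ℚ ℚ.+ (q ℚ.* e ℚ.* d ℚ.* 1ℚ ℚ.+ 0ℚ ℚ.* 0ℚ)
    l₂ = ℚO.solve 4 (λ p q d e → d ℚO.:* e ℚO.:* q ℚO.:+ ℚO.con 0ℤ ℚO.:* p ℚO.:= ℚO.con 0ℤ ℚO.:+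
        (q ℚO.:* e ℚO.:* d ℚO.:* ℚO.con 1ℤ ℚO.:+ ℚO.con 0ℤ ℚO.:* ℚO.con 0ℤ)) refl
    eq : ι (↧ p ℤ.* ↧ q) * x ≡ ι (↥ p ℤ.* ↧ q) + ι (↥ q ℤ.* ↧ p) * (0ℚ +√ 1ℚ)
    eq = cong₂ _+√_
      (trans (cong (λ t → t ℚ.* p ℚ.+ δ ℚ.* 0ℚ ℚ.* q) (ℤ→ℚ-* (↧ p) (↧ q))) (trans (l₁ p q dp dq δ) (sym (cong₂ (λ s t → s ℚ.+
          (t ℚ.* 0ℚ ℚ.+ δ ℚ.* 0ℚ ℚ.* 1ℚ)) eq₁ eq₂))))
      (trans (cong (λ t → t ℚ.* q ℚ.+ 0ℚ ℚ.* p) (ℤ→ℚ-* (↧ p) (↧ q))) (trans (l₂ p q dp dq) (sym (cong (λ t → 0ℚ ℚ.+ (t ℚ.* 1ℚ ℚ.+ 0ℚ ℚ.* 0ℚ)) eq₂))))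

  *-pos : ∀ {x y} → 0ℤ ℤ.< x → 0ℤ ℤ.< y → 0ℤ ℤ.< x ℤ.* y
  *-pos {x} {y} p q = subst (ℤ._< x ℤ.* y) (ℤₚ.*-zeroʳ x) (ℤₚ.*-monoˡ-<-pos x {{ℤ.positive p}} q)

  common-denominator : ∀ {n} (c : Fin n → F) → ∃ λ N → 0ℤ ℤ.< N × (∀ i → InO (ι N * c i))
  common-denominator {zero} c = 1ℤ , ℤ.+<+ (ℕ.s≤s ℕ.z≤n) , λ ()
  common-denominator {suc n} c = merge (denominator (c zero)) (common-denominator (c ∘ suc))
    where
    merge : (∃ λ N → 0ℤ ℤ.< N × InO (ι N * c zero)) → (∃ λ N → 0ℤ ℤ.< N × (∀ i → InO (ι N * c (suc i)))) → ∃ λ N → 0ℤ ℤ.< N × (∀ i → InO (ι N * c i))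
    merge (M , 0<M , h) (N , 0<N , hs) = M ℤ.* N , *-pos 0<M 0<N , all
      where
      l : ∀ x y c → y * (x * c) ≡ x * y * c
      l = solve 3 (λ x y c → y :* (x :* c) := x :* y :* c) refl
      all : ∀ i → InO (ι (M ℤ.* N) * c i)
      all zero = subst InO (trans (l (ι M) (ι N) (c zero)) (cong (_* c zero) (sym (ι-* M N)))) (InO-* (InO-ι N) h)
      all (suc i) = subst InO (trans (sym (*-assoc (ι M) (ι N) (c (suc i)))) (cong (_* c (suc i)) (sym (ι-* M N)))) (InO-* (InO-ι M) (hs i))

  TotPos⇒0≤ : ∀ x → TotPos x → 0# ≤ x × 0# ≤ conj x
  TotPos⇒0≤ x (p , p′) = <⇒≤ (<F-sound {0F} {x} p) , <⇒≤ (<F-sound {0F} {conj x} p′)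

  Q-nonneg : ∀ v → v ∈L → 0# ≤ quad G v v × 0# ≤ conj (quad G v v)
  Q-nonneg v v∈L = go (Finₚ.all? (λ i → v i ≟0))
    where
    go : Dec (∀ i → v i ≡ 0#) → 0# ≤ quad G v v × 0# ≤ conj (quad G v v)
    go (yes v≡0) = ≤-reflexive (sym q≡0) , ≤-reflexive (sym (cong conj q≡0))
      where
      q≡0 : quad G v v ≡ 0#
      q≡0 = ∑-zero λ i → ∑-zero λ j → trans (cong (λ t → t * v j * G i j) (v≡0 i)) (trans (cong (_* G i j) (zeroˡ (v j))) (zeroˡ (G i j)))
    go (no v≢0) = subst (λ q → 0# ≤ q × 0# ≤ conj q) (Q≡quad v) (TotPos⇒0≤ (Q v) (totPosDef v v∈L v≢0))

  quad-scale : ∀ {n} (β : Matrix n) x c → quad β (λ i → x * c i) (λ i → x * c i) ≡ x * x * quad β c c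
  quad-scale β x c = trans (∑-cong λ i → trans (∑-cong λ j → solve 4 (λ x c d g → x :* c :* (x :* d) :* g := x :* x :* (c :* d :* g)) refl x (c i)
      (c j) (β i j)) (∑-* (x * x) (λ j → c i * c j * β i j))) (∑-* (x * x) (λ i → ∑ λ j → c i * c j * β i j))

  -- Positivity is given on L only, that is for coefficients in the ring of integers. A common
  -- denominator N carries a combination into L and multiplies the value by N², which is cancelled
  -- under both embeddings.
  psd-both : ∀ {n} (z : Fin n → X) c → 0# ≤ quad (λ i j → b (z i) (z j)) c c × 0# ≤ conj (quad (λ i j → b (z i) (z j)) c c)
  psd-both z c = go (common-denominator c)
    where
    q = quad (λ i j → b (z i) (z j)) c c
    go : (∃ λ N → 0ℤ ℤ.< N × (∀ i → InO (ι N * c i))) → 0# ≤ q × 0# ≤ conj q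
    go (N , 0<N , Nc∈O) = *-cancel-≤ 0<N² (subst₂ _≤_ (sym (zeroʳ (ι N * ι N))) scaled (proj₁ nn)) ,
                          *-cancel-≤ 0<N² (subst₂ _≤_ (sym (zeroʳ (ι N * ι N))) (trans (cong conj scaled) (trans (conj-* (ι N * ι N) q) (cong
                              (_* conj q) (conj-* (ι N) (ι N))))) (proj₂ nn))
      where
      0<N² : 0# < ι N * ι N
      0<N² = 0<-* (ι-0< {N} 0<N) (ι-0< {N} 0<N)
      Nc = λ i → ι N * c i
      nn = Q-nonneg (lin G G-sym Nc (proj₁ ∘ z)) (lin-∈L Nc Nc∈O z)
      scaled : quad G (lin G G-sym Nc (proj₁ ∘ z)) (lin G G-sym Nc (proj₁ ∘ z)) ≡ ι N * ι N * q
      scaled = trans (quad-lin G G-sym Nc (proj₁ ∘ z)) (quad-scale (λ i j → b (z i) (z j)) (ι N) c)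

  conj-∑ : ∀ {n} (f : Fin n → F) → conj (∑ f) ≡ ∑ (conj ∘ f)
  conj-∑ {zero} f = refl
  conj-∑ {suc n} f = trans (conj-+ (f zero) (∑ (f ∘ suc))) (cong (conj (f zero) +_) (conj-∑ (f ∘ suc)))

  conj-quad : ∀ {n} (β : Matrix n) c → conj (quad β (conj ∘ c) (conj ∘ c)) ≡ quad (λ i j → conj (β i j)) c c
  conj-quad β c = trans (conj-∑ (λ i → ∑ λ j → conj (c i) * conj (c j) * β i j)) (∑-cong λ i → trans (conj-∑ (λ j → conj (c i) * conj
      (c j) * β i j)) (∑-cong λ j →
    trans (conj-* (conj (c i) * conj (c j)) (β i j)) (cong (_* conj (β i j)) (trans (conj-* (conj (c i)) (conj (c j))) (cong₂ _*_ (conj-involutive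
        (c i)) (conj-involutive (c j)))))))

  integral : ∀ x y → InO (b x y)
  integral x y = subst InO (B≡quad (proj₁ x) (proj₁ y)) (classical (proj₁ x) (proj₁ y) (proj₂ x) (proj₂ y))

  setting : Setting
  setting = record
    { R = F-orderedRing ; conj = conj ; conj-* = conj-* ; conj-ι = conj-ι ; √Δ = √Δ ; Δ = ℤ.+ Δ ; 0<√Δ = 0<√Δ ; √Δ² = √Δ²≡Δ
    ; X = X ; b = b ; b-sym = λ x y → quad-sym G G-sym (proj₁ x) (proj₁ y)
    ; psd = λ z c → proj₁ (psd-both z c)
    -- The conjugate form at c is the conjugate of the form at the conjugated coefficients.
    ; psd′ = λ z c → subst (0# ≤_) (conj-quad (λ i j → b (z i) (z j)) c) (proj₂ (psd-both z (conj ∘ c)))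
    -- The coefficient of ω in u + v ω is the skew part, because ω - ω′ = √Δ.
    ; skew = λ x y → proj₁ (proj₂ (integral x y))
    ; skew-≡ = λ x y → skew-eq (proj₁ (integral x y)) (proj₁ (proj₂ (integral x y))) (proj₂ (proj₂ (integral x y)))
    ; rational = λ x y e → proj₁ (integral x y) , trans (proj₂ (proj₂ (integral x y))) (trans (cong (λ t → ι (proj₁ (integral x y)) + ι t * ω) e)
        (trans (cong (ι (proj₁ (integral x y)) +_) (zeroˡ ω)) (+-identityʳ _)))
    }
    where
    skew-eq : ∀ {β} u v → β ≡ ι u + ι v * ω → β ≡ conj β + √Δ * ι v
    skew-eq u v refl = trans (cong (λ t → ι u + ι v * t) ω≡) (trans (solve 4 (λ u v w s → u :+ v :* (w :+ s) := u :+ v :* w :+ s :* v) refl (ι u)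
        (ι v) (conj ω) √Δ)
      (cong (_+ √Δ * ι v) (sym (trans (conj-+ (ι u) (ι v * ω)) (cong (ι u +_) (conj-* (ι v) ω))))))

  -- Vectors of L are combinations of the generators and these of r vectors, so n > r coefficient
  -- rows of length r are dependent. The relation is passed on to the Gram matrix.
  rank-dependence : ∀ {r n} → RankLe r → r ℕ.< n → (z : Fin n → X) → Σ (Fin n → F) λ c → (∃ λ i → c i ≢ 0#) × (∀ i → ((λ i j → b (z i)
      (z j)) · c) i ≡ 0#)
  rank-dependence {r} {n} (w , span) r<n z = finish (dependent r<n M)
    where
    coef = λ i → proj₁ (proj₂ (z i))
    M : Fin n → Fin r → F
    M i t = ∑ λ j → coef i j * proj₁ (span j) t
    z≡ : ∀ i s → proj₁ (z i) s ≡ ∑ λ t → M i t * w t s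
    z≡ i s = trans (proj₂ (proj₂ (proj₂ (z i))) s) (trans (ΣF≡∑ _) (trans (∑-cong λ j → cong (coef i j *_) (trans (proj₂ (span j) s) (ΣF≡∑ _)))
        (∑-reassoc (coef i) (λ j → proj₁ (span j)) (λ t → w t s))))
    finish : (Σ (Fin n → F) λ c → (∃ λ i → c i ≢ 0#) × (∀ t → ∑ (λ i → c i * M i t) ≡ 0#)) → _
    finish (c , nz , null) = c , nz , λ i → trans (∑-cong λ j → cong (c j *_) (quad-sym G G-sym (proj₁ (z i)) (proj₁ (z j))))
        (quad-lin-null G G-sym c (proj₁ ∘ z) lin≡0 (proj₁ (z i)))
      where
      lin≡0 : ∀ s → lin G G-sym c (proj₁ ∘ z) s ≡ 0#
      lin≡0 s = trans (∑-cong λ i → cong (c i *_) (z≡ i s)) (trans (∑-reassoc c M (λ t → w t s)) (∑-zero λ t → trans (cong (_* w t s) (null t))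
          (zeroˡ (w t s))))

open import Data.Nat using (_≤_; _*_; _^_; _⊔_)

-- The represented vectors and the choice of the constants

module Proof (m D : ℕ) (1≤m : 1 ≤ m) (1≤D : 1 ≤ D) (D≢1 : D ≢ 1) (sf : Squarefree D)
  (V : Field.QuadSpace D) (L : Field.QuadSpace.Lattice V)
  (classical : Field.QuadSpace.Lattice.Classical L) (totPosDef : Field.QuadSpace.Lattice.TotPosDef L)
  (represents : Field.QuadSpace.Lattice.RepresentsMult L m) where

  open Integers D 1≤D D≢1 sf renaming (_+_ to _⊕_; _*_ to _⊗_; -_ to ⊖_; _-_ to _⊝_; _≤_ to _≼_; _<_ to _≺_)
  open Field.QuadSpace.Lattice L using (RankLe)
  open FromLattice D 1≤D D≢1 sf V L classical totPosDef

  represent : ∀ a → InO a → TotPos a → Σ X λ x → b x x ≡ ι (ℤ.+ m) ⊗ a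
  represent a a∈O a≻0 = let (v , v∈L , Qv≡) = represents a a∈O a≻0 in (v , v∈L) , trans (sym (Q≡quad v)) Qv≡

  represent-ι : ∀ c → 1 ≤ c → Σ X λ x → b x x ≡ ι (ℤ.+ m ℤ.* ℤ.+ c)
  represent-ι c 1≤c = let (x , eq) = represent (ι (ℤ.+ c)) (InO-ι (ℤ.+ c)) (TotPos-ι c 1≤c) in x , trans eq (sym (ι-* (ℤ.+ m) (ℤ.+ c)))

  represent-α : ∀ c → 1 ≤ c → Σ X λ x → b x x ≡ ι (ℤ.+ m) ⊗ α c
  represent-α c 1≤c = represent (α c) (InO-α c) (TotPos-α c 1≤c)

  -- Index 0 repeats the vector of index 1, which makes the family total and independent of the
  -- proofs of `1 ≤ c`.
  choose : (P : ℕ → X → Set) → (∀ c → 1 ≤ c → Σ X (P c)) → Σ (ℕ → X) λ f → ∀ c → 1 ≤ c → P c (f c)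
  choose P h = (λ { zero → proj₁ (h 1 ℕₚ.≤-refl) ; (suc c) → proj₁ (h (suc c) (ℕ.s≤s ℕ.z≤n)) }) , λ { (suc c) _ → proj₂ (h (suc c) (ℕ.s≤s ℕ.z≤n)) }

  vs : Σ (ℕ → X) λ v → ∀ c → 1 ≤ c → b (v c) (v c) ≡ ι (ℤ.+ m ℤ.* ℤ.+ c)
  vs = choose (λ c x → b x x ≡ ι (ℤ.+ m ℤ.* ℤ.+ c)) represent-ι

  ws : Σ (ℕ → X) λ w → ∀ c → 1 ≤ c → b (w c) (w c) ≡ ι (ℤ.+ m) ⊗ α c
  ws = choose (λ c x → b x x ≡ ι (ℤ.+ m) ⊗ α c) represent-α

  maxF-upper : ∀ x y → x ≼ maxF x y × y ≼ maxF x y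
  maxF-upper x y = go (nonnegᵇ (y -F x)) refl
    where
    choice : Bool → F
    choice t = if t then y else x
    go : ∀ t → nonnegᵇ (y -F x) ≡ t → x ≼ choice (nonnegᵇ (y -F x)) × y ≼ choice (nonnegᵇ (y -F x))
    go true eq = subst (λ t → x ≼ choice t × y ≼ choice t) (sym eq) (≤F-sound {x} {y} (subst T (sym eq) _) , ≤-refl)
    go false eq = subst (λ t → x ≼ choice t × y ≼ choice t) (sym eq) (≤-refl , [ (λ y≤x → y≤x) , (λ x<y → ⊥-elim (subst T eq (≤F-complete {x} {y}
        (<⇒≤ x<y)))) ]′ (≤⊎> y x))

  module Represented (v w : ℕ → X) (v-norm : ∀ c → 1 ≤ c → b (v c) (v c) ≡ ι (ℤ.+ m ℤ.* ℤ.+ c)) (w-norm : ∀ c → 1 ≤ c → b (w c) (w c) ≡ ι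
      (ℤ.+ m) ⊗ α c) where

    open Families setting m 1≤m v w α 2≤√Δ v-norm w-norm α-skew 0<α′ α′≤1 using (φv; φw; module Ranks) public

    -- The selections are variables here because the actual ones compute: with them in the types, conversion
    -- checking would unfold the whole search.
    conclude : Selection m φv → Selection m φw →
        Σ ℕ λ p₁ → Σ ℕ λ p₂ → Σ ℕ λ γ₁ → Σ ℕ λ γ₂ → Σ ℕ λ C₁ → Σ ℕ λ C₂ →
        Σ ℕ λ q₁ → Σ ℕ λ q₂ → Σ ℕ λ δ₁ → Σ ℕ λ δ₂ → Σ ℕ λ D₁ → Σ ℕ λ D₂ →
        Prime p₁ × p₁ ≤ 2 * m ^ 2 × Prime p₂ × p₂ ≤ 2 * m ^ 2 ×
        IsGamma p₁ γ₁ × IsGamma p₂ γ₂ ×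
        2 ≤ C₁ × C₁ ≤ γ₁ × 2 ≤ C₂ × C₂ ≤ γ₂ ×
        Prime q₁ × q₁ ≤ 2 * C₁ * m ^ 3 × Prime q₂ × q₂ ≤ 2 * C₂ * m ^ 3 ×
        IsGamma q₁ δ₁ × IsGamma q₂ δ₂ ×
        1 ≤ D₁ × D₁ ≤ q₁ * δ₁ × 1 ≤ D₂ × D₂ ≤ q₂ * δ₂ ×
        Σ F λ e₁ → Σ F λ e₂ → Σ F λ eC → Σ F λ eD →
        IsCω 1 e₁ × IsCω 2 e₂ × IsCω C₂ eC × IsCω D₂ eD ×
        (RankLe 3 →
        ℕ→F Δ ≤F ℕ→F (4 * C₁ * m ^ 2) *F e₁) ×
        (RankLe 4 →
        ℕ→F Δ ≤F ℕ→F (4 * C₁ * m ^ 2) *F e₂) ×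
        (RankLe 5 →
        (ℕ→F Δ ≤F ℕ→F (4 * C₁ * m ^ 2) *F eC)
        ⊎ (√Δ ^F 3 ≤F ℕ→F (36 * C₂ * m ^ 3) *F √Δ ^F 2
        +F ℕ→F (18 * C₂ * m ^ 3) *F √Δ +F ℕ→F (m ^ 3))) ×
        (RankLe 6 →
        (ℕ→F Δ ≤F ℕ→F (4 * C₁ * m ^ 2) *F eC)
        ⊎ (√Δ ^F 3 ≤F ℕ→F (36 * C₂ * m ^ 3) *F √Δ ^F 2
        +F ℕ→F (18 * C₂ * m ^ 3) *F √Δ +F ℕ→F (m ^ 3))
        ⊎ (ℕ→F Δ ≤F ℕ→F (4 * D₁ * m ^ 2) *F maxF (ℕ→F C₁) eC)) ×
        (RankLe 7 →
        (Δ ≤ 4 * C₁ * D₁ * m ^ 2)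
        ⊎ (ℕ→F Δ ≤F ℕ→F (4 * (C₁ ⊔ D₁) * m ^ 2) *F maxF eC eD)
        ⊎ (√Δ ^F 3 ≤F ℕ→F (36 * C₂ * m ^ 3) *F √Δ ^F 2
        +F ℕ→F (18 * C₂ * m ^ 3) *F √Δ +F ℕ→F (m ^ 3))
        ⊎ (√Δ ^F 4 ≤F ℕ→F (192 * C₂ * D₂ * m ^ 4) *F √Δ ^F 3
        +F ℕ→F (144 * C₂ * D₂ * m ^ 4) *F √Δ ^F 2
        +F ℕ→F (96 * (C₂ ⊔ D₂) * m ^ 4) *F √Δ
        +F ℕ→F (m ^ 4)))
    conclude σv σw =
      v.p , w.p , v.γ , w.γ , v.C , w.C , v.q , w.q , v.δ , w.δ , v.D , w.D ,
      v.prime-p , v.p≤ , w.prime-p , w.p≤ , v.isGamma-p , w.isGamma-p , v.2≤C , v.C≤γ , w.2≤C , w.C≤γ ,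
      v.prime-q , v.q≤ , w.prime-q , w.q≤ , v.isGamma-q , w.isGamma-q , v.1≤D , v.D≤qδ , w.1≤D , w.D≤qδ ,
      α 1 , α 2 , α w.C , α w.D , α-IsCω 1 , α-IsCω 2 , α-IsCω w.C , α-IsCω w.D ,
      bound-3 , bound-4 , bound-5 , bound-6 , bound-7
      where
      module v = Selection σv
      module w = Selection σw
      open Ranks.Bounds σv σw ℕ→F (λ _ → refl) _*F_ _+F_ (λ _ _ → refl) (λ _ _ → refl) √Δ refl (λ k → √Δ ^F k) (λ _ → refl) (0≤ι 1)
        maxF maxF-upper _≤F_ (λ x y → ≤F-complete {x} {y}) Δ refl RankLe rank-dependence

theorem3p1 : (m D : ℕ) → 1 ≤ m → 1 ≤ D → D ≢ 1 → Squarefree D →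
    let open Field D in
    (V : QuadSpace) → let open QuadSpace V in
    (L : Lattice) → let open Lattice L in
    Integral → Classical → TotPosDef → RepresentsMult m →
    Σ ℕ λ p₁ → Σ ℕ λ p₂ → Σ ℕ λ γ₁ → Σ ℕ λ γ₂ → Σ ℕ λ C₁ → Σ ℕ λ C₂ →
    Σ ℕ λ q₁ → Σ ℕ λ q₂ → Σ ℕ λ δ₁ → Σ ℕ λ δ₂ → Σ ℕ λ D₁ → Σ ℕ λ D₂ →
    Prime p₁ × p₁ ≤ 2 * m ^ 2 × Prime p₂ × p₂ ≤ 2 * m ^ 2 ×
    IsGamma p₁ γ₁ × IsGamma p₂ γ₂ ×
    2 ≤ C₁ × C₁ ≤ γ₁ × 2 ≤ C₂ × C₂ ≤ γ₂ ×
    Prime q₁ × q₁ ≤ 2 * C₁ * m ^ 3 × Prime q₂ × q₂ ≤ 2 * C₂ * m ^ 3 ×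
    IsGamma q₁ δ₁ × IsGamma q₂ δ₂ ×
    1 ≤ D₁ × D₁ ≤ q₁ * δ₁ × 1 ≤ D₂ × D₂ ≤ q₂ * δ₂ ×
    Σ F λ e₁ → Σ F λ e₂ → Σ F λ eC → Σ F λ eD →
    IsCω 1 e₁ × IsCω 2 e₂ × IsCω C₂ eC × IsCω D₂ eD ×
    (RankLe 3 →
    ℕ→F Δ ≤F ℕ→F (4 * C₁ * m ^ 2) *F e₁) ×
    (RankLe 4 →
    ℕ→F Δ ≤F ℕ→F (4 * C₁ * m ^ 2) *F e₂) ×
    (RankLe 5 →
    (ℕ→F Δ ≤F ℕ→F (4 * C₁ * m ^ 2) *F eC)
    ⊎ (√Δ ^F 3 ≤F ℕ→F (36 * C₂ * m ^ 3) *F √Δ ^F 2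
    +F ℕ→F (18 * C₂ * m ^ 3) *F √Δ +F ℕ→F (m ^ 3))) ×
    (RankLe 6 →
    (ℕ→F Δ ≤F ℕ→F (4 * C₁ * m ^ 2) *F eC)
    ⊎ (√Δ ^F 3 ≤F ℕ→F (36 * C₂ * m ^ 3) *F √Δ ^F 2
    +F ℕ→F (18 * C₂ * m ^ 3) *F √Δ +F ℕ→F (m ^ 3))
    ⊎ (ℕ→F Δ ≤F ℕ→F (4 * D₁ * m ^ 2) *F maxF (ℕ→F C₁) eC)) ×
    (RankLe 7 →
    (Δ ≤ 4 * C₁ * D₁ * m ^ 2)
    ⊎ (ℕ→F Δ ≤F ℕ→F (4 * (C₁ ⊔ D₁) * m ^ 2) *F maxF eC eD)
    ⊎ (√Δ ^F 3 ≤F ℕ→F (36 * C₂ * m ^ 3) *F √Δ ^F 2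
    +F ℕ→F (18 * C₂ * m ^ 3) *F √Δ +F ℕ→F (m ^ 3))
    ⊎ (√Δ ^F 4 ≤F ℕ→F (192 * C₂ * D₂ * m ^ 4) *F √Δ ^F 3
    +F ℕ→F (144 * C₂ * D₂ * m ^ 4) *F √Δ ^F 2
    +F ℕ→F (96 * (C₂ ⊔ D₂) * m ^ 4) *F √Δ
    +F ℕ→F (m ^ 4)))
theorem3p1 m D 1≤m 1≤D D≢1 sf V L _ classical totPosDef represents =
  conclude (selection m 1≤m φv) (selection m 1≤m φw)
  where
  open Proof m D 1≤m 1≤D D≢1 sf V L classical totPosDef represents
  open Represented (proj₁ vs) (proj₁ ws) (proj₂ vs) (proj₂ ws)
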